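{- There exists a constant $c>0$ such that for every $n=2q$, with $q$ a sufficiently large prime, there exist a prime $p$ with $n^2\log n<p\leq (n^2\log^2 n)^{5.5}$ and an $[n,n/2,d,p]$ code $C$ such that $$|B_{n,p}(d)|\geq c\,n\,p^{n/2}.$$ Furthermore, the automorphism group of $C$ contains a subgroup isomorphic to $\mathbb Z/2\mathbb Z\times\mathbb Z/q\mathbb Z$.
   Context: Let $p$ be an odd prime. Elements $z\in\mathbb F_p$ are identified with the integers $z$ satisfying $-\frac{p-1}{2}\le z\le \frac{p-1}{2}$. With this convention, the norm of $\mathbf x=(x_1,\dots,x_n)\in\mathbb F_p^n$ is $\|\mathbf x\|_2=\sqrt{x_1^2+\cdots+x_n^2}$ (a non-negative real number). $B_{n,p}(d)$ denotes the set of $\mathbf x\in\mathbb F_p^n$ with $\|\mathbf x\|_2\le d$. An $[n,k,d,p]$ code is a $k$-dimensional linear subspace $C$ of $\mathbb F_p^n$ such that $d$ is the minimum of $\|\mathbf x\|_2$ over nonzero $\mathbf x\in C$. The automorphism group of $C$ is the group of transformations of $\mathbb F_p^n$ given by permuting coordinates and multiplying coordinates by signs $\pm1$ that map $C$ onto itself. Here $\log$ is the natural logarithm. -}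

module Defs where

open import Data.Nat as ℕ using (ℕ; zero; suc; _∸_; _≤ᵇ_; _!)
open import Data.Nat.DivMod using (_mod_; _/_)
open import Data.Integer as ℤ using (ℤ; +_; ∣_∣)
open import Data.Rational as ℚ using (ℚ; 0ℚ; 1ℚ)
open import Data.Fin using (Fin; toℕ)
open import Data.Fin.Permutation using (Permutation′; _⟨$⟩ʳ_)
open import Data.List using (List; map; allFin; foldr)
open import Data.Nat.ListAction using (sum)
open import Data.Vec.Functional using (_∷_)
open import Data.Bool using (Bool; if_then_else_)
open import Data.Product using (Σ; ∃; _×_)
open import Data.Empty using (⊥)
open import Relation.Binary.PropositionalEquality using (_≡_)
open import Relation.Nullary using (¬_)

-- a / b as a rational (b = 0 never used; mapped to 0)
ratio : ℕ → ℕ → ℚ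
ratio a zero    = 0ℚ
ratio a (suc b) = (+ a) ℚ./ suc b

fromℕℚ : ℕ → ℚ
fromℕℚ a = ratio a 1

powℚ : ℚ → ℕ → ℚ
powℚ x zero    = 1ℚ
powℚ x (suc k) = x ℚ.* powℚ x k

expPartial : ℚ → ℕ → ℚ
expPartial x zero    = 0ℚ
expPartial x (suc K) = expPartial x K ℚ.+ (powℚ x K ℚ.* ratio 1 (K !))

-- For a rational x ≥ 0 and n ≥ 1:  log n < x  ⇔  n < e^x
--   ⇔ some partial sum of the exponential series at x exceeds n.
LogLt : ℕ → ℚ → Set
LogLt n x = ∃ λ K → fromℕℚ n ℚ.< expPartial x K

LowerBound : ℕ → ℕ → Set
LowerBound n p = LogLt n (ratio p (n ℕ.* n))

-- p ≤ (n² log² n)^{5.5} = (n log n)^{11}   (n ≥ 2, so log n > 0).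
-- Its negation (n log n)^{11} < p holds iff log n < p^{1/11}/n iff there is
-- a rational r ≥ 0 with log n < r and (n r)^{11} < p.
UpperBound : ℕ → ℕ → Set
UpperBound n p =
  ¬ (Σ ℚ λ r → (0ℚ ℚ.≤ r) × LogLt n r ×
       (powℚ (fromℕℚ n ℚ.* r) 11 ℚ.< fromℕℚ p))

module Fp (m : ℕ) where
  p : ℕ
  p = suc m

  F : Set
  F = Fin p

  zeroF : F
  zeroF = Data.Fin.zero

  addF mulF : F → F → F
  addF a b = (toℕ a ℕ.+ toℕ b) mod p
  mulF a b = (toℕ a ℕ.* toℕ b) mod p

  negF : F → F
  negF a = (p ∸ toℕ a) mod p

  -- centred representative in [-(p-1)/2, (p-1)/2]  ( (p-1)/2 = m / 2 )
  lift : F → ℤ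
  lift a = if toℕ a ≤ᵇ (m / 2) then + toℕ a else (+ toℕ a) ℤ.- (+ p)

  Vect : ℕ → Set
  Vect n = Fin n → F

  sumFin : ∀ n → (Fin n → ℕ) → ℕ
  sumFin n f = sum (map f (allFin n))

  sumF : ∀ k → (Fin k → F) → F
  sumF k f = foldr addF zeroF (map f (allFin k))

  normSq : ∀ {n} → Vect n → ℕ
  normSq {n} x = sumFin n (λ j → ∣ lift (x j) ∣ ℕ.* ∣ lift (x j) ∣)

  IsZero : ∀ {n} → Vect n → Set
  IsZero x = ∀ j → x j ≡ zeroF

  lincomb : ∀ {k n} → (Fin k → F) → (Fin k → Vect n) → Vect n
  lincomb {k} a b j = sumF k (λ i → mulF (a i) (b i j))

  LinIndep : ∀ {k n} → (Fin k → Vect n) → Set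
  LinIndep b = ∀ a → IsZero (lincomb a b) → ∀ i → a i ≡ zeroF

  Span : ∀ {k n} → (Fin k → Vect n) → Vect n → Set
  Span b x = ∃ λ a → ∀ j → x j ≡ lincomb a b j

  -- A k-dimensional subspace C of F_p^n is given as the span of a
  -- linearly independent family (a basis) b of k vectors.
  -- d² = D is the minimum squared norm of nonzero codewords.
  MinSqNorm : ∀ {k n} → (Fin k → Vect n) → ℕ → Set
  MinSqNorm b D =
    (∃ λ x → Span b x × ¬ IsZero x × normSq x ≡ D) ×
    (∀ x → Span b x → ¬ IsZero x → D ℕ.≤ normSq x)

  sumVec : ∀ n → (Vect n → ℕ) → ℕ
  sumVec zero    f = f (λ ())
  sumVec (suc n) f = sum (map (λ a → sumVec n (λ v → f (a ∷ v))) (allFin p))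

  ballSize : ℕ → ℕ → ℕ
  ballSize n D = sumVec n (λ x → if normSq x ≤ᵇ D then 1 else 0)

  record Monomial (n : ℕ) : Set where
    field
      perm : Permutation′ n
      sign : Fin n → Bool     -- true = multiply by -1

  apply : ∀ {n} → Monomial n → Vect n → Vect n
  apply M x j =
    if Monomial.sign M j then negF (x (Monomial.perm M ⟨$⟩ʳ j))
                        else x (Monomial.perm M ⟨$⟩ʳ j)

  iter : ∀ {A : Set} → ℕ → (A → A) → A → A
  iter zero    f x = x
  iter (suc k) f x = f (iter k f x)

  SameMap : ∀ {n} → (Vect n → Vect n) → (Vect n → Vect n) → Set
  SameMap f g = ∀ x j → f x j ≡ g x j

  IsAut : ∀ {k n} → (Fin k → Vect n) → Monomial n → Set
  IsAut b M =
    (∀ x → Span b x → Span b (apply M x)) ×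
    (∀ y → Span b y → ∃ λ x → Span b x × (∀ j → apply M x j ≡ y j))

  -- Aut(C) contains a subgroup isomorphic to Z/2 × Z/q: automorphisms g, h
  -- with g of order exactly 2, h ≠ id with h^q = id (order q for q prime),
  -- and gh = hg.  (For q an odd prime, the homomorphism Z/2 × Z/q → Aut(C)
  -- sending the generators to g, h is then well defined and injective.)
  HasZ2xZq : ∀ {k n} → ℕ → (Fin k → Vect n) → Set
  HasZ2xZq {n = n} q b = Σ (Monomial n) λ g → Σ (Monomial n) λ h →
    IsAut b g × IsAut b h ×
    SameMap (λ x → apply g (apply g x)) (λ x → x) ×
    ¬ SameMap (apply g) (λ x → x) ×
    SameMap (iter q (apply h)) (λ x → x) ×
    ¬ SameMap (apply h) (λ x → x) ×
    SameMap (λ x → apply g (apply h x)) (λ x → apply h (apply g x))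

  GoodCode : (n k q : ℕ) → ℚ → Set
  GoodCode n k q c =
    Σ (Fin k → Vect n) λ b → LinIndep b × Σ ℕ λ D → MinSqNorm b D ×
      (c ℚ.* fromℕℚ (n ℕ.* (p ℕ.^ k)) ℚ.≤ fromℕℚ (ballSize n D)) ×
      HasZ2xZq q b

-- same, for an arbitrary p (p = 0 is impossible; p is prime in the use)
GoodCodeOver : ℕ → (n k q : ℕ) → ℚ → Set
GoodCodeOver zero    n k q c = ⊥
GoodCodeOver (suc m) n k q c = Fp.GoodCode m n k q c

{-# OPTIONS --safe #-}
module Submission where

-- Let R = 𝔽_p[x]/(x^q - 1), λ = x - 1, and C_h = {(f , f h) : f ∈ R} for h ∈ R. Every C_h is invariant under negation
-- and under multiplication by x, so it suffices to find h such that no nonzero (f , f h) lies in the largest ball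
-- having fewer than n p^q / c₀ points. Constant f rule out at most three quarters of all h. If f is not constant, then
-- the n elements ± xⁱ f are distinct and h is bad for all of them or for none, which saves the factor n in the union
-- bound, provided that for fixed f the number of h with f h short is comparable to the number of short vectors.
--
-- The last point holds when every class of the augmentation ideal X₀ modulo f X₀ has a short representative. For f a
-- unit of X₀ there is nothing to show. For other f the pigeonhole principle yields a short nonzero w ∈ f X₀. Since
-- ℤ[x]/(1 + x + ⋯ + x^(q-1)) has no zero divisors, some positive integer multiple of any given element is a ℤ-linear
-- combination of the xⁱ w, and rounding its coefficients gives short representatives. The loss is compensated by the
-- rarity of non-units: a given minimal idempotent of X₀ annihilates f + τλ for at most one τ. Those f with a large
-- annihilator have no such w; since an equation f u = f u′ with f, u and u′ short holds over ℤ already, there are too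
-- few of them to matter.
--
-- Any prime p with q⁹ ≤ p ≤ q¹¹ will do. One exists because a common multiple of 1, …, n + 1 is at least 2^n, whereas
-- without primes in that range all numbers up to q¹¹ would have a common multiple of size at most (q¹¹)^(q⁹).

-- The obstacle is the trivial character: ℤ[x]/(x^q - 1) has zero divisors, so smoothing takes place
-- in X₀ and the augmentations survive as a separate condition σ(z) = σ(f) σ(h). For fixed f and z
-- it has at most p^(q-1) solutions h, except when both augmentations vanish, where all p^q elements
-- h solve it. The weight `ω` records this, and zero-sum pairs have to be shown to make up only
-- about 1/p of the pairs in the ball.
--
-- Ball volumes enter through crude bounds. The delicate quantity is the ratio of two counts at
-- nearby radii, which `ball-growth` bounds by 2q + 1 when the squared radius grows by s². Units
-- need no enlargement. For non-units the factor 2q + 1, and another 2q from the averaging, are paid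
-- for by T = 2q (2q + 1) translates f + τλ. The enlargement is at most 2q⁸ and must stay below s²,
-- which is of order p; hence p ≥ q⁹. The upper bound on p serves twice: it keeps p below 2^(q-1),
-- so that exponential slack absorbs every polynomial factor, and q¹¹ ≤ (n log n)¹¹ is the bound
-- demanded.

module IntegerCoefficientSolver where
  import Algebra.Solver.Ring as RS
  import Data.Integer as ℤ
  import Data.Integer.Properties as ℤₚ
  import Data.Nat as ℕ
  import Relation.Binary.PropositionalEquality as Eq
  open import Algebra.Bundles using (CommutativeRing)
  open import Algebra.Solver.Ring.AlmostCommutativeRing using (fromCommutativeRing; _-Raw-AlmostCommutative⟶_)
  open import Data.Integer using (ℤ; +_; -[1+_]; _⊖_)
  open import Data.Maybe using (Maybe; just; nothing)
  open import Data.Nat using (ℕ; zero; suc)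
  open import Level using (0ℓ)
  open import Relation.Nullary using (yes; no)

  -- With integer coefficients the solver cancels opposite terms, which the identities for
  -- differences below rely on. The coefficient map is the canonical homomorphism from ℤ.
  module RingLemmas (R : CommutativeRing 0ℓ 0ℓ) where
    open CommutativeRing R hiding (zero) renaming (Carrier to A)
    open import Algebra.Properties.Semiring.Mult semiring using (×1-homo-*; ×-homo-+; ×-congˡ) renaming (_×_ to _·_)
    open import Algebra.Properties.Ring ring using (-‿distribˡ-*; -‿distribʳ-*; -‿involutive; -0#≈0#; -‿+-comm)
    open import Relation.Binary.Reasoning.Setoid setoid

    ⟦_⟧ᶻ : ℤ → A
    ⟦ + n ⟧ᶻ = n · 1#
    ⟦ -[1+ n ] ⟧ᶻ = - (suc n · 1#)

    private
      cancel-suc : ∀ a b → (1# + a) + (- (1# + b)) ≈ a + (- b)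
      cancel-suc a b = begin
        (1# + a) + (- (1# + b))     ≈⟨ +-cong (+-comm 1# a) (sym (-‿+-comm 1# b)) ⟩
        (a + 1#) + (- 1# + (- b))   ≈⟨ +-assoc a 1# _ ⟩
        a + (1# + (- 1# + (- b)))   ≈⟨ +-congˡ (sym (+-assoc 1# (- 1#) (- b))) ⟩
        a + ((1# + (- 1#)) + (- b)) ≈⟨ +-congˡ (+-congʳ (-‿inverseʳ 1#)) ⟩
        a + (0# + (- b))            ≈⟨ +-congˡ (+-identityˡ _) ⟩
        a + (- b)                   ∎

      ⊖-homo : ∀ m n → ⟦ m ⊖ n ⟧ᶻ ≈ (m · 1#) + (- (n · 1#))
      ⊖-homo zero zero = sym (-‿inverseʳ 0#)
      ⊖-homo zero (suc n) = sym (+-identityˡ _)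
      ⊖-homo (suc m) zero = trans (sym (+-identityʳ _)) (+-congˡ (sym -0#≈0#))
      ⊖-homo (suc m) (suc n) = trans (reflexive (Eq.cong ⟦_⟧ᶻ (ℤₚ.[1+m]⊖[1+n]≡m⊖n m n)))
        (trans (⊖-homo m n) (sym (cancel-suc (m · 1#) (n · 1#))))

      neg-homo : ∀ i → ⟦ ℤ.- i ⟧ᶻ ≈ - ⟦ i ⟧ᶻ
      neg-homo (+ zero) = sym -0#≈0#
      neg-homo (+ suc n) = refl
      neg-homo -[1+ n ] = sym (-‿involutive _)

      +-homo : ∀ i j → ⟦ i ℤ.+ j ⟧ᶻ ≈ ⟦ i ⟧ᶻ + ⟦ j ⟧ᶻ
      +-homo (+ m) (+ n) = ×-homo-+ 1# m n
      +-homo (+ m) -[1+ n ] = ⊖-homo m (suc n)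
      +-homo -[1+ m ] (+ n) = trans (⊖-homo n (suc m)) (+-comm _ _)
      +-homo -[1+ m ] -[1+ n ] = begin
        - (suc (suc (m ℕ.+ n)) · 1#)           ≈⟨ -‿cong (×-congˡ {1#} (Eq.cong suc (Eq.sym (ℕₚ.+-suc m n)))) ⟩
        - ((suc m ℕ.+ suc n) · 1#)             ≈⟨ -‿cong (×-homo-+ 1# (suc m) (suc n)) ⟩
        - ((suc m · 1#) + (suc n · 1#))        ≈⟨ sym (-‿+-comm _ _) ⟩
        - (suc m · 1#) + (- (suc n · 1#))      ∎
        where import Data.Nat.Properties as ℕₚ

      *-homo : ∀ i j → ⟦ i ℤ.* j ⟧ᶻ ≈ ⟦ i ⟧ᶻ * ⟦ j ⟧ᶻ
      *-homo (+ m) (+ n) = trans (reflexive (Eq.cong ⟦_⟧ᶻ (Eq.sym (ℤₚ.pos-* m n)))) (×1-homo-* m n)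
      *-homo (+ m) -[1+ n ] = trans (reflexive (Eq.cong ⟦_⟧ᶻ (Eq.sym (ℤₚ.neg-distribʳ-* (+ m) (+ suc n)))))
        (trans (neg-homo (+ m ℤ.* + suc n)) (trans (-‿cong (*-homo (+ m) (+ suc n))) (-‿distribʳ-* _ _)))
      *-homo -[1+ m ] (+ n) = trans (reflexive (Eq.cong ⟦_⟧ᶻ (Eq.sym (ℤₚ.neg-distribˡ-* (+ suc m) (+ n)))))
        (trans (neg-homo (+ suc m ℤ.* + n)) (trans (-‿cong (*-homo (+ suc m) (+ n))) (-‿distribˡ-* _ _)))
      *-homo -[1+ m ] -[1+ n ] = trans (×1-homo-* (suc m) (suc n)) (trans (sym (-‿involutive _))
        (trans (-‿cong (-‿distribˡ-* _ _)) (-‿distribʳ-* _ _)))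

      morphism : ℤ.+-*-rawRing -Raw-AlmostCommutative⟶ fromCommutativeRing R
      morphism = record { ⟦_⟧ = ⟦_⟧ᶻ ; +-homo = +-homo ; *-homo = *-homo ; -‿homo = neg-homo ; 0-homo = refl ; 1-homo = +-identityʳ 1# }

      dec : ∀ i j → Maybe (⟦ i ⟧ᶻ ≈ ⟦ j ⟧ᶻ)
      dec i j with i ℤ.≟ j
      ... | yes e = just (reflexive (Eq.cong ⟦_⟧ᶻ e))
      ... | no _ = nothing

    open RS ℤ.+-*-rawRing (fromCommutativeRing R) morphism dec public using (solve; _:=_; con; _:+_; _:*_; _:-_; :-_)

    mul-shuffle : ∀ c l z d m y → (c * (l * z)) * (d * (m * y)) ≈ c * (d * ((l * m) * (z * y)))
    mul-shuffle = solve 6 (λ c l z d m y → ((c :* (l :* z)) :* (d :* (m :* y))) := (c :* (d :* ((l :* m) :* (z :* y))))) refl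

    swap-assoc : ∀ a l z → a * (l * z) ≈ (l * a) * z
    swap-assoc = solve 3 (λ a l z → a :* (l :* z) := (l :* a) :* z) refl

    lam-swap : ∀ l a b → (l * a) * (l * b) ≈ l * (l * (a * b))
    lam-swap = solve 3 (λ l a b → (l :* a) :* (l :* b) := l :* (l :* (a :* b))) refl

    distrib-minus : ∀ w a b → (w * a) + (- (w * b)) ≈ w * (a + (- b))
    distrib-minus = solve 3 (λ w a b → (w :* a) :+ (:- (w :* b)) := w :* (a :+ (:- b))) refl

    cancel-quotient : ∀ w r n k → (w * (r + n * k)) + (- (n * (w * k))) ≈ w * r
    cancel-quotient = solve 4 (λ w r n k → (w :* (r :+ n :* k)) :+ (:- (n :* (w :* k))) := w :* r) refl

-- Finite sums, counting, pigeonhole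

module FiniteCounting where
  import Data.Fin.Properties as Finₚ
  import Data.Nat.Properties as ℕₚ
  import Data.Product.Properties as Prodₚ
  import Data.Vec.Properties as Vecₚ
  open import Algebra.Properties.CommutativeSemigroup ℕₚ.+-commutativeSemigroup using () renaming (interchange to +-interchange)
  open import Data.Bool using (Bool; true; false; if_then_else_)
  open import Data.Empty using (⊥-elim)
  open import Data.Fin using (Fin; zero; suc)
  open import Data.List using (List; []; _∷_; _++_; map)
  open import Data.Nat using (ℕ; zero; suc; _+_; _*_; _^_; _≤_; _<_; z≤n; _<?_; _≤?_)
  open import Data.Product using (∃; _×_; _,_; proj₁; proj₂)
  open import Data.Sum using (_⊎_; inj₁; inj₂; [_,_]′)
  open import Data.Vec using (Vec; []; _∷_)
  open import Function using (_∘_)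
  open import Relation.Binary.Definitions using (DecidableEquality)
  open import Relation.Binary.PropositionalEquality using (_≡_; _≢_; refl; sym; trans; cong; cong₂; subst)
  open import Relation.Nullary using (¬_; Dec; yes; no; does; _×-dec_; ¬?)

  𝟙 : ∀ {ℓ} {P : Set ℓ} → Dec P → ℕ
  𝟙 d = if does d then 1 else 0

  𝟙-yes : ∀ {ℓ} {P : Set ℓ} (d : Dec P) → P → 𝟙 d ≡ 1
  𝟙-yes (yes _) _ = refl
  𝟙-yes (no ¬p) p = ⊥-elim (¬p p)

  𝟙-no : ∀ {ℓ} {P : Set ℓ} (d : Dec P) → ¬ P → 𝟙 d ≡ 0
  𝟙-no (no _) _ = refl
  𝟙-no (yes p) ¬p = ⊥-elim (¬p p)

  𝟙-mono : ∀ {ℓ ℓ′} {P : Set ℓ} {Q : Set ℓ′} (d : Dec P) (e : Dec Q) → (P → Q) → 𝟙 d ≤ 𝟙 e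
  𝟙-mono (no _) e f = z≤n
  𝟙-mono (yes p) e f = ℕₚ.≤-reflexive (sym (𝟙-yes e (f p)))

  𝟙≤1 : ∀ {ℓ} {P : Set ℓ} (d : Dec P) → 𝟙 d ≤ 1
  𝟙≤1 (yes _) = ℕₚ.≤-refl
  𝟙≤1 (no _) = z≤n

  𝟙>0 : ∀ {ℓ} {P : Set ℓ} (d : Dec P) → 0 < 𝟙 d → P
  𝟙>0 (yes p) _ = p

  sumL : ∀ {A : Set} → List A → (A → ℕ) → ℕ
  sumL [] f = 0
  sumL (x ∷ xs) f = f x + sumL xs f

  module _ {A : Set} where
    sumL-mono : ∀ xs {f g : A → ℕ} → (∀ x → f x ≤ g x) → sumL xs f ≤ sumL xs g
    sumL-mono [] h = z≤n
    sumL-mono (x ∷ xs) h = ℕₚ.+-mono-≤ (h x) (sumL-mono xs h)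

    sumL-cong : ∀ xs {f g : A → ℕ} → (∀ x → f x ≡ g x) → sumL xs f ≡ sumL xs g
    sumL-cong [] h = refl
    sumL-cong (x ∷ xs) h = cong₂ _+_ (h x) (sumL-cong xs h)

    sumL-+ : ∀ xs (f g : A → ℕ) → sumL xs (λ x → f x + g x) ≡ sumL xs f + sumL xs g
    sumL-+ [] f g = refl
    sumL-+ (x ∷ xs) f g = trans (cong (f x + g x +_) (sumL-+ xs f g)) (+-interchange (f x) (g x) _ _)

    sumL-* : ∀ xs c (f : A → ℕ) → sumL xs (λ x → c * f x) ≡ c * sumL xs f
    sumL-* [] c f = sym (ℕₚ.*-zeroʳ c)
    sumL-* (x ∷ xs) c f = trans (cong (c * f x +_) (sumL-* xs c f)) (sym (ℕₚ.*-distribˡ-+ c (f x) _))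

    sumL-0 : ∀ xs → sumL {A} xs (λ _ → 0) ≡ 0
    sumL-0 [] = refl
    sumL-0 (x ∷ xs) = sumL-0 xs

    sumL-++ : ∀ xs ys (f : A → ℕ) → sumL (xs ++ ys) f ≡ sumL xs f + sumL ys f
    sumL-++ [] ys f = refl
    sumL-++ (x ∷ xs) ys f = trans (cong (f x +_) (sumL-++ xs ys f)) (sym (ℕₚ.+-assoc (f x) _ _))

    sumL-find : ∀ xs (f g : A → ℕ) → sumL xs f < sumL xs g → ∃ λ x → f x < g x
    sumL-find (x ∷ xs) f g h with f x <? g x
    ... | yes lt = x , lt
    ... | no ≮ = sumL-find xs f g (ℕₚ.≰⇒> λ le → ℕₚ.<⇒≱ h (ℕₚ.+-mono-≤ (ℕₚ.≮⇒≥ ≮) le))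

  sumL-map : ∀ {A B : Set} (φ : A → B) xs f → sumL (map φ xs) f ≡ sumL xs (f ∘ φ)
  sumL-map φ [] f = refl
  sumL-map φ (x ∷ xs) f = cong (f (φ x) +_) (sumL-map φ xs f)

  sumL-swap : ∀ {A B : Set} (xs : List A) (ys : List B) (f : A → B → ℕ) →
    sumL xs (λ x → sumL ys (f x)) ≡ sumL ys (λ y → sumL xs (λ x → f x y))
  sumL-swap [] ys f = sym (sumL-0 ys)
  sumL-swap (x ∷ xs) ys f = trans (cong (sumL ys (f x) +_) (sumL-swap xs ys f)) (sym (sumL-+ ys (f x) _))

  pairsWith : ∀ {A B C : Set} → (A → B → C) → List A → List B → List C
  pairsWith h [] ys = []
  pairsWith h (x ∷ xs) ys = map (h x) ys ++ pairsWith h xs ys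

  sumL-pairs : ∀ {A B C : Set} (h : A → B → C) xs ys f →
    sumL (pairsWith h xs ys) f ≡ sumL xs (λ x → sumL ys (λ y → f (h x y)))
  sumL-pairs h [] ys f = refl
  sumL-pairs h (x ∷ xs) ys f = trans (sumL-++ (map (h x) ys) _ f) (cong₂ _+_ (sumL-map (h x) ys f) (sumL-pairs h xs ys f))

  -- `once` states with multiplicity that the list contains every element exactly once, so that
  -- counting arguments become manipulations of sums of indicators.
  record Fintype (A : Set) : Set where
    infix 4 _≟_
    field
      elems : List A
      _≟_   : DecidableEquality A
      once  : ∀ a → sumL elems (λ x → 𝟙 (x ≟ a)) ≡ 1

  open Fintype {{...}} public

  opaque
    -- Opaque, so that conversion checking never enumerates a type such as a vector space.
    ∑ : ∀ {A : Set} {{_ : Fintype A}} → (A → ℕ) → ℕ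
    ∑ f = sumL elems f

  card : ∀ (A : Set) {{_ : Fintype A}} → ℕ
  card A = ∑ {A} (λ _ → 1)

  private
    once-Fin : ∀ n (xs : List (Fin n)) → sumL (map suc xs) (λ x → 𝟙 (x Finₚ.≟ zero)) ≡ 0
    once-Fin n xs = trans (sumL-map suc xs _) (trans (sumL-cong xs (λ x → 𝟙-no (suc x Finₚ.≟ zero) (λ ()))) (sumL-0 xs))

    finList : ∀ n → List (Fin n)
    finList zero = []
    finList (suc n) = zero ∷ map suc (finList n)

    once-finList : ∀ n a → sumL (finList n) (λ x → 𝟙 (x Finₚ.≟ a)) ≡ 1
    once-finList (suc n) zero = cong suc (once-Fin n (finList n))
    once-finList (suc n) (suc a) = trans (sumL-map suc (finList n) _)
      (once-finList n a)

  instance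
    fintype-Fin : ∀ {n} → Fintype (Fin n)
    fintype-Fin {n} = record { elems = finList n ; _≟_ = Finₚ._≟_ ; once = once-finList n }

    fintype-Bool : Fintype Bool
    fintype-Bool = record { elems = true ∷ false ∷ [] ; _≟_ = Data.Bool._≟_ ; once = λ { true → refl ; false → refl } }
      where import Data.Bool

  module _ {A B C : Set} {{FA : Fintype A}} {{FB : Fintype B}} (_≟ᶜ_ : DecidableEquality C) (h : A → B → C)
           (h-inj : ∀ {a b a′ b′} → h a b ≡ h a′ b′ → a ≡ a′ × b ≡ b′) where
    once-pairs : ∀ a b → sumL (pairsWith h elems elems) (λ x → 𝟙 (x ≟ᶜ h a b)) ≡ 1
    once-pairs a b = trans (sumL-pairs h elems elems _)
      (trans (sumL-cong elems row) (once a))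
      where
      row : ∀ x → sumL elems (λ y → 𝟙 (h x y ≟ᶜ h a b)) ≡ 𝟙 (x ≟ a)
      row x with x ≟ a
      ... | yes refl = trans (sumL-cong elems eq) (once b)
        where
        eq : ∀ y → 𝟙 (h x y ≟ᶜ h x b) ≡ 𝟙 (y ≟ b)
        eq y with y ≟ b
        ... | yes refl = 𝟙-yes (h x y ≟ᶜ h x y) refl
        ... | no ¬p = 𝟙-no (h x y ≟ᶜ h x b) (λ q → ¬p (proj₂ (h-inj q)))
      ... | no ¬p = trans (sumL-cong elems (λ y → 𝟙-no (h x y ≟ᶜ h a b) (λ q → ¬p (proj₁ (h-inj q))))) (sumL-0 {B} elems)

  instance
    fintype-× : ∀ {A B : Set} {{_ : Fintype A}} {{_ : Fintype B}} → Fintype (A × B)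
    fintype-× {A} {B} = record { elems = pairsWith _,_ elems elems ; _≟_ = dec
      ; once = λ { (a , b) → once-pairs dec _,_ (λ e → cong proj₁ e , cong proj₂ e) a b } }
      where
      dec : DecidableEquality (A × B)
      dec = Prodₚ.≡-dec _≟_ _≟_

  module _ {A : Set} {{_ : Fintype A}} where
    vecElems : ∀ n → List (Vec A n)
    vecElems zero = [] ∷ []
    vecElems (suc n) = pairsWith _∷_ elems (vecElems n)

    vecOnce : ∀ n (v : Vec A n) → sumL (vecElems n) (λ x → 𝟙 (Vecₚ.≡-dec _≟_ x v)) ≡ 1
    vecOnce zero [] = refl
    vecOnce (suc n) (a ∷ v) = once-pairs {{FB = record { elems = vecElems n ; _≟_ = Vecₚ.≡-dec _≟_ ; once = vecOnce n }}} (Vecₚ.≡-dec _≟_) _∷_ Vecₚ.∷-injective a v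

  instance
    fintype-Vec : ∀ {A : Set} {n} {{_ : Fintype A}} → Fintype (Vec A n)
    fintype-Vec {A} {n} = record { elems = vecElems n ; _≟_ = Vecₚ.≡-dec _≟_ ; once = vecOnce n }

  opaque
    unfolding ∑

    ∑-× : ∀ {A B : Set} {{_ : Fintype A}} {{_ : Fintype B}} (f : A × B → ℕ) → ∑ f ≡ ∑ (λ a → ∑ (λ b → f (a , b)))
    ∑-× f = sumL-pairs _,_ elems elems f

    ∑-Vec : ∀ {A : Set} {{_ : Fintype A}} {n} (f : Vec A (suc n) → ℕ) → ∑ f ≡ ∑ (λ a → ∑ (λ v → f (a ∷ v)))
    ∑-Vec f = sumL-pairs _∷_ elems elems f

    ∑-Fin : ∀ {n} (f : Fin (suc n) → ℕ) → ∑ f ≡ f zero + ∑ (f ∘ suc)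
    ∑-Fin {n} f = cong (f zero +_) (sumL-map suc (finList n) f)

    ∑-∅ : {f : Fin 0 → ℕ} → ∑ f ≡ 0
    ∑-∅ = refl

    ∑-Bool : (f : Bool → ℕ) → ∑ f ≡ f true + f false
    ∑-Bool f = cong (f true +_) (ℕₚ.+-identityʳ (f false))

    ∑-[] : ∀ {A : Set} {{_ : Fintype A}} (f : Vec A 0 → ℕ) → ∑ f ≡ f []
    ∑-[] f = ℕₚ.+-identityʳ (f [])

    ∑-swap : ∀ {A B : Set} {{_ : Fintype A}} {{_ : Fintype B}} (f : A → B → ℕ) →
      ∑ (λ x → ∑ (f x)) ≡ ∑ (λ y → ∑ (λ x → f x y))
    ∑-swap = sumL-swap elems elems

    ∑-find : ∀ {A : Set} {{_ : Fintype A}} (f g : A → ℕ) → ∑ f < ∑ g → ∃ λ x → f x < g x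
    ∑-find = sumL-find elems

    ∑-once : ∀ {A : Set} {{_ : Fintype A}} (a : A) → ∑ (λ x → 𝟙 (x ≟ a)) ≡ 1
    ∑-once = once

  module _ {A : Set} {{FA : Fintype A}} where
    opaque
      unfolding ∑

      ∑-mono : {f g : A → ℕ} → (∀ x → f x ≤ g x) → ∑ f ≤ ∑ g
      ∑-mono = sumL-mono elems

      ∑-cong : {f g : A → ℕ} → (∀ x → f x ≡ g x) → ∑ f ≡ ∑ g
      ∑-cong = sumL-cong elems

      ∑-+ : (f g : A → ℕ) → ∑ (λ x → f x + g x) ≡ ∑ f + ∑ g
      ∑-+ = sumL-+ elems

      ∑-* : ∀ c (f : A → ℕ) → ∑ (λ x → c * f x) ≡ c * ∑ f
      ∑-* = sumL-* elems

      ∑-*ʳ : ∀ c (f : A → ℕ) → ∑ (λ x → f x * c) ≡ ∑ f * c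
      ∑-*ʳ c f = trans (∑-cong (λ x → ℕₚ.*-comm (f x) c)) (trans (∑-* c f) (ℕₚ.*-comm c (∑ f)))

      ∑-0 : ∑ {A} (λ _ → 0) ≡ 0
      ∑-0 = sumL-0 {A} elems

    ∑-const : ∀ c → ∑ {A} (λ _ → c) ≡ card A * c
    ∑-const c = trans (∑-cong (λ _ → sym (ℕₚ.*-identityˡ c))) (∑-*ʳ c (λ _ → 1))

    ∑-δ : ∀ a (f : A → ℕ) → ∑ (λ x → 𝟙 (x ≟ a) * f x) ≡ f a
    ∑-δ a f = trans (∑-cong eq) (trans (∑-*ʳ (f a) _) (trans (cong (_* f a) (∑-once a)) (ℕₚ.*-identityˡ _)))
      where
      eq : ∀ x → 𝟙 (x ≟ a) * f x ≡ 𝟙 (x ≟ a) * f a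
      eq x with x ≟ a
      ... | yes refl = refl
      ... | no _ = refl

    term≤∑ : ∀ a (f : A → ℕ) → f a ≤ ∑ f
    term≤∑ a f = ℕₚ.≤-trans (ℕₚ.≤-reflexive (sym (∑-δ a f)))
      (∑-mono (λ x → ℕₚ.≤-trans (ℕₚ.*-monoˡ-≤ (f x) (𝟙≤1 (x ≟ a))) (ℕₚ.≤-reflexive (ℕₚ.*-identityˡ _))))

    ∃? : ∀ {ℓ} {P : A → Set ℓ} → (∀ x → Dec (P x)) → Dec (∃ P)
    ∃? {_} {P} P? with 0 <? ∑ (λ x → 𝟙 (P? x))
    ... | yes pos = let (x , lt) = ∑-find (λ _ → 0) _ (subst (_< ∑ (λ x → 𝟙 (P? x))) (sym ∑-0) pos)
                    in yes (x , 𝟙>0 (P? x) lt)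
    ... | no ≯0 = no λ { (a , pa) → ≯0 (ℕₚ.≤-trans (ℕₚ.≤-reflexive (sym (𝟙-yes (P? a) pa))) (term≤∑ a _)) }

    count≤1 : ∀ {ℓ} {P : A → Set ℓ} (P? : ∀ x → Dec (P x)) → (∀ x y → P x → P y → x ≡ y) → ∑ (λ x → 𝟙 (P? x)) ≤ 1
    count≤1 P? uniq with ∃? P?
    ... | yes (a , pa) = ℕₚ.≤-trans (∑-mono (λ x → 𝟙-mono (P? x) (x ≟ a) (λ px → uniq x a px pa))) (ℕₚ.≤-reflexive (∑-once a))
    ... | no ∄ = ℕₚ.≤-trans (ℕₚ.≤-reflexive (trans (∑-cong (λ x → 𝟙-no (P? x) (λ p → ∄ (x , p)))) ∑-0)) z≤n

  module _ {A B : Set} {{FA : Fintype A}} {{FB : Fintype B}} where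
    -- Each y has at most one preimage under φ among the x of positive weight.
    ∑-inj-on : (φ : A → B) (w : A → ℕ) (f : B → ℕ) → (∀ x → w x ≤ f (φ x)) →
      (∀ x y → 0 < w x → 0 < w y → φ x ≡ φ y → x ≡ y) → ∑ w ≤ ∑ f
    ∑-inj-on φ w f w≤f inj = begin
      ∑ w                                          ≡⟨ ∑-cong (λ x → sym (∑-δ (φ x) (λ _ → w x))) ⟩
      ∑ (λ x → ∑ (λ y → 𝟙 (y ≟ φ x) * w x))        ≡⟨ ∑-swap _ ⟩
      ∑ (λ y → ∑ (λ x → 𝟙 (y ≟ φ x) * w x))        ≤⟨ ∑-mono (λ y → ∑-mono (λ x → bound x y)) ⟩
      ∑ (λ y → ∑ (λ x → 𝟙 (P? y x) * f y))         ≡⟨ ∑-cong (λ y → ∑-*ʳ (f y) _) ⟩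
      ∑ (λ y → ∑ (λ x → 𝟙 (P? y x)) * f y)         ≤⟨ ∑-mono (λ y → ℕₚ.*-monoˡ-≤ (f y) (count≤1 (P? y)
                                                        (λ x x′ (e , p) (e′ , p′) → inj x x′ p p′ (trans (sym e) e′)))) ⟩
      ∑ (λ y → 1 * f y)                            ≡⟨ ∑-cong (λ y → ℕₚ.*-identityˡ (f y)) ⟩
      ∑ f                                          ∎
      where
      open ℕₚ.≤-Reasoning
      P? : ∀ y x → Dec (y ≡ φ x × 0 < w x)
      P? y x = (y ≟ φ x) ×-dec (0 <? w x)
      bound′ : ∀ {P : Set} {u v} (d : Dec P) (e : Dec (0 < u)) → (P → u ≤ v) → 𝟙 d * u ≤ 𝟙 (d ×-dec e) * v
      bound′ (no _) _ _ = z≤n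
      bound′ (yes p) (yes _) h = ℕₚ.*-monoʳ-≤ 1 (h p)
      bound′ {u = u} (yes p) (no u≯0) h = subst (_≤ 0) (sym (ℕₚ.*-identityˡ u)) (ℕₚ.≮⇒≥ u≯0)
      bound : ∀ x y → 𝟙 (y ≟ φ x) * w x ≤ 𝟙 (P? y x) * f y
      bound x y = bound′ (y ≟ φ x) (0 <? w x) (λ { refl → w≤f x })

    ∑-inj : (φ : A → B) (f : B → ℕ) → (∀ x y → φ x ≡ φ y → x ≡ y) → ∑ (f ∘ φ) ≤ ∑ f
    ∑-inj φ f inj = ∑-inj-on φ (f ∘ φ) f (λ _ → ℕₚ.≤-refl) (λ x y _ _ → inj x y)

    count-inj : ∀ {ℓ ℓ′} {P : A → Set ℓ} {Q : B → Set ℓ′} (P? : ∀ x → Dec (P x)) (Q? : ∀ y → Dec (Q y)) (φ : A → B) →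
      (∀ x → P x → Q (φ x)) → (∀ x y → P x → P y → φ x ≡ φ y → x ≡ y) →
      ∑ (λ x → 𝟙 (P? x)) ≤ ∑ (λ y → 𝟙 (Q? y))
    count-inj P? Q? φ pq inj = ∑-inj-on φ _ _ (λ x → 𝟙-mono (P? x) (Q? (φ x)) (pq x))
      (λ x y p p′ → inj x y (𝟙>0 (P? x) p) (𝟙>0 (P? y) p′))

  module _ {A B : Set} {{FA : Fintype A}} {{FB : Fintype B}} where
    -- A collision can be searched for, since the domain is finite with decidable equality; if none
    -- is found, φ is injective.
    pigeonhole : (φ : A → B) → card B < card A → ∃ λ x → ∃ λ y → x ≢ y × φ x ≡ φ y
    pigeonhole φ lt with ∃? {A × A} (λ { (x , y) → ¬? (x ≟ y) ×-dec (φ x ≟ φ y) })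
    ... | yes ((x , y) , x≢y , e) = x , y , x≢y , e
    ... | no ∄ = ⊥-elim (ℕₚ.<⇒≱ lt (∑-inj φ (λ _ → 1) inj))
      where
      inj : ∀ x y → φ x ≡ φ y → x ≡ y
      inj x y e with x ≟ y
      ... | yes x≡y = x≡y
      ... | no x≢y = ⊥-elim (∄ ((x , y) , x≢y , e))

  card-× : ∀ {A B : Set} {{_ : Fintype A}} {{_ : Fintype B}} → card (A × B) ≡ card A * card B
  card-× {A} {B} = trans (∑-× {A} {B} (λ _ → 1)) (∑-const {A} (card B))

  card-Vec : ∀ {A : Set} {{_ : Fintype A}} n → card (Vec A n) ≡ card A ^ n
  card-Vec {A} zero = ∑-[] {A} (λ _ → 1)
  card-Vec {A} (suc n) = trans (∑-Vec {A} {n} (λ _ → 1)) (trans (∑-const {A} (card (Vec A n))) (cong (card A *_) (card-Vec {A} n)))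

  card-Fin : ∀ n → card (Fin n) ≡ n
  card-Fin zero = ∑-∅
  card-Fin (suc n) = trans (∑-Fin {n} (λ _ → 1)) (cong suc (card-Fin n))

  least : ∀ {P : ℕ → Set} → (∀ k → Dec (P k)) → ∀ N → P N → ∃ λ k → P k × (∀ j → j < k → ¬ P j)
  least {P} P? N pN with search N
    where
    search : ∀ n → (∃ λ k → P k × (∀ j → j < k → ¬ P j)) ⊎ (∀ j → j < n → ¬ P j)
    search zero = inj₂ λ j ()
    search (suc n) with search n
    ... | inj₁ r = inj₁ r
    ... | inj₂ none with P? n
    ...   | yes p = inj₁ (n , p , none)
    ...   | no ¬p = inj₂ λ j j<1+n → [ none j , (λ { refl → ¬p }) ]′ (ℕₚ.m<1+n⇒m<n∨m≡n j<1+n)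
  ... | inj₁ r = r
  ... | inj₂ none = N , pN , none

  argmin : ∀ {A : Set} {{_ : Fintype A}} {P : A → Set} → (∀ x → Dec (P x)) → (f : A → ℕ) → ∃ P →
    ∃ λ x → P x × (∀ y → P y → f x ≤ f y)
  argmin {A} {P} P? f (a , pa) with least {λ k → ∃ λ x → P x × f x ≤ k} (λ k → ∃? (λ x → P? x ×-dec (f x ≤? k))) (f a) (a , pa , ℕₚ.≤-refl)
  ... | k , (x , px , fx≤k) , min = x , px , λ y py → ℕₚ.≮⇒≥ λ fy<fx → min (f y) (ℕₚ.<-≤-trans fy<fx fx≤k) (y , py , ℕₚ.≤-refl)

-- Integer congruences, and periodic sequences under convolution

module PeriodicConvolution where
  open FiniteCounting
  import Data.Integer as ℤ
  import Data.Integer.Properties as ℤₚ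
  import Data.Nat as ℕ
  import Data.Nat.Properties as ℕₚ
  open import Algebra.Bundles using (CommutativeRing)
  open import Data.Empty using (⊥-elim)
  open import Data.Integer using (ℤ; +_; -[1+_]) renaming (_+_ to _+ᶻ_; _*_ to _*ᶻ_; _-_ to _-ᶻ_; -_ to -ᶻ_)
  open import Data.Integer.DivMod using (_%ℕ_; _/ℕ_; n%ℕd<d; a≡a%ℕn+[a/ℕn]*n)
  open import Data.Integer.Tactic.RingSolver using (solve-∀)
  open import Data.Nat using (ℕ; zero; suc; s≤s)
  open import Data.Product using (_,_)
  open import Function using (_∘_)
  open import Level using (0ℓ)
  open import Relation.Binary.PropositionalEquality using (_≡_; refl; sym; trans; cong; cong₂; subst; module ≡-Reasoning)
  open import Relation.Binary.Structures using (IsEquivalence)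

  -- The modulus may be 0, where congruence is equality; so every statement about congruences also
  -- covers identities over ℤ.
  record Cong (m a b : ℤ) : Set where
    constructor cg
    field
      quo : ℤ
      eqn : a ≡ b +ᶻ quo *ᶻ m

  cong-≡ : ∀ {m a b} → a ≡ b → Cong m a b
  cong-≡ {m} {a} refl = cg (+ 0) (solve1 a m)
    where
    solve1 : ∀ a m → a ≡ a +ᶻ + 0 *ᶻ m
    solve1 = solve-∀

  cong-refl : ∀ {m a} → Cong m a a
  cong-refl = cong-≡ refl

  cong-sym : ∀ {m a b} → Cong m a b → Cong m b a
  cong-sym {m} {a} {b} (cg t refl) = cg (-ᶻ t) (lem b t m)
    where
    lem : ∀ b t m → b ≡ (b +ᶻ t *ᶻ m) +ᶻ (-ᶻ t) *ᶻ m
    lem = solve-∀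

  cong-trans : ∀ {m a b c} → Cong m a b → Cong m b c → Cong m a c
  cong-trans {m} {c = c} (cg t refl) (cg s refl) = cg (s +ᶻ t) (lem c s t m)
    where
    lem : ∀ c s t m → (c +ᶻ s *ᶻ m) +ᶻ t *ᶻ m ≡ c +ᶻ (s +ᶻ t) *ᶻ m
    lem = solve-∀

  cong-+ : ∀ {m a b c d} → Cong m a b → Cong m c d → Cong m (a +ᶻ c) (b +ᶻ d)
  cong-+ {m} {b = b} {d = d} (cg t refl) (cg s refl) = cg (t +ᶻ s) (lem b d s t m)
    where
    lem : ∀ b d s t m → (b +ᶻ t *ᶻ m) +ᶻ (d +ᶻ s *ᶻ m) ≡ (b +ᶻ d) +ᶻ (t +ᶻ s) *ᶻ m
    lem = solve-∀

  cong-* : ∀ {m a b c d} → Cong m a b → Cong m c d → Cong m (a *ᶻ c) (b *ᶻ d)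
  cong-* {m} {b = b} {d = d} (cg t refl) (cg s refl) = cg (b *ᶻ s +ᶻ t *ᶻ d +ᶻ t *ᶻ m *ᶻ s) (lem b d s t m)
    where
    lem : ∀ b d s t m → (b +ᶻ t *ᶻ m) *ᶻ (d +ᶻ s *ᶻ m) ≡ (b *ᶻ d) +ᶻ (b *ᶻ s +ᶻ t *ᶻ d +ᶻ t *ᶻ m *ᶻ s) *ᶻ m
    lem = solve-∀

  cong-neg : ∀ {m a b} → Cong m a b → Cong m (-ᶻ a) (-ᶻ b)
  cong-neg {m} {b = b} (cg t refl) = cg (-ᶻ t) (lem b t m)
    where
    lem : ∀ b t m → -ᶻ (b +ᶻ t *ᶻ m) ≡ (-ᶻ b) +ᶻ (-ᶻ t) *ᶻ m
    lem = solve-∀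

  cong-0⇒≡ : ∀ {a b} → Cong (+ 0) a b → a ≡ b
  cong-0⇒≡ {b = b} (cg t refl) = lem b t
    where
    lem : ∀ b t → b +ᶻ t *ᶻ + 0 ≡ b
    lem = solve-∀

  -- Summands are functions on ℤ, so that shifts and reflections of the index by arbitrary integers
  -- need no case distinction.
  Sn : ℕ → (ℤ → ℤ) → ℤ
  Sn zero F = + 0
  Sn (suc n) F = Sn n F +ᶻ F (+ n)

  Sn-cong : ∀ n {F G : ℤ → ℤ} → (∀ k → F k ≡ G k) → Sn n F ≡ Sn n G
  Sn-cong zero h = refl
  Sn-cong (suc n) h = cong₂ _+ᶻ_ (Sn-cong n h) (h (+ n))

  Sn-cong< : ∀ n {F G : ℤ → ℤ} → (∀ i → i ℕ.< n → F (+ i) ≡ G (+ i)) → Sn n F ≡ Sn n G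
  Sn-cong< zero h = refl
  Sn-cong< (suc n) h = cong₂ _+ᶻ_ (Sn-cong< n (λ i i<n → h i (ℕₚ.m<n⇒m<1+n i<n))) (h n ℕₚ.≤-refl)

  Sn-Cong : ∀ n {m} {F G : ℤ → ℤ} → (∀ k → Cong m (F k) (G k)) → Cong m (Sn n F) (Sn n G)
  Sn-Cong zero h = cong-refl
  Sn-Cong (suc n) h = cong-+ (Sn-Cong n h) (h (+ n))

  Sn-+ : ∀ n F G → Sn n (λ k → F k +ᶻ G k) ≡ Sn n F +ᶻ Sn n G
  Sn-+ zero F G = refl
  Sn-+ (suc n) F G = trans (cong (_+ᶻ (F (+ n) +ᶻ G (+ n))) (Sn-+ n F G)) (lem (Sn n F) (Sn n G) (F (+ n)) (G (+ n)))
    where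
    lem : ∀ a b c d → (a +ᶻ b) +ᶻ (c +ᶻ d) ≡ (a +ᶻ c) +ᶻ (b +ᶻ d)
    lem = solve-∀

  Sn-* : ∀ n c F → Sn n (λ k → c *ᶻ F k) ≡ c *ᶻ Sn n F
  Sn-* zero c F = sym (ℤₚ.*-zeroʳ c)
  Sn-* (suc n) c F = trans (cong (_+ᶻ c *ᶻ F (+ n)) (Sn-* n c F)) (sym (ℤₚ.*-distribˡ-+ c _ _))

  Sn-*ʳ : ∀ n c F → Sn n (λ k → F k *ᶻ c) ≡ Sn n F *ᶻ c
  Sn-*ʳ n c F = trans (Sn-cong n (λ k → ℤₚ.*-comm (F k) c)) (trans (Sn-* n c F) (ℤₚ.*-comm c _))

  Sn-0 : ∀ n → Sn n (λ _ → + 0) ≡ + 0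
  Sn-0 zero = refl
  Sn-0 (suc n) = trans (ℤₚ.+-identityʳ _) (Sn-0 n)

  Sn-const : ∀ n c → Sn n (λ _ → c) ≡ + n *ᶻ c
  Sn-const zero c = sym (ℤₚ.*-zeroˡ c)
  Sn-const (suc n) c = trans (cong (_+ᶻ c) (Sn-const n c)) (lem (+ n) c)
    where
    lem : ∀ n c → n *ᶻ c +ᶻ c ≡ (+ 1 +ᶻ n) *ᶻ c
    lem = solve-∀

  Sn-swap : ∀ n m (F : ℤ → ℤ → ℤ) → Sn n (λ i → Sn m (F i)) ≡ Sn m (λ j → Sn n (λ i → F i j))
  Sn-swap zero m F = sym (Sn-0 m)
  Sn-swap (suc n) m F = trans (cong (_+ᶻ Sn m (F (+ n))) (Sn-swap n m F)) (sym (Sn-+ m _ (F (+ n))))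

  Sn-front : ∀ n F → Sn (suc n) F ≡ F (+ 0) +ᶻ Sn n (λ k → F (+ 1 +ᶻ k))
  Sn-front zero F = ℤₚ.+-comm (+ 0) (F (+ 0))
  Sn-front (suc n) F = trans (cong (_+ᶻ F (+ suc n)) (Sn-front n F)) (ℤₚ.+-assoc (F (+ 0)) _ _)

  Sn-reverse : ∀ n F → Sn n (λ k → F ((+ n -ᶻ + 1) -ᶻ k)) ≡ Sn n F
  Sn-reverse zero F = refl
  Sn-reverse (suc n) F = begin
    Sn n (λ k → F ((+ suc n -ᶻ + 1) -ᶻ k)) +ᶻ F ((+ suc n -ᶻ + 1) -ᶻ + n)
      ≡⟨ cong₂ _+ᶻ_ (Sn-cong n (λ k → cong F (lem₁ (+ n) k))) (cong F (lem₂ (+ n))) ⟩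
    Sn n (λ k → F (+ 1 +ᶻ ((+ n -ᶻ + 1) -ᶻ k))) +ᶻ F (+ 0)
      ≡⟨ cong (_+ᶻ F (+ 0)) (Sn-reverse n (λ k → F (+ 1 +ᶻ k))) ⟩
    Sn n (λ k → F (+ 1 +ᶻ k)) +ᶻ F (+ 0) ≡⟨ ℤₚ.+-comm _ (F (+ 0)) ⟩
    F (+ 0) +ᶻ Sn n (λ k → F (+ 1 +ᶻ k)) ≡⟨ Sn-front n F ⟨
    Sn (suc n) F ∎
    where
    open ≡-Reasoning
    lem₁ : ∀ n k → ((+ 1 +ᶻ n) -ᶻ + 1) -ᶻ k ≡ + 1 +ᶻ ((n -ᶻ + 1) -ᶻ k)
    lem₁ = solve-∀
    lem₂ : ∀ n → ((+ 1 +ᶻ n) -ᶻ + 1) -ᶻ n ≡ + 0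
    lem₂ = solve-∀

  +ᶻ-cancelˡ : ∀ a {b c} → a +ᶻ b ≡ a +ᶻ c → b ≡ c
  +ᶻ-cancelˡ a {b} {c} e = trans (lem a b) (trans (cong (-ᶻ a +ᶻ_) e) (sym (lem a c)))
    where
    lem : ∀ a b → b ≡ -ᶻ a +ᶻ (a +ᶻ b)
    lem = solve-∀

  module Periodic (q′ : ℕ) where
    q : ℕ
    q = suc q′

    IsPer : (ℤ → ℤ) → Set
    IsPer F = ∀ k → F (k +ᶻ + q) ≡ F k

    S : (ℤ → ℤ) → ℤ
    S = Sn q

    per-ℕ : ∀ {F} → IsPer F → ∀ n k → F (k +ᶻ + n *ᶻ + q) ≡ F k
    per-ℕ {F} h zero k = cong F (lem k (+ q))
      where
      lem : ∀ k m → k +ᶻ + 0 *ᶻ m ≡ k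
      lem = solve-∀
    per-ℕ {F} h (suc n) k = trans (cong F (lem k (+ n) (+ q))) (trans (h _) (per-ℕ h n k))
      where
      lem : ∀ k n m → k +ᶻ (+ 1 +ᶻ n) *ᶻ m ≡ (k +ᶻ n *ᶻ m) +ᶻ m
      lem = solve-∀

    per-ℤ : ∀ {F} → IsPer F → ∀ t k → F (k +ᶻ t *ᶻ + q) ≡ F k
    per-ℤ h (+ n) k = per-ℕ h n k
    per-ℤ {F} h (-[1+ n ]) k = trans (sym (per-ℕ h (suc n) _)) (cong F (lem k (+ suc n) (+ q)))
      where
      lem : ∀ k t m → (k +ᶻ (-ᶻ t) *ᶻ m) +ᶻ t *ᶻ m ≡ k
      lem = solve-∀

    per-Cong : ∀ {F} → IsPer F → ∀ {a b} → Cong (+ q) a b → F a ≡ F b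
    per-Cong h {b = b} (cg t refl) = per-ℤ h t b

    S-shift1 : ∀ {F} → IsPer F → S (λ k → F (+ 1 +ᶻ k)) ≡ S F
    S-shift1 {F} h = +ᶻ-cancelˡ (F (+ 0)) (begin
      F (+ 0) +ᶻ S (λ k → F (+ 1 +ᶻ k))  ≡⟨ Sn-front q F ⟨
      S F +ᶻ F (+ q)                     ≡⟨ cong (S F +ᶻ_) (trans (cong F (sym (ℤₚ.+-identityˡ (+ q)))) (h (+ 0))) ⟩
      S F +ᶻ F (+ 0)                     ≡⟨ ℤₚ.+-comm (S F) _ ⟩
      F (+ 0) +ᶻ S F                     ∎)
      where open ≡-Reasoning

    per-shift : ∀ {F} c → IsPer F → IsPer (λ k → F (k +ᶻ c))
    per-shift {F} c h k = trans (cong F (lem k c (+ q))) (h _)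
      where
      lem : ∀ k c m → (k +ᶻ m) +ᶻ c ≡ (k +ᶻ c) +ᶻ m
      lem = solve-∀

    S-shiftℕ : ∀ {F} → IsPer F → ∀ n → S (λ k → F (k +ᶻ + n)) ≡ S F
    S-shiftℕ {F} h zero = Sn-cong q (λ k → cong F (ℤₚ.+-identityʳ k))
    S-shiftℕ {F} h (suc n) = trans (Sn-cong q (λ k → cong F (lem k (+ n))))
      (trans (S-shift1 (per-shift (+ n) h)) (S-shiftℕ h n))
      where
      lem : ∀ k n → k +ᶻ (+ 1 +ᶻ n) ≡ (+ 1 +ᶻ k) +ᶻ n
      lem = solve-∀

    S-shift : ∀ {F} → IsPer F → ∀ c → S (λ k → F (k +ᶻ c)) ≡ S F
    S-shift h (+ n) = S-shiftℕ h n
    S-shift {F} h (-[1+ n ]) = sym (trans (Sn-cong q (λ k → cong F (lem k (+ suc n))))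
      (S-shiftℕ (per-shift (-[1+ n ]) h) (suc n)))
      where
      lem : ∀ k c → k ≡ (k +ᶻ c) +ᶻ (-ᶻ c)
      lem = solve-∀

    per-reflect : ∀ {F} c → IsPer F → IsPer (λ k → F (c -ᶻ k))
    per-reflect {F} c h k = trans (sym (h _)) (cong F (lem k c (+ q)))
      where
      lem : ∀ k c m → (c -ᶻ (k +ᶻ m)) +ᶻ m ≡ c -ᶻ k
      lem = solve-∀

    -- A translation turns the reflection into k ↦ q - 1 - k, which permutes 0, ..., q - 1.
    S-reflect : ∀ {F} → IsPer F → ∀ c → S (λ k → F (c -ᶻ k)) ≡ S F
    S-reflect {F} h c = begin
      S (λ k → F (c -ᶻ k))                                   ≡⟨ Sn-cong q (λ k → cong F (lem k c (+ q -ᶻ + 1))) ⟩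
      S (λ k → F ((+ q -ᶻ + 1) -ᶻ (k +ᶻ ((+ q -ᶻ + 1) -ᶻ c)))) ≡⟨ S-shift (per-reflect (+ q -ᶻ + 1) h) ((+ q -ᶻ + 1) -ᶻ c) ⟩
      S (λ k → F ((+ q -ᶻ + 1) -ᶻ k))                        ≡⟨ Sn-reverse q F ⟩
      S F                                                    ∎
      where
      open ≡-Reasoning
      lem : ∀ k c m → c -ᶻ k ≡ m -ᶻ (k +ᶻ (m -ᶻ c))
      lem = solve-∀

    -- A q-periodic sequence f stands for the element Σ_{0≤i<q} f(i) xⁱ of ℤ[x]/(x^q - 1).
    record Per : Set where
      no-eta-equality
      constructor mkPer
      field
        at  : ℤ → ℤ
        per : IsPer at
    open Per public

    infix 4 _≈[_]_
    record _≈[_]_ (f : Per) (m : ℤ) (g : Per) : Set where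
      constructor pw
      field ap : ∀ k → Cong m (at f k) (at g k)
    open _≈[_]_ public

    pw≡ : ∀ {f g m} → (∀ k → at f k ≡ at g k) → f ≈[ m ] g
    pw≡ h = pw (λ k → cong-≡ (h k))

    infixl 6 _⊞_
    infixl 7 _⋆_
    _⊞_ : Per → Per → Per
    f ⊞ g = mkPer (λ k → at f k +ᶻ at g k) (λ k → cong₂ _+ᶻ_ (per f k) (per g k))

    neg : Per → Per
    neg f = mkPer (λ k → -ᶻ at f k) (λ k → cong -ᶻ_ (per f k))

    const : ℤ → Per
    const c = mkPer (λ _ → c) (λ _ → refl)

    conv : Per → Per → ℤ → ℤ
    conv f g k = S (λ i → at f i *ᶻ at g (k -ᶻ i))

    opaque
      _⋆_ : Per → Per → Per
      f ⋆ g = mkPer (conv f g) (λ k → Sn-cong q (λ i → cong (at f i *ᶻ_)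
        (trans (cong (at g) (lem k i (+ q))) (per g _))))
        where
        lem : ∀ k i m → (k +ᶻ m) -ᶻ i ≡ (k -ᶻ i) +ᶻ m
        lem = solve-∀

      at-⋆ : ∀ f g k → at (f ⋆ g) k ≡ S (λ i → at f i *ᶻ at g (k -ᶻ i))
      at-⋆ f g k = refl

    per-term : ∀ f g k → IsPer (λ i → at f i *ᶻ at g (k -ᶻ i))
    per-term f g k i = cong₂ _*ᶻ_ (per f i) (per-reflect k (per g) i)

    opaque
      unfolding _⋆_

      ⋆-comm : ∀ f g k → at (f ⋆ g) k ≡ at (g ⋆ f) k
      ⋆-comm f g k = trans (sym (S-reflect (per-term f g k) k))
        (Sn-cong q (λ i → trans (cong (at f (k -ᶻ i) *ᶻ_) (cong (at g) (lem k i))) (ℤₚ.*-comm _ (at g i))))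
        where
        lem : ∀ k i → k -ᶻ (k -ᶻ i) ≡ i
        lem = solve-∀

      ⋆-assoc : ∀ f g h k → at ((f ⋆ g) ⋆ h) k ≡ at (f ⋆ (g ⋆ h)) k
      ⋆-assoc f g h k = begin
        S (λ i → S (λ j → at f j *ᶻ at g (i -ᶻ j)) *ᶻ at h (k -ᶻ i))
          ≡⟨ Sn-cong q (λ i → sym (Sn-*ʳ q (at h (k -ᶻ i)) _)) ⟩
        S (λ i → S (λ j → at f j *ᶻ at g (i -ᶻ j) *ᶻ at h (k -ᶻ i)))
          ≡⟨ Sn-swap q q _ ⟩
        S (λ j → S (λ i → at f j *ᶻ at g (i -ᶻ j) *ᶻ at h (k -ᶻ i)))
          ≡⟨ Sn-cong q (λ j → trans (Sn-cong q (λ i → ℤₚ.*-assoc (at f j) _ _)) (Sn-* q (at f j) _)) ⟩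
        S (λ j → at f j *ᶻ S (λ i → at g (i -ᶻ j) *ᶻ at h (k -ᶻ i)))
          ≡⟨ Sn-cong q (λ j → cong (at f j *ᶻ_) (inner j)) ⟩
        S (λ j → at f j *ᶻ S (λ i → at g i *ᶻ at h ((k -ᶻ j) -ᶻ i))) ∎
        where
        open ≡-Reasoning
        lem₁ : ∀ i j → i ≡ (i +ᶻ j) -ᶻ j
        lem₁ = solve-∀
        lem₂ : ∀ k i j → (k -ᶻ j) -ᶻ i ≡ k -ᶻ (i +ᶻ j)
        lem₂ = solve-∀
        inner : ∀ j → S (λ i → at g (i -ᶻ j) *ᶻ at h (k -ᶻ i)) ≡ S (λ i → at g i *ᶻ at h ((k -ᶻ j) -ᶻ i))
        inner j = sym (trans
          (Sn-cong q (λ i → cong₂ _*ᶻ_ (cong (at g) (lem₁ i j)) (cong (at h) (lem₂ k i j))))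
          (S-shift {λ i → at g (i -ᶻ j) *ᶻ at h (k -ᶻ i)} (λ i → cong₂ _*ᶻ_ (per-shift (-ᶻ j) (per g) i) (per-reflect k (per h) i)) j))

      ⋆-distribˡ : ∀ f g h k → at (f ⋆ (g ⊞ h)) k ≡ at ((f ⋆ g) ⊞ (f ⋆ h)) k
      ⋆-distribˡ f g h k = trans (Sn-cong q (λ i → ℤₚ.*-distribˡ-+ (at f i) _ _)) (Sn-+ q _ _)

      ⋆-Cong : ∀ {m f f₁ g g₁} → f ≈[ m ] f₁ → g ≈[ m ] g₁ → f ⋆ g ≈[ m ] f₁ ⋆ g₁
      ⋆-Cong (pw a) (pw b) = pw λ k → Sn-Cong q (λ i → cong-* (a i) (b (k -ᶻ i)))

    rem : ℤ → ℕ
    rem k = k %ℕ q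

    rem<q : ∀ k → rem k ℕ.< q
    rem<q k = n%ℕd<d k q

    rem-Cong : ∀ k → Cong (+ q) k (+ rem k)
    rem-Cong k = cg (k /ℕ q) (a≡a%ℕn+[a/ℕn]*n k q)

    residue-unique : ∀ {a b} → a ℕ.< q → b ℕ.< q → Cong (+ q) (+ a) (+ b) → a ≡ b
    residue-unique {a} {b} a<q b<q (cg (+ zero) e) = ℤₚ.+-injective (trans e (ℤₚ.+-identityʳ (+ b)))
    residue-unique {a} {b} a<q b<q (cg (+ suc t) e) = ⊥-elim (ℕₚ.<⇒≱ a<q (subst (q ℕ.≤_)
      (ℤₚ.+-injective (trans (trans (ℤₚ.pos-+ b (suc t ℕ.* q)) (cong (+ b +ᶻ_) (ℤₚ.pos-* (suc t) q))) (sym e)))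
      (ℕₚ.≤-trans (ℕₚ.m≤m+n q (t ℕ.* q)) (ℕₚ.m≤n+m (suc t ℕ.* q) b))))
    residue-unique {a} {b} a<q b<q (cg -[1+ t ] e) = ⊥-elim (ℕₚ.<⇒≱ b<q (subst (q ℕ.≤_)
      (ℤₚ.+-injective (trans (trans (ℤₚ.pos-+ a (suc t ℕ.* q)) (cong (+ a +ᶻ_) (ℤₚ.pos-* (suc t) q)))
        (trans (cong (_+ᶻ + suc t *ᶻ + q) e) (lem (+ b) (+ suc t) (+ q)))))
      (ℕₚ.≤-trans (ℕₚ.m≤m+n q (t ℕ.* q)) (ℕₚ.m≤n+m (suc t ℕ.* q) a))))
      where
      lem : ∀ b t q → (b +ᶻ (-ᶻ t) *ᶻ q) +ᶻ t *ᶻ q ≡ b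
      lem = solve-∀

    rem-cong : ∀ {a b} → Cong (+ q) a b → rem a ≡ rem b
    rem-cong {a} {b} c = residue-unique (rem<q a) (rem<q b) (cong-trans (cong-sym (rem-Cong a)) (cong-trans c (rem-Cong b)))

    rem-small : ∀ {a} → a ℕ.< q → rem (+ a) ≡ a
    rem-small {a} a<q = residue-unique (rem<q (+ a)) a<q (cong-sym (rem-Cong (+ a)))

    +q-Cong : ∀ k → Cong (+ q) (k +ᶻ + q) k
    +q-Cong k = cg (+ 1) (cong (k +ᶻ_) (sym (ℤₚ.*-identityˡ (+ q))))

    fromℕ→ : (ℕ → ℤ) → Per
    fromℕ→ g = mkPer (λ k → g (rem k)) (λ k → cong g (rem-cong (+q-Cong k)))

    at-rem : ∀ f k → at f k ≡ at f (+ rem k)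
    at-rem f k = per-Cong (per f) (rem-Cong k)

    ind0 : ℕ → ℤ
    ind0 zero = + 1
    ind0 (suc _) = + 0

    x^ : ℤ → Per
    x^ n = mkPer (λ k → ind0 (rem (k -ᶻ n))) (λ k → cong ind0 (rem-cong {b = k -ᶻ n} (cg (+ 1) (lem k n (+ q)))))
      where
      lem : ∀ k n m → (k +ᶻ m) -ᶻ n ≡ (k -ᶻ n) +ᶻ + 1 *ᶻ m
      lem = solve-∀

    opaque
      unfolding _⋆_

      x^⋆ : ∀ n f k → at (x^ n ⋆ f) k ≡ at f (k -ᶻ n)
      x^⋆ n f k = begin
        S (λ i → ind0 (rem (i -ᶻ n)) *ᶻ at f (k -ᶻ i))
          -- Summing from n instead of 0 brings the only nonzero term to the front.
          ≡⟨ S-shift (per-term (x^ n) f k) n ⟨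
        S (λ i → ind0 (rem ((i +ᶻ n) -ᶻ n)) *ᶻ at f (k -ᶻ (i +ᶻ n)))
          ≡⟨ Sn-front q′ _ ⟩
        ind0 (rem ((+ 0 +ᶻ n) -ᶻ n)) *ᶻ at f (k -ᶻ (+ 0 +ᶻ n)) +ᶻ Sn q′ (λ i → ind0 (rem ((+ 1 +ᶻ i +ᶻ n) -ᶻ n)) *ᶻ at f (k -ᶻ (+ 1 +ᶻ i +ᶻ n)))
          ≡⟨ cong₂ _+ᶻ_ (cong₂ _*ᶻ_ (cong (ind0 ∘ rem) (lem₁ (+ 0) n)) (cong (λ t → at f (k -ᶻ t)) (ℤₚ.+-identityˡ n)))
              (trans (Sn-cong< q′ (λ i i<q′ → cong (_*ᶻ at f (k -ᶻ (+ suc i +ᶻ n)))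
                 (trans (cong (ind0 ∘ rem) (lem₁ (+ suc i) n)) (cong ind0 (rem-small (s≤s i<q′)))))) (Sn-0 q′)) ⟩
        + 1 *ᶻ at f (k -ᶻ n) +ᶻ + 0 ≡⟨ trans (ℤₚ.+-identityʳ _) (ℤₚ.*-identityˡ _) ⟩
        at f (k -ᶻ n) ∎
        where
        open ≡-Reasoning
        lem₁ : ∀ i n → (i +ᶻ n) -ᶻ n ≡ i
        lem₁ = solve-∀

    zeroP oneP lam : Per
    zeroP = const (+ 0)
    oneP = x^ (+ 0)
    lam = x^ (+ 1) ⊞ neg oneP

    one⋆ : ∀ f k → at (oneP ⋆ f) k ≡ at f k
    one⋆ f k = trans (x^⋆ (+ 0) f k) (cong (at f) (ℤₚ.+-identityʳ k))

    ≈-isEquivalence : ∀ m → IsEquivalence (_≈[ m ]_)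
    ≈-isEquivalence m = record
      { refl = pw λ _ → cong-refl
      ; sym = λ h → pw λ k → cong-sym (ap h k)
      ; trans = λ h g → pw λ k → cong-trans (ap h k) (ap g k) }

    -- For m = 0 this is ℤ[x]/(x^q - 1), for m = p and m = q its reductions. The carrier and the
    -- operations stay the same and only the equality changes, so lifting and reducing are changes
    -- of viewpoint.
    R : ℤ → CommutativeRing 0ℓ 0ℓ
    R m = record
      { Carrier = Per ; _≈_ = _≈[ m ]_ ; _+_ = _⊞_ ; _*_ = _⋆_ ; -_ = neg ; 0# = zeroP ; 1# = oneP
      ; isCommutativeRing = record
        { isRing = record
          { +-isAbelianGroup = record
            { isGroup = record
              { isMonoid = record
                { isSemigroup = record
                  { isMagma = record { isEquivalence = ≈-isEquivalence m
                    ; ∙-cong = λ h g → pw λ k → cong-+ (ap h k) (ap g k) }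
                  ; assoc = λ f g h → pw≡ λ k → ℤₚ.+-assoc (at f k) _ _ }
                ; identity = (λ f → pw≡ λ k → ℤₚ.+-identityˡ _) , (λ f → pw≡ λ k → ℤₚ.+-identityʳ _) }
              ; inverse = (λ f → pw≡ λ k → ℤₚ.+-inverseˡ (at f k)) , (λ f → pw≡ λ k → ℤₚ.+-inverseʳ (at f k))
              ; ⁻¹-cong = λ h → pw λ k → cong-neg (ap h k) }
            ; comm = λ f g → pw≡ λ k → ℤₚ.+-comm (at f k) _ }
          ; *-cong = ⋆-Cong
          ; *-assoc = λ f g h → pw≡ (⋆-assoc f g h)
          ; *-identity = (λ f → pw≡ (one⋆ f)) , (λ f → pw≡ λ k → trans (⋆-comm f oneP k) (one⋆ f k))
          ; distrib = (λ f g h → pw≡ (⋆-distribˡ f g h))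
            , (λ f g h → pw≡ λ k → trans (⋆-comm (g ⊞ h) f k) (trans (⋆-distribˡ f g h k) (cong₂ _+ᶻ_ (⋆-comm f g k) (⋆-comm f h k)))) }
        ; *-comm = λ f g → pw≡ (⋆-comm f g) } }

-- The Frobenius endomorphism in prime characteristic

module FrobeniusIdentity where
  open FiniteCounting
  import Data.Fin.Properties as Finₚ
  import Data.Nat.Properties as ℕₚ
  open import Algebra.Bundles using (CommutativeRing)
  open import Data.Empty using (⊥-elim)
  open import Data.Fin using (Fin; zero; suc; toℕ; fromℕ; inject₁)
  open import Data.Integer using (+_; ∣_∣)
  open import Data.Nat using (zero; suc; _∸_; _<_; z≤n; s≤s) renaming (_+_ to _+ℕ_; _*_ to _*ℕ_)
  open import Data.Nat.Combinatorics using (_C_; nCn≡1; nC1≡n; nCk+nC[k+1]≡[n+1]C[k+1]; k>n⇒nCk≡0)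
  open import Data.Nat.Divisibility using (_∣_; divides; ∣⇒≤)
  open import Data.Nat.Primality using (Prime; euclidsLemma)
  open import Data.Nat.Tactic.RingSolver using () renaming (solve-∀ to solveℕ-∀)
  open import Data.Product using (_×_)
  open import Data.Sum using (inj₁; inj₂)
  open import Function using (_∘_)
  open import Level using (0ℓ)
  open import Relation.Binary.PropositionalEquality using (_≡_; refl; sym; trans; cong; cong₂; subst; module ≡-Reasoning)

  C-zero : ∀ n → n C 0 ≡ 1
  C-zero zero = refl
  C-zero (suc n) = refl

  -- Both sides count the subsets of k + 1 among n + 1 points with one marked element. The induction
  -- is by Pascal's rule.
  C-absorb : ∀ n k → suc k *ℕ (suc n C suc k) ≡ suc n *ℕ (n C k)
  C-absorb zero zero = refl
  C-absorb zero (suc k) = trans (cong (suc (suc k) *ℕ_) (k>n⇒nCk≡0 {1} {suc (suc k)} (s≤s (s≤s z≤n)))) (trans (ℕₚ.*-zeroʳ (suc (suc k))) (sym (cong (_+ℕ 0) (k>n⇒nCk≡0 {0} {suc k} (s≤s z≤n)))))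
  C-absorb (suc n) zero = trans (ℕₚ.*-identityˡ _) (trans (nC1≡n (suc (suc n))) (sym (trans (cong (suc (suc n) *ℕ_) (C-zero (suc n))) (ℕₚ.*-identityʳ _))))
  C-absorb (suc n) (suc k) = begin
    suc (suc k) *ℕ (suc (suc n) C suc (suc k)) ≡⟨ cong (suc (suc k) *ℕ_) (sym (nCk+nC[k+1]≡[n+1]C[k+1] (suc n) (suc k))) ⟩
    suc (suc k) *ℕ (suc n C suc k +ℕ suc n C suc (suc k)) ≡⟨ lem k (suc n C suc k) (suc n C suc (suc k)) ⟩
    suc n C suc k +ℕ suc k *ℕ (suc n C suc k) +ℕ suc (suc k) *ℕ (suc n C suc (suc k))
      ≡⟨ cong₂ (λ a b → suc n C suc k +ℕ a +ℕ b) (C-absorb n k) (C-absorb n (suc k)) ⟩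
    suc n C suc k +ℕ suc n *ℕ (n C k) +ℕ suc n *ℕ (n C suc k) ≡⟨ lem₂ (suc n) (suc n C suc k) (n C k) (n C suc k) ⟩
    suc n C suc k +ℕ suc n *ℕ (n C k +ℕ n C suc k) ≡⟨ cong (λ t → suc n C suc k +ℕ suc n *ℕ t) (nCk+nC[k+1]≡[n+1]C[k+1] n k) ⟩
    suc (suc n) *ℕ (suc n C suc k) ∎
    where
    open ≡-Reasoning
    lem : ∀ k a b → suc (suc k) *ℕ (a +ℕ b) ≡ a +ℕ suc k *ℕ a +ℕ suc (suc k) *ℕ b
    lem = solveℕ-∀
    lem₂ : ∀ n a b c → a +ℕ n *ℕ b +ℕ n *ℕ c ≡ a +ℕ n *ℕ (b +ℕ c)
    lem₂ = solveℕ-∀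

  -- By absorption the prime divides (k + 1) C(n + 1, k + 1), and it exceeds k + 1.
  prime∣C : ∀ {n} → Prime (suc n) → ∀ k → k < n → suc n ∣ (suc n C suc k)
  prime∣C {n} pr k k<n with euclidsLemma (suc k) (suc n C suc k) pr (divides (n C k) (trans (C-absorb n k) (ℕₚ.*-comm (suc n) _)))
  ... | inj₁ d = ⊥-elim (ℕₚ.<⇒≱ (s≤s k<n) (∣⇒≤ d))
  ... | inj₂ d = d

  module Frobenius {a} (R : CommutativeRing a 0ℓ) where
    open CommutativeRing R hiding (zero) renaming (Carrier to A; refl to ≈-refl; sym to ≈-sym; trans to ≈-trans)
    open import Algebra.Properties.Semiring.Exp semiring
    open import Algebra.Properties.CommutativeSemiring.Exp commutativeSemiring using (^-distrib-*)
    open import Algebra.Properties.Semiring.Mult semiring using (×-comm-*; ×-assoc-*; ×-assocˡ; ×-congˡ; ×-congʳ; ×-homo-1) renaming (_×_ to _·_)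
    open import Algebra.Properties.CommutativeSemiring.Binomial commutativeSemiring using (theorem; binomial)
    open import Algebra.Properties.Monoid.Sum +-monoid using (sum; sum-init-last; sum-cong-≋; sum-replicate-zero)
    open import Relation.Binary.Reasoning.Setoid setoid

    -- Only the two outer terms of the binomial expansion survive.
    frobenius-+ : ∀ {n} → Prime (suc n) → (∀ z → suc n · z ≈ 0#) → ∀ x y → (x + y) ^ suc n ≈ x ^ suc n + y ^ suc n
    frobenius-+ {zero} pr char x y = ≈-trans (*-identityʳ (x + y)) (+-cong (≈-sym (*-identityʳ x)) (≈-sym (*-identityʳ y)))
    frobenius-+ {suc m} pr char x y = begin
      (x + y) ^ n ≈⟨ theorem n x y ⟩
      sum t ≈⟨ +-cong first (≈-trans (sum-init-last (t ∘ suc)) (+-cong middle last)) ⟩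
      y ^ n + (0# + x ^ n) ≈⟨ +-congˡ (+-identityˡ _) ⟩
      y ^ n + x ^ n ≈⟨ +-comm _ _ ⟩
      x ^ n + y ^ n ∎
      where
      n = suc (suc m)
      t : Fin (suc n) → A
      t k = (n C toℕ k) · binomial x y n k
      first : t zero ≈ y ^ n
      first = ≈-trans (×-congˡ {binomial x y n zero} (C-zero n)) (≈-trans (×-homo-1 _) (*-identityˡ _))
      last : t (suc (fromℕ (suc m))) ≈ x ^ n
      last rewrite Finₚ.toℕ-fromℕ m = ≈-trans (×-congˡ {x ^ n * y ^ (n ∸ n)} (nCn≡1 n)) (≈-trans (×-homo-1 _)
        (≈-trans (*-congˡ (^-congʳ y (ℕₚ.n∸n≡0 n))) (*-identityʳ _)))
      vanish : ∀ (i : Fin (suc m)) → t (suc (inject₁ i)) ≈ 0#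
      vanish i with prime∣C pr (toℕ (inject₁ i)) (subst (_< suc m) (sym (Finₚ.toℕ-inject₁ i)) (Finₚ.toℕ<n i))
      ... | divides c e = ≈-trans (×-congˡ {binomial x y n (suc (inject₁ i))} (trans e (ℕₚ.*-comm c n)))
        (≈-trans (≈-sym (×-assocˡ (binomial x y n (suc (inject₁ i))) n c)) (char _))
      middle : sum (λ i → t (suc (inject₁ i))) ≈ 0#
      middle = ≈-trans (sum-cong-≋ vanish) (sum-replicate-zero (suc m))

    ^-distrib : ∀ x y n → (x * y) ^ n ≈ x ^ n * y ^ n
    ^-distrib = ^-distrib-*

    0^ : ∀ n → 0# ^ suc n ≈ 0#
    0^ n = zeroˡ _

    1^ : ∀ n → 1# ^ n ≈ 1#
    1^ zero = ≈-refl
    1^ (suc n) = ≈-trans (*-identityˡ _) (1^ n)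

-- Scalars and monomials in the cyclic ring, and Frobenius on them

module CyclicPowers where
  open FiniteCounting
  open PeriodicConvolution
  open FrobeniusIdentity
  import Data.Integer as ℤ
  import Data.Integer.Properties as ℤₚ
  import Data.Nat as ℕ
  import Data.Nat.Properties as ℕₚ
  open import Algebra.Bundles using (CommutativeRing)
  open import Data.Empty using (⊥-elim)
  open import Data.Integer using (ℤ; +_; -[1+_]; ∣_∣) renaming (_+_ to _+ᶻ_; _*_ to _*ᶻ_; _-_ to _-ᶻ_; -_ to -ᶻ_)
  open import Data.Integer.DivMod using (_%ℕ_; _/ℕ_; a≡a%ℕn+[a/ℕn]*n)
  open import Data.Integer.Tactic.RingSolver using (solve-∀)
  open import Data.Nat using (ℕ; zero; suc; _<_; z≤n; s≤s) renaming (_^_ to _^ℕ_)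
  open import Data.Nat.Divisibility using (_∣_; divides; ∣⇒≤)
  open import Data.Nat.Primality using (Prime; euclidsLemma; prime⇒irreducible; ¬prime[1])
  open import Data.Product using (_×_; _,_)
  open import Data.Sum using (_⊎_; inj₁; inj₂; [_,_]′)
  open import Function using (_∘_)
  open import Relation.Binary.PropositionalEquality using (_≡_; _≢_; refl; sym; trans; cong; cong₂; subst)
  open import Relation.Nullary using (¬_)

  Cong⇒∣ : ∀ {m a} → Cong (+ m) a (+ 0) → m ∣ ∣ a ∣
  Cong⇒∣ {m} {a} (cg t e) = divides ∣ t ∣ (trans (cong ∣_∣ (trans e (ℤₚ.+-identityˡ (t *ᶻ + m)))) (ℤₚ.abs-* t (+ m)))

  ∣⇒Cong : ∀ {m a} → m ∣ ∣ a ∣ → Cong (+ m) a (+ 0)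
  ∣⇒Cong {m} {+ n} (divides c e) = cg (+ c) (trans (cong +_ e) (trans (ℤₚ.pos-* c m) (sym (ℤₚ.+-identityˡ _))))
  ∣⇒Cong {m} { -[1+ n ]} (divides c e) = cg (-ᶻ + c) (trans (cong (λ t → -ᶻ (+ t)) e)
    (trans (cong -ᶻ_ (ℤₚ.pos-* c m)) (lem (+ c) (+ m))))
    where
    lem : ∀ c m → -ᶻ (c *ᶻ m) ≡ + 0 +ᶻ (-ᶻ c) *ᶻ m
    lem = solve-∀

  Cong-diff : ∀ {m a b} → Cong m a b → Cong m (a -ᶻ b) (+ 0)
  Cong-diff {m} {b = b} (cg t refl) = cg t (lem b (t *ᶻ m))
    where
    lem : ∀ b u → (b +ᶻ u) -ᶻ b ≡ + 0 +ᶻ u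
    lem = solve-∀

  Cong-undiff : ∀ {m a b} → Cong m (a -ᶻ b) (+ 0) → Cong m a b
  Cong-undiff {m} {a} {b} (cg t e) = cg t (trans (lem a b) (trans (cong (b +ᶻ_) e) (cong (b +ᶻ_) (ℤₚ.+-identityˡ _))))
    where
    lem : ∀ a b → a ≡ b +ᶻ (a -ᶻ b)
    lem = solve-∀

  Cong-prime : ∀ {m} → Prime m → ∀ a b → Cong (+ m) (a *ᶻ b) (+ 0) → Cong (+ m) a (+ 0) ⊎ Cong (+ m) b (+ 0)
  Cong-prime {m} pr a b c with euclidsLemma ∣ a ∣ ∣ b ∣ pr (subst (m ∣_) (ℤₚ.abs-* a b) (Cong⇒∣ c))
  ... | inj₁ d = inj₁ (∣⇒Cong d)
  ... | inj₂ d = inj₂ (∣⇒Cong d)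

  Cong-small : ∀ {m a} → Cong (+ m) a (+ 0) → ∣ a ∣ < m → a ≡ + 0
  Cong-small {m} {a} c lt = ℤₚ.∣i∣≡0⇒i≡0 (go ∣ a ∣ (Cong⇒∣ c) lt)
    where
    go : ∀ k → m ∣ k → k < m → k ≡ 0
    go zero _ _ = refl
    go (suc k) d lt = ⊥-elim (ℕₚ.<⇒≱ lt (∣⇒≤ d))

  powℤ : ℤ → ℕ → ℤ
  powℤ a n = a ℤ.^ n

  module Cyclic (q′ : ℕ) where
    open Periodic q′ public

    module Rm (m : ℤ) where
      open CommutativeRing (R m) public hiding (zero) renaming (refl to ≈refl; sym to ≈sym; trans to ≈trans)
      open Frobenius (R m) public
      open import Algebra.Properties.Semiring.Exp semiring public using (_^_; ^-congˡ; ^-assocʳ; ^-homo-*)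
      open import Algebra.Properties.Semiring.Mult semiring public using () renaming (_×_ to _·_)
      open import Algebra.Properties.Ring ring public using (-‿distribˡ-*; -‿distribʳ-*; -0#≈0#; x+x≈x⇒x≈0; +-cancelʳ; +-cancelˡ)

    pow : Per → ℕ → Per
    pow f n = Rm._^_ (+ 0) f n

    -- The operations do not depend on the modulus, so powers computed in rings with different
    -- moduli are the same sequences.
    pow-is : ∀ m f n → Rm._^_ m f n ≡ pow f n
    pow-is m f zero = refl
    pow-is m f (suc n) = cong (f ⋆_) (pow-is m f n)

    ≡⇒≈ : ∀ {m f g} → f ≡ g → f ≈[ m ] g
    ≡⇒≈ {m} refl = Rm.≈refl m

    sc : ℤ → Per
    sc a = mkPer (λ k → a *ᶻ at oneP k) (λ k → cong (a *ᶻ_) (per oneP k))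

    opaque
      unfolding _⋆_

      sc⋆ : ∀ a f k → at (sc a ⋆ f) k ≡ a *ᶻ at f k
      sc⋆ a f k = trans (Sn-cong q (λ i → ℤₚ.*-assoc a _ _)) (trans (Sn-* q a _) (cong (a *ᶻ_) (one⋆ f k)))

    sc-pow : ∀ a n k → at (pow (sc a) n) k ≡ at (sc (powℤ a n)) k
    sc-pow a zero k = sym (ℤₚ.*-identityˡ _)
    sc-pow a (suc n) k = trans (sc⋆ a (pow (sc a) n) k) (trans (cong (a *ᶻ_) (sc-pow a n k)) (sym (ℤₚ.*-assoc a _ _)))

    sc-at0 : ∀ a → at (sc a) (+ 0) ≡ a
    sc-at0 a = trans (cong (a *ᶻ_) (cong ind0 (rem-small (s≤s z≤n)))) (ℤₚ.*-identityʳ a)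

    mult-at : ∀ m n f k → at (Rm._·_ m n f) k ≡ + n *ᶻ at f k
    mult-at m zero f k = sym (ℤₚ.*-zeroˡ (at f k))
    mult-at m (suc n) f k = trans (cong (at f k +ᶻ_) (mult-at m n f k)) (lem (at f k) (+ n))
      where
      lem : ∀ a n → a +ᶻ n *ᶻ a ≡ (+ 1 +ᶻ n) *ᶻ a
      lem = solve-∀

    x^-+ : ∀ a b k → at (x^ a ⋆ x^ b) k ≡ at (x^ (a +ᶻ b)) k
    x^-+ a b k = trans (x^⋆ a (x^ b) k) (cong (ind0 ∘ rem) (lem k a b))
      where
      lem : ∀ k a b → (k -ᶻ a) -ᶻ b ≡ k -ᶻ (a +ᶻ b)
      lem = solve-∀

    x^-pow : ∀ a n k → at (pow (x^ a) n) k ≡ at (x^ (+ n *ᶻ a)) k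
    x^-pow a zero k = cong (ind0 ∘ rem) (cong (λ t → k -ᶻ t) (sym (ℤₚ.*-zeroˡ a)))
    x^-pow a (suc n) k = trans (cong-0⇒≡ (ap (Rm.*-congˡ (+ 0) {x^ a} {pow (x^ a) n} {x^ (+ n *ᶻ a)} (pw≡ (x^-pow a n))) k))
      (trans (x^-+ a (+ n *ᶻ a) k) (cong (λ t → ind0 (rem (k -ᶻ t))) (lem a (+ n))))
      where
      lem : ∀ a n → a +ᶻ n *ᶻ a ≡ (+ 1 +ᶻ n) *ᶻ a
      lem = solve-∀

    x^-Cong : ∀ {a b} → Cong (+ q) a b → ∀ k → at (x^ a) k ≡ at (x^ b) k
    x^-Cong {a} {b} c k = cong ind0 (rem-cong (cong-+ (cong-refl {a = k}) (cong-neg c)))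

    module PrimeChar {n : ℕ} (pr : Prime (suc n)) where
      ℓ : ℤ
      ℓ = + suc n
      open Rm ℓ

      char : ∀ z → suc n · z ≈[ ℓ ] zeroP
      char z = pw λ k → cg (at z k) (trans (mult-at ℓ (suc n) z k) (trans (ℤₚ.*-comm ℓ (at z k)) (sym (ℤₚ.+-identityˡ _))))

      frob : ∀ f g → (f ⊞ g) ^ suc n ≈[ ℓ ] f ^ suc n ⊞ g ^ suc n
      frob = frobenius-+ pr char

      frobN : ∀ N f g → (f ⊞ g) ^ (suc n ^ℕ N) ≈[ ℓ ] f ^ (suc n ^ℕ N) ⊞ g ^ (suc n ^ℕ N)
      frobN zero f g = ≈trans (*-identityʳ (f ⊞ g)) (≈sym (+-cong (*-identityʳ f) (*-identityʳ g)))
      frobN (suc N) f g = ≈trans (≈sym (^-assocʳ (f ⊞ g) (suc n) (suc n ^ℕ N)))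
        (≈trans (^-congˡ (suc n ^ℕ N) (frob f g))
        (≈trans (frobN N (f ^ suc n) (g ^ suc n)) (+-cong (^-assocʳ f (suc n) (suc n ^ℕ N)) (^-assocʳ g (suc n) (suc n ^ℕ N)))))

      -- Induction on a: (1 + a)^ℓ = 1 + a^ℓ by Frobenius.
      sc-ℕ : ∀ a → sc (+ a) ^ suc n ≈[ ℓ ] sc (+ a)
      sc-ℕ zero = ≈trans (*-congʳ {sc (+ 0) ^ n} {sc (+ 0)} {zeroP} z) (≈trans (zeroˡ (sc (+ 0) ^ n)) (≈sym z))
        where
        z : sc (+ 0) ≈[ ℓ ] zeroP
        z = pw≡ λ k → ℤₚ.*-zeroˡ (at oneP k)
      sc-ℕ (suc a) = ≈trans (^-congˡ (suc n) step) (≈trans (frob oneP (sc (+ a))) (≈trans (+-cong (1^ (suc n)) (sc-ℕ a)) (≈sym step)))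
        where
        step : sc (+ suc a) ≈[ ℓ ] oneP ⊞ sc (+ a)
        step = pw≡ λ k → lem (+ a) (at oneP k)
          where
          lem : ∀ a o → (+ 1 +ᶻ a) *ᶻ o ≡ o +ᶻ a *ᶻ o
          lem = solve-∀

      sc-Cong : ∀ {a b} → Cong ℓ a b → sc a ≈[ ℓ ] sc b
      sc-Cong c = pw λ k → cong-* c cong-refl

      sc-frob : ∀ a → sc a ^ suc n ≈[ ℓ ] sc a
      sc-frob a = ≈trans (^-congˡ (suc n) (sc-Cong c)) (≈trans (sc-ℕ r) (≈sym (sc-Cong c)))
        where
        r = a %ℕ suc n
        c : Cong ℓ a (+ r)
        c = cg (a /ℕ suc n) (a≡a%ℕn+[a/ℕn]*n a (suc n))

      sc-frobN : ∀ N a → sc a ^ (suc n ^ℕ N) ≈[ ℓ ] sc a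
      sc-frobN zero a = *-identityʳ (sc a)
      sc-frobN (suc N) a = ≈trans (≈sym (^-assocʳ (sc a) (suc n) (suc n ^ℕ N))) (≈trans (^-congˡ (suc n ^ℕ N) (sc-frob a)) (sc-frobN N a))

      -- Fermat's little theorem is the coefficient of x⁰ in `sc-frob`.
      fermat : ∀ a → Cong ℓ (powℤ a (suc n)) a
      fermat a = cong-trans (cong-≡ (sym (trans (trans (cong (λ f → at f (+ 0)) (pow-is ℓ (sc a) (suc n))) (sc-pow a (suc n) (+ 0))) (sc-at0 _))))
        (cong-trans (ap (sc-frob a) (+ 0)) (cong-≡ (sc-at0 a)))

    -- With ℓ = q the Frobenius map kills λ = x - 1, as x^q = 1.
    lam-nilpotent : Prime q → pow lam q ≈[ + q ] zeroP
    lam-nilpotent pr = F.≈trans (F.≈sym (≡⇒≈ {+ q} (pow-is (+ q) lam q))) (F.+-cancelʳ oneP (lam F.^ q) zeroP (F.≈trans key (F.≈sym (F.+-identityˡ oneP))))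
      where
      module F = Rm (+ q)
      open PrimeChar pr using (frob)
      x≈ : x^ (+ 1) ≈[ + q ] lam ⊞ oneP
      x≈ = pw≡ λ k → lem (at (x^ (+ 1)) k) (at oneP k)
        where
        lem : ∀ a b → a ≡ (a +ᶻ -ᶻ b) +ᶻ b
        lem = solve-∀
      xq : x^ (+ 1) F.^ q ≈[ + q ] oneP
      xq = pw≡ λ k → trans (cong (λ f → at f k) (pow-is (+ q) (x^ (+ 1)) q)) (trans (x^-pow (+ 1) q k)
        (x^-Cong {+ q *ᶻ + 1} {+ 0} (cg (+ 1) (trans (ℤₚ.*-comm (+ q) (+ 1)) (sym (ℤₚ.+-identityˡ (+ 1 *ᶻ + q))))) k))
      key : lam F.^ q ⊞ oneP ≈[ + q ] oneP
      key = F.≈trans (F.+-congˡ {lam F.^ q} {oneP} {oneP F.^ q} (F.≈sym (F.1^ q))) (F.≈trans (F.≈sym (frob lam oneP)) (F.≈trans (F.^-congˡ q (F.≈sym x≈)) xq))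

    module FrobeniusX {m : ℕ} (prq : Prime q) (prp : Prime (suc m)) (q≢p : q ≢ suc m) where
      private
        P = suc m
        open PrimeChar prp
        module F = Rm (+ P)

      partial : Per → ℕ → Per
      partial f zero = zeroP
      partial f (suc n) = partial f n ⊞ (sc (at f (+ n)) ⋆ x^ (+ n))

      partial-at : ∀ f n k → at (partial f n) k ≡ Sn n (λ i → at f i *ᶻ at (x^ i) k)
      partial-at f zero k = refl
      partial-at f (suc n) k = cong₂ _+ᶻ_ (partial-at f n k) (sc⋆ (at f (+ n)) (x^ (+ n)) k)

      -- Every f is the sum of its monomials; an additive and multiplicative map such as Frobenius
      -- is therefore known from scalars and powers of x.
      expand : ∀ f k → at (partial f q) k ≡ at f k
      expand f k = trans (partial-at f q k) (trans (Sn-cong q {λ i → at f i *ᶻ at (x^ i) k} {λ i → G (k -ᶻ i)} (λ i → trans (ℤₚ.*-comm (at f i) (at (x^ i) k))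
          (cong (λ t → ind0 (rem (k -ᶻ i)) *ᶻ at f t) (lem i k))))
        (trans (S-reflect {G} pt k)
        (trans (Sn-cong q {G} {λ i → at oneP i *ᶻ at f (k -ᶻ i)} (λ i → cong (λ t → ind0 (rem t) *ᶻ at f (k -ᶻ i)) (sym (ℤₚ.+-identityʳ i)))) (trans (sym (at-⋆ oneP f k)) (one⋆ f k)))))
        where
        lem : ∀ i k → i ≡ k -ᶻ (k -ᶻ i)
        lem = solve-∀
        G : ℤ → ℤ
        G i = ind0 (rem i) *ᶻ at f (k -ᶻ i)
        pt : IsPer G
        pt i = cong₂ _*ᶻ_ (cong ind0 (rem-cong (+q-Cong i))) (per-reflect k (per f) i)

      q∤p : ¬ (q ∣ P)
      q∤p d = [ (λ e → prime≢1 prq e) , q≢p ]′ (prime⇒irreducible prp d)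
        where
        prime≢1 : ∀ {k} → Prime k → k ≢ 1
        prime≢1 pr refl = ¬prime[1] pr

      -- Fermat modulo q with one factor P cancelled, which is possible since q does not divide the
      -- prime P ≠ q.
      pq : Cong (+ q) (powℤ (+ P) q′) (+ 1)
      pq = [ (λ c → ⊥-elim (q∤p (Cong⇒∣ {q} {+ P} c))) , Cong-undiff {+ q} {w} {+ 1} ]′ (Cong-prime prq (+ P) (w -ᶻ + 1) fer)
        where
        w = powℤ (+ P) q′
        lem : ∀ a b → a *ᶻ (b -ᶻ + 1) ≡ a *ᶻ b -ᶻ a
        lem = solve-∀
        fer : Cong (+ q) (+ P *ᶻ (w -ᶻ + 1)) (+ 0)
        fer = subst (λ t → Cong (+ q) t (+ 0)) (sym (lem (+ P) w)) (Cong-diff {+ q} {+ P *ᶻ w} {+ P} (PrimeChar.fermat prq (+ P)))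

      pow-pos : ∀ a n → powℤ (+ a) n ≡ + (a ^ℕ n)
      pow-pos a zero = refl
      pow-pos a (suc n) = trans (cong (+ a *ᶻ_) (pow-pos a n)) (sym (ℤₚ.pos-* a (a ^ℕ n)))

      private N = P ^ℕ q′

      x-fix : ∀ i → x^ i F.^ N ≈[ + P ] x^ i
      x-fix i = pw≡ λ k → trans (cong (λ f → at f k) (pow-is (+ P) (x^ i) N)) (trans (x^-pow i N k) (x^-Cong {+ N *ᶻ i} {i} c k))
        where
        c : Cong (+ q) (+ N *ᶻ i) i
        c = subst (Cong (+ q) (+ N *ᶻ i)) (ℤₚ.*-identityˡ i)
          (cong-* {+ q} {+ N} {+ 1} {i} {i} (subst (λ t → Cong (+ q) t (+ 1)) (pow-pos P q′) pq) cong-refl)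

      partial-fix : ∀ f n → partial f n F.^ N ≈[ + P ] partial f n
      partial-fix f zero = go N (ℕₚ.m^n>0 P q′)
        where
        go : ∀ j → 0 < j → zeroP F.^ j ≈[ + P ] zeroP
        go (suc j) _ = F.0^ j
      partial-fix f (suc n) = F.≈trans (frobN q′ (partial f n) (sc (at f (+ n)) ⋆ x^ (+ n))) (F.+-cong (partial-fix f n)
        (F.≈trans (F.^-distrib (sc (at f (+ n))) (x^ (+ n)) N) (F.*-cong (sc-frobN q′ (at f (+ n))) (x-fix (+ n)))))

      -- As P^(q-1) ≡ 1 modulo q, this iterate of Frobenius fixes x as well as all scalars. The
      -- identity takes the place of a factorisation of x^q - 1: reducedness, idempotents and
      -- inverses are all read off it.
      power-fix : ∀ f → f F.^ (P ^ℕ q′) ≈[ + P ] f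
      power-fix f = F.≈trans (F.^-congˡ N (F.≈sym e)) (F.≈trans (partial-fix f q) e)
        where
        e : partial f q ≈[ + P ] f
        e = pw≡ (expand f)

-- Augmentation, multiplication by λ, and sizes over ℤ

module CyclicDomain where
  open FiniteCounting
  open PeriodicConvolution
  open CyclicPowers
  import Data.Fin.Properties as Finₚ
  import Data.Integer as ℤ
  import Data.Integer.Properties as ℤₚ
  import Data.Nat as ℕ
  import Data.Nat.Properties as ℕₚ
  open import Data.Fin using (Fin; zero; suc; toℕ; fromℕ<)
  open import Data.Integer using (ℤ; +_; ∣_∣) renaming (_+_ to _+ᶻ_; _*_ to _*ᶻ_; _-_ to _-ᶻ_; -_ to -ᶻ_)
  open import Data.Integer.DivMod using (_/ℕ_; n%ℕd<d; a≡a%ℕn+[a/ℕn]*n)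
  open import Data.Integer.Tactic.RingSolver using (solve-∀)
  open import Data.Nat using (ℕ; zero; suc; _<_; _≤_; z≤n; s≤s) renaming (_+_ to _+ℕ_; _*_ to _*ℕ_)
  open import Data.Nat.Divisibility using (_∣_)
  open import Data.Product using (∃; _,_)
  open import Data.Sum using (inj₁; inj₂; [_,_]′)
  open import Function using (_∘_; id)
  open import Relation.Binary.PropositionalEquality using (_≡_; refl; sym; trans; cong; cong₂; subst)
  open import Relation.Nullary using (Dec; yes; no)

  Σℕ : ℕ → (ℕ → ℕ) → ℕ
  Σℕ zero g = 0
  Σℕ (suc n) g = Σℕ n g +ℕ g n

  term≤Σℕ : ∀ n g i → i < n → g i ≤ Σℕ n g
  term≤Σℕ (suc n) g i i<1+n with ℕₚ.m<1+n⇒m<n∨m≡n i<1+n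
  ... | inj₁ i<n = ℕₚ.≤-trans (term≤Σℕ n g i i<n) (ℕₚ.m≤m+n _ _)
  ... | inj₂ refl = ℕₚ.m≤n+m _ _

  Σℕ-mono : ∀ n {f g : ℕ → ℕ} → (∀ i → i < n → f i ≤ g i) → Σℕ n f ≤ Σℕ n g
  Σℕ-mono zero h = z≤n
  Σℕ-mono (suc n) h = ℕₚ.+-mono-≤ (Σℕ-mono n (λ i i<n → h i (ℕₚ.m<n⇒m<1+n i<n))) (h n ℕₚ.≤-refl)

  Σℕ-cong : ∀ n {f g : ℕ → ℕ} → (∀ i → i < n → f i ≡ g i) → Σℕ n f ≡ Σℕ n g
  Σℕ-cong zero h = refl
  Σℕ-cong (suc n) h = cong₂ _+ℕ_ (Σℕ-cong n (λ i i<n → h i (ℕₚ.m<n⇒m<1+n i<n))) (h n ℕₚ.≤-refl)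

  Σℕ-*ʳ : ∀ n c g → Σℕ n (λ i → g i *ℕ c) ≡ Σℕ n g *ℕ c
  Σℕ-*ʳ zero c g = refl
  Σℕ-*ʳ (suc n) c g = trans (cong (_+ℕ g n *ℕ c) (Σℕ-*ʳ n c g)) (sym (ℕₚ.*-distribʳ-+ c (Σℕ n g) (g n)))

  Σℕ-const : ∀ n c → Σℕ n (λ _ → c) ≡ n *ℕ c
  Σℕ-const zero c = refl
  Σℕ-const (suc n) c = trans (cong (_+ℕ c) (Σℕ-const n c)) (ℕₚ.+-comm (n *ℕ c) c)

  Σℕ-front : ∀ n g → Σℕ (suc n) g ≡ g 0 +ℕ Σℕ n (g ∘ suc)
  Σℕ-front zero g = ℕₚ.+-comm 0 (g 0)
  Σℕ-front (suc n) g = trans (cong (_+ℕ g (suc n)) (Σℕ-front n g)) (ℕₚ.+-assoc (g 0) _ _)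

  ∣Sn∣≤ : ∀ n F → ∣ Sn n F ∣ ≤ Σℕ n (λ i → ∣ F (+ i) ∣)
  ∣Sn∣≤ zero F = z≤n
  ∣Sn∣≤ (suc n) F = ℕₚ.≤-trans (ℤₚ.∣i+j∣≤∣i∣+∣j∣ (Sn n F) (F (+ n))) (ℕₚ.+-monoˡ-≤ _ (∣Sn∣≤ n F))

  ∣i-j∣≤ : ∀ i j → ∣ i -ᶻ j ∣ ≤ ∣ i ∣ +ℕ ∣ j ∣
  ∣i-j∣≤ i j = subst (λ t → ∣ i -ᶻ j ∣ ≤ ∣ i ∣ +ℕ t) (ℤₚ.∣-i∣≡∣i∣ j) (ℤₚ.∣i+j∣≤∣i∣+∣j∣ i (-ᶻ j))

  res : ∀ n → ℤ → Fin (suc n)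
  res n a = fromℕ< (n%ℕd<d a (suc n))

  toℕ-res : ∀ n a → Cong (+ suc n) a (+ toℕ (res n a))
  toℕ-res n a = cg (a /ℕ suc n) (trans (a≡a%ℕn+[a/ℕn]*n a (suc n)) (cong (λ t → + t +ᶻ (a /ℕ suc n) *ᶻ + suc n) (sym (Finₚ.toℕ-fromℕ< (n%ℕd<d a (suc n))))))

  res≡⇒Cong : ∀ n {a b} → res n a ≡ res n b → Cong (+ suc n) a b
  res≡⇒Cong n {a} {b} e = cong-trans (toℕ-res n a) (cong-trans (cong-≡ (cong (λ t → + toℕ t) e)) (cong-sym (toℕ-res n b)))

  Cong⇒res≡ : ∀ n {a b} → Cong (+ suc n) a b → res n a ≡ res n b
  Cong⇒res≡ n {a} {b} c = Finₚ.toℕ-injective (Periodic.residue-unique n (Finₚ.toℕ<n (res n a)) (Finₚ.toℕ<n (res n b))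
    (cong-trans (cong-sym (toℕ-res n a)) (cong-trans c (toℕ-res n b))))

  res-toℕ : ∀ n (i : Fin (suc n)) → res n (+ toℕ i) ≡ i
  res-toℕ n i = Finₚ.toℕ-injective (Periodic.residue-unique n (Finₚ.toℕ<n (res n (+ toℕ i))) (Finₚ.toℕ<n i) (cong-sym (toℕ-res n (+ toℕ i))))

  -- The bridge back from residues to ℤ: a nonzero difference of small numbers is no multiple of m.
  Cong-near : ∀ {m a b} → Cong (+ m) a b → ∣ a ∣ +ℕ ∣ b ∣ < m → a ≡ b
  Cong-near {m} {a} {b} c lt = ℤₚ.i-j≡0⇒i≡j a b (Cong-small (Cong-diff c) (ℕₚ.≤-<-trans (∣i-j∣≤ a b) lt))

  Cong? : ∀ n a b → Dec (Cong (+ suc n) a b)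
  Cong? n a b with res n a Finₚ.≟ res n b
  ... | yes e = yes (res≡⇒Cong n e)
  ... | no ¬e = no (¬e ∘ Cong⇒res≡ n)

  module Domain (q′ : ℕ) where
    open Cyclic q′ public

    infix 4 _≐_
    _≐_ : Per → Per → Set
    f ≐ g = ∀ k → at f k ≡ at g k

    ≐⇒≈ : ∀ {m f g} → f ≐ g → f ≈[ m ] g
    ≐⇒≈ = pw≡

    ≈⇒≐ : ∀ {f g} → f ≈[ + 0 ] g → f ≐ g
    ≈⇒≐ h k = cong-0⇒≡ (ap h k)

    residues : ∀ {f g} → (∀ r → r < q → at f (+ r) ≡ at g (+ r)) → f ≐ g
    residues {f} {g} h k = trans (at-rem f k) (trans (h (rem k) (rem<q k)) (sym (at-rem g k)))

    σ : Per → ℤ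
    σ f = S (at f)

    σ-⊞ : ∀ f g → σ (f ⊞ g) ≡ σ f +ᶻ σ g
    σ-⊞ f g = Sn-+ q (at f) (at g)

    σ-neg : ∀ f → σ (neg f) ≡ -ᶻ σ f
    σ-neg f = trans (Sn-cong q (λ k → lem (at f k))) (trans (Sn-* q (-ᶻ + 1) (at f)) (sym (lem (σ f))))
      where
      lem : ∀ a → -ᶻ a ≡ (-ᶻ + 1) *ᶻ a
      lem = solve-∀

    opaque
      unfolding _⋆_

      σ-⋆ : ∀ f g → σ (f ⋆ g) ≡ σ f *ᶻ σ g
      σ-⋆ f g = trans (Sn-swap q q (λ k i → at f i *ᶻ at g (k -ᶻ i))) (trans (Sn-cong q {λ i → S (λ k → at f i *ᶻ at g (k -ᶻ i))} {λ i → at f i *ᶻ σ g}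
        (λ i → trans (Sn-* q (at f i) (λ k → at g (k -ᶻ i))) (cong (at f i *ᶻ_) (S-shift (per g) (-ᶻ i))))) (Sn-*ʳ q (σ g) (at f)))

    σ-const : ∀ c → σ (const c) ≡ + q *ᶻ c
    σ-const c = Sn-const q c

    σ-cong : ∀ {m f g} → f ≈[ m ] g → Cong m (σ f) (σ g)
    σ-cong h = Sn-Cong q (ap h)

    σ-x^ : ∀ n → σ (x^ n) ≡ + 1
    σ-x^ n = trans (S-shift {λ k → ind0 (rem k)} (λ k → cong ind0 (rem-cong (+q-Cong k))) (-ᶻ n))
      (trans (Sn-front q′ (λ k → ind0 (rem k))) (cong₂ _+ᶻ_ (cong ind0 (rem-small (s≤s z≤n)))
        (trans (Sn-cong< q′ {λ k → ind0 (rem (+ 1 +ᶻ k))} {λ _ → + 0} (λ i i<q′ → cong ind0 (rem-small (s≤s i<q′)))) (Sn-0 q′))))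

    σ-lam : σ lam ≡ + 0
    σ-lam = trans (σ-⊞ (x^ (+ 1)) (neg oneP)) (trans (cong₂ _+ᶻ_ (σ-x^ (+ 1)) (trans (σ-neg oneP) (cong -ᶻ_ (σ-x^ (+ 0))))) refl)

    opaque
      unfolding _⋆_

      const⋆ : ∀ c f k → at (const c ⋆ f) k ≡ c *ᶻ σ f
      const⋆ c f k = trans (Sn-* q c _) (cong (c *ᶻ_) (S-reflect (per f) k))

      lam⋆ : ∀ f k → at (lam ⋆ f) k ≡ at f (k -ᶻ + 1) -ᶻ at f k
      lam⋆ f k = trans (⋆-comm lam f k) (trans (⋆-distribˡ f (x^ (+ 1)) (neg oneP) k) (cong₂ _+ᶻ_
        (trans (⋆-comm f (x^ (+ 1)) k) (x^⋆ (+ 1) f k))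
        (trans (Sn-cong q {λ i → at f i *ᶻ -ᶻ at oneP (k -ᶻ i)} {λ i → (-ᶻ + 1) *ᶻ (at f i *ᶻ at oneP (k -ᶻ i))} (λ i → lem (at f i) (at oneP (k -ᶻ i))))
          (trans (Sn-* q (-ᶻ + 1) (λ i → at f i *ᶻ at oneP (k -ᶻ i))) (trans (cong ((-ᶻ + 1) *ᶻ_) (trans (⋆-comm f oneP k) (one⋆ f k))) (lem₂ (at f k)))))))
        where
        lem : ∀ a b → a *ᶻ (-ᶻ b) ≡ (-ᶻ + 1) *ᶻ (a *ᶻ b)
        lem = solve-∀
        lem₂ : ∀ a → (-ᶻ + 1) *ᶻ a ≡ -ᶻ a
        lem₂ = solve-∀

    -- The entries of λ f are the differences f(k - 1) - f(k).
    lam-zero⇒const : ∀ {m} f → lam ⋆ f ≈[ m ] zeroP → ∀ k → Cong m (at f k) (at f (+ 0))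
    lam-zero⇒const {m} f h k = subst (λ t → Cong m t (at f (+ 0))) (sym (at-rem f k)) (go (rem k))
      where
      go : ∀ n → Cong m (at f (+ n)) (at f (+ 0))
      go zero = cong-refl
      go (suc n) = cong-trans (cong-sym (Cong-undiff (cong-trans (cong-≡ (sym (trans (lam⋆ f (+ suc n)) (cong (λ t → at f t -ᶻ at f (+ suc n)) (lem (+ n)))))) (ap h (+ suc n))))) (go n)
        where
        lem : ∀ a → (+ 1 +ᶻ a) -ᶻ + 1 ≡ a
        lem = solve-∀

    -- Division by λ: partial sums.
    lam-divide : ∀ w → σ w ≡ + 0 → ∃ λ z → lam ⋆ z ≐ w
    lam-divide w σw = z , residues {lam ⋆ z} {w} (λ { zero _ → trans (lam⋆ z (+ 0)) (z0 q′ refl) ; (suc r) lt → trans (lam⋆ z (+ suc r)) (z+ r lt) })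
      where
      z : Per
      z = fromℕ→ (λ r → -ᶻ Sn (suc r) (at w))
      val : ∀ r → r < q → at z (+ r) ≡ -ᶻ Sn (suc r) (at w)
      val r r<q = cong (λ t → -ᶻ Sn (suc t) (at w)) (rem-small r<q)
      lem₀ : ∀ a → (-ᶻ + 0) -ᶻ (-ᶻ (+ 0 +ᶻ a)) ≡ a
      lem₀ = solve-∀
      z0 : ∀ n → n ≡ q′ → at z (+ 0 -ᶻ + 1) -ᶻ at z (+ 0) ≡ at w (+ 0)
      z0 _ _ = trans (cong₂ _-ᶻ_ (trans (per-Cong (per z) {+ 0 -ᶻ + 1} {+ q′} (cg (-ᶻ + 1) (lem₁ (+ q′)))) (trans (val q′ ℕₚ.≤-refl) (cong -ᶻ_ σw))) (val 0 (s≤s z≤n))) (lem₀ (at w (+ 0)))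
        where
        lem₁ : ∀ a → + 0 -ᶻ + 1 ≡ a +ᶻ (-ᶻ + 1) *ᶻ (+ 1 +ᶻ a)
        lem₁ = solve-∀
      z+ : ∀ r → suc r < q → at z (+ suc r -ᶻ + 1) -ᶻ at z (+ suc r) ≡ at w (+ suc r)
      z+ r lt = trans (cong₂ _-ᶻ_ (trans (cong (at z) (lem₁ (+ r))) (val r (ℕₚ.<-trans ℕₚ.≤-refl lt))) (val (suc r) lt)) (lem₂ (Sn (suc r) (at w)) (at w (+ suc r)))
        where
        lem₁ : ∀ a → (+ 1 +ᶻ a) -ᶻ + 1 ≡ a
        lem₁ = solve-∀
        lem₂ : ∀ s a → (-ᶻ s) -ᶻ (-ᶻ (s +ᶻ a)) ≡ a
        lem₂ = solve-∀

    -- The ℓ¹ norm. It bounds products over ℤ and serves as the measure of the descent.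
    ‖_‖ : Per → ℕ
    ‖ f ‖ = Σℕ q (λ i → ∣ at f (+ i) ∣)

    at≤‖‖ : ∀ f k → ∣ at f k ∣ ≤ ‖ f ‖
    at≤‖‖ f k = subst (λ t → ∣ t ∣ ≤ ‖ f ‖) (sym (at-rem f k)) (term≤Σℕ q (λ i → ∣ at f (+ i) ∣) (rem k) (rem<q k))

    ‖‖≡0 : ∀ f → ‖ f ‖ ≡ 0 → f ≐ zeroP
    ‖‖≡0 f e k = ℤₚ.∣i∣≡0⇒i≡0 (ℕₚ.n≤0⇒n≡0 (subst (∣ at f k ∣ ≤_) e (at≤‖‖ f k)))

    zero? : ∀ f → Dec (f ≐ zeroP)
    zero? f with ‖ f ‖ ℕ.≟ 0
    ... | yes e = yes (‖‖≡0 f e)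
    ... | no ¬e = no λ h → ¬e (trans (Σℕ-cong q (λ i _ → cong ∣_∣ (h (+ i)))) (trans (Σℕ-const q 0) (ℕₚ.*-zeroʳ q)))

    opaque
      unfolding _⋆_

      ‖⋆‖ : ∀ f g M → (∀ k → ∣ at g k ∣ ≤ M) → ∀ k → ∣ at (f ⋆ g) k ∣ ≤ ‖ f ‖ *ℕ M
      ‖⋆‖ f g M h k = ℕₚ.≤-trans (∣Sn∣≤ q _) (ℕₚ.≤-trans
        (Σℕ-mono q (λ i _ → ℕₚ.≤-trans (ℕₚ.≤-reflexive (ℤₚ.abs-* (at f (+ i)) _)) (ℕₚ.*-monoʳ-≤ ∣ at f (+ i) ∣ (h (k -ᶻ + i)))))
        (ℕₚ.≤-reflexive (Σℕ-*ʳ q M _)))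

    module Z = Rm (+ 0)

    -- Being killed by λ, the element λ v is a constant; as its sum is 0, q times this constant
    -- vanishes.
    lam-lam : ∀ v → lam ⋆ (lam ⋆ v) ≐ zeroP → lam ⋆ v ≐ zeroP
    lam-lam v h = λ k → trans (c k) (c0 (trans (sym (Sn-cong q {at (lam ⋆ v)} {λ _ → c₀} c)) (trans (σ-⋆ lam v) (trans (cong (_*ᶻ σ v) σ-lam) (ℤₚ.*-zeroˡ (σ v))))))
      where
      c₀ = at (lam ⋆ v) (+ 0)
      c : ∀ k → at (lam ⋆ v) k ≡ c₀
      c k = cong-0⇒≡ (lam-zero⇒const (lam ⋆ v) (pw≡ h) k)
      c0 : S (λ _ → c₀) ≡ + 0 → c₀ ≡ + 0
      c0 e = [ (λ ()) , id ]′ (ℤₚ.i*j≡0⇒i≡0∨j≡0 (+ q) (trans (sym (Sn-const q c₀)) e))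

    lam^-cancel : ∀ K y → pow lam (suc K) ⋆ y ≐ zeroP → lam ⋆ y ≐ zeroP
    lam^-cancel zero y h k = trans (sym (≈⇒≐ (Z.*-congʳ {y} {pow lam 1} {lam} (Z.*-identityʳ lam)) k)) (h k)
    lam^-cancel (suc K) y h = lam^-cancel K y (λ k → trans (⋆-assoc lam (pow lam K) y k) (lam-lam (pow lam K ⋆ y)
      (λ j → trans (sym (≈⇒≐ (Z.≈trans (Z.*-assoc lam (pow lam (suc K)) y) (Z.*-congˡ {lam} (Z.*-assoc lam (pow lam K) y))) j)) (h j)) k))

-- The λ-adic valuation and the absence of zero divisors

module Valuation where
  open FiniteCounting
  open PeriodicConvolution
  open CyclicPowers
  open CyclicDomain
  import Data.Integer.Properties as ℤₚ
  import Data.Nat as ℕ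
  import Data.Nat.Properties as ℕₚ
  open import Data.Empty using (⊥-elim)
  open import Data.Fin using (zero; suc)
  open import Data.Integer using (ℤ; +_; ∣_∣) renaming (_+_ to _+ᶻ_; _*_ to _*ᶻ_; _-_ to _-ᶻ_; -_ to -ᶻ_)
  open import Data.Integer.DivMod using (_/ℕ_; a≡a%ℕn+[a/ℕn]*n)
  open import Data.Integer.Tactic.RingSolver using (solve-∀)
  open import Data.Nat using (ℕ; zero; suc; _≤_; z≤n; s≤s) renaming (_+_ to _+ℕ_; _*_ to _*ℕ_)
  open import Data.Nat.Divisibility using (_∣_)
  open import Data.Nat.Primality using (Prime)
  open import Data.Product using (∃; _×_; _,_)
  open import Data.Sum using (_⊎_; inj₁; inj₂; [_,_]′)
  open import Function using (id)
  open import Relation.Binary.PropositionalEquality using (_≡_; _≢_; sym; trans; cong; cong₂; subst)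
  open import Relation.Nullary using (¬_; Dec; yes; no)

  module DomainPrime (q′ : ℕ) (prq : Prime (suc q′)) where
    open Domain q′ public

    -- A λ-adic valuation over ℤ. Modulo q, λ divides z exactly when q divides σ z, so `ndiv` says
    -- that no further λ can be extracted. The scalar c collects the factors q removed in the
    -- descent.
    record Division (w : Per) : Set where
      constructor division
      field
        c : ℤ
        k : ℕ
        z : Per
        c≢0 : c ≢ + 0
        split : w ≐ sc c ⋆ (pow lam k ⋆ z)
        ndiv : ¬ Cong (+ q) (σ z) (+ 0)

    q≥2 : 2 ≤ q
    q≥2 = go q′ prq
      where
      open import Data.Nat.Primality using (¬prime[1])
      go : ∀ n → Prime (suc n) → 2 ≤ suc n
      go zero pr = ⊥-elim (¬prime[1] pr)
      go (suc n) pr = s≤s (s≤s z≤n)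

    one-scale : ∀ f → f ≐ sc (+ 1) ⋆ f
    one-scale f k = sym (trans (sc⋆ (+ 1) f k) (ℤₚ.*-identityˡ (at f k)))

    absorb-lam : ∀ {w z} j z′ → w ≐ pow lam j ⋆ z → lam ⋆ z′ ≐ z → w ≐ pow lam (suc j) ⋆ z′
    absorb-lam {w} {z} j z′ e lz k = trans (e k) (cong-0⇒≡ (ap eq k))
      where
      eq : pow lam j ⋆ z ≈[ + 0 ] (lam ⋆ pow lam j) ⋆ z′
      eq = Z.≈trans (Z.*-congˡ {pow lam j} {z} {lam ⋆ z′} (Z.≈sym (≐⇒≈ {f = lam ⋆ z′} {z} lz)))
        (IntegerCoefficientSolver.RingLemmas.swap-assoc (R (+ 0)) (pow lam j) lam z′)

    divide-step : ∀ w j → (Division w) ⊎ (∃ λ z → σ z ≡ + 0 × w ≐ pow lam j ⋆ z) →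
      (Division w) ⊎ (∃ λ z → σ z ≡ + 0 × w ≐ pow lam (suc j) ⋆ z)
    divide-step w j (inj₁ d) = inj₁ d
    divide-step w j (inj₂ (z , σz , e)) = decide (lam-divide z σz)
      where
      lem : ∀ t q → (+ 0 +ᶻ t *ᶻ q) +ᶻ -ᶻ (q *ᶻ t) ≡ + 0
      lem = solve-∀
      lem₂ : ∀ a b t → (a +ᶻ -ᶻ t) -ᶻ (b +ᶻ -ᶻ t) ≡ a -ᶻ b
      lem₂ = solve-∀
      subtract : ∀ z′ → lam ⋆ z′ ≐ z → ∀ t → σ z′ ≡ + 0 +ᶻ t *ᶻ + q → ∃ λ z → σ z ≡ + 0 × w ≐ pow lam (suc j) ⋆ z
      -- The constant t has sum q t = σ z′ and is killed by λ, so subtracting it restores sum 0 and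
      -- leaves the product with λ unchanged.
      subtract z′ lz t et = z″
        , trans (σ-⊞ z′ (neg (const t))) (trans (cong₂ _+ᶻ_ et (trans (σ-neg (const t)) (cong -ᶻ_ (σ-const t)))) (lem t (+ q)))
        , absorb-lam {w} {z} j z″ e (λ k → trans (lam⋆ z″ k) (trans (lem₂ (at z′ (k -ᶻ + 1)) (at z′ k) t) (trans (sym (lam⋆ z′ k)) (lz k))))
        where z″ = z′ ⊞ neg (const t)
      decide : (∃ λ z′ → lam ⋆ z′ ≐ z) → (Division w) ⊎ (∃ λ z → σ z ≡ + 0 × w ≐ pow lam (suc j) ⋆ z)
      decide (z′ , lz) = by (Cong? q′ (σ z′) (+ 0))
        where
        by : Dec (Cong (+ q) (σ z′) (+ 0)) → (Division w) ⊎ (∃ λ z → σ z ≡ + 0 × w ≐ pow lam (suc j) ⋆ z)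
        by (yes (cg t et)) = inj₂ (subtract z′ lz t et)
        by (no nd) = inj₁ (division (+ 1) (suc j) z′ (λ ())
          (λ k → trans (absorb-lam {w} {z} j z′ e lz k) (one-scale (pow lam (suc j) ⋆ z′) k)) nd)

    divide-steps : ∀ w → σ w ≡ + 0 → ∀ j → (Division w) ⊎ (∃ λ z → σ z ≡ + 0 × w ≐ pow lam j ⋆ z)
    divide-steps w σw zero = inj₂ (w , σw , λ k → sym (one⋆ w k))
    divide-steps w σw (suc j) = divide-step w j (divide-steps w σw j)

    module Descend (w z : Per) (σw : σ w ≡ + 0) (w≢0 : ¬ (w ≐ zeroP)) (e : w ≐ pow lam q ⋆ z) where
      private module Q = Rm (+ q)
      w≈0 : w ≈[ + q ] zeroP
      w≈0 = Q.≈trans (≐⇒≈ {f = w} {pow lam q ⋆ z} e) (Q.≈trans (Q.*-congʳ {z} {pow lam q} {zeroP} (lam-nilpotent prq)) (Q.zeroˡ z))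
      w/q : Per
      w/q = mkPer (λ k → at w k /ℕ q) (λ k → cong (_/ℕ q) (per w k))
      rem0 : ∀ k → rem (at w k) ≡ 0
      rem0 k = trans (rem-cong (ap w≈0 k)) (rem-small (s≤s z≤n))
      exact : ∀ k → at w k ≡ at w/q k *ᶻ + q
      exact k = trans (a≡a%ℕn+[a/ℕn]*n (at w k) q) (trans (cong (λ t → + t +ᶻ at w/q k *ᶻ + q) (rem0 k)) (ℤₚ.+-identityˡ (at w/q k *ᶻ + q)))
      σw/q : σ w/q ≡ + 0
      σw/q = [ id , (λ ()) ]′ (ℤₚ.i*j≡0⇒i≡0∨j≡0 (σ w/q) (trans (sym (Sn-*ʳ q (+ q) (at w/q))) (trans (sym (Sn-cong q exact)) σw)))
      w/q≢0 : ¬ (w/q ≐ zeroP)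
      w/q≢0 h = w≢0 (λ k → trans (exact k) (trans (cong (_*ᶻ + q) (h k)) (ℤₚ.*-zeroˡ (+ q))))
      size : ‖ w ‖ ≡ ‖ w/q ‖ *ℕ q
      size = trans (Σℕ-cong q (λ i _ → trans (cong ∣_∣ (exact (+ i))) (ℤₚ.abs-* (at w/q (+ i)) (+ q)))) (Σℕ-*ʳ q q (λ i → ∣ at w/q (+ i) ∣))
      smaller : ∀ B → ‖ w ‖ ≤ suc B → ‖ w/q ‖ ≤ B
      smaller B le = by (‖ w/q ‖ ℕ.≟ 0)
        where
        by : Dec (‖ w/q ‖ ≡ 0) → ‖ w/q ‖ ≤ B
        by (yes e0) = subst (_≤ B) (sym e0) z≤n
        by (no ne) = ℕₚ.≤-pred (ℕₚ.≤-trans (ℕₚ.m<m*n ‖ w/q ‖ q {{ℕ.≢-nonZero ne}} q≥2) (subst (_≤ suc B) size le))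
      scale : Division w/q → Division w
      scale (division c k y c≢0 s nd) = division (+ q *ᶻ c) k y
        (λ e → [ (λ ()) , c≢0 ]′ (ℤₚ.i*j≡0⇒i≡0∨j≡0 (+ q) e))
        (λ j → trans (exact j) (trans (cong (_*ᶻ + q) (trans (s j) (sc⋆ c (pow lam k ⋆ y) j)))
          (trans (lem c (at (pow lam k ⋆ y) j) (+ q)) (sym (sc⋆ (+ q *ᶻ c) (pow lam k ⋆ y) j))))) nd
        where
        lem : ∀ c y q → (c *ᶻ y) *ᶻ q ≡ (q *ᶻ c) *ᶻ y
        lem = solve-∀

    -- Infinite descent: λ^q divides w only if q does, and then w / q is smaller.
    division-of : ∀ B w → ‖ w ‖ ≤ B → σ w ≡ + 0 → ¬ (w ≐ zeroP) → Division w
    division-of zero w le σw w≢0 = ⊥-elim (w≢0 (‖‖≡0 w (ℕₚ.n≤0⇒n≡0 le)))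
    division-of (suc B) w le σw w≢0 = [ id , (λ { (z , _ , e) → descend z e }) ]′ (divide-steps w σw q)
      where
      descend : ∀ z → w ≐ pow lam q ⋆ z → Division w
      descend z e = scale (division-of B w/q (smaller B le) σw/q w/q≢0)
        where open Descend w z σw w≢0 e

    -- If a b = 0, cancelling scalars and powers of λ leaves λ z z₁ = 0, so z z₁ is a constant u.
    -- Then σ(z) σ(z₁) = q u, although q divides neither factor.
    no-zero-divisors₀ : ∀ {a b} → Division a → Division b → ¬ (a ⋆ b ≐ zeroP)
    no-zero-divisors₀ {a} {b} (division c k z c≢0 s nd) (division c₁ k₁ z₁ c₁≢0 s₁ nd₁) ab =
      [ nd , nd₁ ]′ (Cong-prime prq (σ z) (σ z₁) (cg u (trans (sym (σ-⋆ z z₁)) (trans (Sn-cong q uc) (trans (Sn-const q u) (trans (ℤₚ.*-comm (+ q) u) (sym (ℤₚ.+-identityˡ _))))))))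
      where
      L = pow lam (k +ℕ k₁) ⋆ (z ⋆ z₁)
      rearrange : a ⋆ b ≈[ + 0 ] sc c ⋆ (sc c₁ ⋆ L)
      rearrange = Z.≈trans (Z.*-cong (≐⇒≈ {f = a} {sc c ⋆ (pow lam k ⋆ z)} s) (≐⇒≈ {f = b} {sc c₁ ⋆ (pow lam k₁ ⋆ z₁)} s₁))
        (Z.≈trans (IntegerCoefficientSolver.RingLemmas.mul-shuffle (R (+ 0)) (sc c) (pow lam k) z (sc c₁) (pow lam k₁) z₁)
          (Z.*-congˡ {sc c} (Z.*-congˡ {sc c₁} (Z.*-congʳ {z ⋆ z₁} (Z.≈sym (Z.^-homo-* lam k k₁))))))
      L0 : L ≐ zeroP
      L0 j = [ (λ e → ⊥-elim (c≢0 e)) , (λ e → [ (λ e → ⊥-elim (c₁≢0 e)) , id ]′ (ℤₚ.i*j≡0⇒i≡0∨j≡0 c₁ (trans (sym (sc⋆ c₁ L j)) e))) ]′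
        (ℤₚ.i*j≡0⇒i≡0∨j≡0 c (trans (sym (sc⋆ c (sc c₁ ⋆ L) j)) (trans (sym (≈⇒≐ rearrange j)) (ab j))))
      L1 : lam ⋆ (z ⋆ z₁) ≐ zeroP
      L1 = lam^-cancel (k +ℕ k₁) (z ⋆ z₁) (≈⇒≐ (Z.≈trans (Z.*-assoc lam (pow lam (k +ℕ k₁)) (z ⋆ z₁)) (Z.≈trans (Z.*-congˡ {lam} (≐⇒≈ {f = L} {zeroP} L0)) (Z.zeroʳ lam))))
      u = at (z ⋆ z₁) (+ 0)
      uc : ∀ j → at (z ⋆ z₁) j ≡ u
      uc j = cong-0⇒≡ (lam-zero⇒const (z ⋆ z₁) (pw≡ L1) j)

    σ-lam⋆ : ∀ f → σ (lam ⋆ f) ≡ + 0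
    σ-lam⋆ f = trans (σ-⋆ lam f) (trans (cong (_*ᶻ σ f) σ-lam) (ℤₚ.*-zeroˡ (σ f)))

    -- Multiplication by λ moves both factors into the augmentation ideal, where valuations exist.
    -- What λ kills are the constants, that is, the multiples of 1 + x + ⋯ + x^(q-1).
    no-zero-divisors : ∀ a b → ¬ (lam ⋆ a ≐ zeroP) → a ⋆ b ≐ zeroP → lam ⋆ b ≐ zeroP
    no-zero-divisors a b la≢0 ab = by (zero? (lam ⋆ b))
      where
      prod : (lam ⋆ a) ⋆ (lam ⋆ b) ≐ zeroP
      prod = ≈⇒≐ {(lam ⋆ a) ⋆ (lam ⋆ b)} {zeroP} (Z.≈trans (IntegerCoefficientSolver.RingLemmas.lam-swap (R (+ 0)) lam a b)
        (Z.≈trans (Z.*-congˡ {lam} {lam ⋆ (a ⋆ b)} {zeroP} (Z.≈trans (Z.*-congˡ {lam} {a ⋆ b} {zeroP} (≐⇒≈ {f = a ⋆ b} {zeroP} ab)) (Z.zeroʳ lam))) (Z.zeroʳ lam)))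
      by : Dec (lam ⋆ b ≐ zeroP) → lam ⋆ b ≐ zeroP
      by (yes e) = e
      by (no lb≢0) = ⊥-elim (no-zero-divisors₀ {lam ⋆ a} {lam ⋆ b} (division-of ‖ lam ⋆ a ‖ (lam ⋆ a) ℕₚ.≤-refl (σ-lam⋆ a) la≢0)
        (division-of ‖ lam ⋆ b ‖ (lam ⋆ b) ℕₚ.≤-refl (σ-lam⋆ b) lb≢0) prod)

-- Integer multiples in a principal lattice, and rounding

module Multiples where
  open FiniteCounting
  open PeriodicConvolution
  open CyclicDomain
  open Valuation
  import Data.Fin.Properties as Finₚ
  import Data.Integer.Properties as ℤₚ
  import Data.Nat as ℕ
  import Data.Nat.Properties as ℕₚ
  import Data.Vec.Properties as Vecₚ
  open import Data.Empty using (⊥-elim)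
  open import Data.Fin using (Fin; zero; suc; toℕ; fromℕ<)
  open import Data.Integer using (ℤ; +_; ∣_∣) renaming (_+_ to _+ᶻ_; _*_ to _*ᶻ_; _-_ to _-ᶻ_; -_ to -ᶻ_)
  open import Data.Integer.DivMod using (_%ℕ_; _/ℕ_; n%ℕd<d; a≡a%ℕn+[a/ℕn]*n)
  open import Data.Integer.Tactic.RingSolver using (solve-∀)
  open import Data.Nat using (ℕ; zero; suc; _∸_; _<_; _≤_; z≤n; s≤s) renaming (_+_ to _+ℕ_; _*_ to _*ℕ_; _^_ to _^ℕ_)
  open import Data.Nat.Divisibility using (_∣_)
  open import Data.Nat.Primality using (Prime)
  open import Data.Nat.Tactic.RingSolver using () renaming (solve-∀ to solveℕ-∀)
  open import Data.Product using (∃; _×_; _,_; proj₁; proj₂)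
  open import Data.Sum using ([_,_]′)
  open import Data.Vec using (Vec; lookup; tabulate)
  open import Function using (id)
  open import Relation.Binary.PropositionalEquality using (_≡_; _≢_; refl; sym; trans; cong; cong₂; subst)
  open import Relation.Nullary using (¬_)

  ^-*-distrib : ∀ a b n → (a *ℕ b) ^ℕ n ≡ a ^ℕ n *ℕ b ^ℕ n
  ^-*-distrib a b zero = refl
  ^-*-distrib a b (suc n) = trans (cong (a *ℕ b *ℕ_) (^-*-distrib a b n)) (lem a b (a ^ℕ n) (b ^ℕ n))
    where
    lem : ∀ a b s t → a *ℕ b *ℕ (s *ℕ t) ≡ a *ℕ s *ℕ (b *ℕ t)
    lem = solveℕ-∀

  -- The pigeonhole inequality for `Multiple`: n coordinates bounded by M C take fewer values than
  -- there are choices of n + 1 numbers up to M. The reason is 2 M C + 1 ≤ (2 C + 1)(M + 1).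
  box-bound : ∀ C n M → (suc (2 *ℕ C)) ^ℕ n ≤ M → suc (2 *ℕ (M *ℕ C)) ^ℕ n < suc M *ℕ suc M ^ℕ n
  box-bound C n M h = begin-strict
    suc (2 *ℕ (M *ℕ C)) ^ℕ n ≤⟨ ℕₚ.^-monoˡ-≤ n le ⟩
    (suc (2 *ℕ C) *ℕ suc M) ^ℕ n ≡⟨ ^-*-distrib (suc (2 *ℕ C)) (suc M) n ⟩
    suc (2 *ℕ C) ^ℕ n *ℕ suc M ^ℕ n ≤⟨ ℕₚ.*-monoˡ-≤ (suc M ^ℕ n) h ⟩
    M *ℕ suc M ^ℕ n <⟨ ℕₚ.*-monoˡ-< (suc M ^ℕ n) {{ℕₚ.m^n≢0 (suc M) n}} (ℕₚ.n<1+n M) ⟩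
    suc M *ℕ suc M ^ℕ n ∎
    where
    open ℕₚ.≤-Reasoning
    lem : ∀ M C → suc (2 *ℕ C) *ℕ suc M ≡ suc (2 *ℕ (M *ℕ C)) +ℕ (M +ℕ 2 *ℕ C)
    lem = solveℕ-∀
    le : suc (2 *ℕ (M *ℕ C)) ≤ suc (2 *ℕ C) *ℕ suc M
    le = subst (suc (2 *ℕ (M *ℕ C)) ≤_) (sym (lem M C)) (ℕₚ.m≤m+n _ _)

  module Approx (q′ : ℕ) (prq : Prime (suc q′)) where
    open DomainPrime q′ prq public

    infixl 6 _⊟_
    _⊟_ : Per → Per → Per
    f ⊟ g = f ⊞ neg g

    vper : (Fin q → ℤ) → Per
    vper g = mkPer (λ k → g (res q′ k)) (λ k → cong g (Cong⇒res≡ q′ (+q-Cong k)))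

    vper-at : ∀ g i → at (vper g) (+ toℕ i) ≡ g i
    vper-at g i = cong g (res-toℕ q′ i)

    -- Coordinate 0 is fixed at 0, so that two different boxes never differ by a constant, which λ
    -- would kill.
    coords : ∀ {M} → Vec (Fin M) q′ → Fin q → ℤ
    coords z zero = + 0
    coords z (suc i) = + toℕ (lookup z i)

    box : ∀ {M} → Vec (Fin M) q′ → Per
    box z = vper (coords z)

    ∣+m-+n∣≤ : ∀ {M} a b → a ≤ M → b ≤ M → ∣ + a -ᶻ + b ∣ ≤ M
    ∣+m-+n∣≤ a b a≤M b≤M = subst (λ t → ∣ t ∣ ≤ _) (sym (ℤₚ.[+m]-[+n]≡m⊖n a b)) (ℕₚ.≤-trans (ℤₚ.∣m⊝n∣≤m⊔n a b) (ℕₚ.⊔-lub a≤M b≤M))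

    coord-bound : ∀ {M} (z : Vec (Fin (suc M)) q′) i → ∃ λ a → coords z i ≡ + a × a ≤ M
    coord-bound z zero = 0 , refl , z≤n
    coord-bound z (suc i) = toℕ (lookup z i) , refl , ℕₚ.≤-pred (Finₚ.toℕ<n (lookup z i))

    box-bounded : ∀ {M} (z : Vec (Fin (suc M)) q′) k → ∣ at (box z) k ∣ ≤ M
    box-bounded z k = let (a , e , a≤M) = coord-bound z (res q′ k) in subst (λ t → ∣ t ∣ ≤ _) (sym e) a≤M

    box-diff : ∀ {M} (z z₁ : Vec (Fin (suc M)) q′) k → ∣ at (box z ⊟ box z₁) k ∣ ≤ M
    box-diff z z₁ k = let (a , e , a≤M) = coord-bound z (res q′ k) ; (b , e₁ , b≤M) = coord-bound z₁ (res q′ k)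
      in subst (λ t → ∣ t ∣ ≤ _) (sym (cong₂ _-ᶻ_ e e₁)) (∣+m-+n∣≤ a b a≤M b≤M)

    box-inj : ∀ {M} (z z₁ : Vec (Fin (suc M)) q′) → lam ⋆ (box z ⊟ box z₁) ≐ zeroP → z ≡ z₁
    box-inj z z₁ h = trans (sym (Vecₚ.tabulate∘lookup z)) (trans (Vecₚ.tabulate-cong eq) (Vecₚ.tabulate∘lookup z₁))
      where
      d = box z ⊟ box z₁
      zer : ∀ k → at d k ≡ + 0
      zer k = trans (cong-0⇒≡ (lam-zero⇒const d (≐⇒≈ {f = lam ⋆ d} {zeroP} h) k)) (cong₂ _-ᶻ_ (vper-at (coords z) zero) (vper-at (coords z₁) zero))
      eq : ∀ i → lookup z i ≡ lookup z₁ i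
      eq i = Finₚ.toℕ-injective (ℤₚ.+-injective (trans (sym (vper-at (coords z) (suc i)))
        (trans (ℤₚ.i-j≡0⇒i≡j (at (box z) (+ suc (toℕ i))) (at (box z₁) (+ suc (toℕ i))) (zer (+ suc (toℕ i)))) (vper-at (coords z₁) (suc i)))))

    lam-kernel : ∀ w → σ w ≡ + 0 → lam ⋆ w ≐ zeroP → w ≐ zeroP
    lam-kernel w σw h k = trans (c k) ([ (λ ()) , id ]′ (ℤₚ.i*j≡0⇒i≡0∨j≡0 (+ q) (trans (sym (Sn-const q (at w (+ 0)))) (trans (sym (Sn-cong q c)) σw))))
      where
      c : ∀ k → at w k ≡ at w (+ 0)
      c k = cong-0⇒≡ (lam-zero⇒const w (≐⇒≈ {f = lam ⋆ w} {zeroP} h) k)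

    -- The sum determines coordinate 0. The values of the pigeonhole argument thus have q - 1 free
    -- coordinates, as many as the boxes, and the coefficient of y tips the balance.
    ≐-from-tail : ∀ f g → σ f ≡ σ g → (∀ i → i < q′ → at f (+ suc i) ≡ at g (+ suc i)) → f ≐ g
    ≐-from-tail f g e h = residues {f} {g} (λ { zero _ → head ; (suc r) lt → h r (ℕₚ.≤-pred lt) })
      where
      tails : Sn q′ (λ k → at f (+ 1 +ᶻ k)) ≡ Sn q′ (λ k → at g (+ 1 +ᶻ k))
      tails = Sn-cong< q′ h
      head : at f (+ 0) ≡ at g (+ 0)
      head = +ᶻ-cancelˡ (Sn q′ (λ k → at g (+ 1 +ᶻ k))) (trans (cong (_+ᶻ at f (+ 0)) (sym tails)) (trans (ℤₚ.+-comm _ (at f (+ 0)))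
        (trans (sym (Sn-front q′ (at f))) (trans e (trans (Sn-front q′ (at g)) (ℤₚ.+-comm (at g (+ 0)) _))))))

    -- Some positive multiple of y lies in the lattice wℤ[x]: pigeonhole on the combinations a y + w z with small a, z.
    module Multiple (w y : Per) (σw : σ w ≡ + 0) (w≢0 : ¬ (w ≐ zeroP)) (σy : σ y ≡ + 0) where
      C M B : ℕ
      C = ‖ y ‖ +ℕ ‖ w ‖
      -- The smallest value that `box-bound` admits.
      M = suc (2 *ℕ C) ^ℕ q′
      B = M *ℕ C

      A : Set
      A = Fin (suc M) × Vec (Fin (suc M)) q′

      val : A → Per
      val (a , z) = (sc (+ toℕ a) ⋆ y) ⊞ (w ⋆ box z)

      σ-val : ∀ az → σ (val az) ≡ + 0
      σ-val (a , z) = trans (σ-⊞ (sc (+ toℕ a) ⋆ y) (w ⋆ box z)) (cong₂ _+ᶻ_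
        (trans (σ-⋆ (sc (+ toℕ a)) y) (trans (cong (σ (sc (+ toℕ a)) *ᶻ_) σy) (ℤₚ.*-zeroʳ (σ (sc (+ toℕ a))))))
        (trans (σ-⋆ w (box z)) (trans (cong (_*ᶻ σ (box z)) σw) (ℤₚ.*-zeroˡ (σ (box z))))))

      val-bound : ∀ az k → ∣ at (val az) k ∣ ≤ B
      val-bound (a , z) k = begin
        ∣ at (sc (+ toℕ a) ⋆ y) k +ᶻ at (w ⋆ box z) k ∣ ≤⟨ ℤₚ.∣i+j∣≤∣i∣+∣j∣ (at (sc (+ toℕ a) ⋆ y) k) (at (w ⋆ box z) k) ⟩
        ∣ at (sc (+ toℕ a) ⋆ y) k ∣ +ℕ ∣ at (w ⋆ box z) k ∣
          ≤⟨ ℕₚ.+-mono-≤ (ℕₚ.≤-trans (ℕₚ.≤-reflexive (trans (cong ∣_∣ (sc⋆ (+ toℕ a) y k)) (ℤₚ.abs-* (+ toℕ a) (at y k))))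
               (ℕₚ.*-mono-≤ (ℕₚ.≤-pred (Finₚ.toℕ<n a)) (at≤‖‖ y k))) (‖⋆‖ w (box z) M (box-bounded z) k) ⟩
        M *ℕ ‖ y ‖ +ℕ ‖ w ‖ *ℕ M ≡⟨ cong (M *ℕ ‖ y ‖ +ℕ_) (ℕₚ.*-comm ‖ w ‖ M) ⟩
        M *ℕ ‖ y ‖ +ℕ M *ℕ ‖ w ‖ ≡⟨ ℕₚ.*-distribˡ-+ M ‖ y ‖ ‖ w ‖ ⟨
        B ∎
        where open ℕₚ.≤-Reasoning

      φ : A → Vec (Fin (suc (2 *ℕ B))) q′
      φ az = tabulate (λ i → res (2 *ℕ B) (at (val az) (+ suc (toℕ i))))

      φ-val : ∀ u v → φ u ≡ φ v → val u ≐ val v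
      φ-val u v e = ≐-from-tail (val u) (val v) (trans (σ-val u) (sym (σ-val v))) (λ i i<q′ → Cong-near (res≡⇒Cong (2 *ℕ B) (entry i i<q′))
          (s≤s (ℕₚ.≤-trans (ℕₚ.+-mono-≤ (val-bound u (+ suc i)) (val-bound v (+ suc i))) (ℕₚ.≤-reflexive (cong (B +ℕ_) (sym (ℕₚ.+-identityʳ B)))))))
        where
        entry : ∀ i → i < q′ → res (2 *ℕ B) (at (val u) (+ suc i)) ≡ res (2 *ℕ B) (at (val v) (+ suc i))
        entry i i<q′ = subst (λ j → res (2 *ℕ B) (at (val u) (+ suc j)) ≡ res (2 *ℕ B) (at (val v) (+ suc j))) (Finₚ.toℕ-fromℕ< i<q′)
          (trans (sym (Vecₚ.lookup∘tabulate _ (fromℕ< i<q′))) (trans (cong (λ t → lookup t (fromℕ< i<q′)) e) (Vecₚ.lookup∘tabulate _ (fromℕ< i<q′))))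

      card< : card (Vec (Fin (suc (2 *ℕ B))) q′) < card A
      card< = subst₂ _<_ (sym (trans (card-Vec {Fin (suc (2 *ℕ B))} q′) (cong (_^ℕ q′) (card-Fin (suc (2 *ℕ B))))))
        (sym (trans (card-× {Fin (suc M)} {Vec (Fin (suc M)) q′}) (cong₂ _*ℕ_ (card-Fin (suc M)) (trans (card-Vec {Fin (suc M)} q′) (cong (_^ℕ q′) (card-Fin (suc M)))))))
        (box-bound C q′ M ℕₚ.≤-refl)
        where open import Relation.Binary.PropositionalEquality using (subst₂)

      Goal : Set
      Goal = ∃ λ N → ∃ λ c → ∀ k → + suc N *ᶻ at y k ≡ at (w ⋆ c) k

      combine : ∀ u v → val u ≐ val v → ∀ k → (+ toℕ (proj₁ u) -ᶻ + toℕ (proj₁ v)) *ᶻ at y k ≡ at (w ⋆ (box (proj₂ v) ⊟ box (proj₂ u))) k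
      combine (a , z) (b , z₁) e k = trans (lem (+ toℕ a) (+ toℕ b) (at y k) (at (w ⋆ box z) k) (at (w ⋆ box z₁) k)
          (trans (cong (_+ᶻ at (w ⋆ box z) k) (sym (sc⋆ (+ toℕ a) y k))) (trans (e k) (cong (_+ᶻ at (w ⋆ box z₁) k) (sc⋆ (+ toℕ b) y k)))))
        (cong-0⇒≡ (ap dist k))
        where
        lem : ∀ a b y s t → a *ᶻ y +ᶻ s ≡ b *ᶻ y +ᶻ t → (a -ᶻ b) *ᶻ y ≡ t +ᶻ -ᶻ s
        lem a b y s t h = trans (lem₁ a b y s) (trans (cong (λ u → u -ᶻ (b *ᶻ y +ᶻ s)) h) (lem₂ b y s t))
          where
          lem₁ : ∀ a b y s → (a -ᶻ b) *ᶻ y ≡ (a *ᶻ y +ᶻ s) -ᶻ (b *ᶻ y +ᶻ s)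
          lem₁ = solve-∀
          lem₂ : ∀ b y s t → (b *ᶻ y +ᶻ t) -ᶻ (b *ᶻ y +ᶻ s) ≡ t +ᶻ -ᶻ s
          lem₂ = solve-∀
        dist : (w ⋆ box z₁) ⊞ neg (w ⋆ box z) ≈[ + 0 ] w ⋆ (box z₁ ⊟ box z)
        dist = IntegerCoefficientSolver.RingLemmas.distrib-minus (R (+ 0)) w (box z₁) (box z)

      positive : ∀ u v → val u ≐ val v → toℕ (proj₁ v) < toℕ (proj₁ u) → Goal
      positive u v e lt = N , (box (proj₂ v) ⊟ box (proj₂ u)) , λ k → trans (cong (_*ᶻ at y k) (sym eqN)) (combine u v e k)
        where
        a = toℕ (proj₁ u)
        b = toℕ (proj₁ v)
        N = ℕ.pred (a ∸ b)
        eqN : + a -ᶻ + b ≡ + suc N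
        eqN = trans (ℤₚ.[+m]-[+n]≡m⊖n a b) (trans (ℤₚ.⊖-≥ (ℕₚ.<⇒≤ lt)) (cong +_ (sym (ℕₚ.suc-pred (a ∸ b) {{ℕ.≢-nonZero (ℕₚ.m>n⇒m∸n≢0 lt)}}))))

      -- Excludes the trivial multiple 0 y: equal coefficients of y leave w (box z₁ - box z) = 0,
      -- and there are no zero divisors.
      same : ∀ u v → val u ≐ val v → toℕ (proj₁ u) ≡ toℕ (proj₁ v) → u ≡ v
      same (a , z) (b , z₁) e ab = cong₂ _,_ (Finₚ.toℕ-injective ab) (sym (box-inj z₁ z (no-zero-divisors w (box z₁ ⊟ box z) (λ lw → w≢0 (lam-kernel w σw lw)) zer)))
        where
        zer : w ⋆ (box z₁ ⊟ box z) ≐ zeroP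
        zer k = trans (sym (combine (a , z) (b , z₁) e k)) (trans (cong (λ t → (t -ᶻ + toℕ b) *ᶻ at y k) (cong +_ ab))
          (trans (cong (_*ᶻ at y k) (ℤₚ.+-inverseʳ (+ toℕ b))) (ℤₚ.*-zeroˡ (at y k))))

      multiple : Goal
      multiple = by (pigeonhole φ card<)
        where
        by : (∃ λ u → ∃ λ v → u ≢ v × φ u ≡ φ v) → Goal
        by (u , v , u≢v , e) = tri (ℕₚ.<-cmp (toℕ (proj₁ u)) (toℕ (proj₁ v)))
          where
          open import Relation.Binary.Definitions using (Tri; tri<; tri≈; tri>)
          tri : Tri _ _ _ → Goal
          tri (tri< lt _ _) = positive v u (φ-val v u (sym e)) lt
          tri (tri≈ _ eq _) = ⊥-elim (u≢v (same u v (φ-val u v e) eq))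
          tri (tri> _ _ gt) = positive u v (φ-val u v e) gt

    open Multiple using (multiple) public

    -- Rounding: v = y - w ⌊c / N⌋ is small and N v = w (c mod N).
    round : ∀ w y → σ w ≡ + 0 → ¬ (w ≐ zeroP) → σ y ≡ + 0 → ∃ λ k → ∀ j → ∣ at (y ⊟ (w ⋆ k)) j ∣ ≤ ‖ w ‖
    round w y σw w≢0 σy = by (multiple w y σw w≢0 σy)
      where
      by : (∃ λ N → ∃ λ c → ∀ k → + suc N *ᶻ at y k ≡ at (w ⋆ c) k) → ∃ λ k → ∀ j → ∣ at (y ⊟ (w ⋆ k)) j ∣ ≤ ‖ w ‖
      by (N , c , e) = quot , λ j → ℕₚ.*-cancelʳ-≤ _ _ (suc N) (begin
          ∣ at (y ⊟ (w ⋆ quot)) j ∣ *ℕ suc N ≡⟨ ℤₚ.abs-* (at (y ⊟ (w ⋆ quot)) j) (+ suc N) ⟨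
          ∣ at (y ⊟ (w ⋆ quot)) j *ᶻ + suc N ∣ ≡⟨ cong ∣_∣ (key j) ⟩
          ∣ at (w ⋆ rest) j ∣ ≤⟨ ‖⋆‖ w rest (suc N) (λ k → ℕₚ.<⇒≤ (n%ℕd<d (at c k) (suc N))) j ⟩
          ‖ w ‖ *ℕ suc N ∎)
        where
        open ℕₚ.≤-Reasoning
        quot rest : Per
        quot = mkPer (λ k → at c k /ℕ suc N) (λ k → cong (_/ℕ suc N) (per c k))
        rest = mkPer (λ k → + (at c k %ℕ suc N)) (λ k → cong (λ t → + (t %ℕ suc N)) (per c k))
        split : c ≈[ + 0 ] rest ⊞ sc (+ suc N) ⋆ quot
        split = pw≡ λ k → trans (a≡a%ℕn+[a/ℕn]*n (at c k) (suc N)) (cong (+ (at c k %ℕ suc N) +ᶻ_) (trans (ℤₚ.*-comm (at quot k) (+ suc N)) (sym (sc⋆ (+ suc N) quot k))))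
        key′ : (sc (+ suc N) ⋆ y) ⊞ neg (sc (+ suc N) ⋆ (w ⋆ quot)) ≈[ + 0 ] w ⋆ rest
        key′ = Z.≈trans (Z.+-congʳ {neg (sc (+ suc N) ⋆ (w ⋆ quot))} {sc (+ suc N) ⋆ y} {w ⋆ (rest ⊞ sc (+ suc N) ⋆ quot)}
            (Z.≈trans (pw≡ λ k → trans (sc⋆ (+ suc N) y k) (e k)) (Z.*-congˡ {w} {c} split)))
          (IntegerCoefficientSolver.RingLemmas.cancel-quotient (R (+ 0)) w rest (sc (+ suc N)) quot)
        key : ∀ j → at (y ⊟ (w ⋆ quot)) j *ᶻ + suc N ≡ at (w ⋆ rest) j
        key j = trans (lem (at y j) (at (w ⋆ quot) j) (+ suc N)) (trans (cong₂ (λ s t → s +ᶻ -ᶻ t) (sym (sc⋆ (+ suc N) y j)) (sym (sc⋆ (+ suc N) (w ⋆ quot) j))) (cong-0⇒≡ (ap key′ j)))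
          where
          lem : ∀ a b n → (a +ᶻ -ᶻ b) *ᶻ n ≡ n *ᶻ a +ᶻ -ᶻ (n *ᶻ b)
          lem = solve-∀

-- Centred residues and the group algebra over 𝔽_p

module FiniteGroupAlgebra where
  open FiniteCounting
  open PeriodicConvolution
  open CyclicDomain
  open Valuation
  open Multiples
  import Data.Fin.Properties as Finₚ
  import Data.Integer.Properties as ℤₚ
  import Data.Nat as ℕ
  import Data.Nat.DivMod as DM
  import Data.Nat.Properties as ℕₚ
  import Data.Vec.Properties as Vecₚ
  open import Algebra.Bundles using (CommutativeRing)
  open import Data.Bool using (Bool; true; false)
  open import Data.Fin using (Fin; zero; suc; toℕ; fromℕ<)
  open import Data.Integer using (+_; -[1+_]; ∣_∣) renaming (_+_ to _+ᶻ_; _*_ to _*ᶻ_; _-_ to _-ᶻ_; -_ to -ᶻ_)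
  open import Data.Integer.Tactic.RingSolver using (solve-∀)
  open import Data.Nat using (ℕ; zero; suc; _∸_; _<_; _≤_; s≤s) renaming (_+_ to _+ℕ_; _*_ to _*ℕ_; _^_ to _^ℕ_)
  open import Data.Nat.Divisibility using (_∣_)
  open import Data.Nat.Primality using (Prime)
  open import Data.Nat.Tactic.RingSolver using () renaming (solve-∀ to solveℕ-∀)
  open import Data.Product using (∃; _×_; _,_; proj₁; proj₂)
  open import Data.Vec using (Vec; []; _∷_; lookup; tabulate)
  open import Defs
  open import Function using (_∘_)
  open import Level using (0ℓ)
  open import Relation.Binary.PropositionalEquality using (_≡_; _≢_; refl; sym; trans; cong; cong₂; subst)
  open import Relation.Nullary using (Dec)

  vsum : ∀ {A : Set} {n} → (A → ℕ) → Vec A n → ℕ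
  vsum g [] = 0
  vsum g (a ∷ v) = g a +ℕ vsum g v

  vsum-Σℕ : ∀ {A : Set} {n} (g : A → ℕ) (x : Vec A n) (G : ℕ → ℕ) → (∀ i → G (toℕ i) ≡ g (lookup x i)) → vsum g x ≡ Σℕ n G
  vsum-Σℕ g [] G h = refl
  vsum-Σℕ {n = suc n} g (a ∷ v) G h = trans (cong₂ _+ℕ_ (sym (h zero)) (vsum-Σℕ g v (G ∘ suc) (λ i → h (suc i)))) (sym (Σℕ-front n G))

  sq : ℕ → ℕ
  sq a = a *ℕ a

  sq-mono : ∀ {a b} → a ≤ b → sq a ≤ sq b
  sq-mono h = ℕₚ.*-mono-≤ h h

  -- Centred representatives

  module Centred (m : ℕ) where
    open Fp m using (p; lift)

    abs : Fin p → ℕ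
    abs a = ∣ lift a ∣

    private
      half = m DM./ 2

    lift-Cong : ∀ a → Cong (+ p) (lift a) (+ toℕ a)
    lift-Cong a with toℕ a ℕ.≤ᵇ half
    ... | true = cong-refl
    ... | false = cg (-ᶻ + 1) (lem (+ toℕ a) (+ p))
      where
      lem : ∀ a p → a -ᶻ p ≡ a +ᶻ (-ᶻ + 1) *ᶻ p
      lem = solve-∀

    res-lift : ∀ a → res m (lift a) ≡ a
    res-lift a = trans (Cong⇒res≡ m (lift-Cong a)) (res-toℕ m a)

    -- The centred absolute value is the smaller of a and p - a, stated as the two bounds that
    -- `abs-minimal` and `2abs≤P` use.
    abs≤toℕ×abs≤p∸toℕ : ∀ a → abs a ≤ toℕ a × abs a ≤ p ∸ toℕ a
    abs≤toℕ×abs≤p∸toℕ a with toℕ a ℕ.≤ᵇ half in eq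
    ... | true = ℕₚ.≤-refl , ℕₚ.m+n≤o⇒m≤o∸n (toℕ a) (begin
      toℕ a +ℕ toℕ a ≤⟨ ℕₚ.+-mono-≤ le le ⟩
      half +ℕ half ≡⟨ trans (cong (half +ℕ_) (sym (ℕₚ.+-identityʳ half))) (ℕₚ.*-comm 2 half) ⟩
      half *ℕ 2 ≤⟨ DM.m/n*n≤m m 2 ⟩
      m ≤⟨ ℕₚ.n≤1+n m ⟩
      p ∎)
      where
      open ℕₚ.≤-Reasoning
      le : toℕ a ≤ half
      le = ℕₚ.≤ᵇ⇒≤ (toℕ a) half (subst T (sym eq) _)
        where open import Data.Bool using (T)
    ... | false = ℕₚ.≤-trans (ℕₚ.≤-reflexive dist) (ℕₚ.m≤n+o⇒m∸n≤o p (toℕ a) le2) , ℕₚ.≤-reflexive dist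
      where
      open ℕₚ.≤-Reasoning
      dist : ∣ + toℕ a -ᶻ + p ∣ ≡ p ∸ toℕ a
      dist = trans (cong ∣_∣ (ℤₚ.[+m]-[+n]≡m⊖n (toℕ a) p)) (ℤₚ.∣⊖∣-≤ (ℕₚ.<⇒≤ (Finₚ.toℕ<n a)))
      gt : half < toℕ a
      gt = ℕₚ.≰⇒> (λ le → subst T eq (ℕₚ.≤⇒≤ᵇ le))
        where open import Data.Bool using (T)
      le2 : p ≤ toℕ a +ℕ toℕ a
      le2 = begin
        suc m ≡⟨ cong suc (DM.m≡m%n+[m/n]*n m 2) ⟩
        suc (m DM.% 2 +ℕ half *ℕ 2) ≤⟨ s≤s (ℕₚ.+-monoˡ-≤ (half *ℕ 2) (ℕₚ.≤-pred (DM.m%n<n m 2))) ⟩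
        suc (1 +ℕ half *ℕ 2) ≡⟨ lem half ⟩
        suc half +ℕ suc half ≤⟨ ℕₚ.+-mono-≤ gt gt ⟩
        toℕ a +ℕ toℕ a ∎
        where
        lem : ∀ h → suc (1 +ℕ h *ℕ 2) ≡ suc h +ℕ suc h
        lem = solveℕ-∀

    -- An integer in the class of a, where 0 ≤ a < p, is at least a or at most a - p.
    abs-minimal : ∀ z → abs (res m z) ≤ ∣ z ∣
    abs-minimal z = go (toℕ-res m z) (abs≤toℕ×abs≤p∸toℕ (res m z))
      where
      a = toℕ (res m z)
      go : Cong (+ p) z (+ a) → abs (res m z) ≤ a × abs (res m z) ≤ p ∸ a → abs (res m z) ≤ ∣ z ∣
      go (cg (+ t) e) (h , _) = ℕₚ.≤-trans h (subst (a ≤_) (cong ∣_∣ (sym (trans e (trans (cong (+ a +ᶻ_) (sym (ℤₚ.pos-* t p))) (sym (ℤₚ.pos-+ a (t *ℕ p))))))) (ℕₚ.m≤m+n a (t *ℕ p)))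
      go (cg -[1+ t ] e) (_ , h) = ℕₚ.≤-trans h (ℕₚ.≤-trans (ℕₚ.∸-monoˡ-≤ a (ℕₚ.m≤m+n p (t *ℕ p)))
        (ℕₚ.≤-reflexive (sym (trans (cong ∣_∣ (trans e (trans (lem (+ a) (+ suc t) (+ p)) (trans (cong (λ u → + a -ᶻ u) (sym (ℤₚ.pos-* (suc t) p))) (ℤₚ.[+m]-[+n]≡m⊖n a (suc t *ℕ p))))))
          (ℤₚ.∣⊖∣-≤ (ℕₚ.≤-trans (ℕₚ.<⇒≤ (Finₚ.toℕ<n (res m z))) (ℕₚ.m≤m+n p (t *ℕ p))))))))
        where
        lem : ∀ a t p → a +ᶻ (-ᶻ t) *ᶻ p ≡ a -ᶻ t *ᶻ p
        lem = solve-∀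

  -- The group algebra 𝔽_p[x]/(x^q - 1)

  module GroupAlgebra (q′ m : ℕ) (prq : Prime (suc q′)) (prp : Prime (suc m)) (q≢p : suc q′ ≢ suc m) where
    open Approx q′ prq public
    open Centred m public
    open FrobeniusX {m} prq prp q≢p using (power-fix; q∤p) public

    P : ℕ
    P = suc m

    open Fp m using (lift) public

    module F = Rm (+ P)

    X : Set
    X = Vec (Fin P) q

    opaque
      -- Arithmetic in X is carried out over ℤ on centred lifts and then reduced by `π`; the ring
      -- laws are inherited through `emb-inj`.
      emb : X → Per
      emb x = vper (λ i → lift (lookup x i))

      π : Per → X
      π f = tabulate (λ i → res m (at f (+ toℕ i)))

      emb-at : ∀ x i → at (emb x) (+ toℕ i) ≡ lift (lookup x i)
      emb-at x i = vper-at (λ i → lift (lookup x i)) i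

      lookup-π : ∀ f i → lookup (π f) i ≡ res m (at f (+ toℕ i))
      lookup-π f i = Vecₚ.lookup∘tabulate (λ i → res m (at f (+ toℕ i))) i

    vec-ext : ∀ {A : Set} {n} {u v : Vec A n} → (∀ i → lookup u i ≡ lookup v i) → u ≡ v
    vec-ext {u = u} {v} h = trans (sym (Vecₚ.tabulate∘lookup u)) (trans (Vecₚ.tabulate-cong h) (Vecₚ.tabulate∘lookup v))

    π-emb : ∀ x → π (emb x) ≡ x
    π-emb x = vec-ext λ i → trans (lookup-π (emb x) i) (trans (cong (res m) (emb-at x i)) (res-lift (lookup x i)))

    emb-π-at : ∀ f i → at (emb (π f)) (+ toℕ i) ≡ lift (res m (at f (+ toℕ i)))
    emb-π-at f i = trans (emb-at (π f) i) (cong lift (lookup-π f i))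

    residuesF : ∀ {n f g} → (∀ (i : Fin q) → Cong n (at f (+ toℕ i)) (at g (+ toℕ i))) → f ≈[ n ] g
    residuesF {n} {f} {g} h = pw λ k → cong-trans (cong-≡ (at-res f k)) (cong-trans (h (res q′ k)) (cong-≡ (sym (at-res g k))))
      where
      at-res : ∀ f k → at f k ≡ at f (+ toℕ (res q′ k))
      at-res f k = per-Cong (per f) (toℕ-res q′ k)

    emb-π : ∀ f → emb (π f) ≈[ + P ] f
    emb-π f = residuesF λ i → cong-trans (cong-≡ (emb-π-at f i)) (cong-trans (lift-Cong _) (cong-sym (toℕ-res m _)))

    π-cong : ∀ {f g} → f ≈[ + P ] g → π f ≡ π g
    π-cong {f} {g} h = vec-ext λ i → trans (lookup-π f i) (trans (Cong⇒res≡ m (ap h (+ toℕ i))) (sym (lookup-π g i)))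

    emb-inj : ∀ {x y} → emb x ≈[ + P ] emb y → x ≡ y
    emb-inj {x} {y} h = trans (sym (π-emb x)) (trans (π-cong h) (π-emb y))

    emb-cong : ∀ {x y} → x ≡ y → emb x ≈[ + P ] emb y
    emb-cong refl = F.≈refl

    infixl 6 _⊕_ _⊖_
    infixl 7 _⊗_
    opaque
      _⊕_ _⊗_ : X → X → X
      x ⊕ y = π (emb x ⊞ emb y)
      x ⊗ y = π (emb x ⋆ emb y)
      ⊝_ : X → X
      ⊝ x = π (neg (emb x))
      0X 1X : X
      0X = π zeroP
      1X = π oneP

      emb-⊕ : ∀ x y → emb (x ⊕ y) ≈[ + P ] emb x ⊞ emb y
      emb-⊕ x y = emb-π _
      emb-⊗ : ∀ x y → emb (x ⊗ y) ≈[ + P ] emb x ⋆ emb y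
      emb-⊗ x y = emb-π _
      emb-⊝ : ∀ x → emb (⊝ x) ≈[ + P ] neg (emb x)
      emb-⊝ x = emb-π _
      emb-0 : emb 0X ≈[ + P ] zeroP
      emb-0 = emb-π _
      emb-1 : emb 1X ≈[ + P ] oneP
      emb-1 = emb-π _

      ⊕-def : ∀ x y → x ⊕ y ≡ π (emb x ⊞ emb y)
      ⊕-def x y = refl
      ⊝-def : ∀ x → ⊝ x ≡ π (neg (emb x))
      ⊝-def x = refl

    _⊖_ : X → X → X
    x ⊖ y = x ⊕ (⊝ y)

    private
      via : ∀ {x y f g} → emb x ≈[ + P ] f → f ≈[ + P ] g → emb y ≈[ + P ] g → x ≡ y
      via a b c = emb-inj (F.≈trans a (F.≈trans b (F.≈sym c)))

      e⊕ : ∀ {x y f g} → emb x ≈[ + P ] f → emb y ≈[ + P ] g → emb (x ⊕ y) ≈[ + P ] f ⊞ g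
      e⊕ {x} {y} a b = F.≈trans (emb-⊕ x y) (F.+-cong a b)

      e⊗ : ∀ {x y f g} → emb x ≈[ + P ] f → emb y ≈[ + P ] g → emb (x ⊗ y) ≈[ + P ] f ⋆ g
      e⊗ {x} {y} a b = F.≈trans (emb-⊗ x y) (F.*-cong a b)

      e⊝ : ∀ {x f} → emb x ≈[ + P ] f → emb (⊝ x) ≈[ + P ] neg f
      e⊝ {x} a = F.≈trans (emb-⊝ x) (F.-‿cong a)

      e : ∀ {x} → emb x ≈[ + P ] emb x
      e = F.≈refl

    XR : CommutativeRing 0ℓ 0ℓ
    XR = record
      { Carrier = X ; _≈_ = _≡_ ; _+_ = _⊕_ ; _*_ = _⊗_ ; -_ = ⊝_ ; 0# = 0X ; 1# = 1X
      ; isCommutativeRing = record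
        { isRing = record
          { +-isAbelianGroup = record
            { isGroup = record
              { isMonoid = record
                { isSemigroup = record
                  { isMagma = record { isEquivalence = Eq.isEquivalence ; ∙-cong = cong₂ _⊕_ }
                  ; assoc = λ x y z → via (e⊕ (e⊕ e e) e) (F.+-assoc (emb x) (emb y) (emb z)) (e⊕ e (e⊕ e e)) }
                ; identity = (λ x → via (e⊕ emb-0 e) (F.+-identityˡ (emb x)) e) , (λ x → via (e⊕ e emb-0) (F.+-identityʳ (emb x)) e) }
              ; inverse = (λ x → via (e⊕ (e⊝ e) e) (F.-‿inverseˡ (emb x)) emb-0) , (λ x → via (e⊕ e (e⊝ e)) (F.-‿inverseʳ (emb x)) emb-0)
              ; ⁻¹-cong = cong ⊝_ }
            ; comm = λ x y → via (e⊕ e e) (F.+-comm (emb x) (emb y)) (e⊕ e e) }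
          ; *-cong = cong₂ _⊗_
          ; *-assoc = λ x y z → via (e⊗ (e⊗ e e) e) (F.*-assoc (emb x) (emb y) (emb z)) (e⊗ e (e⊗ e e))
          ; *-identity = (λ x → via (e⊗ emb-1 e) (F.*-identityˡ (emb x)) e) , (λ x → via (e⊗ e emb-1) (F.*-identityʳ (emb x)) e)
          ; distrib = (λ x y z → via (e⊗ e (e⊕ e e)) (F.distribˡ (emb x) (emb y) (emb z)) (e⊕ (e⊗ e e) (e⊗ e e)))
            , (λ x y z → via (e⊗ (e⊕ e e) e) (F.distribʳ (emb x) (emb y) (emb z)) (e⊕ (e⊗ e e) (e⊗ e e))) }
        ; *-comm = λ x y → via (e⊗ e e) (F.*-comm (emb x) (emb y)) (e⊗ e e) } }
      where import Relation.Binary.PropositionalEquality as Eq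

    module XM where
      open CommutativeRing XR public hiding (zero; refl; sym; trans; _≈_; _+_; _*_; -_; 0#; 1#; Carrier; _-_)
      open import Algebra.Properties.Semiring.Exp semiring public using (_^_; ^-homo-*; ^-assocʳ)
      open import Algebra.Properties.CommutativeSemiring.Exp commutativeSemiring public using (^-distrib-*)
      open IntegerCoefficientSolver.RingLemmas XR public

    open XM using () renaming (_^_ to _^X_) public

    emb-^ : ∀ x n → emb (x ^X n) ≈[ + P ] emb x F.^ n
    emb-^ x zero = emb-1
    emb-^ x (suc n) = F.≈trans (emb-⊗ x (x ^X n)) (F.*-congˡ {emb x} (emb-^ x n))

    N : ℕ
    N = P ^ℕ q′

    ^N : ∀ x → x ^X N ≡ x
    ^N x = emb-inj (F.≈trans (emb-^ x N) (power-fix (emb x)))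

    λX : X
    λX = π lam

    ZS : X → Set
    ZS x = Cong (+ P) (σ (emb x)) (+ 0)

    ZS? : ∀ x → Dec (ZS x)
    ZS? x = Cong? m (σ (emb x)) (+ 0)

    σX-⊕ : ∀ x y → Cong (+ P) (σ (emb (x ⊕ y))) (σ (emb x) +ᶻ σ (emb y))
    σX-⊕ x y = cong-trans (σ-cong (emb-⊕ x y)) (cong-≡ (σ-⊞ (emb x) (emb y)))

    σX-⊗ : ∀ x y → Cong (+ P) (σ (emb (x ⊗ y))) (σ (emb x) *ᶻ σ (emb y))
    σX-⊗ x y = cong-trans (σ-cong (emb-⊗ x y)) (cong-≡ (σ-⋆ (emb x) (emb y)))

    σX-⊝ : ∀ x → Cong (+ P) (σ (emb (⊝ x))) (-ᶻ σ (emb x))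
    σX-⊝ x = cong-trans (σ-cong (emb-⊝ x)) (cong-≡ (σ-neg (emb x)))

    ZS-⊗ : ∀ x {y} → ZS y → ZS (x ⊗ y)
    ZS-⊗ x {y} h = cong-trans (σX-⊗ x y) (cong-trans (cong-* (cong-refl {a = σ (emb x)}) h) (cong-≡ (ℤₚ.*-zeroʳ (σ (emb x)))))

    ZS-⊗ˡ : ∀ {x} y → ZS x → ZS (x ⊗ y)
    ZS-⊗ˡ {x} y h = subst ZS (XM.*-comm y x) (ZS-⊗ y h)

    ZS-⊕ : ∀ {x y} → ZS x → ZS y → ZS (x ⊕ y)
    ZS-⊕ {x} {y} h g = cong-trans (σX-⊕ x y) (cong-+ h g)

    ZS-⊝ : ∀ {x} → ZS x → ZS (⊝ x)
    ZS-⊝ {x} h = cong-trans (σX-⊝ x) (cong-neg h)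

    ZS-λ : ZS λX
    ZS-λ = cong-trans (σ-cong (emb-π lam)) (cong-≡ σ-lam)

    -- Rounding over ℤ needs a sum equal to 0, not just divisible by P. The sum s of the centred
    -- lift is a multiple of P, so it can be subtracted from coordinate 0 within the class.
    exact-lift : ∀ x → ZS x → ∃ λ w → σ w ≡ + 0 × w ≈[ + P ] emb x
    exact-lift x zs = emb x ⊟ sc s , trans (σ-⊞ (emb x) (neg (sc s))) (trans (cong (s +ᶻ_) (trans (σ-neg (sc s)) (cong -ᶻ_ σ-sc))) (ℤₚ.+-inverseʳ s))
      , pw λ k → subst (Cong (+ P) (at (emb x ⊟ sc s) k)) (lem (at (emb x) k) (at oneP k)) (cong-+ (cong-refl {a = at (emb x) k}) (cong-neg (cong-* zs (cong-refl {a = at oneP k}))))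
      where
      s = σ (emb x)
      σ-sc : σ (sc s) ≡ s
      σ-sc = trans (Sn-* q s (at oneP)) (trans (cong (s *ᶻ_) (σ-x^ (+ 0))) (ℤₚ.*-identityʳ s))
      lem : ∀ a b → a +ᶻ -ᶻ (+ 0 *ᶻ b) ≡ a
      lem = solve-∀

    ZS⇒λ∣ : ∀ x → ZS x → ∃ λ z → x ≡ λX ⊗ z
    ZS⇒λ∣ x zs = by (exact-lift x zs)
      where
      by : (∃ λ w → σ w ≡ + 0 × w ≈[ + P ] emb x) → ∃ λ z → x ≡ λX ⊗ z
      by (w , σw , w≈x) = π z , sym (via (e⊗ (emb-π lam) (emb-π z)) (F.≈trans (≐⇒≈ {f = lam ⋆ z} {w} lz) w≈x) e)
        where
        z = proj₁ (lam-divide w σw)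
        lz = proj₂ (lam-divide w σw)

    N-2 : ℕ
    N-2 = N ∸ 2

    N≡ : N ≡ suc (suc N-2)
    N≡ = sym (ℕₚ.m+[n∸m]≡n {2} {N} (ℕₚ.≤-trans p≥2 (ℕₚ.≤-trans (ℕₚ.≤-reflexive (sym (ℕₚ.^-identityʳ P))) (ℕₚ.^-monoʳ-≤ P q′≥1))))
      where
      q′≥1 : 1 ≤ q′
      q′≥1 = ℕₚ.≤-pred q≥2
      p≥2 : 2 ≤ P
      p≥2 = DomainPrime.q≥2 m prp

    -- The form in which x^N = x is applied: x ⊗ x^(N-2) is an idempotent generating the same ideal
    -- as x.
    ^N-2 : ∀ x → x ⊗ (x ⊗ x ^X N-2) ≡ x
    ^N-2 x = trans (cong (x ^X_) (sym N≡)) (^N x)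

    -- Write x = λ z. Then λ² z = 0, and λ z is a multiple of λ² z by `^N-2`.
    λ-kernel : ∀ x → ZS x → λX ⊗ x ≡ 0X → x ≡ 0X
    λ-kernel x zs h = by (ZS⇒λ∣ x zs)
      where
      by : (∃ λ z → x ≡ λX ⊗ z) → x ≡ 0X
      by (z , eq) = trans eq (trans (cong (_⊗ z) (sym (^N-2 λX))) (trans (XM.solve 3 (λ l k z → (l XM.:* (l XM.:* k)) XM.:* z XM.:= k XM.:* (l XM.:* (l XM.:* z))) refl λX (λX ^X N-2) z)
        (trans (cong ((λX ^X N-2) ⊗_) (trans (cong (λX ⊗_) (sym eq)) h)) (XM.zeroʳ (λX ^X N-2)))))

    -- By `^N-2`, x is a multiple of its square.
    reduced : ∀ x → x ⊗ x ≡ 0X → x ≡ 0X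
    reduced x h = trans (sym (^N-2 x)) (trans (sym (XM.*-assoc x x (x ^X N-2))) (trans (cong (_⊗ (x ^X N-2)) h) (XM.zeroˡ (x ^X N-2))))

    -- The Euclidean norm

    nrm : X → ℕ
    nrm x = vsum (λ a → sq (abs a)) x

    nrm-emb : ∀ x → nrm x ≡ Σℕ q (λ i → sq ∣ at (emb x) (+ i) ∣)
    nrm-emb x = vsum-Σℕ _ x _ (λ i → cong (λ t → sq ∣ t ∣) (emb-at x i))

    emb-π-minimal : ∀ f i → i < q → ∣ at (emb (π f)) (+ i) ∣ ≤ ∣ at f (+ i) ∣
    emb-π-minimal f i i<q = subst (λ j → ∣ at (emb (π f)) (+ j) ∣ ≤ ∣ at f (+ j) ∣) (Finₚ.toℕ-fromℕ< i<q)
      (subst (λ t → ∣ t ∣ ≤ ∣ at f (+ toℕ (fromℕ< i<q)) ∣) (sym (emb-π-at f (fromℕ< i<q))) (abs-minimal (at f (+ toℕ (fromℕ< i<q)))))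

    nrm-π : ∀ f → nrm (π f) ≤ Σℕ q (λ i → sq ∣ at f (+ i) ∣)
    nrm-π f = ℕₚ.≤-trans (ℕₚ.≤-reflexive (nrm-emb (π f))) (Σℕ-mono q (λ i i<q → sq-mono (emb-π-minimal f i i<q)))

-- Splitting ideals of the group algebra into fields

module IdempotentSplitting where
  open FiniteCounting
  open PeriodicConvolution
  open CyclicPowers
  open CyclicDomain
  open FiniteGroupAlgebra
  import Data.Fin.Properties as Finₚ
  import Data.Integer as ℤ
  import Data.Integer.Properties as ℤₚ
  import Data.Nat.Properties as ℕₚ
  open import Data.Empty using (⊥-elim)
  open import Data.Fin using (Fin; zero; suc; toℕ)
  open import Data.Integer using (ℤ; +_) renaming (_+_ to _+ᶻ_; _*_ to _*ᶻ_; _-_ to _-ᶻ_; -_ to -ᶻ_)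
  open import Data.Integer.Tactic.RingSolver using (solve-∀)
  open import Data.Nat using (ℕ; zero; suc; _<_; _≤_; _<?_; z≤n; s≤s) renaming (_+_ to _+ℕ_; _*_ to _*ℕ_)
  open import Data.Nat.Primality using (Prime)
  open import Data.Product using (∃; _×_; _,_; proj₁; proj₂)
  open import Data.Sum using (_⊎_; inj₁; inj₂; [_,_]′)
  open import Data.Vec using (Vec; []; _∷_)
  open import Data.Vec using (_++_)
  open import Relation.Binary.PropositionalEquality using (_≡_; _≢_; refl; sym; trans; cong; cong₂; subst)
  open import Relation.Nullary using (¬_; Dec; yes; no; _×-dec_; ¬?)

  module Idempotents (q′ m : ℕ) (prq : Prime (suc q′)) (prp : Prime (suc m)) (q≢p : suc q′ ≢ suc m) where
    open GroupAlgebra q′ m prq prp q≢p public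

    inverse : ∀ c → ¬ Cong (+ P) c (+ 0) → ∃ λ d → Cong (+ P) (c *ᶻ d) (+ 1)
    inverse c nz = go m prp nz
      where
      go : ∀ n → Prime (suc n) → ¬ Cong (+ suc n) c (+ 0) → ∃ λ d → Cong (+ suc n) (c *ᶻ d) (+ 1)
      go zero pr nz = ⊥-elim (nz (cg c (lem c)))
        where
        lem : ∀ c → c ≡ + 0 +ᶻ c *ᶻ + 1
        lem = solve-∀
      go (suc n) pr nz = powℤ c n , [ (λ z → ⊥-elim (nz z)) , Cong-undiff ]′ (Cong-prime pr c (w -ᶻ + 1)
          (subst (λ t → Cong (+ suc (suc n)) t (+ 0)) (sym (lem c w)) (Cong-diff (PrimeChar.fermat pr c))))
        where
        w = c *ᶻ powℤ c n
        lem : ∀ a b → a *ᶻ (b -ᶻ + 1) ≡ a *ᶻ b -ᶻ a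
        lem = solve-∀

    opaque
      scale : ℤ → X → X
      scale a x = π (sc a ⋆ emb x)

      emb-scale : ∀ a x k → Cong (+ P) (at (emb (scale a x)) k) (a *ᶻ at (emb x) k)
      emb-scale a x k = cong-trans (ap (emb-π (sc a ⋆ emb x)) k) (cong-≡ (sc⋆ a (emb x) k))

    scale-ext : ∀ {x y} → (∀ k → Cong (+ P) (at (emb x) k) (at (emb y) k)) → x ≡ y
    scale-ext h = emb-inj (pw h)

    scale-cong : ∀ {a b} x → Cong (+ P) a b → scale a x ≡ scale b x
    scale-cong {a} {b} x c = scale-ext λ k → cong-trans (emb-scale a x k) (cong-trans (cong-* c cong-refl) (cong-sym (emb-scale b x k)))

    scale-scale : ∀ a b x → scale a (scale b x) ≡ scale (a *ᶻ b) x
    scale-scale a b x = scale-ext λ k → cong-trans (emb-scale a (scale b x) k) (cong-trans (cong-* (cong-refl {a = a}) (emb-scale b x k))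
      (cong-trans (cong-≡ (sym (ℤₚ.*-assoc a b (at (emb x) k)))) (cong-sym (emb-scale (a *ᶻ b) x k))))

    scale-1 : ∀ x → scale (+ 1) x ≡ x
    scale-1 x = scale-ext λ k → cong-trans (emb-scale (+ 1) x k) (cong-≡ (ℤₚ.*-identityˡ (at (emb x) k)))

    scale-0X : ∀ a → scale a 0X ≡ 0X
    scale-0X a = scale-ext λ k → cong-trans (emb-scale a 0X k) (cong-trans (cong-* (cong-refl {a = a}) (ap emb-0 k))
      (cong-trans (cong-≡ (ℤₚ.*-zeroʳ a)) (cong-sym (ap emb-0 k))))

    scale-⊖ : ∀ a b x → scale a x ⊖ scale b x ≡ scale (a -ᶻ b) x
    scale-⊖ a b x = scale-ext λ k → cong-trans (ap (emb-⊕ (scale a x) (⊝ scale b x)) k) (cong-trans (cong-+ (emb-scale a x k)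
      (cong-trans (ap (emb-⊝ (scale b x)) k) (cong-neg (emb-scale b x k))))
      (cong-trans (cong-≡ (lem a b (at (emb x) k))) (cong-sym (emb-scale (a -ᶻ b) x k))))
      where
      lem : ∀ a b x → a *ᶻ x +ᶻ -ᶻ (b *ᶻ x) ≡ (a -ᶻ b) *ᶻ x
      lem = solve-∀

    opaque
      unfolding scale
      scale-⊗ : ∀ a x y → scale a (x ⊗ y) ≡ scale a x ⊗ y
      scale-⊗ a x y = emb-inj (F.≈trans (emb-π _) (F.≈trans (F.*-congˡ {sc a} (emb-⊗ x y)) (F.≈trans (F.≈sym (F.*-assoc (sc a) (emb x) (emb y)))
        (F.≈trans (F.*-congʳ {emb y} (F.≈sym (emb-π (sc a ⋆ emb x)))) (F.≈sym (emb-⊗ (scale a x) y))))))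

    scale-kernel : ∀ a x → ¬ Cong (+ P) a (+ 0) → scale a x ≡ 0X → x ≡ 0X
    scale-kernel a x nz h = by (inverse a nz)
      where
      by : (∃ λ d → Cong (+ P) (a *ᶻ d) (+ 1)) → x ≡ 0X
      by (d , c) = trans (sym (scale-1 x)) (trans (sym (scale-cong x c)) (trans (cong (λ t → scale t x) (ℤₚ.*-comm a d))
        (trans (sym (scale-scale d a x)) (trans (cong (scale d) h) (scale-0X d)))))

    scale-inj : ∀ (a b : Fin P) x → x ≢ 0X → scale (+ toℕ a) x ≡ scale (+ toℕ b) x → a ≡ b
    scale-inj a b x x≢0 h = by (a Finₚ.≟ b)
      where
      by : Dec (a ≡ b) → a ≡ b
      by (yes e) = e
      by (no ne) = ⊥-elim (x≢0 (scale-kernel (+ toℕ a -ᶻ + toℕ b) x nz (trans (sym (scale-⊖ (+ toℕ a) (+ toℕ b) x)) (trans (cong (_⊖ scale (+ toℕ b) x) h) (XM.-‿inverseʳ (scale (+ toℕ b) x))))))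
        where
        nz : ¬ Cong (+ P) (+ toℕ a -ᶻ + toℕ b) (+ 0)
        nz c = ne (trans (sym (res-toℕ m a)) (trans (Cong⇒res≡ m {+ toℕ a} {+ toℕ b} (Cong-undiff c)) (res-toℕ m b)))

    ⊖≡0 : ∀ {x y} → x ⊖ y ≡ 0X → x ≡ y
    ⊖≡0 {x} {y} h = trans (XM.solve 2 (λ x y → x XM.:= (x XM.:+ (XM.:- y)) XM.:+ y) refl x y) (trans (cong (_⊕ y) h) (XM.+-identityˡ y))

    -- Complete systems of orthogonal idempotents

    Under : X → X → Set
    Under e x = x ⊗ e ≡ x

    under? : ∀ e x → Dec (Under e x)
    under? e x = x ⊗ e ≟ x

    size : X → ℕ
    size e = ∑ (λ x → 𝟙 (under? e x))

    -- For a nonzero idempotent e this says that the ideal e X is a field.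
    Fieldlike : X → Set
    Fieldlike e = ∀ f → f ⊗ e ≡ 0X ⊎ ∃ λ g → (f ⊗ g) ⊗ e ≡ e

    record Split (e e₁ e₂ : X) : Set where
      field
        sum≡ : e ≡ e₁ ⊕ e₂
        orth : e₁ ⊗ e₂ ≡ 0X
        idem₁ : e₁ ⊗ e₁ ≡ e₁
        idem₂ : e₂ ⊗ e₂ ≡ e₂

    -- A tree of binary splittings whose leaves are the minimal idempotents; both detection of 0 and
    -- counting of elements are inductions on it.
    data Decomp : X → ∀ {k} → Vec X k → Set where
      leaf : ∀ {e} → Fieldlike e → e ≢ 0X → e ⊗ e ≡ e → ZS e → Decomp e (e ∷ [])
      node : ∀ {e e₁ e₂ k₁ k₂} {v₁ : Vec X k₁} {v₂ : Vec X k₂} → Split e e₁ e₂ → Decomp e₁ v₁ → Decomp e₂ v₂ → Decomp e (v₁ ++ v₂)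

    module _ (e f : X) (ee : e ⊗ e ≡ e) (fe≢0 : f ⊗ e ≢ 0X) (noinv : ¬ ∃ λ g → (f ⊗ g) ⊗ e ≡ e) where
      private
        y = f ⊗ e
        yk = y ^X N-2
      -- The idempotent e₁ generates the ideal of y = f e. It is nonzero because y = y e₁ is, and e₂
      -- is nonzero because e₁ = e would make y^(N-2) an inverse of f on e X.
      e₁ e₂ : X
      e₁ = y ⊗ yk
      e₂ = e ⊖ e₁

      private
        y-e₁ : y ⊗ e₁ ≡ y
        y-e₁ = ^N-2 y

        ye : y ⊗ e ≡ y
        ye = trans (XM.*-assoc f e e) (cong (f ⊗_) ee)

        e₁e : e₁ ⊗ e ≡ e₁
        e₁e = trans (XM.solve 3 (λ y k e → (y XM.:* k) XM.:* e XM.:= (y XM.:* e) XM.:* k) refl y yk e) (cong (_⊗ yk) ye)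

        e₁e₁ : e₁ ⊗ e₁ ≡ e₁
        e₁e₁ = trans (XM.solve 2 (λ y k → (y XM.:* k) XM.:* (y XM.:* k) XM.:= (y XM.:* (y XM.:* k)) XM.:* k) refl y yk) (cong (_⊗ yk) y-e₁)

      e₁≢0 : e₁ ≢ 0X
      e₁≢0 h = fe≢0 (trans (sym y-e₁) (trans (cong (y ⊗_) h) (XM.zeroʳ y)))

      e₂≢0 : e₂ ≢ 0X
      e₂≢0 h = noinv (yk , trans (XM.solve 3 (λ f k e → (f XM.:* k) XM.:* e XM.:= (f XM.:* e) XM.:* k) refl f yk e) (sym (⊖≡0 h)))

      split : Split e e₁ e₂
      split = record
        { sum≡ = XM.solve 2 (λ e a → e XM.:= a XM.:+ (e XM.:+ (XM.:- a))) refl e e₁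
        ; orth = trans (XM.solve 2 (λ e a → a XM.:* (e XM.:+ (XM.:- a)) XM.:= (a XM.:* e) XM.:+ (XM.:- (a XM.:* a))) refl e e₁)
            (trans (cong₂ _⊖_ e₁e e₁e₁) (XM.-‿inverseʳ e₁))
        ; idem₁ = e₁e₁
        ; idem₂ = trans (XM.solve 2 (λ e a → (e XM.:+ (XM.:- a)) XM.:* (e XM.:+ (XM.:- a)) XM.:= (e XM.:* e) XM.:+ (XM.:- (a XM.:* e)) XM.:+ (XM.:- ((a XM.:* e) XM.:+ (XM.:- (a XM.:* a))))) refl e e₁)
            (trans (cong₂ (λ s t → s ⊕ (⊝ (e₁ ⊗ e)) ⊕ (⊝ (t ⊖ (e₁ ⊗ e₁)))) ee e₁e)
            (trans (cong₂ (λ s t → e ⊕ (⊝ s) ⊕ (⊝ (e₁ ⊖ t))) e₁e e₁e₁)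
              (XM.solve 2 (λ e a → e XM.:+ (XM.:- a) XM.:+ (XM.:- (a XM.:+ (XM.:- a))) XM.:= e XM.:+ (XM.:- a)) refl e e₁))) }

      ZS₁ : ZS e → ZS e₁
      ZS₁ zs = ZS-⊗ˡ yk (ZS-⊗ f zs)

      ZS₂ : ZS e → ZS e₂
      ZS₂ zs = ZS-⊕ zs (ZS-⊝ (ZS₁ zs))

    module _ {e e₁ e₂ : X} (s : Split e e₁ e₂) where
      open Split s

      below₁ : e₁ ⊗ e ≡ e₁
      below₁ = trans (cong (e₁ ⊗_) sum≡) (trans (XM.distribˡ e₁ e₁ e₂) (trans (cong₂ _⊕_ idem₁ orth) (XM.+-identityʳ e₁)))

      below₂ : e₂ ⊗ e ≡ e₂
      below₂ = trans (cong (e₂ ⊗_) sum≡) (trans (XM.distribˡ e₂ e₁ e₂) (trans (cong₂ _⊕_ (trans (XM.*-comm e₂ e₁) orth) idem₂) (XM.+-identityˡ e₂)))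

      under₁ : ∀ {x} → Under e₁ x → Under e x
      under₁ {x} u = trans (cong (_⊗ e) (sym u)) (trans (XM.*-assoc x e₁ e) (trans (cong (x ⊗_) below₁) u))

      under₂ : ∀ {x} → Under e₂ x → Under e x
      under₂ {x} u = trans (cong (_⊗ e) (sym u)) (trans (XM.*-assoc x e₂ e) (trans (cong (x ⊗_) below₂) u))

      kill₁₂ : ∀ {x} → Under e₁ x → x ⊗ e₂ ≡ 0X
      kill₁₂ {x} u = trans (cong (_⊗ e₂) (sym u)) (trans (XM.*-assoc x e₁ e₂) (trans (cong (x ⊗_) orth) (XM.zeroʳ x)))

      kill₂₁ : ∀ {x} → Under e₂ x → x ⊗ e₁ ≡ 0X
      kill₂₁ {x} u = trans (cong (_⊗ e₁) (sym u)) (trans (XM.*-assoc x e₂ e₁) (trans (cong (x ⊗_) (trans (XM.*-comm e₂ e₁) orth)) (XM.zeroʳ x)))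

      -- The map (x, y) ↦ x + y is injective: multiplication by e₁ and by e₂ recovers the two parts.
      size-mul : size e₁ *ℕ size e₂ ≤ size e
      size-mul = ℕₚ.≤-trans (ℕₚ.≤-reflexive (trans (sym (∑-*ʳ (size e₂) (λ x → 𝟙 (under? e₁ x)))) (trans (∑-cong (λ x → sym (∑-* (𝟙 (under? e₁ x)) (λ y → 𝟙 (under? e₂ y))))) (sym (∑-× {X} {X} (λ { (x , y) → 𝟙 (under? e₁ x) *ℕ 𝟙 (under? e₂ y) }))))))
        (∑-inj-on (λ { (x , y) → x ⊕ y }) _ _ bound inj)
        where
        both : ∀ {x y} → 0 < 𝟙 (under? e₁ x) *ℕ 𝟙 (under? e₂ y) → Under e₁ x × Under e₂ y
        both {x} {y} h = 𝟙>0 (under? e₁ x) (pos₁ (𝟙 (under? e₁ x)) (𝟙 (under? e₂ y)) h) , 𝟙>0 (under? e₂ y) (pos₂ (𝟙 (under? e₁ x)) (𝟙 (under? e₂ y)) h)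
          where
          pos₁ : ∀ a b → 0 < a *ℕ b → 0 < a
          pos₁ (suc a) b _ = s≤s z≤n
          pos₂ : ∀ a b → 0 < a *ℕ b → 0 < b
          pos₂ a zero h = subst (0 <_) (ℕₚ.*-zeroʳ a) h
          pos₂ a (suc b) _ = s≤s z≤n
        bound : ∀ (xy : X × X) → 𝟙 (under? e₁ (proj₁ xy)) *ℕ 𝟙 (under? e₂ (proj₂ xy)) ≤ 𝟙 (under? e (proj₁ xy ⊕ proj₂ xy))
        bound (x , y) = by (0 <? 𝟙 (under? e₁ x) *ℕ 𝟙 (under? e₂ y))
          where
          by : Dec (0 < 𝟙 (under? e₁ x) *ℕ 𝟙 (under? e₂ y)) → 𝟙 (under? e₁ x) *ℕ 𝟙 (under? e₂ y) ≤ 𝟙 (under? e (x ⊕ y))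
          by (yes h) = ℕₚ.≤-trans (ℕₚ.*-mono-≤ (𝟙≤1 (under? e₁ x)) (𝟙≤1 (under? e₂ y))) (ℕₚ.≤-reflexive (sym (𝟙-yes (under? e (x ⊕ y))
            (trans (XM.distribʳ e x y) (cong₂ _⊕_ (under₁ (proj₁ (both h))) (under₂ (proj₂ (both h))))))))
          by (no h) = ℕₚ.≤-trans (ℕₚ.≮⇒≥ h) z≤n
        inj : ∀ (u v : X × X) → 0 < 𝟙 (under? e₁ (proj₁ u)) *ℕ 𝟙 (under? e₂ (proj₂ u)) → 0 < 𝟙 (under? e₁ (proj₁ v)) *ℕ 𝟙 (under? e₂ (proj₂ v)) →
          proj₁ u ⊕ proj₂ u ≡ proj₁ v ⊕ proj₂ v → u ≡ v
        inj (x , y) (z , w) h g eq = cong₂ _,_ (trans (sym (part₁ (both h))) (trans (cong (_⊗ e₁) eq) (part₁ (both g)))) (trans (sym (part₂ (both h))) (trans (cong (_⊗ e₂) eq) (part₂ (both g))))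
          where
          part₁ : ∀ {x y} → Under e₁ x × Under e₂ y → (x ⊕ y) ⊗ e₁ ≡ x
          part₁ {x} {y} (a , b) = trans (XM.distribʳ e₁ x y) (trans (cong₂ _⊕_ a (kill₂₁ b)) (XM.+-identityʳ x))
          part₂ : ∀ {x y} → Under e₁ x × Under e₂ y → (x ⊕ y) ⊗ e₂ ≡ y
          part₂ {x} {y} (a , b) = trans (XM.distribʳ e₂ x y) (trans (cong₂ _⊕_ (kill₁₂ a) b) (XM.+-identityˡ y))

      -- The element e₂ lies in e X but not in e₁ X.
      size-<₁ : e₂ ≢ 0X → size e₁ < size e
      size-<₁ ne = strict e₁ e₂ (λ h → ne (trans (sym h) (trans (XM.*-comm e₂ e₁) orth))) below₂ (λ u → under₁ u)
        where
        strict : ∀ a b → ¬ Under a b → Under e b → (∀ {x} → Under a x → Under e x) → size a < size e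
        strict a b nab eb mono = ℕₚ.≤-trans (ℕₚ.≤-reflexive (trans (ℕₚ.+-comm 1 (size a)) (trans (cong (size a +ℕ_) (sym (∑-once b))) (sym (∑-+ _ _)))))
          (∑-mono {f = λ x → 𝟙 (under? a x) +ℕ 𝟙 (x ≟ b)} {g = λ x → 𝟙 (under? e x)} (λ x → pt x (under? a x) (x ≟ b)))
          where
          pt : ∀ x (d : Dec (Under a x)) (d₁ : Dec (x ≡ b)) → 𝟙 d +ℕ 𝟙 d₁ ≤ 𝟙 (under? e x)
          pt x (yes u) (yes refl) = ⊥-elim (nab u)
          pt x (yes u) (no _) = ℕₚ.≤-reflexive (sym (𝟙-yes (under? e x) (mono u)))
          pt x (no _) (yes refl) = ℕₚ.≤-reflexive (sym (𝟙-yes (under? e x) eb))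
          pt x (no _) (no _) = z≤n

    flip-split : ∀ {e e₁ e₂} → Split e e₁ e₂ → Split e e₂ e₁
    flip-split {e} {e₁} {e₂} s = record { sum≡ = trans sum≡ (XM.+-comm e₁ e₂) ; orth = trans (XM.*-comm e₂ e₁) orth ; idem₁ = idem₂ ; idem₂ = idem₁ }
      where open Split s

    -- Any f that is neither zero nor invertible on e X splits e into two strictly smaller parts; B
    -- bounds the depth of the recursion.
    decompose : ∀ B e → size e ≤ B → e ⊗ e ≡ e → e ≢ 0X → ZS e → ∃ λ k → ∃ λ (v : Vec X k) → Decomp e v
    decompose B e le ee e≢0 zs = by (∃? bad?)
      where
      Bad : X → Set
      Bad f = f ⊗ e ≢ 0X × ¬ ∃ λ g → (f ⊗ g) ⊗ e ≡ e
      bad? : ∀ f → Dec (Bad f)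
      bad? f = ¬? (f ⊗ e ≟ 0X) ×-dec ¬? (∃? (λ g → (f ⊗ g) ⊗ e ≟ e))
      by : Dec (∃ Bad) → ∃ λ k → ∃ λ (v : Vec X k) → Decomp e v
      by (no none) = 1 , e ∷ [] , leaf fl e≢0 ee zs
        where
        fl : Fieldlike e
        fl f = cases (f ⊗ e ≟ 0X) (∃? (λ g → (f ⊗ g) ⊗ e ≟ e))
          where
          cases : Dec (f ⊗ e ≡ 0X) → Dec (∃ λ g → (f ⊗ g) ⊗ e ≡ e) → f ⊗ e ≡ 0X ⊎ ∃ λ g → (f ⊗ g) ⊗ e ≡ e
          cases (yes h) _ = inj₁ h
          cases (no _) (yes h) = inj₂ h
          cases (no a) (no b) = ⊥-elim (none (f , a , b))
      by (yes (f , fe , ni)) = go B le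
        where
        s = split e f ee fe ni
        go : ∀ B → size e ≤ B → ∃ λ k → ∃ λ (v : Vec X k) → Decomp e v
        go zero le = ⊥-elim (ℕₚ.<⇒≱ (ℕₚ.≤-<-trans z≤n (size-<₁ s (e₂≢0 e f ee fe ni))) le)
        go (suc B) le =
          let (k₁ , v₁ , d₁) = decompose B (e₁ e f ee fe ni) (ℕₚ.≤-pred (ℕₚ.≤-trans (size-<₁ s (e₂≢0 e f ee fe ni)) le)) (Split.idem₁ s) (e₁≢0 e f ee fe ni) (ZS₁ e f ee fe ni zs)
              (k₂ , v₂ , d₂) = decompose B (e₂ e f ee fe ni) (ℕₚ.≤-pred (ℕₚ.≤-trans (size-<₁ (flip-split s) (e₁≢0 e f ee fe ni)) le)) (Split.idem₂ s) (e₂≢0 e f ee fe ni) (ZS₂ e f ee fe ni zs)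
          in k₁ +ℕ k₂ , v₁ ++ v₂ , node s d₁ d₂

-- Smoothing: counting short multiples of a fixed element

module CountingMultiples where
  open FiniteCounting
  open PeriodicConvolution
  open CyclicPowers
  open CyclicDomain
  open FiniteGroupAlgebra
  open IdempotentSplitting
  import Data.Fin.Properties as Finₚ
  import Data.Integer.Properties as ℤₚ
  import Data.Nat as ℕ
  import Data.Nat.Properties as ℕₚ
  open import Data.Empty using (⊥-elim)
  open import Data.Fin using (Fin; zero; suc; fromℕ<)
  open import Data.Integer using (ℤ; +_; -[1+_]; ∣_∣) renaming (_+_ to _+ᶻ_; _*_ to _*ᶻ_; _-_ to _-ᶻ_; -_ to -ᶻ_)
  open import Data.Integer.Tactic.RingSolver using (solve-∀)
  open import Data.Nat using (ℕ; zero; suc; _<_; _≤_; _≤?_; z≤n; s≤s) renaming (_+_ to _+ℕ_; _*_ to _*ℕ_; _^_ to _^ℕ_)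
  open import Data.Nat.Divisibility using (_∣_)
  open import Data.Nat.Primality using (Prime)
  open import Data.Nat.Tactic.RingSolver using () renaming (solve-∀ to solveℕ-∀)
  open import Data.Product using (_×_; _,_; proj₁; proj₂)
  open import Data.Sum using (_⊎_; inj₁; inj₂; [_,_]′)
  open import Data.Vec using (Vec; _∷_)
  open import Data.Vec using (tail)
  open import Defs
  open import Function using (_∘_)
  open import Relation.Binary.PropositionalEquality using (_≡_; _≢_; refl; sym; trans; cong; cong₂; subst; module ≡-Reasoning)
  open import Relation.Nullary using (Dec; yes; no)

  sq-abs : ∀ a → + sq ∣ a ∣ ≡ a *ᶻ a
  sq-abs (+ n) = ℤₚ.pos-* n n
  sq-abs -[1+ n ] = refl

  parallelogram : ∀ a b → sq ∣ a +ᶻ b ∣ +ℕ sq ∣ a -ᶻ b ∣ ≡ 2 *ℕ (sq ∣ a ∣ +ℕ sq ∣ b ∣)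
  parallelogram a b = ℤₚ.+-injective (begin
    + (sq ∣ a +ᶻ b ∣ +ℕ sq ∣ a -ᶻ b ∣) ≡⟨ ℤₚ.pos-+ (sq ∣ a +ᶻ b ∣) (sq ∣ a -ᶻ b ∣) ⟩
    + sq ∣ a +ᶻ b ∣ +ᶻ + sq ∣ a -ᶻ b ∣ ≡⟨ cong₂ _+ᶻ_ (sq-abs (a +ᶻ b)) (sq-abs (a -ᶻ b)) ⟩
    (a +ᶻ b) *ᶻ (a +ᶻ b) +ᶻ (a -ᶻ b) *ᶻ (a -ᶻ b) ≡⟨ lem a b ⟩
    + 2 *ᶻ (a *ᶻ a +ᶻ b *ᶻ b) ≡⟨ cong (+ 2 *ᶻ_) (cong₂ _+ᶻ_ (sym (sq-abs a)) (sym (sq-abs b))) ⟩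
    + 2 *ᶻ (+ sq ∣ a ∣ +ᶻ + sq ∣ b ∣) ≡⟨ cong (+ 2 *ᶻ_) (ℤₚ.pos-+ (sq ∣ a ∣) (sq ∣ b ∣)) ⟨
    + 2 *ᶻ + (sq ∣ a ∣ +ℕ sq ∣ b ∣) ≡⟨ ℤₚ.pos-* 2 (sq ∣ a ∣ +ℕ sq ∣ b ∣) ⟨
    + (2 *ℕ (sq ∣ a ∣ +ℕ sq ∣ b ∣)) ∎)
    where
    open ≡-Reasoning
    lem : ∀ a b → (a +ᶻ b) *ᶻ (a +ᶻ b) +ᶻ (a -ᶻ b) *ᶻ (a -ᶻ b) ≡ + 2 *ᶻ (a *ᶻ a +ᶻ b *ᶻ b)
    lem = solve-∀

  Σℕ-+ : ∀ n f g → Σℕ n (λ i → f i +ℕ g i) ≡ Σℕ n f +ℕ Σℕ n g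
  Σℕ-+ zero f g = refl
  Σℕ-+ (suc n) f g = trans (cong (_+ℕ (f n +ℕ g n)) (Σℕ-+ n f g)) (lem (Σℕ n f) (Σℕ n g) (f n) (g n))
    where
    lem : ∀ a b c d → a +ℕ b +ℕ (c +ℕ d) ≡ a +ℕ c +ℕ (b +ℕ d)
    lem = solveℕ-∀

  one-of : ∀ {a b c} → a +ℕ b ≤ 2 *ℕ c → a ≤ c ⊎ b ≤ c
  one-of {a} {b} {c} h with a ≤? c
  ... | yes a≤c = inj₁ a≤c
  ... | no a≰c = inj₂ (ℕₚ.≮⇒≥ λ c<b → ℕₚ.<⇒≱ (ℕₚ.+-mono-< (ℕₚ.≰⇒> a≰c) c<b) (subst (a +ℕ b ≤_) (cong (c +ℕ_) (ℕₚ.+-identityʳ c)) h))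

  module Consequences (q′ m : ℕ) (prq : Prime (suc q′)) (prp : Prime (suc m)) (q≢p : suc q′ ≢ suc m) where
    open Idempotents q′ m prq prp q≢p public

    -- The kernel X₀ of the augmentation, parametrised by the last q - 1 coordinates

    X₀ : Set
    X₀ = Vec (Fin P) q′

    tailsum : X₀ → ℤ
    tailsum t = Sn q′ (λ k → at (emb (zero ∷ t)) (+ 1 +ᶻ k))

    σ-∷ : ∀ a t → σ (emb (a ∷ t)) ≡ lift a +ᶻ tailsum t
    σ-∷ a t = trans (Sn-front q′ (at (emb (a ∷ t)))) (cong₂ _+ᶻ_ (emb-at (a ∷ t) zero) (Sn-cong< q′ (λ i i<q′ →
      subst (λ j → at (emb (a ∷ t)) (+ suc j) ≡ at (emb (zero ∷ t)) (+ suc j)) (Finₚ.toℕ-fromℕ< i<q′)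
        (trans (emb-at (a ∷ t) (suc (fromℕ< i<q′))) (sym (emb-at (zero ∷ t) (suc (fromℕ< i<q′))))))))

    -- The first coordinate is the one that makes the sum 0 modulo P, so X₀ is parametrised freely
    -- and has P^(q-1) elements.
    ι : X₀ → X
    ι t = res m (-ᶻ tailsum t) ∷ t

    ZS-ι : ∀ t → ZS (ι t)
    ZS-ι t = cong-trans (cong-≡ (σ-∷ (res m (-ᶻ tailsum t)) t)) (cong-trans (cong-+ (cong-trans (lift-Cong (res m (-ᶻ tailsum t))) (cong-sym (toℕ-res m (-ᶻ tailsum t)))) (cong-refl {a = tailsum t}))
      (cong-≡ (ℤₚ.+-inverseˡ (tailsum t))))

    same-tail : ∀ {x y} → tail x ≡ tail y → Cong (+ P) (σ (emb x)) (σ (emb y)) → x ≡ y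
    same-tail {a ∷ t} {b ∷ .t} refl c = cong (_∷ t) (trans (sym (res-lift a)) (trans (Cong⇒res≡ m lifts) (res-lift b)))
      where
      lem : ∀ a s → (a +ᶻ s) +ᶻ -ᶻ s ≡ a
      lem = solve-∀
      lifts : Cong (+ P) (lift a) (lift b)
      lifts = cong-trans (cong-≡ (sym (trans (cong (_+ᶻ -ᶻ tailsum t) (σ-∷ a t)) (lem (lift a) (tailsum t)))))
        (cong-trans (cong-+ c (cong-refl {a = -ᶻ tailsum t})) (cong-≡ (trans (cong (_+ᶻ -ᶻ tailsum t) (σ-∷ b t)) (lem (lift b) (tailsum t)))))

    ι-tail : ∀ x → ZS x → ι (tail x) ≡ x
    ι-tail x zs = same-tail refl (cong-trans (ZS-ι (tail x)) (cong-sym zs))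

    ι-inj : ∀ {s t} → ι s ≡ ι t → s ≡ t
    ι-inj e = cong tail e

    card-X₀>0 : 0 < card X₀
    card-X₀>0 = subst (0 <_) (sym (trans (card-Vec {Fin P} q′) (cong (_^ℕ q′) (card-Fin P)))) (ℕₚ.m^n>0 P q′)

    card-X : card X ≡ P *ℕ card X₀
    card-X = trans (∑-Vec {Fin P} {n = q′} (λ _ → 1)) (trans (∑-const {Fin P} (card X₀)) (cong (_*ℕ card X₀) (card-Fin P)))

    -- Times |X₀|, a bound for the number of h with σ(z) = σ(f) σ(h): there is one value of σ(h) if
    -- σ(f) ≠ 0, and otherwise all P values or none.
    ω : X → X → ℕ
    ω f z = suc (P *ℕ (𝟙 (ZS? f) *ℕ 𝟙 (ZS? z)))

    -- What remains of the equation z = f h after z and h have been translated by elements of X₀.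
    Solves : X → X → X → Set
    Solves f z h = Cong (+ P) (σ (emb z)) (σ (emb f) *ᶻ σ (emb h))

    solves? : ∀ f z h → Dec (Solves f z h)
    solves? f z h = Cong? m (σ (emb z)) (σ (emb f) *ᶻ σ (emb h))

    count-solves : ∀ f z → ∑ (λ h → 𝟙 (solves? f z h)) ≤ card X₀ *ℕ ω f z
    count-solves f z = by (ZS? f) (ZS? z) refl refl
      where
      by : (d : Dec (ZS f)) (e : Dec (ZS z)) → ZS? f ≡ d → ZS? z ≡ e → ∑ (λ h → 𝟙 (solves? f z h)) ≤ card X₀ *ℕ ω f z
      by (yes a) (yes b) ea eb = begin
        ∑ (λ h → 𝟙 (solves? f z h)) ≤⟨ ∑-mono (λ h → 𝟙≤1 (solves? f z h)) ⟩
        card X ≡⟨ card-X ⟩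
        P *ℕ card X₀ ≡⟨ ℕₚ.*-comm P (card X₀) ⟩
        card X₀ *ℕ P ≤⟨ ℕₚ.*-monoʳ-≤ (card X₀) (ℕₚ.≤-trans (ℕₚ.≤-reflexive (sym (ℕₚ.*-identityʳ P))) (ℕₚ.n≤1+n _)) ⟩
        card X₀ *ℕ suc (P *ℕ 1) ≡⟨ cong (λ t → card X₀ *ℕ suc (P *ℕ t)) (sym (cong₂ _*ℕ_ (cong 𝟙 ea) (cong 𝟙 eb))) ⟩
        card X₀ *ℕ ω f z ∎
        where open ℕₚ.≤-Reasoning
      by (yes a) (no nb) _ _ = ℕₚ.≤-trans (ℕₚ.≤-reflexive (trans (∑-cong (λ h → 𝟙-no (solves? f z h) (λ s → nb (cong-trans s
        (cong-trans (cong-* a (cong-refl {a = σ (emb h)})) (cong-≡ (ℤₚ.*-zeroˡ (σ (emb h))))))))) ∑-0)) z≤n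
      by (no na) _ _ _ = ℕₚ.≤-trans (ℕₚ.≤-trans (∑-inj-on tail (λ h → 𝟙 (solves? f z h)) (λ _ → 1) (λ h → 𝟙≤1 (solves? f z h)) inj)
          (ℕₚ.≤-reflexive (sym (ℕₚ.*-identityʳ (card X₀))))) (ℕₚ.*-monoʳ-≤ (card X₀) (s≤s z≤n))
        where
        inj : ∀ h g → 0 < 𝟙 (solves? f z h) → 0 < 𝟙 (solves? f z g) → tail h ≡ tail g → h ≡ g
        inj h g a b e = same-tail e ([ (λ c → ⊥-elim (na c)) , Cong-undiff ]′ (Cong-prime prp (σ (emb f)) (σ (emb h) -ᶻ σ (emb g))
          (subst (λ t → Cong (+ P) t (+ 0)) (lem (σ (emb f)) (σ (emb h)) (σ (emb g))) (Cong-diff (cong-trans (cong-sym (𝟙>0 (solves? f z h) a)) (𝟙>0 (solves? f z g) b))))))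
          where
          lem : ∀ s a b → s *ᶻ a -ᶻ s *ᶻ b ≡ s *ᶻ (a -ᶻ b)
          lem = solve-∀

    nrm-⊕ : ∀ x v → nrm (x ⊕ v) ≤ Σℕ q (λ i → sq ∣ at (emb x) (+ i) +ᶻ at (emb v) (+ i) ∣)
    nrm-⊕ x v = ℕₚ.≤-trans (ℕₚ.≤-reflexive (cong nrm (⊕-def x v))) (nrm-π (emb x ⊞ emb v))

    nrm-⊖ : ∀ x v → nrm (x ⊖ v) ≤ Σℕ q (λ i → sq ∣ at (emb x) (+ i) -ᶻ at (emb v) (+ i) ∣)
    nrm-⊖ x v = ℕₚ.≤-trans (ℕₚ.≤-reflexive (cong nrm eq)) (nrm-π (emb x ⊞ neg (emb v)))
      where
      eq : x ⊖ v ≡ π (emb x ⊞ neg (emb v))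
      eq = emb-inj (F.≈trans (emb-⊕ x (⊝ v)) (F.≈trans (F.+-congˡ {emb x} (emb-⊝ v)) (F.≈sym (emb-π (emb x ⊞ neg (emb v))))))

    -- By the parallelogram law the right-hand side bounds the average of the two squared norms.
    -- Choosing the sign costs a factor 2 in each count and avoids the cross term.
    nrm-± : ∀ x v → nrm (x ⊕ v) ≤ nrm x +ℕ nrm v ⊎ nrm (x ⊖ v) ≤ nrm x +ℕ nrm v
    nrm-± x v = one-of (begin
      nrm (x ⊕ v) +ℕ nrm (x ⊖ v) ≤⟨ ℕₚ.+-mono-≤ (nrm-⊕ x v) (nrm-⊖ x v) ⟩
      Σℕ q (λ i → sq ∣ a i +ᶻ b i ∣) +ℕ Σℕ q (λ i → sq ∣ a i -ᶻ b i ∣) ≡⟨ Σℕ-+ q _ _ ⟨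
      Σℕ q (λ i → sq ∣ a i +ᶻ b i ∣ +ℕ sq ∣ a i -ᶻ b i ∣) ≡⟨ Σℕ-cong q (λ i _ → trans (parallelogram (a i) (b i)) (ℕₚ.*-comm 2 (sq ∣ a i ∣ +ℕ sq ∣ b i ∣))) ⟩
      Σℕ q (λ i → (sq ∣ a i ∣ +ℕ sq ∣ b i ∣) *ℕ 2) ≡⟨ Σℕ-*ʳ q 2 _ ⟩
      Σℕ q (λ i → sq ∣ a i ∣ +ℕ sq ∣ b i ∣) *ℕ 2 ≡⟨ ℕₚ.*-comm (Σℕ q (λ i → sq ∣ a i ∣ +ℕ sq ∣ b i ∣)) 2 ⟩
      2 *ℕ Σℕ q (λ i → sq ∣ a i ∣ +ℕ sq ∣ b i ∣) ≡⟨ cong (2 *ℕ_) (trans (Σℕ-+ q _ _) (cong₂ _+ℕ_ (sym (nrm-emb x)) (sym (nrm-emb v)))) ⟩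
      2 *ℕ (nrm x +ℕ nrm v) ∎)
      where
      open ℕₚ.≤-Reasoning
      a b : ℕ → ℤ
      a i = at (emb x) (+ i)
      b i = at (emb v) (+ i)

    -- Smoothing: if every class modulo f X₀ has a short representative, then the multiples of f
    -- are no denser than the whole lattice, at the price of enlarging the ball.
    record Shortening (f : X) (E : ℕ) : Set where
      field
        v k : X₀ → X
        k-ZS : ∀ y → ZS (k y)
        v≡ : ∀ y → v y ≡ ι y ⊕ f ⊗ k y
        v-short : ∀ y → nrm (v y) ≤ E

    within? : ∀ f D z → Dec (nrm f +ℕ nrm z ≤ D)
    within? f D z = nrm f +ℕ nrm z ≤? D

    module _ {f : X} {E : ℕ} (sh : Shortening f E) (D : ℕ) where
      open Shortening sh
      private
        Q : X × X → ℕ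
        Q (z , h) = 𝟙 (within? f (D +ℕ E) z) *ℕ 𝟙 (solves? f z h)
        φ₊ φ₋ : X × X₀ → X × X
        φ₊ (h , y) = f ⊗ h ⊕ v y , h ⊕ k y
        φ₋ (h , y) = f ⊗ h ⊖ v y , h ⊖ k y

        σ-shift : ∀ {x d} → ZS d → Cong (+ P) (σ (emb (x ⊕ d))) (σ (emb x))
        σ-shift {x} {d} zs = cong-trans (σX-⊕ x d) (cong-trans (cong-+ (cong-refl {a = σ (emb x)}) zs) (cong-≡ (ℤₚ.+-identityʳ (σ (emb x)))))

        v-ZS : ∀ y → ZS (v y)
        v-ZS y = subst ZS (sym (v≡ y)) (ZS-⊕ (ZS-ι y) (ZS-⊗ f (k-ZS y)))

        solves-shift : ∀ h {d e} → ZS d → ZS e → Solves f (f ⊗ h ⊕ d) (h ⊕ e)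
        solves-shift h {d} {e} zd ze = cong-trans (σ-shift zd) (cong-trans (σX-⊗ f h) (cong-* (cong-refl {a = σ (emb f)}) (cong-sym (σ-shift {h} {e} ze))))

        inj₊ : ∀ u w → φ₊ u ≡ φ₊ w → u ≡ w
        inj₊ (h , y) (h₁ , y₁) e = cong₂ _,_ (trans (sym (cancel h (k y))) (trans (cong₂ _⊖_ eh (cong k y≡)) (cancel h₁ (k y₁)))) y≡
          where
          ez = cong proj₁ e
          eh = cong proj₂ e
          cancel : ∀ h d → h ⊕ d ⊖ d ≡ h
          cancel = XM.solve 2 (λ h d → h XM.:+ d XM.:+ (XM.:- d) XM.:= h) refl
          recover : ∀ h y → f ⊗ h ⊕ v y ⊖ f ⊗ (h ⊕ k y) ≡ ι y
          recover h y = trans (cong (λ t → f ⊗ h ⊕ t ⊖ f ⊗ (h ⊕ k y)) (v≡ y))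
            (XM.solve 4 (λ f h k i → f XM.:* h XM.:+ (i XM.:+ f XM.:* k) XM.:+ (XM.:- (f XM.:* (h XM.:+ k))) XM.:= i) refl f h (k y) (ι y))
          y≡ : y ≡ y₁
          y≡ = ι-inj (trans (sym (recover h y)) (trans (cong₂ (λ s t → s ⊖ f ⊗ t) ez eh) (recover h₁ y₁)))

        inj₋ : ∀ u w → φ₋ u ≡ φ₋ w → u ≡ w
        inj₋ (h , y) (h₁ , y₁) e = cong₂ _,_ (trans (sym (cancel h (k y))) (trans (cong₂ _⊕_ eh (cong k y≡)) (cancel h₁ (k y₁)))) y≡
          where
          ez = cong proj₁ e
          eh = cong proj₂ e
          cancel : ∀ h d → h ⊖ d ⊕ d ≡ h
          cancel = XM.solve 2 (λ h d → h XM.:+ (XM.:- d) XM.:+ d XM.:= h) refl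
          recover : ∀ h y → f ⊗ (h ⊖ k y) ⊖ (f ⊗ h ⊖ v y) ≡ ι y
          recover h y = trans (cong (λ t → f ⊗ (h ⊖ k y) ⊖ (f ⊗ h ⊖ t)) (v≡ y))
            (XM.solve 4 (λ f h k i → f XM.:* (h XM.:+ (XM.:- k)) XM.:+ (XM.:- (f XM.:* h XM.:+ (XM.:- (i XM.:+ f XM.:* k)))) XM.:= i) refl f h (k y) (ι y))
          y≡ : y ≡ y₁
          y≡ = ι-inj (trans (sym (recover h y)) (trans (cong₂ (λ s t → f ⊗ t ⊖ s) ez eh) (recover h₁ y₁)))

        in-ball : ∀ {h z y} → nrm f +ℕ nrm (f ⊗ h) ≤ D → nrm z ≤ nrm (f ⊗ h) +ℕ nrm (v y) → nrm f +ℕ nrm z ≤ D +ℕ E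
        in-ball {h} {z} {y} hD hz = begin
          nrm f +ℕ nrm z ≤⟨ ℕₚ.+-monoʳ-≤ (nrm f) hz ⟩
          nrm f +ℕ (nrm (f ⊗ h) +ℕ nrm (v y)) ≡⟨ ℕₚ.+-assoc (nrm f) _ _ ⟨
          nrm f +ℕ nrm (f ⊗ h) +ℕ nrm (v y) ≤⟨ ℕₚ.+-mono-≤ hD (v-short y) ⟩
          D +ℕ E ∎
          where open ℕₚ.≤-Reasoning

        Q-yes : ∀ {z h} → nrm f +ℕ nrm z ≤ D +ℕ E → Solves f z h → 1 ≤ Q (z , h)
        Q-yes {z} {h} a b = ℕₚ.≤-reflexive (sym (cong₂ _*ℕ_ (𝟙-yes (within? f (D +ℕ E) z) a) (𝟙-yes (solves? f z h) b)))

        pointwise : ∀ h y → 𝟙 (within? f D (f ⊗ h)) ≤ Q (φ₊ (h , y)) +ℕ Q (φ₋ (h , y))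
        pointwise h y = by (within? f D (f ⊗ h))
          where
          by : (d : Dec (nrm f +ℕ nrm (f ⊗ h) ≤ D)) → 𝟙 d ≤ Q (φ₊ (h , y)) +ℕ Q (φ₋ (h , y))
          by (no _) = z≤n
          by (yes hD) = [ (λ le → ℕₚ.≤-trans (Q-yes {f ⊗ h ⊕ v y} {h ⊕ k y} (in-ball {h} {f ⊗ h ⊕ v y} {y} hD le) (solves-shift h (v-ZS y) (k-ZS y))) (ℕₚ.m≤m+n _ _))
            , (λ le → ℕₚ.≤-trans (Q-yes {f ⊗ h ⊖ v y} {h ⊖ k y} (in-ball {h} {f ⊗ h ⊖ v y} {y} hD le) (solves-shift h (ZS-⊝ (v-ZS y)) (ZS-⊝ (k-ZS y)))) (ℕₚ.m≤n+m _ _)) ]′ (nrm-± (f ⊗ h) (v y))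

      -- For each sign the pairs (h, y) map injectively to (f h ± v y, h ± k y): the first component
      -- minus f times the second is ± ι y. With the right sign the image lies in the ball enlarged
      -- by E and satisfies `Solves`, whose solutions `count-solves` bounds. Both sides carry the
      -- factor |X₀|.
      multiples-count : ∑ (λ h → 𝟙 (within? f D (f ⊗ h))) ≤ 2 *ℕ ∑ (λ z → 𝟙 (within? f (D +ℕ E) z) *ℕ ω f z)
      multiples-count = ℕₚ.*-cancelʳ-≤ _ _ (card X₀) {{ℕ.>-nonZero card-X₀>0}} (begin
        ∑ (λ h → 𝟙 (within? f D (f ⊗ h))) *ℕ card X₀ ≡⟨ ∑-*ʳ (card X₀) _ ⟨
        ∑ (λ h → 𝟙 (within? f D (f ⊗ h)) *ℕ card X₀) ≡⟨ ∑-cong (λ h → trans (ℕₚ.*-comm _ (card X₀)) (sym (∑-const {X₀} (𝟙 (within? f D (f ⊗ h)))))) ⟩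
        ∑ (λ h → ∑ {X₀} (λ y → 𝟙 (within? f D (f ⊗ h)))) ≤⟨ ∑-mono (λ h → ∑-mono (λ y → pointwise h y)) ⟩
        ∑ (λ h → ∑ {X₀} (λ y → Q (φ₊ (h , y)) +ℕ Q (φ₋ (h , y)))) ≡⟨ ∑-× {X} {X₀} (λ u → Q (φ₊ u) +ℕ Q (φ₋ u)) ⟨
        ∑ (λ u → Q (φ₊ u) +ℕ Q (φ₋ u)) ≡⟨ ∑-+ (Q ∘ φ₊) (Q ∘ φ₋) ⟩
        ∑ (Q ∘ φ₊) +ℕ ∑ (Q ∘ φ₋) ≤⟨ ℕₚ.+-mono-≤ (∑-inj φ₊ Q inj₊) (∑-inj φ₋ Q inj₋) ⟩
        ∑ Q +ℕ ∑ Q ≡⟨ cong (∑ Q +ℕ_) (sym (ℕₚ.+-identityʳ (∑ Q))) ⟩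
        2 *ℕ ∑ Q ≤⟨ ℕₚ.*-monoʳ-≤ 2 ∑Q ⟩
        2 *ℕ (W *ℕ card X₀) ≡⟨ ℕₚ.*-assoc 2 W (card X₀) ⟨
        2 *ℕ W *ℕ card X₀ ∎)
        where
        open ℕₚ.≤-Reasoning
        W = ∑ (λ z → 𝟙 (within? f (D +ℕ E) z) *ℕ ω f z)
        ∑Q : ∑ Q ≤ W *ℕ card X₀
        ∑Q = begin
          ∑ Q ≡⟨ ∑-× {X} {X} Q ⟩
          ∑ (λ z → ∑ (λ h → Q (z , h))) ≡⟨ ∑-cong (λ z → ∑-* (𝟙 (within? f (D +ℕ E) z)) (λ h → 𝟙 (solves? f z h))) ⟩
          ∑ (λ z → 𝟙 (within? f (D +ℕ E) z) *ℕ ∑ (λ h → 𝟙 (solves? f z h))) ≤⟨ ∑-mono (λ z → ℕₚ.*-monoʳ-≤ (𝟙 (within? f (D +ℕ E) z)) (count-solves f z)) ⟩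
          ∑ (λ z → 𝟙 (within? f (D +ℕ E) z) *ℕ (card X₀ *ℕ ω f z)) ≡⟨ ∑-cong (λ z → lem (𝟙 (within? f (D +ℕ E) z)) (card X₀) (ω f z)) ⟩
          ∑ (λ z → 𝟙 (within? f (D +ℕ E) z) *ℕ ω f z *ℕ card X₀) ≡⟨ ∑-*ʳ (card X₀) _ ⟩
          W *ℕ card X₀ ∎
          where
          lem : ∀ a b c → a *ℕ (b *ℕ c) ≡ a *ℕ c *ℕ b
          lem = solveℕ-∀

-- Annihilators, units of the augmentation ideal, short multiples

module Annihilators where
  open FiniteCounting
  open PeriodicConvolution
  open CyclicPowers
  open CyclicDomain
  open Valuation
  open CountingMultiples
  import Data.Nat as ℕ
  import Data.Nat.Properties as ℕₚ
  import Data.Vec.Properties as Vecₚ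
  open import Data.Bool using (Bool)
  open import Data.Empty using (⊥-elim)
  open import Data.Fin using (Fin; zero; suc; toℕ)
  open import Data.Fin using (_↑ˡ_; _↑ʳ_)
  open import Data.Integer using (+_) renaming (_+_ to _+ᶻ_; _-_ to _-ᶻ_; -_ to -ᶻ_)
  open import Data.Nat using (ℕ; zero; suc; _<_; _≤_; z≤n; s≤s) renaming (_*_ to _*ℕ_; _^_ to _^ℕ_)
  open import Data.Nat.Primality using (Prime)
  open import Data.Product using (∃; _×_; _,_; proj₁; proj₂)
  open import Data.Sum using ([_,_]′)
  open import Data.Vec using (Vec; []; _∷_; lookup; tabulate)
  open import Data.Vec using (_++_; tail)
  open import Relation.Binary.PropositionalEquality using (_≡_; _≢_; refl; sym; trans; cong; cong₂; subst)
  open import Relation.Nullary using (¬_; Dec; yes; no; does; _×-dec_; ¬?)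

  *-pos₁ : ∀ a b → 0 < a *ℕ b → 0 < a
  *-pos₁ (suc a) b _ = s≤s z≤n

  *-pos₂ : ∀ a b → 0 < a *ℕ b → 0 < b
  *-pos₂ a zero h = subst (0 <_) (ℕₚ.*-zeroʳ a) h
  *-pos₂ a (suc b) _ = s≤s z≤n

  fibre-bound : ∀ {A B : Set} {{_ : Fintype A}} {{_ : Fintype B}} (φ : A → B) c →
    (∀ y → ∑ (λ x → 𝟙 (y ≟ φ x)) ≤ c) → card A ≤ card B *ℕ c
  fibre-bound {A} {B} φ c h = begin
    card A ≡⟨ ∑-cong (λ x → sym (∑-once (φ x))) ⟩
    ∑ (λ x → ∑ (λ y → 𝟙 (y ≟ φ x))) ≡⟨ ∑-swap _ ⟩
    ∑ (λ y → ∑ (λ x → 𝟙 (y ≟ φ x))) ≤⟨ ∑-mono h ⟩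
    ∑ {B} (λ _ → c) ≡⟨ ∑-const {B} c ⟩
    card B *ℕ c ∎
    where open ℕₚ.≤-Reasoning

  lookup-++⁺ : ∀ {A : Set} {Q : A → Set} {j k} (u : Vec A j) (v : Vec A k) →
    (∀ i → Q (lookup u i)) → (∀ i → Q (lookup v i)) → ∀ i → Q (lookup (u ++ v) i)
  lookup-++⁺ {Q = Q} [] v h g i = g i
  lookup-++⁺ {Q = Q} (x ∷ u) v h g zero = h zero
  lookup-++⁺ {Q = Q} (x ∷ u) v h g (suc i) = lookup-++⁺ {Q = Q} u v (λ i → h (suc i)) g i

  lookup-++⁻ : ∀ {A : Set} {Q : A → Set} {j k} (u : Vec A j) (v : Vec A k) →
    (∀ i → Q (lookup (u ++ v) i)) → (∀ i → Q (lookup u i)) × (∀ i → Q (lookup v i))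
  lookup-++⁻ {Q = Q} u v h = (λ i → subst Q (Vecₚ.lookup-++ˡ u v i) (h (i ↑ˡ _))) , (λ i → subst Q (Vecₚ.lookup-++ʳ u v i) (h (_ ↑ʳ i)))

  module Smoothing (q′ m : ℕ) (prq : Prime (suc q′)) (prp : Prime (suc m)) (q≢p : suc q′ ≢ suc m) where
    open Consequences q′ m prq prp q≢p public

    detect : ∀ {e k} {v : Vec X k} → Decomp e v → ∀ u → (∀ i → u ⊗ lookup v i ≡ 0X) → u ⊗ e ≡ 0X
    detect (leaf _ _ _ _) u h = h zero
    detect (node {e} {e₁} {e₂} {v₁ = v₁} {v₂} s d₁ d₂) u h = trans (cong (u ⊗_) (Split.sum≡ s)) (trans (XM.distribˡ u e₁ e₂)
      (trans (cong₂ _⊕_ (detect d₁ u (proj₁ parts)) (detect d₂ u (proj₂ parts))) (XM.+-identityˡ 0X)))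
      where parts = lookup-++⁻ {Q = λ x → u ⊗ x ≡ 0X} v₁ v₂ h

    leaves : ∀ {e k} {v : Vec X k} → Decomp e v → ∀ i → Fieldlike (lookup v i) × lookup v i ≢ 0X × ZS (lookup v i)
    leaves (leaf fl ne _ zs) zero = fl , ne , zs
    leaves (node {v₁ = v₁} {v₂} s d₁ d₂) = lookup-++⁺ {Q = λ x → Fieldlike x × x ≢ 0X × ZS x} v₁ v₂ (leaves d₁) (leaves d₂)

    size-bound : ∀ {e k} {v : Vec X k} → Decomp e v → P ^ℕ k ≤ size e
    size-bound (leaf {e} fl ne ee zs) = ℕₚ.≤-trans (ℕₚ.≤-reflexive (trans (ℕₚ.*-identityʳ P) (sym (card-Fin P))))
      (∑-inj-on (λ a → scale (+ toℕ a) e) (λ _ → 1) (λ x → 𝟙 (under? e x))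
        (λ a → ℕₚ.≤-reflexive (sym (𝟙-yes (under? e (scale (+ toℕ a) e)) (trans (sym (scale-⊗ (+ toℕ a) e e)) (cong (scale (+ toℕ a)) ee)))))
        (λ a b _ _ → scale-inj a b e ne))
    size-bound (node {k₁ = k₁} {k₂} s d₁ d₂) = ℕₚ.≤-trans (ℕₚ.≤-reflexive (ℕₚ.^-distribˡ-+-* P k₁ k₂)) (ℕₚ.≤-trans (ℕₚ.*-mono-≤ (size-bound d₁) (size-bound d₂)) (size-mul s))

    -- The identity element of the augmentation ideal: the idempotent that belongs to its generator
    -- λ.
    e⊤ : X
    e⊤ = λX ⊗ λX ^X N-2

    e⊤-λ : λX ⊗ e⊤ ≡ λX
    e⊤-λ = ^N-2 λX

    e⊤-idem : e⊤ ⊗ e⊤ ≡ e⊤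
    e⊤-idem = trans (XM.solve 2 (λ l k → (l XM.:* k) XM.:* (l XM.:* k) XM.:= (l XM.:* (l XM.:* k)) XM.:* k) refl λX (λX ^X N-2)) (cong (_⊗ (λX ^X N-2)) e⊤-λ)

    e⊤-ZS : ZS e⊤
    e⊤-ZS = ZS-⊗ˡ (λX ^X N-2) ZS-λ

    ⊗e⊤ : ∀ u → ZS u → u ⊗ e⊤ ≡ u
    ⊗e⊤ u zs = let (z , eq) = ZS⇒λ∣ u zs in trans (cong (_⊗ e⊤) eq) (trans (XM.solve 3 (λ l z e → (l XM.:* z) XM.:* e XM.:= (l XM.:* e) XM.:* z) refl λX z e⊤)
      (trans (cong (_⊗ z) e⊤-λ) (sym eq)))

    P≥2 : 2 ≤ P
    P≥2 = DomainPrime.q≥2 m prp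

    lam-at-1 : at lam (+ 1) ≡ + 1
    lam-at-1 = cong₂ (λ s t → ind0 s +ᶻ -ᶻ ind0 t) (rem-small {0} (s≤s z≤n)) (rem-small {1} q≥2)

    λX≢0 : λX ≢ 0X
    λX≢0 h = impossible (Cong-small (cong-trans (cong-≡ (sym lam-at-1)) (ap (F.≈trans (F.≈sym (emb-π lam)) (F.≈trans (emb-cong h) emb-0)) (+ 1))) P≥2)
      where
      impossible : ¬ (+ 1 ≡ + 0)
      impossible ()

    e⊤≢0 : e⊤ ≢ 0X
    e⊤≢0 h = λX≢0 (trans (sym e⊤-λ) (trans (cong (λX ⊗_) h) (XM.zeroʳ λX)))

    -- The minimal idempotents of X₀. Their number bounds both the number of annihilation patterns,
    -- by 2^q, and the number of exceptional τ for which a translate by τλ is a non-unit, by q.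
    record CompleteSystem : Set where
      field
        rank : ℕ
        rank≤q : rank ≤ q
        es : Vec X rank
        es-detect : ∀ u → ZS u → (∀ i → u ⊗ lookup es i ≡ 0X) → u ≡ 0X
        es-leaf : ∀ i → Fieldlike (lookup es i) × lookup es i ≢ 0X × ZS (lookup es i)

    opaque
      complete-system : CompleteSystem
      complete-system = by (decompose (size e⊤) e⊤ ℕₚ.≤-refl e⊤-idem e⊤≢0 e⊤-ZS)
        where
        by : (∃ λ k → ∃ λ (v : Vec X k) → Decomp e⊤ v) → CompleteSystem
        -- A direct sum of k nonzero ideals has at least P^k elements, while X has P^q.
        by (k , v , d) = record { rank = k ; es = v ; rank≤q = ℕₚ.≮⇒≥ (λ q<k → ℕₚ.<⇒≱ (ℕₚ.^-monoʳ-< P P≥2 q<k) Pk≤Pq)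
          ; es-detect = λ u zs h → trans (sym (⊗e⊤ u zs)) (detect d u h) ; es-leaf = leaves d }
          where
          Pk≤Pq : P ^ℕ k ≤ P ^ℕ q
          Pk≤Pq = ℕₚ.≤-trans (size-bound d) (ℕₚ.≤-trans (∑-mono (λ x → 𝟙≤1 (under? e⊤ x))) (ℕₚ.≤-reflexive (trans (card-Vec {Fin P} q) (cong (_^ℕ q) (card-Fin P)))))

    open CompleteSystem complete-system public

    kills? : ∀ f i → Dec (f ⊗ lookup es i ≡ 0X)
    kills? f i = f ⊗ lookup es i ≟ 0X

    NonUnit : X → Set
    NonUnit f = ∃ λ i → f ⊗ lookup es i ≡ 0X

    nonUnit? : ∀ f → Dec (NonUnit f)
    nonUnit? f = ∃? (kills? f)

    pattern-of : X → Vec Bool rank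
    pattern-of f = tabulate (λ i → does (kills? f i))

    -- At an idempotent killed by g there is nothing to show. At any other, f is invertible too, so
    -- f u = 0 makes that component of u vanish. Hence annihilators depend on patterns only.
    same-pattern : ∀ f g → pattern-of f ≡ pattern-of g → ∀ u → ZS u → f ⊗ u ≡ 0X → g ⊗ u ≡ 0X
    same-pattern f g pe u zs fu = es-detect (g ⊗ u) (ZS-⊗ g zs) (λ i → by i (kills? f i) (kills? g i) (doesEq i))
      where
      doesEq : ∀ i → does (kills? f i) ≡ does (kills? g i)
      doesEq i = trans (sym (Vecₚ.lookup∘tabulate _ i)) (trans (cong (λ t → lookup t i) pe) (Vecₚ.lookup∘tabulate _ i))
      by : ∀ i (d : Dec (f ⊗ lookup es i ≡ 0X)) (d₁ : Dec (g ⊗ lookup es i ≡ 0X)) → does d ≡ does d₁ → (g ⊗ u) ⊗ lookup es i ≡ 0X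
      by i _ (yes ge) _ = trans (XM.solve 3 (λ g u e → (g XM.:* u) XM.:* e XM.:= (g XM.:* e) XM.:* u) refl g u (lookup es i)) (trans (cong (_⊗ u) ge) (XM.zeroˡ u))
      by i (no fe) (no _) _ = [ (λ h → ⊥-elim (fe h)) , (λ { (h , eq) → trans (XM.*-assoc g u (lookup es i)) (trans (cong (g ⊗_) (trans (cong (u ⊗_) (sym eq))
        (trans (XM.solve 4 (λ u f h e → u XM.:* ((f XM.:* h) XM.:* e) XM.:= (f XM.:* u) XM.:* (h XM.:* e)) refl u f h (lookup es i)) (trans (cong (_⊗ (h ⊗ lookup es i)) fu) (XM.zeroˡ (h ⊗ lookup es i)))))) (XM.zeroʳ g)) }) ]′ (proj₁ (es-leaf i) f)

    -- Units of X₀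

    -- Let e₀ be the idempotent of f e⊤. Then f kills d = e⊤ - e₀, but f is invertible at every
    -- minimal idempotent, so d vanishes at each of them.
    unit-inverse : ∀ f → ¬ NonUnit f → ∃ λ g → f ⊗ g ⊗ e⊤ ≡ e⊤
    unit-inverse f nu = y ^X N-2 , trans (XM.solve 3 (λ f k e → (f XM.:* k) XM.:* e XM.:= (f XM.:* e) XM.:* k) refl f (y ^X N-2) e⊤) (sym (⊖≡0 d≡0))
      where
      y = f ⊗ e⊤
      e₀ = y ⊗ y ^X N-2
      d = e⊤ ⊖ e₀
      yd : y ⊗ d ≡ 0X
      yd = trans (XM.distribˡ y e⊤ (⊝ e₀)) (trans (cong₂ _⊕_ (trans (XM.*-assoc f e⊤ e⊤) (cong (f ⊗_) e⊤-idem)) (trans (XM.solve 2 (λ y e → y XM.:* (XM.:- e) XM.:= XM.:- (y XM.:* e)) refl y e₀) (cong ⊝_ (^N-2 y)))) (XM.-‿inverseʳ y))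
      d-ZS : ZS d
      d-ZS = ZS-⊕ e⊤-ZS (ZS-⊝ (ZS-⊗ˡ (y ^X N-2) (ZS-⊗ f e⊤-ZS)))
      fd : f ⊗ d ≡ 0X
      fd = trans (cong (f ⊗_) (sym (⊗e⊤ d d-ZS))) (trans (XM.solve 3 (λ f d e → f XM.:* (d XM.:* e) XM.:= (f XM.:* e) XM.:* d) refl f d e⊤) yd)
      d≡0 : d ≡ 0X
      d≡0 = es-detect d d-ZS (λ i → [ (λ h → ⊥-elim (nu (i , h))) , (λ { (g , eq) → trans (cong (d ⊗_) (sym eq))
        (trans (XM.solve 4 (λ d f g e → d XM.:* ((f XM.:* g) XM.:* e) XM.:= (f XM.:* d) XM.:* (g XM.:* e)) refl d f g (lookup es i)) (trans (cong (_⊗ (g ⊗ lookup es i)) fd) (XM.zeroˡ (g ⊗ lookup es i)))) }) ]′ (proj₁ (es-leaf i) f))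

    nrm-0 : nrm 0X ≡ 0
    nrm-0 = ℕₚ.n≤0⇒n≡0 (subst (λ x → nrm x ≤ 0) (trans (π-cong (F.≈sym emb-0)) (π-emb 0X)) (ℕₚ.≤-trans (nrm-π zeroP) (ℕₚ.≤-reflexive (trans (Σℕ-const q 0) (ℕₚ.*-zeroʳ q)))))

    -- For a unit f X₀ = X₀, so 0 represents the only class.
    unit-shortening : ∀ f → ¬ NonUnit f → Shortening f 0
    unit-shortening f nu = record { v = λ _ → 0X ; k = λ y → ⊝ (g ⊗ ι y) ; k-ZS = λ y → ZS-⊝ (ZS-⊗ g (ZS-ι y))
      ; v≡ = λ y → sym (trans (XM.solve 3 (λ i f g → i XM.:+ f XM.:* (XM.:- (g XM.:* i)) XM.:= i XM.:+ (XM.:- ((f XM.:* g) XM.:* i))) refl (ι y) f g)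
          (trans (cong (λ t → ι y ⊖ t) (inv (ι y) (ZS-ι y))) (XM.-‿inverseʳ (ι y)))) ; v-short = λ _ → ℕₚ.≤-reflexive nrm-0 }
      where
      g = proj₁ (unit-inverse f nu)
      inv : ∀ u → ZS u → f ⊗ g ⊗ u ≡ u
      inv u zs = trans (cong (f ⊗ g ⊗_) (sym (⊗e⊤ u zs))) (trans (XM.solve 4 (λ f g u e → (f XM.:* g) XM.:* (u XM.:* e) XM.:= ((f XM.:* g) XM.:* e) XM.:* u) refl f g u e⊤)
        (trans (cong (_⊗ u) (proj₂ (unit-inverse f nu))) (trans (XM.*-comm e⊤ u) (⊗e⊤ u zs))))

    -- Annihilators

    Ann : X → X₀ → Set
    Ann f u = f ⊗ ι u ≡ 0X

    ann? : ∀ f u → Dec (Ann f u)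
    ann? f u = f ⊗ ι u ≟ 0X

    annSize : X → ℕ
    annSize f = ∑ (λ u → 𝟙 (ann? f u))

    annSize-pattern : ∀ f g → pattern-of f ≡ pattern-of g → annSize f ≡ annSize g
    annSize-pattern f g e = ℕₚ.≤-antisym (∑-mono (λ u → 𝟙-mono (ann? f u) (ann? g u) (same-pattern f g e (ι u) (ZS-ι u))))
      (∑-mono (λ u → 𝟙-mono (ann? g u) (ann? f u) (same-pattern g f (sym e) (ι u) (ZS-ι u))))

    πbox : ∀ {M} → Vec (Fin (suc M)) q′ → X
    πbox z = π (box z)

    ⊟-emb : ∀ {a b x y} → emb x ≈[ + P ] a → emb y ≈[ + P ] b → emb (x ⊖ y) ≈[ + P ] a ⊟ b
    ⊟-emb {x = x} {y} h g = F.≈trans (emb-⊕ x (⊝ y)) (F.+-cong h (F.≈trans (emb-⊝ y) (F.-‿cong g)))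

    card-box : ∀ M → card (Vec (Fin (suc M)) q′) ≡ suc M ^ℕ q′
    card-box M = trans (card-Vec {Fin (suc M)} q′) (cong (_^ℕ q′) (card-Fin (suc M)))

    -- A short u ≠ u′ with f u = f u′ would make f (u - u′) vanish over ℤ, by size.
    annSize-upper : ∀ f M → λX ⊗ f ≢ 0X → ‖ emb f ‖ *ℕ M < P → annSize f *ℕ suc M ^ℕ q′ ≤ P *ℕ card X₀
    annSize-upper f M nc small = begin
      annSize f *ℕ suc M ^ℕ q′ ≡⟨ cong (annSize f *ℕ_) (sym (card-box M)) ⟩
      annSize f *ℕ card Box ≡⟨ ∑-*ʳ (card Box) _ ⟨
      ∑ (λ u → 𝟙 (ann? f u) *ℕ card Box) ≡⟨ ∑-cong (λ u → trans (ℕₚ.*-comm _ (card Box)) (sym (∑-const {Box} (𝟙 (ann? f u))))) ⟩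
      ∑ (λ u → ∑ {Box} (λ z → 𝟙 (ann? f u))) ≡⟨ ∑-× {X₀} {Box} (λ uz → 𝟙 (ann? f (proj₁ uz))) ⟨
      ∑ {X₀ × Box} (λ uz → 𝟙 (ann? f (proj₁ uz))) ≤⟨ ∑-inj-on φ _ (λ _ → 1) (λ uz → 𝟙≤1 (ann? f (proj₁ uz))) inj ⟩
      card X ≡⟨ card-X ⟩
      P *ℕ card X₀ ∎
      where
      open ℕₚ.≤-Reasoning
      Box = Vec (Fin (suc M)) q′
      φ : X₀ × Box → X
      φ (u , z) = πbox z ⊕ ι u
      lemma : ∀ u z u₁ z₁ → Ann f u → Ann f u₁ → φ (u , z) ≡ φ (u₁ , z₁) → z ≡ z₁
      lemma u z u₁ z₁ a a₁ e = box-inj z z₁ (no-zero-divisors (emb f) (box z ⊟ box z₁) nonconst zero′)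
        where
        fz : f ⊗ (πbox z ⊖ πbox z₁) ≡ 0X
        fz = trans (XM.solve 5 (λ f z z₁ u u₁ → f XM.:* (z XM.:+ (XM.:- z₁)) XM.:= (f XM.:* (z XM.:+ u) XM.:+ (XM.:- (f XM.:* (z₁ XM.:+ u₁)))) XM.:+ (XM.:- (f XM.:* u)) XM.:+ (f XM.:* u₁)) refl f (πbox z) (πbox z₁) (ι u) (ι u₁))
          (trans (cong₂ (λ s t → s ⊕ (⊝ (f ⊗ ι u)) ⊕ t) (trans (cong (λ t → f ⊗ t ⊖ f ⊗ φ (u₁ , z₁)) e) (XM.-‿inverseʳ (f ⊗ φ (u₁ , z₁)))) a₁)
          (trans (cong (λ t → 0X ⊕ (⊝ t) ⊕ 0X) a) (XM.solve 0 ((XM.con (+ 0) XM.:+ (XM.:- XM.con (+ 0)) XM.:+ XM.con (+ 0)) XM.:= XM.con (+ 0)) refl)))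
        modP : emb f ⋆ (box z ⊟ box z₁) ≈[ + P ] zeroP
        modP = F.≈trans (F.≈sym (F.≈trans (emb-⊗ f (πbox z ⊖ πbox z₁)) (F.*-congˡ {emb f} (⊟-emb (emb-π (box z)) (emb-π (box z₁)))))) (F.≈trans (emb-cong fz) emb-0)
        zero′ : emb f ⋆ (box z ⊟ box z₁) ≐ zeroP
        zero′ k = Cong-small (ap modP k) (ℕₚ.≤-<-trans (‖⋆‖ (emb f) (box z ⊟ box z₁) M (box-diff z z₁) k) small)
        nonconst : ¬ (lam ⋆ emb f ≐ zeroP)
        nonconst h = nc (emb-inj (F.≈trans (emb-⊗ λX f) (F.≈trans (F.*-congʳ {emb f} (emb-π lam)) (F.≈trans (≐⇒≈ {f = lam ⋆ emb f} {zeroP} h) (F.≈sym emb-0)))))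
      inj : ∀ (a b : X₀ × Box) → 0 < 𝟙 (ann? f (proj₁ a)) → 0 < 𝟙 (ann? f (proj₁ b)) → φ a ≡ φ b → a ≡ b
      inj (u , z) (u₁ , z₁) a b e = cong₂ _,_ (ι-inj (trans (sym (cancel (πbox z) (ι u))) (trans (cong₂ _⊖_ e (cong πbox z≡)) (cancel (πbox z₁) (ι u₁))))) z≡
        where
        z≡ = lemma u z u₁ z₁ (𝟙>0 (ann? f u) a) (𝟙>0 (ann? f u₁) b) e
        cancel : ∀ a b → a ⊕ b ⊖ a ≡ b
        cancel = XM.solve 2 (λ a b → a XM.:+ b XM.:+ (XM.:- a) XM.:= b) refl

    -- A short nonzero element of f X₀, by pigeonhole on λ z + f h.
    short-multiple : ∀ f M → annSize f < suc M ^ℕ q′ →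
      ∃ λ (z : Vec (Fin (suc M)) q′) → ∃ λ z₁ → ∃ λ h → z ≢ z₁ × ZS h × λX ⊗ (πbox z ⊖ πbox z₁) ≡ f ⊗ h
    short-multiple f M lt = by (∃? {Pair × Pair} (λ ab → ¬? (proj₁ (proj₁ ab) ≟ proj₁ (proj₂ ab)) ×-dec (φ (proj₁ ab) ≟ φ (proj₂ ab))))
      where
      Box = Vec (Fin (suc M)) q′
      Pair = Box × X₀
      val : Pair → X
      val (z , h) = λX ⊗ πbox z ⊕ f ⊗ ι h
      φ : Pair → X₀
      φ a = tail (val a)
      val-ZS : ∀ a → ZS (val a)
      val-ZS (z , h) = ZS-⊕ (ZS-⊗ˡ (πbox z) ZS-λ) (ZS-⊗ f (ZS-ι h))
      φ-val : ∀ a b → φ a ≡ φ b → val a ≡ val b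
      φ-val a b e = same-tail e (cong-trans (val-ZS a) (cong-sym (val-ZS b)))
      Conclusion = ∃ λ (z : Box) → ∃ λ z₁ → ∃ λ h → z ≢ z₁ × ZS h × λX ⊗ (πbox z ⊖ πbox z₁) ≡ f ⊗ h
      by : Dec (∃ λ ab → (proj₁ (proj₁ ab) ≢ proj₁ (proj₂ ab)) × φ (proj₁ ab) ≡ φ (proj₂ ab)) → Conclusion
      by (yes (((z , h) , (z₁ , h₁)) , ne , e)) = z , z₁ , (ι h₁ ⊖ ι h) , ne , ZS-⊕ (ZS-ι h₁) (ZS-⊝ (ZS-ι h)) ,
        trans (XM.solve 5 (λ l z z₁ fh fh₁ → l XM.:* (z XM.:+ (XM.:- z₁)) XM.:= ((l XM.:* z XM.:+ fh) XM.:+ (XM.:- (l XM.:* z₁ XM.:+ fh₁))) XM.:+ (fh₁ XM.:+ (XM.:- fh))) refl λX (πbox z) (πbox z₁) (f ⊗ ι h) (f ⊗ ι h₁))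
          (trans (cong (_⊕ (f ⊗ ι h₁ ⊖ f ⊗ ι h)) (trans (cong (_⊖ val (z₁ , h₁)) (φ-val (z , h) (z₁ , h₁) e)) (XM.-‿inverseʳ (val (z₁ , h₁)))))
          (trans (XM.+-identityˡ _) (XM.solve 3 (λ f a b → f XM.:* a XM.:+ (XM.:- (f XM.:* b)) XM.:= f XM.:* (a XM.:+ (XM.:- b))) refl f (ι h₁) (ι h))))
      by (no none) = ⊥-elim (ℕₚ.<⇒≱ (ℕₚ.*-monoʳ-< (card X₀) {{ℕ.>-nonZero card-X₀>0}} lt) (ℕₚ.≤-trans (ℕₚ.≤-reflexive (trans (ℕₚ.*-comm (card X₀) (suc M ^ℕ q′)) (trans (cong (_*ℕ card X₀) (sym (card-box M))) (sym (card-× {Box} {X₀}))))) (fibre-bound φ (annSize f) fib)))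
        where
        same-z : ∀ a b → φ a ≡ φ b → proj₁ a ≡ proj₁ b
        same-z a b e = dec (proj₁ a ≟ proj₁ b)
          where
          dec : Dec (proj₁ a ≡ proj₁ b) → proj₁ a ≡ proj₁ b
          dec (yes h) = h
          dec (no h) = ⊥-elim (none ((a , b) , h , e))
        -- If pairs with different z never collide, a fibre has a single z, and the differences of
        -- its h annihilate f.
        fib : ∀ y → ∑ (λ a → 𝟙 (y ≟ φ a)) ≤ annSize f
        fib y = dec (∃? (λ a → y ≟ φ a))
          where
          dec : Dec (∃ λ a → y ≡ φ a) → ∑ (λ a → 𝟙 (y ≟ φ a)) ≤ annSize f
          dec (no em) = ℕₚ.≤-trans (ℕₚ.≤-reflexive (trans (∑-cong (λ a → 𝟙-no (y ≟ φ a) (λ e → em (a , e)))) ∑-0)) z≤n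
          dec (yes (a₀ , e₀)) = count-inj (λ a → y ≟ φ a) (ann? f) (λ a → tail (ι (proj₂ a) ⊖ ι (proj₂ a₀))) good inj
            where
            ι-diff : ∀ h g → ι (tail (ι h ⊖ ι g)) ≡ ι h ⊖ ι g
            ι-diff h g = ι-tail (ι h ⊖ ι g) (ZS-⊕ (ZS-ι h) (ZS-⊝ (ZS-ι g)))
            good : ∀ a → y ≡ φ a → Ann f (tail (ι (proj₂ a) ⊖ ι (proj₂ a₀)))
            good (z , h) e = trans (cong (f ⊗_) (ι-diff h (proj₂ a₀))) (trans (XM.solve 5 (λ f a b l z → f XM.:* (a XM.:+ (XM.:- b)) XM.:= (l XM.:* z XM.:+ f XM.:* a) XM.:+ (XM.:- (l XM.:* z XM.:+ f XM.:* b))) refl f (ι h) (ι (proj₂ a₀)) λX (πbox z))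
              (trans (cong₂ _⊖_ (φ-val (z , h) a₀ (trans (sym e) e₀)) (cong (λ t → λX ⊗ πbox t ⊕ f ⊗ ι (proj₂ a₀)) (same-z (z , h) a₀ (trans (sym e) e₀)))) (XM.-‿inverseʳ (val a₀))))
            inj : ∀ a b → y ≡ φ a → y ≡ φ b → tail (ι (proj₂ a) ⊖ ι (proj₂ a₀)) ≡ tail (ι (proj₂ b) ⊖ ι (proj₂ a₀)) → a ≡ b
            inj (z , h) (z₁ , h₁) e e₁ t = cong₂ _,_ (same-z (z , h) (z₁ , h₁) (trans (sym e) e₁)) (ι-inj (trans (sym (cancel (ι h) (ι (proj₂ a₀)))) (trans (cong (_⊕ ι (proj₂ a₀))
              (trans (sym (ι-diff h (proj₂ a₀))) (trans (cong ι t) (ι-diff h₁ (proj₂ a₀))))) (cancel (ι h₁) (ι (proj₂ a₀))))))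
              where
              cancel : ∀ a b → a ⊖ b ⊕ b ≡ a
              cancel = XM.solve 2 (λ a b → a XM.:+ (XM.:- b) XM.:+ b XM.:= a) refl

-- Short representatives, and short vectors in an ideal

module Ideals where
  open FiniteCounting
  open CyclicDomain
  open FiniteGroupAlgebra
  open Annihilators
  import Data.Nat as ℕ
  import Data.Nat.Properties as ℕₚ
  open import Data.Fin using (Fin; suc)
  open import Data.Integer using (+_; ∣_∣) renaming (_-_ to _-ᶻ_; -_ to -ᶻ_)
  open import Data.Nat using (ℕ; suc; _<_; _≤_; _≤?_; z≤n) renaming (_+_ to _+ℕ_; _*_ to _*ℕ_; _^_ to _^ℕ_)
  open import Data.Nat.Divisibility using (_∣_)
  open import Data.Nat.Primality using (Prime)
  open import Data.Nat.Tactic.RingSolver using () renaming (solve-∀ to solveℕ-∀)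
  open import Data.Product using (∃; _×_; _,_; proj₁; proj₂)
  open import Data.Sum using ([_,_]′)
  open import Data.Vec using (Vec)
  open import Data.Vec using (tail)
  open import Relation.Binary.PropositionalEquality using (_≡_; _≢_; refl; sym; trans; cong; cong₂)
  open import Relation.Nullary using (¬_; Dec; yes; no; _×-dec_)

  module Representatives (q′ m : ℕ) (prq : Prime (suc q′)) (prp : Prime (suc m)) (q≢p : suc q′ ≢ suc m) where
    open Smoothing q′ m prq prp q≢p public

    lam-bound : ∀ d M → (∀ k → ∣ at d k ∣ ≤ M) → ‖ lam ⋆ d ‖ ≤ q *ℕ (2 *ℕ M)
    lam-bound d M h = ℕₚ.≤-trans (Σℕ-mono q (λ i _ → bound (+ i))) (ℕₚ.≤-reflexive (Σℕ-const q (2 *ℕ M)))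
      where
      bound : ∀ k → ∣ at (lam ⋆ d) k ∣ ≤ 2 *ℕ M
      bound k = ℕₚ.≤-trans (ℕₚ.≤-reflexive (cong ∣_∣ (lam⋆ d k))) (ℕₚ.≤-trans (∣i-j∣≤ (at d (k -ᶻ + 1)) (at d k))
        (ℕₚ.≤-trans (ℕₚ.+-mono-≤ (h (k -ᶻ + 1)) (h k)) (ℕₚ.≤-reflexive (cong (M +ℕ_) (sym (ℕₚ.+-identityʳ M))))))

    -- The squared norm of q entries of size 2 q M, the bound of `lam-bound` for ‖ λ d ‖ and hence
    -- for the rounding error.
    radius : ℕ → ℕ
    radius M = q *ℕ sq (q *ℕ (2 *ℕ M))

    -- The short multiple of f lifts to w = λ d over ℤ, nonzero because d is a difference of two
    -- distinct boxes. Rounding an exact lift of ι y by w changes it modulo P by an element of f X₀.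
    short-shortening : ∀ f M → annSize f < suc M ^ℕ q′ → Shortening f (radius M)
    short-shortening f M lt = build (short-multiple f M lt)
      where
      build : (∃ λ (z : Vec (Fin (suc M)) q′) → ∃ λ z₁ → ∃ λ h → z ≢ z₁ × ZS h × λX ⊗ (πbox z ⊖ πbox z₁) ≡ f ⊗ h) → Shortening f (radius M)
      build (z , z₁ , h , ne , zsh , eq) = record
        { v = λ y → π (rep y) ; k = λ y → ⊝ (h ⊗ π (κ y)) ; k-ZS = λ y → ZS-⊝ (ZS-⊗ˡ (π (κ y)) zsh)
        ; v≡ = λ y → trans (emb-inj (F.≈trans (emb-π (rep y)) (F.≈sym (⊟-emb (F.≈sym (proj₂ (proj₂ (lifted y))))
              (F.≈trans (emb-⊗ (f ⊗ h) (π (κ y))) (F.*-cong {emb (f ⊗ h)} {w} (F.≈sym w≈) (emb-π (κ y))))))))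
            (XM.solve 4 (λ i f h k → i XM.:+ (XM.:- ((f XM.:* h) XM.:* k)) XM.:= i XM.:+ f XM.:* (XM.:- (h XM.:* k))) refl (ι y) f h (π (κ y)))
        ; v-short = λ y → ℕₚ.≤-trans (nrm-π (rep y)) (ℕₚ.≤-trans (Σℕ-mono q (λ i _ → sq-mono (ℕₚ.≤-trans (proj₂ (rounded y) (+ i)) (lam-bound d M (box-diff z z₁))))) (ℕₚ.≤-reflexive (Σℕ-const q _))) }
        where
        d = box z ⊟ box z₁
        w = lam ⋆ d
        w≢0 : ¬ (w ≐ zeroP)
        w≢0 e = ne (box-inj z z₁ e)
        w≈ : w ≈[ + P ] emb (f ⊗ h)
        w≈ = F.≈trans (F.≈sym (F.≈trans (emb-⊗ λX (πbox z ⊖ πbox z₁)) (F.*-cong {emb λX} {lam} (emb-π lam) (⊟-emb (emb-π (box z)) (emb-π (box z₁)))))) (emb-cong eq)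
        lifted : ∀ y → ∃ λ t → σ t ≡ + 0 × t ≈[ + P ] emb (ι y)
        lifted y = exact-lift (ι y) (ZS-ι y)
        rounded : ∀ y → ∃ λ κ → ∀ j → ∣ at (proj₁ (lifted y) ⊟ (w ⋆ κ)) j ∣ ≤ ‖ w ‖
        rounded y = round w (proj₁ (lifted y)) (σ-lam⋆ d) w≢0 (proj₁ (proj₂ (lifted y)))
        κ : X₀ → Per
        κ y = proj₁ (rounded y)
        rep : X₀ → Per
        rep y = proj₁ (lifted y) ⊟ (w ⋆ κ y)

    ball? : ∀ D z → Dec (nrm z ≤ D)
    ball? D z = nrm z ≤? D

    ballX : ℕ → ℕ
    ballX D = ∑ (λ z → 𝟙 (ball? D z))

    module _ {f : X} {E : ℕ} (sh : Shortening f E) (D : ℕ) {K : X → Set} (K? : ∀ x → Dec (K x))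
             (K-ann : ∀ {x} → K x → ∀ u → Ann f u → Ann x u) where
      open Shortening sh
      private
        T = X × X₀ × X₀
        here? : ∀ x → Dec (K x × nrm x ≤ D)
        here? x = K? x ×-dec ball? D x
        target : X × X₀ → ℕ
        target (z , _) = 𝟙 (ball? (D +ℕ E) z)
        weight : T → ℕ
        weight (x , y , u) = 𝟙 (here? x) *ℕ 𝟙 (ann? f u)
        φ₊ φ₋ : T → X × X₀
        φ₊ (x , y , u) = x ⊕ v y , tail (ι y ⊕ ι u)
        φ₋ (x , y , u) = x ⊖ v y , tail (ι y ⊕ ι u)

        ι-sum : ∀ y u → ι (tail (ι y ⊕ ι u)) ≡ ι y ⊕ ι u
        ι-sum y u = ι-tail (ι y ⊕ ι u) (ZS-⊕ (ZS-ι y) (ZS-ι u))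

        kills-diff : ∀ {x u u₁} → K x → Ann f u → Ann f u₁ → (ι u ⊖ ι u₁) ⊗ x ≡ 0X
        kills-diff {x} {u} {u₁} kx a a₁ = trans (XM.solve 3 (λ a b x → (a XM.:+ (XM.:- b)) XM.:* x XM.:= (x XM.:* a) XM.:+ (XM.:- (x XM.:* b))) refl (ι u) (ι u₁) x)
          (trans (cong₂ _⊖_ (K-ann kx u a) (K-ann kx u₁ a₁)) (XM.-‿inverseʳ 0X))

        kills-f : ∀ {u u₁} → Ann f u → Ann f u₁ → (ι u ⊖ ι u₁) ⊗ f ≡ 0X
        kills-f {u} {u₁} a a₁ = trans (XM.solve 3 (λ a b x → (a XM.:+ (XM.:- b)) XM.:* x XM.:= (x XM.:* a) XM.:+ (XM.:- (x XM.:* b))) refl (ι u) (ι u₁) f)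
          (trans (cong₂ _⊖_ a a₁) (XM.-‿inverseʳ 0X))

        -- d = u - u₁ lies both in the annihilator and in the ideal it annihilates, so d² = 0.
        u≡ : ∀ {x x₁ u u₁ c} → K x → K x₁ → Ann f u → Ann f u₁ → ι u ⊖ ι u₁ ≡ x ⊖ x₁ ⊕ f ⊗ c → u ≡ u₁
        u≡ {x} {x₁} {u} {u₁} {c} kx kx₁ a a₁ e = ι-inj (⊖≡0 (reduced d (trans (cong (d ⊗_) e)
          (trans (XM.solve 5 (λ d x x₁ f c → d XM.:* (x XM.:+ (XM.:- x₁) XM.:+ f XM.:* c) XM.:= (d XM.:* x XM.:+ (XM.:- (d XM.:* x₁))) XM.:+ (d XM.:* f) XM.:* c) refl d x x₁ f c)
          (trans (cong₂ (λ s t → s ⊕ t ⊗ c) (trans (cong₂ _⊖_ (kills-diff kx a a₁) (kills-diff kx₁ a a₁)) (XM.-‿inverseʳ 0X)) (kills-f {u} {u₁} a a₁))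
          (trans (cong (0X ⊕_) (XM.zeroˡ c)) (XM.+-identityˡ 0X)))))))
          where d = ι u ⊖ ι u₁

        y≡ : ∀ {y u y₁ u₁} → u ≡ u₁ → tail (ι y ⊕ ι u) ≡ tail (ι y₁ ⊕ ι u₁) → y ≡ y₁
        y≡ {y} {u} {y₁} refl e = ι-inj (trans (sym (cancel (ι y) (ι u))) (trans (cong (_⊖ ι u) (trans (sym (ι-sum y u)) (trans (cong ι e) (ι-sum y₁ u)))) (cancel (ι y₁) (ι u))))
          where
          cancel : ∀ a b → a ⊕ b ⊖ b ≡ a
          cancel = XM.solve 2 (λ a b → a XM.:+ b XM.:+ (XM.:- b) XM.:= a) refl

        in-supp : ∀ x u n → 0 < 𝟙 (here? x) *ℕ 𝟙 (ann? f u) *ℕ n → K x × Ann f u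
        in-supp x u n h = proj₁ (𝟙>0 (here? x) (*-pos₁ _ (𝟙 (ann? f u)) (*-pos₁ _ n h))) , 𝟙>0 (ann? f u) (*-pos₂ (𝟙 (here? x)) _ (*-pos₁ _ n h))

        inj₊ : ∀ (a b : T) → 0 < weight a *ℕ target (φ₊ a) → 0 < weight b *ℕ target (φ₊ b) → φ₊ a ≡ φ₊ b → a ≡ b
        inj₊ (x , y , u) (x₁ , y₁ , u₁) h h₁ e = cong₂ _,_ x≡ (cong₂ _,_ yy uu)
          where
          s = in-supp x u _ h
          s₁ = in-supp x₁ u₁ _ h₁
          diff : ι u ⊖ ι u₁ ≡ x ⊖ x₁ ⊕ f ⊗ (k y ⊖ k y₁)
          diff = trans (XM.solve 9 (λ x x₁ i i₁ a b f c d → a XM.:+ (XM.:- b) XM.:= (x XM.:+ (XM.:- x₁) XM.:+ f XM.:* (c XM.:+ (XM.:- d))) XM.:+ ((i XM.:+ a) XM.:+ (XM.:- (i₁ XM.:+ b))) XM.:+ (XM.:- ((x XM.:+ (i XM.:+ f XM.:* c)) XM.:+ (XM.:- (x₁ XM.:+ (i₁ XM.:+ f XM.:* d))))))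
              refl x x₁ (ι y) (ι y₁) (ι u) (ι u₁) f (k y) (k y₁))
            (trans (cong₂ (λ s t → (x ⊖ x₁ ⊕ f ⊗ (k y ⊖ k y₁)) ⊕ s ⊕ (⊝ t))
              (trans (cong (_⊖ (ι y₁ ⊕ ι u₁)) (trans (sym (ι-sum y u)) (trans (cong ι (cong proj₂ e)) (ι-sum y₁ u₁)))) (XM.-‿inverseʳ (ι y₁ ⊕ ι u₁)))
              (trans (cong (_⊖ (x₁ ⊕ (ι y₁ ⊕ f ⊗ k y₁))) (trans (cong (x ⊕_) (sym (v≡ y))) (trans (cong proj₁ e) (cong (x₁ ⊕_) (v≡ y₁))))) (XM.-‿inverseʳ (x₁ ⊕ (ι y₁ ⊕ f ⊗ k y₁)))))
              (XM.solve 1 (λ t → t XM.:+ XM.con (+ 0) XM.:+ (XM.:- XM.con (+ 0)) XM.:= t) refl (x ⊖ x₁ ⊕ f ⊗ (k y ⊖ k y₁))))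
          uu = u≡ (proj₁ s) (proj₁ s₁) (proj₂ s) (proj₂ s₁) diff
          yy = y≡ {y} {u} {y₁} {u₁} uu (cong proj₂ e)
          x≡ : x ≡ x₁
          x≡ = trans (sym (cancel x (v y))) (trans (cong₂ _⊖_ (cong proj₁ e) (cong v yy)) (cancel x₁ (v y₁)))
            where
            cancel : ∀ a b → a ⊕ b ⊖ b ≡ a
            cancel = XM.solve 2 (λ a b → a XM.:+ b XM.:+ (XM.:- b) XM.:= a) refl

        inj₋ : ∀ (a b : T) → 0 < weight a *ℕ target (φ₋ a) → 0 < weight b *ℕ target (φ₋ b) → φ₋ a ≡ φ₋ b → a ≡ b
        inj₋ (x , y , u) (x₁ , y₁ , u₁) h h₁ e = cong₂ _,_ x≡ (cong₂ _,_ yy uu)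
          where
          s = in-supp x u _ h
          s₁ = in-supp x₁ u₁ _ h₁
          diff : ι u ⊖ ι u₁ ≡ x₁ ⊖ x ⊕ f ⊗ (k y ⊖ k y₁)
          diff = trans (XM.solve 9 (λ x x₁ i i₁ a b f c d → a XM.:+ (XM.:- b) XM.:= (x₁ XM.:+ (XM.:- x) XM.:+ f XM.:* (c XM.:+ (XM.:- d))) XM.:+ ((i XM.:+ a) XM.:+ (XM.:- (i₁ XM.:+ b))) XM.:+ ((x XM.:+ (XM.:- (i XM.:+ f XM.:* c))) XM.:+ (XM.:- (x₁ XM.:+ (XM.:- (i₁ XM.:+ f XM.:* d))))))
              refl x x₁ (ι y) (ι y₁) (ι u) (ι u₁) f (k y) (k y₁))
            (trans (cong₂ (λ s t → (x₁ ⊖ x ⊕ f ⊗ (k y ⊖ k y₁)) ⊕ s ⊕ t)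
              (trans (cong (_⊖ (ι y₁ ⊕ ι u₁)) (trans (sym (ι-sum y u)) (trans (cong ι (cong proj₂ e)) (ι-sum y₁ u₁)))) (XM.-‿inverseʳ (ι y₁ ⊕ ι u₁)))
              (trans (cong (_⊖ (x₁ ⊖ (ι y₁ ⊕ f ⊗ k y₁))) (trans (cong (x ⊖_) (sym (v≡ y))) (trans (cong proj₁ e) (cong (x₁ ⊖_) (v≡ y₁))))) (XM.-‿inverseʳ (x₁ ⊖ (ι y₁ ⊕ f ⊗ k y₁)))))
              (XM.solve 1 (λ t → t XM.:+ XM.con (+ 0) XM.:+ XM.con (+ 0) XM.:= t) refl (x₁ ⊖ x ⊕ f ⊗ (k y ⊖ k y₁))))
          uu = u≡ (proj₁ s₁) (proj₁ s) (proj₂ s) (proj₂ s₁) diff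
          yy = y≡ {y} {u} {y₁} {u₁} uu (cong proj₂ e)
          x≡ : x ≡ x₁
          x≡ = trans (sym (cancel x (v y))) (trans (cong₂ _⊕_ (cong proj₁ e) (cong v yy)) (cancel x₁ (v y₁)))
            where
            cancel : ∀ a b → a ⊖ b ⊕ b ≡ a
            cancel = XM.solve 2 (λ a b → a XM.:+ (XM.:- b) XM.:+ b XM.:= a) refl

        pointwise : ∀ (a : T) → weight a ≤ weight a *ℕ target (φ₊ a) +ℕ weight a *ℕ target (φ₋ a)
        pointwise a@(x , y , u) = by (here? x) refl
          where
          scaled : ∀ {n} → 1 ≤ n → weight a ≤ weight a *ℕ n
          scaled {n} h = ℕₚ.≤-trans (ℕₚ.≤-reflexive (sym (ℕₚ.*-identityʳ (weight a)))) (ℕₚ.*-monoʳ-≤ (weight a) h)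
          inside : ∀ {z} → nrm x ≤ D → nrm z ≤ nrm x +ℕ nrm (v y) → 1 ≤ 𝟙 (ball? (D +ℕ E) z)
          inside {z} hD hz = ℕₚ.≤-reflexive (sym (𝟙-yes (ball? (D +ℕ E) z) (ℕₚ.≤-trans hz (ℕₚ.+-mono-≤ hD (v-short y)))))
          by : (d : Dec (K x × nrm x ≤ D)) → here? x ≡ d → weight a ≤ weight a *ℕ target (φ₊ a) +ℕ weight a *ℕ target (φ₋ a)
          by (no _) eq = ℕₚ.≤-trans (ℕₚ.≤-reflexive (cong (λ d → 𝟙 d *ℕ 𝟙 (ann? f u)) eq)) z≤n
          by (yes (_ , hD)) _ = [ (λ le → ℕₚ.≤-trans (scaled (inside {x ⊕ v y} hD le)) (ℕₚ.m≤m+n _ _)) , (λ le → ℕₚ.≤-trans (scaled (inside {x ⊖ v y} hD le)) (ℕₚ.m≤n+m _ _)) ]′ (nrm-± x (v y))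

        bounded : ∀ (φ : T → X × X₀) → ∀ a → weight a *ℕ target (φ a) ≤ target (φ a)
        bounded φ (x , y , u) = ℕₚ.≤-trans (ℕₚ.*-monoˡ-≤ _ (ℕₚ.*-mono-≤ (𝟙≤1 (here? x)) (𝟙≤1 (ann? f u)))) (ℕₚ.≤-reflexive (ℕₚ.*-identityˡ _))

      -- The elements of K are killed by Ann f, and they should fill at most about 1 / |Ann f| of
      -- the ball. For each sign, triples (x, y, u) with u ∈ Ann f map injectively to (x ± v y, y +
      -- u): a collision puts the difference of the u both into Ann f and into the ideal generated
      -- by f and the two x, which Ann f kills.
      ideal-count : ∑ (λ x → 𝟙 (K? x ×-dec ball? D x)) *ℕ annSize f ≤ 2 *ℕ ballX (D +ℕ E)
      ideal-count = ℕₚ.*-cancelʳ-≤ _ _ (card X₀) {{ℕ.>-nonZero card-X₀>0}} (begin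
        ∑ (λ x → 𝟙 (here? x)) *ℕ annSize f *ℕ card X₀ ≡⟨ expand ⟩
        ∑ weight ≤⟨ ∑-mono pointwise ⟩
        ∑ (λ a → weight a *ℕ target (φ₊ a) +ℕ weight a *ℕ target (φ₋ a)) ≡⟨ ∑-+ _ _ ⟩
        ∑ (λ a → weight a *ℕ target (φ₊ a)) +ℕ ∑ (λ a → weight a *ℕ target (φ₋ a))
          ≤⟨ ℕₚ.+-mono-≤ (∑-inj-on φ₊ _ target (bounded φ₊) inj₊) (∑-inj-on φ₋ _ target (bounded φ₋) inj₋) ⟩
        ∑ target +ℕ ∑ target ≡⟨ cong (λ t → t +ℕ t) ∑target ⟩
        ballX (D +ℕ E) *ℕ card X₀ +ℕ ballX (D +ℕ E) *ℕ card X₀ ≡⟨ lem (ballX (D +ℕ E)) (card X₀) ⟩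
        2 *ℕ ballX (D +ℕ E) *ℕ card X₀ ∎)
        where
        open ℕₚ.≤-Reasoning
        lem : ∀ a b → a *ℕ b +ℕ a *ℕ b ≡ 2 *ℕ a *ℕ b
        lem = solveℕ-∀
        ∑target : ∑ target ≡ ballX (D +ℕ E) *ℕ card X₀
        ∑target = trans (∑-× {X} {X₀} target) (trans (∑-cong (λ z → trans (∑-const {X₀} (𝟙 (ball? (D +ℕ E) z))) (ℕₚ.*-comm (card X₀) _))) (∑-*ʳ (card X₀) _))
        expand : ∑ (λ x → 𝟙 (here? x)) *ℕ annSize f *ℕ card X₀ ≡ ∑ weight
        expand = trans (ℕₚ.*-assoc (∑ (λ x → 𝟙 (here? x))) (annSize f) (card X₀)) (trans (sym (∑-*ʳ (annSize f *ℕ card X₀) _))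
          (trans (∑-cong (λ x → trans (cong (𝟙 (here? x) *ℕ_) (ℕₚ.*-comm (annSize f) (card X₀))) (sym (row x)))) (sym (∑-× {X} {X₀ × X₀} weight))))
          where
          row : ∀ x → ∑ {X₀ × X₀} (λ yu → weight (x , yu)) ≡ 𝟙 (here? x) *ℕ (card X₀ *ℕ annSize f)
          row x = trans (∑-× {X₀} {X₀} (λ yu → weight (x , yu))) (trans (∑-cong {X₀} (λ y → ∑-* (𝟙 (here? x)) (λ u → 𝟙 (ann? f u))))
            (trans (∑-const {X₀} (𝟙 (here? x) *ℕ annSize f)) (lem₂ (card X₀) (𝟙 (here? x)) (annSize f))))
            where
            lem₂ : ∀ a b c → a *ℕ (b *ℕ c) ≡ b *ℕ (a *ℕ c)
            lem₂ = solveℕ-∀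

-- Lattice points in balls and discs

module LatticePoints where
  open FiniteCounting
  open CyclicDomain
  open Multiples
  open FiniteGroupAlgebra
  import Data.Fin.Properties as Finₚ
  import Data.Integer as ℤ
  import Data.Integer.Properties as ℤₚ
  import Data.Nat as ℕ
  import Data.Nat.DivMod as DM
  import Data.Nat.Properties as ℕₚ
  import Data.Vec.Properties as Vecₚ
  open import Data.Bool using (true; false)
  open import Data.Empty using (⊥-elim)
  open import Data.Fin using (Fin; zero; suc; toℕ)
  open import Data.Integer using (ℤ; +_; -[1+_]; ∣_∣)
  open import Data.Nat using (ℕ; zero; suc; _∸_; _<_; _≤_; _≤?_; _<?_; z≤n; s≤s) renaming (_+_ to _+ℕ_; _*_ to _*ℕ_; _^_ to _^ℕ_)
  open import Data.Nat.Divisibility using (_∣_; divides)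
  open import Data.Nat.Tactic.RingSolver using () renaming (solve-∀ to solveℕ-∀)
  open import Data.Product using (∃; _×_; _,_; proj₁; proj₂)
  open import Data.Sum using (_⊎_; inj₁; inj₂; [_,_]′)
  open import Data.Vec using (Vec; []; _∷_; lookup)
  open import Data.Vec using (_++_; _[_]≔_)
  open import Defs
  open import Function using (_∘_)
  open import Relation.Binary.PropositionalEquality using (_≡_; refl; sym; trans; cong; cong₂; subst; module ≡-Reasoning)
  open import Relation.Nullary using (¬_; Dec; yes; no)

  Σℕ-split : ∀ a b g → Σℕ (a +ℕ b) g ≡ Σℕ a g +ℕ Σℕ b (λ i → g (a +ℕ i))
  Σℕ-split a zero g = trans (cong (λ t → Σℕ t g) (ℕₚ.+-identityʳ a)) (sym (ℕₚ.+-identityʳ (Σℕ a g)))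
  Σℕ-split a (suc b) g = trans (cong (λ t → Σℕ t g) (ℕₚ.+-suc a b)) (trans (cong (_+ℕ g (a +ℕ b)) (Σℕ-split a b g)) (ℕₚ.+-assoc (Σℕ a g) _ _))

  Σℕ-mono-len : ∀ {a b} g → a ≤ b → Σℕ a g ≤ Σℕ b g
  Σℕ-mono-len {a} {b} g a≤b = subst (λ t → Σℕ a g ≤ Σℕ t g) (ℕₚ.m+[n∸m]≡n a≤b) (subst (Σℕ a g ≤_) (sym (Σℕ-split a (b ∸ a) g)) (ℕₚ.m≤m+n _ _))

  ∑-Σℕ : ∀ n (g : ℕ → ℕ) → ∑ {Fin n} (λ a → g (toℕ a)) ≡ Σℕ n g
  ∑-Σℕ zero g = ∑-∅
  ∑-Σℕ (suc n) g = trans (∑-Fin {n} (λ a → g (toℕ a))) (trans (cong (g 0 +ℕ_) (∑-Σℕ n (g ∘ suc))) (sym (Σℕ-front n g)))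

  Σℕ-rev : ∀ n (g : ℕ → ℕ) → Σℕ n (λ i → g (n ∸ i)) ≡ Σℕ n (λ i → g (suc i))
  Σℕ-rev zero g = refl
  Σℕ-rev (suc n) g = trans (Σℕ-front n (λ i → g (suc n ∸ i))) (trans (cong (g (suc n) +ℕ_) (Σℕ-rev n g)) (ℕₚ.+-comm (g (suc n)) _))

  -- The weight 2^(-j) scaled by 2^s, and cut off to 0 where it would drop below 1.
  geo : ℕ → ℕ → ℕ
  geo s j = 𝟙 (j ≤? s) *ℕ 2 ^ℕ (s ∸ j)

  geo-suc : ∀ s j → geo (suc s) (suc j) ≡ geo s j
  geo-suc s j = cong (_*ℕ 2 ^ℕ (s ∸ j)) (ℕₚ.≤-antisym (𝟙-mono (suc j ≤? suc s) (j ≤? s) ℕₚ.≤-pred) (𝟙-mono (j ≤? s) (suc j ≤? suc s) s≤s))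

  geo-sum : ∀ s J → Σℕ J (geo s) ≤ 2 *ℕ 2 ^ℕ s
  geo-sum s zero = z≤n
  geo-sum zero (suc J) = ℕₚ.≤-trans (ℕₚ.≤-reflexive (trans (Σℕ-front J (geo 0)) (cong (1 +ℕ_) (trans (Σℕ-cong J (λ j _ → refl)) (trans (Σℕ-const J 0) (ℕₚ.*-zeroʳ J)))))) (s≤s z≤n)
  geo-sum (suc s) (suc J) = begin
    Σℕ (suc J) (geo (suc s)) ≡⟨ Σℕ-front J (geo (suc s)) ⟩
    geo (suc s) 0 +ℕ Σℕ J (λ j → geo (suc s) (suc j)) ≡⟨ cong₂ _+ℕ_ (ℕₚ.*-identityˡ (2 ^ℕ suc s)) (Σℕ-cong J (λ j _ → geo-suc s j)) ⟩
    2 ^ℕ suc s +ℕ Σℕ J (geo s) ≤⟨ ℕₚ.+-monoʳ-≤ (2 ^ℕ suc s) (geo-sum s J) ⟩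
    2 ^ℕ suc s +ℕ 2 ^ℕ suc s ≡⟨ cong (2 ^ℕ suc s +ℕ_) (sym (ℕₚ.+-identityʳ (2 ^ℕ suc s))) ⟩
    2 *ℕ 2 ^ℕ suc s ∎
    where open ℕₚ.≤-Reasoning

  geo-blocks : ∀ s μ J → Σℕ (J *ℕ suc μ) (λ b → geo s (b DM./ suc μ)) ≡ suc μ *ℕ Σℕ J (geo s)
  geo-blocks s μ zero = sym (ℕₚ.*-zeroʳ (suc μ))
  geo-blocks s μ (suc J) = begin
    Σℕ (suc μ +ℕ J *ℕ suc μ) G ≡⟨ cong (λ t → Σℕ t G) (ℕₚ.+-comm (suc μ) (J *ℕ suc μ)) ⟩
    Σℕ (J *ℕ suc μ +ℕ suc μ) G ≡⟨ Σℕ-split (J *ℕ suc μ) (suc μ) G ⟩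
    Σℕ (J *ℕ suc μ) G +ℕ Σℕ (suc μ) (λ i → G (J *ℕ suc μ +ℕ i)) ≡⟨ cong₂ _+ℕ_ (geo-blocks s μ J) (trans (Σℕ-cong (suc μ) (λ i i<μ → cong (geo s) (quot i i<μ))) (Σℕ-const (suc μ) (geo s J))) ⟩
    suc μ *ℕ Σℕ J (geo s) +ℕ suc μ *ℕ geo s J ≡⟨ ℕₚ.*-distribˡ-+ (suc μ) (Σℕ J (geo s)) (geo s J) ⟨
    suc μ *ℕ Σℕ (suc J) (geo s) ∎
    where
    open ≡-Reasoning
    G : ℕ → ℕ
    G b = geo s (b DM./ suc μ)
    quot : ∀ i → i < suc μ → (J *ℕ suc μ +ℕ i) DM./ suc μ ≡ J
    quot i i<μ = trans (DM.+-distrib-/-∣ˡ {J *ℕ suc μ} i (divides J refl)) (trans (cong₂ _+ℕ_ (DM.m*n/n≡m J (suc μ)) (DM.m<n⇒m/n≡0 i<μ)) (ℕₚ.+-identityʳ J))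

  vsum-update : ∀ {A : Set} {n} (g : A → ℕ) (x : Vec A n) i b → vsum g (x [ i ]≔ b) +ℕ g (lookup x i) ≡ vsum g x +ℕ g b
  vsum-update g (a ∷ x) zero b = lem (g b) (vsum g x) (g a)
    where
    lem : ∀ b x a → b +ℕ x +ℕ a ≡ a +ℕ x +ℕ b
    lem = solveℕ-∀
  vsum-update g (a ∷ x) (suc i) b = trans (ℕₚ.+-assoc (g a) _ _) (trans (cong (g a +ℕ_) (vsum-update g x i b)) (sym (ℕₚ.+-assoc (g a) _ _)))

  update-inj : ∀ {A : Set} {n} (x y : Vec A n) i {a b} → x [ i ]≔ a ≡ y [ i ]≔ b → lookup x i ≡ lookup y i → x ≡ y
  update-inj x y i {a} {b} e h = trans (restore x a) (trans (cong₂ (λ u c → u [ i ]≔ c) e h) (sym (restore y b)))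
    where
    restore : ∀ x c → x ≡ (x [ i ]≔ c) [ i ]≔ lookup x i
    restore x c = sym (trans (Vecₚ.[]≔-idempotent x i) (Vecₚ.[]≔-lookup x i))

  vsum-++ : ∀ {A : Set} {j k} (g : A → ℕ) (u : Vec A j) (v : Vec A k) → vsum g (u ++ v) ≡ vsum g u +ℕ vsum g v
  vsum-++ g [] v = refl
  vsum-++ g (a ∷ u) v = trans (cong (g a +ℕ_) (vsum-++ g u v)) (sym (ℕₚ.+-assoc (g a) _ _))

  ∑-++ : ∀ {A : Set} {{_ : Fintype A}} j {k} (F : Vec A (j +ℕ k) → ℕ) → ∑ F ≡ ∑ (λ (u : Vec A j) → ∑ (λ (v : Vec A k) → F (u ++ v)))
  ∑-++ {A} zero {k} F = sym (∑-[] {A} (λ u → ∑ (λ (v : Vec A k) → F (u ++ v))))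
  ∑-++ {A} (suc j) {k} F = trans (∑-Vec {A} F) (trans (∑-cong {A} (λ a → ∑-++ j (λ w → F (a ∷ w)))) (sym (∑-Vec {A} {n = j} (λ u → ∑ (λ (v : Vec A k) → F (u ++ v))))))

  vsum-mono : ∀ {A : Set} {n} {g h : A → ℕ} → (∀ a → g a ≤ h a) → (x : Vec A n) → vsum g x ≤ vsum h x
  vsum-mono le [] = z≤n
  vsum-mono le (a ∷ x) = ℕₚ.+-mono-≤ (le a) (vsum-mono le x)

  vsum-*ʳ : ∀ {A : Set} {n} (g : A → ℕ) c (x : Vec A n) → vsum (λ a → g a *ℕ c) x ≡ vsum g x *ℕ c
  vsum-*ʳ g c [] = refl
  vsum-*ʳ g c (a ∷ x) = trans (cong (g a *ℕ c +ℕ_) (vsum-*ʳ g c x)) (sym (ℕₚ.*-distribʳ-+ c (g a) (vsum g x)))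

  vsum-bounded : ∀ {A : Set} {n} (g : A → ℕ) c (x : Vec A n) → (∀ i → g (lookup x i) ≤ c) → vsum g x ≤ n *ℕ c
  vsum-bounded g c [] h = z≤n
  vsum-bounded g c (a ∷ x) h = ℕₚ.+-mono-≤ (h zero) (vsum-bounded g c x (λ i → h (suc i)))

  vsum-∑ : ∀ {A : Set} {n} (g : A → ℕ) (x : Vec A n) → vsum g x ≡ ∑ (λ i → g (lookup x i))
  vsum-∑ g [] = sym ∑-∅
  vsum-∑ {n = suc n} g (a ∷ x) = trans (cong (g a +ℕ_) (vsum-∑ g x)) (sym (∑-Fin {n} (λ i → g (lookup (a ∷ x) i))))

  module Balls (m : ℕ) where
    open Centred m public
    P : ℕ
    P = suc m

    nrmV : ∀ {n} → Vec (Fin P) n → ℕ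
    nrmV = vsum (λ a → sq (abs a))

    module _ (μ : ℕ) where
      levels : ∀ {n} → Vec (Fin P) n → ℕ
      levels = vsum (λ a → abs a DM./ suc μ)

      geo-abs : ∀ s → ∑ {Fin P} (λ a → geo s (abs a DM./ suc μ)) ≤ 4 *ℕ suc μ *ℕ 2 ^ℕ s
      geo-abs s = begin
        ∑ {Fin P} (λ a → G (abs a)) ≤⟨ ∑-mono (λ a → split a) ⟩
        ∑ {Fin P} (λ a → G (toℕ a) +ℕ G (P ∸ toℕ a)) ≡⟨ ∑-+ _ _ ⟩
        ∑ {Fin P} (λ a → G (toℕ a)) +ℕ ∑ {Fin P} (λ a → G (P ∸ toℕ a)) ≡⟨ cong₂ _+ℕ_ (∑-Σℕ P G) (trans (∑-Σℕ P (λ i → G (P ∸ i))) (Σℕ-rev P G)) ⟩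
        Σℕ P G +ℕ Σℕ P (G ∘ suc) ≤⟨ ℕₚ.+-mono-≤ (long P) (ℕₚ.≤-trans (ℕₚ.m≤n+m _ (G 0)) (ℕₚ.≤-trans (ℕₚ.≤-reflexive (sym (Σℕ-front P G))) (long (suc P)))) ⟩
        suc μ *ℕ (2 *ℕ 2 ^ℕ s) +ℕ suc μ *ℕ (2 *ℕ 2 ^ℕ s) ≡⟨ lem (suc μ) (2 ^ℕ s) ⟩
        4 *ℕ suc μ *ℕ 2 ^ℕ s ∎
        where
        open ℕₚ.≤-Reasoning
        G : ℕ → ℕ
        G b = geo s (b DM./ suc μ)
        lem : ∀ a b → a *ℕ (2 *ℕ b) +ℕ a *ℕ (2 *ℕ b) ≡ 4 *ℕ a *ℕ b
        lem = solveℕ-∀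
        long : ∀ L → Σℕ L G ≤ suc μ *ℕ (2 *ℕ 2 ^ℕ s)
        long L = ℕₚ.≤-trans (Σℕ-mono-len G (ℕₚ.m≤m*n L (suc μ))) (ℕₚ.≤-trans (ℕₚ.≤-reflexive (geo-blocks s μ L)) (ℕₚ.*-monoʳ-≤ (suc μ) (geo-sum s L)))
        lift-case : ∀ a → abs a ≡ toℕ a ⊎ abs a ≡ P ∸ toℕ a
        lift-case a with toℕ a ℕ.≤ᵇ (m DM./ 2)
        ... | true = inj₁ refl
        ... | false = inj₂ (trans (cong ∣_∣ (ℤₚ.[+m]-[+n]≡m⊖n (toℕ a) P)) (ℤₚ.∣⊖∣-≤ (ℕₚ.<⇒≤ (Finₚ.toℕ<n a))))
        split : ∀ a → G (abs a) ≤ G (toℕ a) +ℕ G (P ∸ toℕ a)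
        split a = [ (λ e → subst (λ t → G t ≤ G (toℕ a) +ℕ G (P ∸ toℕ a)) (sym e) (ℕₚ.m≤m+n _ _)) , (λ e → subst (λ t → G t ≤ G (toℕ a) +ℕ G (P ∸ toℕ a)) (sym e) (ℕₚ.m≤n+m _ _)) ]′ (lift-case a)

      -- A generating function evaluated at 1/2: the weights 2^(-level) of a single coordinate add
      -- up to at most 4 (μ + 1), and every vector counted has weight at least 2^(-s).
      levels-count : ∀ n s → ∑ {Vec (Fin P) n} (λ x → 𝟙 (levels x ≤? s)) ≤ 2 ^ℕ s *ℕ (4 *ℕ suc μ) ^ℕ n
      levels-count zero s = ℕₚ.≤-trans (ℕₚ.≤-reflexive (∑-[] {Fin P} (λ x → 𝟙 (levels x ≤? s)))) (ℕₚ.≤-trans (ℕₚ.m^n>0 2 s) (ℕₚ.≤-reflexive (sym (ℕₚ.*-identityʳ (2 ^ℕ s)))))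
      levels-count (suc n) s = begin
        ∑ {Vec (Fin P) (suc n)} (λ x → 𝟙 (levels x ≤? s)) ≡⟨ ∑-Vec {Fin P} {n = n} _ ⟩
        ∑ {Fin P} (λ a → ∑ {Vec (Fin P) n} (λ x → 𝟙 (ℓ a +ℕ levels x ≤? s))) ≤⟨ ∑-mono row ⟩
        ∑ {Fin P} (λ a → geo s (ℓ a) *ℕ (4 *ℕ suc μ) ^ℕ n) ≡⟨ ∑-*ʳ _ _ ⟩
        ∑ {Fin P} (λ a → geo s (ℓ a)) *ℕ (4 *ℕ suc μ) ^ℕ n ≤⟨ ℕₚ.*-monoˡ-≤ _ (geo-abs s) ⟩
        4 *ℕ suc μ *ℕ 2 ^ℕ s *ℕ (4 *ℕ suc μ) ^ℕ n ≡⟨ lem (4 *ℕ suc μ) (2 ^ℕ s) _ ⟩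
        2 ^ℕ s *ℕ (4 *ℕ suc μ) ^ℕ suc n ∎
        where
        open ℕₚ.≤-Reasoning
        ℓ : Fin P → ℕ
        ℓ a = abs a DM./ suc μ
        lem : ∀ a b c → a *ℕ b *ℕ c ≡ b *ℕ (a *ℕ c)
        lem = solveℕ-∀
        row : ∀ a → ∑ {Vec (Fin P) n} (λ x → 𝟙 (ℓ a +ℕ levels x ≤? s)) ≤ geo s (ℓ a) *ℕ (4 *ℕ suc μ) ^ℕ n
        row a = by (ℓ a ≤? s) refl
          where
          by : (d : Dec (ℓ a ≤ s)) → (ℓ a ≤? s) ≡ d → ∑ {Vec (Fin P) n} (λ x → 𝟙 (ℓ a +ℕ levels x ≤? s)) ≤ geo s (ℓ a) *ℕ (4 *ℕ suc μ) ^ℕ n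
          by (yes h) eq = ℕₚ.≤-trans (∑-mono (λ x → 𝟙-mono (ℓ a +ℕ levels x ≤? s) (levels x ≤? s ∸ ℓ a) (λ le → ℕₚ.m+n≤o⇒m≤o∸n (levels x) (subst (_≤ s) (ℕₚ.+-comm (ℓ a) (levels x)) le))))
            (ℕₚ.≤-trans (levels-count n (s ∸ ℓ a)) (ℕₚ.≤-reflexive (cong (_*ℕ (4 *ℕ suc μ) ^ℕ n) (sym (trans (cong (λ d → 𝟙 d *ℕ 2 ^ℕ (s ∸ ℓ a)) eq) (ℕₚ.*-identityˡ (2 ^ℕ (s ∸ ℓ a))))))))
          by (no h) eq = ℕₚ.≤-trans (ℕₚ.≤-reflexive (trans (∑-cong (λ x → 𝟙-no (ℓ a +ℕ levels x ≤? s) (λ le → h (ℕₚ.≤-trans (ℕₚ.m≤m+n (ℓ a) _) le)))) ∑-0)) z≤n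

      -- For an entry b of level j: j (μ + 1)² ≤ (j (μ + 1))² ≤ b².
      levels≤nrm : ∀ {n} (x : Vec (Fin P) n) → levels x *ℕ sq (suc μ) ≤ nrmV x
      levels≤nrm x = ℕₚ.≤-trans (ℕₚ.≤-reflexive (sym (vsum-*ʳ _ (sq (suc μ)) x))) (vsum-mono (λ a → pt (abs a)) x)
        where
        pt : ∀ b → (b DM./ suc μ) *ℕ sq (suc μ) ≤ sq b
        pt b = begin
          j *ℕ (suc μ *ℕ suc μ) ≡⟨ ℕₚ.*-assoc j (suc μ) (suc μ) ⟨
          j *ℕ suc μ *ℕ suc μ ≤⟨ ℕₚ.*-monoʳ-≤ (j *ℕ suc μ) (up j) ⟩
          j *ℕ suc μ *ℕ (suc μ *ℕ 1) ≤⟨ fin j (DM.m/n*n≤m b (suc μ)) ⟩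
          b *ℕ b ∎
          where
          open ℕₚ.≤-Reasoning
          j = b DM./ suc μ
          up : ∀ j → suc μ ≤ suc μ *ℕ 1
          up j = ℕₚ.≤-reflexive (sym (ℕₚ.*-identityʳ (suc μ)))
          fin : ∀ j → j *ℕ suc μ ≤ b → j *ℕ suc μ *ℕ (suc μ *ℕ 1) ≤ b *ℕ b
          fin zero h = z≤n
          fin (suc j) h = ℕₚ.*-mono-≤ h (ℕₚ.≤-trans (ℕₚ.≤-reflexive (ℕₚ.*-identityʳ (suc μ))) (ℕₚ.≤-trans (ℕₚ.m≤m+n (suc μ) (j *ℕ suc μ)) h))

      levels≤sum : ∀ {n} (x : Vec (Fin P) n) → levels x *ℕ suc μ ≤ vsum abs x
      levels≤sum x = ℕₚ.≤-trans (ℕₚ.≤-reflexive (sym (vsum-*ʳ _ (suc μ) x))) (vsum-mono (λ a → DM.m/n*n≤m (abs a) (suc μ)) x)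

      -- Vectors of this ball have total level at most n, so `levels-count` applies with s = n and 8
      -- = 2 · 4. The crude constant is absorbed by the choice of the scales.
      ball-count : ∀ n D → D ≤ n *ℕ sq (suc μ) → ∑ {Vec (Fin P) n} (λ x → 𝟙 (nrmV x ≤? D)) ≤ (8 *ℕ suc μ) ^ℕ n
      ball-count n D h = begin
        ∑ {Vec (Fin P) n} (λ x → 𝟙 (nrmV x ≤? D)) ≤⟨ ∑-mono (λ x → 𝟙-mono (nrmV x ≤? D) (levels x ≤? n) (λ le → ℕₚ.*-cancelʳ-≤ (levels x) n (sq (suc μ)) (ℕₚ.≤-trans (levels≤nrm x) (ℕₚ.≤-trans le h)))) ⟩
        ∑ {Vec (Fin P) n} (λ x → 𝟙 (levels x ≤? n)) ≤⟨ levels-count n n ⟩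
        2 ^ℕ n *ℕ (4 *ℕ suc μ) ^ℕ n ≡⟨ ^-*-distrib 2 (4 *ℕ suc μ) n ⟨
        (2 *ℕ (4 *ℕ suc μ)) ^ℕ n ≡⟨ cong (_^ℕ n) (lem (suc μ)) ⟩
        (8 *ℕ suc μ) ^ℕ n ∎
        where
        open ℕₚ.≤-Reasoning
        lem : ∀ a → 2 *ℕ (4 *ℕ a) ≡ 8 *ℕ a
        lem = solveℕ-∀

    -- Moving one large coordinate towards 0 by s lowers the squared norm by at least s².

    shrinkℤ : ℕ → ℤ → ℤ
    shrinkℤ s (+ n) = + (n ∸ s)
    shrinkℤ s -[1+ n ] = -[1+ n ∸ s ]

    shrink : ℕ → Fin P → Fin P
    shrink s a = res m (shrinkℤ s (lift a))
      where open Fp m using (lift)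

    shrinkℤ-abs : ∀ s z → s < ∣ z ∣ → ∣ shrinkℤ s z ∣ ≡ ∣ z ∣ ∸ s
    shrinkℤ-abs s (+ n) _ = refl
    shrinkℤ-abs s -[1+ n ] (s≤s s≤n) = sym (ℕₚ.+-∸-assoc 1 s≤n)

    shrinkℤ-inj : ∀ s y z → s < ∣ y ∣ → s < ∣ z ∣ → shrinkℤ s y ≡ shrinkℤ s z → y ≡ z
    shrinkℤ-inj s (+ n) (+ k) a b e = cong +_ (ℕₚ.∸-cancelʳ-≡ (ℕₚ.<⇒≤ a) (ℕₚ.<⇒≤ b) (ℤₚ.+-injective e))
    shrinkℤ-inj s -[1+ n ] -[1+ k ] (s≤s a) (s≤s b) e = cong -[1+_] (ℕₚ.∸-cancelʳ-≡ a b (ℤₚ.-[1+-injective e))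

    2abs≤P : ∀ a → abs a +ℕ abs a ≤ P
    2abs≤P a = ℕₚ.≤-trans (ℕₚ.+-mono-≤ (proj₁ (abs≤toℕ×abs≤p∸toℕ a)) (proj₂ (abs≤toℕ×abs≤p∸toℕ a))) (ℕₚ.≤-reflexive (ℕₚ.m+[n∸m]≡n (ℕₚ.<⇒≤ (Finₚ.toℕ<n a))))

    -- Centred lifts are at most P / 2, so after shrinking they are strictly below it, and equal
    -- residues come from equal integers.
    shrink-inj : ∀ s a b → s < abs a → s < abs b → 0 < s → shrink s a ≡ shrink s b → a ≡ b
    shrink-inj s a b ha hb s>0 e = trans (sym (res-lift a)) (trans (cong (res m) (shrinkℤ-inj s (lift a) (lift b) ha hb (Cong-near (res≡⇒Cong m e) near))) (res-lift b))
      where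
      open Fp m using (lift)
      half : ∀ x → s < x → x +ℕ x ≤ P → (x ∸ s) +ℕ (x ∸ s) < P
      half x h le = ℕₚ.<-≤-trans (ℕₚ.+-mono-< (ℕₚ.∸-monoʳ-< s>0 (ℕₚ.<⇒≤ h)) (ℕₚ.∸-monoʳ-< s>0 (ℕₚ.<⇒≤ h))) le
      mid : ∀ x y n → x +ℕ x < n → y +ℕ y < n → x +ℕ y < n
      mid x y n hx hy = [ (λ x≤y → ℕₚ.≤-<-trans (ℕₚ.+-monoˡ-≤ y x≤y) hy) , (λ y≤x → ℕₚ.≤-<-trans (ℕₚ.+-monoʳ-≤ x y≤x) hx) ]′ (ℕₚ.≤-total x y)
      near : ∣ shrinkℤ s (lift a) ∣ +ℕ ∣ shrinkℤ s (lift b) ∣ < P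
      near = subst₂ (λ u v → u +ℕ v < P) (sym (shrinkℤ-abs s (lift a) ha)) (sym (shrinkℤ-abs s (lift b) hb)) (mid (abs a ∸ s) (abs b ∸ s) P (half (abs a) ha (2abs≤P a)) (half (abs b) hb (2abs≤P b)))
        where open import Relation.Binary.PropositionalEquality using (subst₂)

    shrink-sq : ∀ s a → s < abs a → sq (abs (shrink s a)) +ℕ sq s ≤ sq (abs a)
    shrink-sq s a h = ℕₚ.≤-trans (ℕₚ.+-monoˡ-≤ (sq s) (sq-mono (ℕₚ.≤-trans (abs-minimal (shrinkℤ s (lift a))) (ℕₚ.≤-reflexive (shrinkℤ-abs s (lift a) h)))))
        (subst (λ t → sq (abs a ∸ s) +ℕ sq s ≤ sq t) (ℕₚ.m∸n+n≡m (ℕₚ.<⇒≤ h)) (ineq (abs a ∸ s) s))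
      where
      open Fp m using (lift)
      lem : ∀ x y → sq (x +ℕ y) ≡ sq x +ℕ sq y +ℕ 2 *ℕ (x *ℕ y)
      lem x y = lem₀ x y
        where
        lem₀ : ∀ x y → (x +ℕ y) *ℕ (x +ℕ y) ≡ x *ℕ x +ℕ y *ℕ y +ℕ 2 *ℕ (x *ℕ y)
        lem₀ = solveℕ-∀
      ineq : ∀ x y → sq x +ℕ sq y ≤ sq (x +ℕ y)
      ineq x y = ℕₚ.≤-trans (ℕₚ.m≤m+n _ _) (ℕₚ.≤-reflexive (sym (lem x y)))

    ballV : ∀ n → ℕ → ℕ
    ballV n D = ∑ {Vec (Fin P) n} (λ x → 𝟙 (nrmV x ≤? D))

    -- A vector outside the smaller ball has an entry above s, because n s² ≤ D. Shrinking that
    -- entry leads into the smaller ball and is undone once its index is known; the additional index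
    -- 0 marks vectors that were inside from the start.
    ball-growth : ∀ n D s → 0 < s → n *ℕ sq s ≤ D → ballV n (D +ℕ sq s) ≤ suc n *ℕ ballV n D
    ball-growth n D s s>0 big = ℕₚ.≤-trans (∑-inj-on φ _ target bound inj) (ℕₚ.≤-reflexive total)
      where
      V = Vec (Fin P) n
      target : Fin (suc n) × V → ℕ
      target (_ , x) = 𝟙 (nrmV x ≤? D)
      total : ∑ target ≡ suc n *ℕ ballV n D
      total = trans (∑-× {Fin (suc n)} {V} target) (trans (∑-const {Fin (suc n)} (ballV n D)) (cong (_*ℕ ballV n D) (card-Fin (suc n))))
      large? : (x : V) → Dec (∃ λ i → s < abs (lookup x i))
      large? x = ∃? (λ i → s <? abs (lookup x i))
      has-large : ∀ x → ¬ nrmV x ≤ D → ∃ λ i → s < abs (lookup x i)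
      has-large x h = by (large? x)
        where
        by : Dec (∃ λ i → s < abs (lookup x i)) → ∃ λ i → s < abs (lookup x i)
        by (yes l) = l
        by (no nl) = ⊥-elim (h (ℕₚ.≤-trans (vsum-bounded _ (sq s) x (λ i → sq-mono (ℕₚ.≮⇒≥ (λ lt → nl (i , lt))))) big))
      φ′ : ∀ x → Dec (nrmV x ≤ D) → Fin (suc n) × V
      φ′ x (yes _) = zero , x
      φ′ x (no h) = let i = proj₁ (has-large x h) in suc i , x [ i ]≔ shrink s (lookup x i)
      φ : V → Fin (suc n) × V
      φ x = φ′ x (nrmV x ≤? D)
      bound′ : ∀ x (d : Dec (nrmV x ≤ D)) → 𝟙 (nrmV x ≤? D +ℕ sq s) ≤ target (φ′ x d)
      bound′ x (yes h) = ℕₚ.≤-trans (𝟙≤1 (nrmV x ≤? D +ℕ sq s)) (ℕₚ.≤-reflexive (sym (𝟙-yes (nrmV x ≤? D) h)))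
      bound′ x (no h) = 𝟙-mono (nrmV x ≤? D +ℕ sq s) (nrmV (x [ i ]≔ shrink s (lookup x i)) ≤? D) (λ le → ℕₚ.+-cancelʳ-≤ (sq (abs (lookup x i))) _ _ (begin
          nrmV (x [ i ]≔ shrink s (lookup x i)) +ℕ sq (abs (lookup x i)) ≡⟨ vsum-update _ x i (shrink s (lookup x i)) ⟩
          nrmV x +ℕ sq (abs (shrink s (lookup x i))) ≤⟨ ℕₚ.+-monoˡ-≤ _ le ⟩
          D +ℕ sq s +ℕ sq (abs (shrink s (lookup x i))) ≡⟨ trans (ℕₚ.+-assoc D _ _) (cong (D +ℕ_) (ℕₚ.+-comm (sq s) _)) ⟩
          D +ℕ (sq (abs (shrink s (lookup x i))) +ℕ sq s) ≤⟨ ℕₚ.+-monoʳ-≤ D (shrink-sq s (lookup x i) (proj₂ (has-large x h))) ⟩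
          D +ℕ sq (abs (lookup x i)) ∎))
        where
        open ℕₚ.≤-Reasoning
        i = proj₁ (has-large x h)
      bound : ∀ x → 𝟙 (nrmV x ≤? D +ℕ sq s) ≤ target (φ x)
      bound x = bound′ x (nrmV x ≤? D)
      inj′ : ∀ x y d e → φ′ x d ≡ φ′ y e → x ≡ y
      inj′ x y (yes _) (yes _) e = cong proj₂ e
      inj′ x y (yes _) (no _) ()
      inj′ x y (no _) (yes _) ()
      inj′ x y (no h) (no g) e = same (proj₁ (has-large x h)) (proj₁ (has-large y g)) (proj₂ (has-large x h)) (proj₂ (has-large y g)) (Finₚ.suc-injective (cong proj₁ e)) (cong proj₂ e)
        where
        same : ∀ i j → s < abs (lookup x i) → s < abs (lookup y j) → i ≡ j → x [ i ]≔ shrink s (lookup x i) ≡ y [ j ]≔ shrink s (lookup y j) → x ≡ y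
        same i .i hx hy refl eq = update-inj x y i eq (shrink-inj s (lookup x i) (lookup y i) hx hy s>0
          (trans (sym (Vecₚ.lookup∘update i x _)) (trans (cong (λ t → lookup t i) eq) (Vecₚ.lookup∘update i y _))))
      inj : ∀ x y → 0 < 𝟙 (nrmV x ≤? D +ℕ sq s) → 0 < 𝟙 (nrmV y ≤? D +ℕ sq s) → φ x ≡ φ y → x ≡ y
      inj x y _ _ = inj′ x y (nrmV x ≤? D) (nrmV y ≤? D)

    -- Products of planar discs

    disc : ℕ → ℕ
    disc r = ∑ {Fin P} (λ a → ∑ {Fin P} (λ b → 𝟙 (sq (abs a) +ℕ sq (abs b) ≤? r)))

    pairBall : ∀ n → ℕ → ℕ
    pairBall n D = ∑ {Vec (Fin P) n} (λ f → ∑ {Vec (Fin P) n} (λ g → 𝟙 (nrmV f +ℕ nrmV g ≤? D)))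

    -- The n-fold product of the disc sits inside the ball of squared radius n r. This turns an
    -- upper bound for the critical ball into one for the disc, which governs constant codewords.
    disc-power : ∀ n r → disc r ^ℕ n ≤ pairBall n (n *ℕ r)
    disc-power zero r = ℕₚ.≤-reflexive (sym (trans (∑-[] {Fin P} _) (∑-[] {Fin P} _)))
    disc-power (suc n) r = begin
      disc r *ℕ disc r ^ℕ n ≤⟨ ℕₚ.*-monoʳ-≤ (disc r) (disc-power n r) ⟩
      disc r *ℕ pairBall n (n *ℕ r) ≡⟨ ∑-*ʳ (pairBall n (n *ℕ r)) _ ⟨
      ∑ {Fin P} (λ a → ∑ {Fin P} (λ b → I a b) *ℕ pairBall n (n *ℕ r)) ≡⟨ ∑-cong (λ a → sym (∑-*ʳ (pairBall n (n *ℕ r)) _)) ⟩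
      ∑ {Fin P} (λ a → ∑ {Fin P} (λ b → I a b *ℕ pairBall n (n *ℕ r))) ≡⟨ ∑-cong (λ a → ∑-cong (λ b → trans (sym (∑-* (I a b) _)) (∑-cong (λ f → sym (∑-* (I a b) _))))) ⟩
      ∑ {Fin P} (λ a → ∑ {Fin P} (λ b → ∑ {V} (λ f → ∑ {V} (λ g → I a b *ℕ J f g)))) ≤⟨ ∑-mono (λ a → ∑-mono (λ b → ∑-mono (λ f → ∑-mono (λ g → pt a b f g)))) ⟩
      ∑ {Fin P} (λ a → ∑ {Fin P} (λ b → ∑ {V} (λ f → ∑ {V} (λ g → T (a ∷ f) (b ∷ g))))) ≡⟨ ∑-cong (λ a → ∑-swap {Fin P} {V} _) ⟩
      ∑ {Fin P} (λ a → ∑ {V} (λ f → ∑ {Fin P} (λ b → ∑ {V} (λ g → T (a ∷ f) (b ∷ g))))) ≡⟨ ∑-cong (λ a → ∑-cong (λ f → sym (∑-Vec {Fin P} {n = n} (T (a ∷ f))))) ⟩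
      ∑ {Fin P} (λ a → ∑ {V} (λ f → ∑ (T (a ∷ f)))) ≡⟨ ∑-Vec {Fin P} {n = n} (λ f → ∑ (T f)) ⟨
      pairBall (suc n) (suc n *ℕ r) ∎
      where
      open ℕₚ.≤-Reasoning
      V = Vec (Fin P) n
      I : Fin P → Fin P → ℕ
      I a b = 𝟙 (sq (abs a) +ℕ sq (abs b) ≤? r)
      J : V → V → ℕ
      J f g = 𝟙 (nrmV f +ℕ nrmV g ≤? n *ℕ r)
      T : Vec (Fin P) (suc n) → Vec (Fin P) (suc n) → ℕ
      T f g = 𝟙 (nrmV f +ℕ nrmV g ≤? suc n *ℕ r)
      lem : ∀ a b f g → a +ℕ f +ℕ (b +ℕ g) ≡ a +ℕ b +ℕ (f +ℕ g)
      lem = solveℕ-∀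
      pt : ∀ a b f g → I a b *ℕ J f g ≤ T (a ∷ f) (b ∷ g)
      pt a b f g = by (sq (abs a) +ℕ sq (abs b) ≤? r) (nrmV f +ℕ nrmV g ≤? n *ℕ r)
        where
        by : (d : Dec (sq (abs a) +ℕ sq (abs b) ≤ r)) (e : Dec (nrmV f +ℕ nrmV g ≤ n *ℕ r)) → 𝟙 d *ℕ 𝟙 e ≤ T (a ∷ f) (b ∷ g)
        by (no _) _ = z≤n
        by (yes _) (no _) = z≤n
        by (yes h) (yes h₁) = ℕₚ.≤-reflexive (sym (𝟙-yes (nrmV (a ∷ f) +ℕ nrmV (b ∷ g) ≤? suc n *ℕ r)
          (ℕₚ.≤-trans (ℕₚ.≤-reflexive (lem (sq (abs a)) (sq (abs b)) (nrmV f) (nrmV g))) (ℕₚ.+-mono-≤ h h₁))))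

    pairBall-ballV : ∀ n D → pairBall n D ≡ ballV (n +ℕ n) D
    pairBall-ballV n D = sym (trans (∑-++ {Fin P} n {n} _) (∑-cong (λ f → ∑-cong (λ g → cong (λ t → 𝟙 (t ≤? D)) (vsum-++ _ f g)))))

-- Pairs of zero-sum vectors are rare

module ZeroSumPairs where
  open FiniteCounting
  open PeriodicConvolution
  open CyclicDomain
  open Multiples
  open FiniteGroupAlgebra
  open Annihilators
  open Ideals
  open LatticePoints
  import Data.Fin.Properties as Finₚ
  import Data.Integer as ℤ
  import Data.Integer.Properties as ℤₚ
  import Data.Nat as ℕ
  import Data.Nat.Properties as ℕₚ
  import Data.Vec.Properties as Vecₚ
  open import Data.Fin using (Fin; zero; suc; toℕ)
  open import Data.Integer using (ℤ; +_) renaming (_+_ to _+ᶻ_; _-_ to _-ᶻ_; -_ to -ᶻ_)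
  open import Data.Integer.Tactic.RingSolver using (solve-∀)
  open import Data.Nat using (ℕ; zero; suc; _<_; _≤_; _≤?_; _<?_; z≤n) renaming (_+_ to _+ℕ_; _*_ to _*ℕ_; _^_ to _^ℕ_)
  open import Data.Nat.Primality using (Prime)
  open import Data.Nat.Tactic.RingSolver using () renaming (solve-∀ to solveℕ-∀)
  open import Data.Product using (_×_; _,_; proj₁; proj₂)
  open import Data.Vec using (Vec; []; _∷_; lookup)
  open import Data.Vec using (_[_]≔_)
  open import Relation.Binary.PropositionalEquality using (_≡_; _≢_; refl; sym; trans; cong; cong₂)
  open import Relation.Nullary using (Dec; yes; no; _×-dec_)

  𝟙-× : ∀ {A B : Set} (d : Dec A) (e : Dec B) → 𝟙 (d ×-dec e) ≡ 𝟙 d *ℕ 𝟙 e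
  𝟙-× (yes _) (yes _) = refl
  𝟙-× (yes _) (no _) = refl
  𝟙-× (no _) e = refl

  ∑²-+ : ∀ {A B : Set} {{_ : Fintype A}} {{_ : Fintype B}} (a b : A → B → ℕ) →
    ∑ (λ x → ∑ (λ y → a x y +ℕ b x y)) ≡ ∑ (λ x → ∑ (a x)) +ℕ ∑ (λ x → ∑ (b x))
  ∑²-+ a b = trans (∑-cong (λ x → ∑-+ (a x) (b x))) (∑-+ (λ x → ∑ (a x)) (λ x → ∑ (b x)))

  module ZeroSum (q′ m : ℕ) (prq : Prime (suc q′)) (prp : Prime (suc m)) (q≢p : suc q′ ≢ suc m) where
    open Representatives q′ m prq prp q≢p public
    open Balls m using (levels; levels-count; levels≤sum; ball-count; disc; pairBall; ballV; ball-growth; disc-power; pairBall-ballV; 2abs≤P) public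

    zsum : ∀ {n} → Vec (Fin P) n → ℤ
    zsum [] = + 0
    zsum (a ∷ v) = lift a +ᶻ zsum v

    zsum-Sn : ∀ {n} (x : Vec (Fin P) n) (G : ℤ → ℤ) → (∀ i → G (+ toℕ i) ≡ lift (lookup x i)) → Sn n G ≡ zsum x
    zsum-Sn [] G h = refl
    zsum-Sn {suc n} (a ∷ v) G h = trans (Sn-front n G) (cong₂ _+ᶻ_ (h zero) (zsum-Sn v (λ k → G (+ 1 +ᶻ k)) (λ i → h (suc i))))

    σ-zsum : ∀ x → σ (emb x) ≡ zsum x
    σ-zsum x = zsum-Sn x (at (emb x)) (emb-at x)

    zsum-update : ∀ {n} (x : Vec (Fin P) n) i b → zsum (x [ i ]≔ b) +ᶻ lift (lookup x i) ≡ zsum x +ᶻ lift b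
    zsum-update (a ∷ x) zero b = lem (lift b) (zsum x) (lift a)
      where
      lem : ∀ b x a → (b +ᶻ x) +ᶻ a ≡ (a +ᶻ x) +ᶻ b
      lem = solve-∀
    zsum-update (a ∷ x) (suc i) b = trans (ℤₚ.+-assoc (lift a) _ _) (trans (cong (lift a +ᶻ_) (zsum-update x i b)) (sym (ℤₚ.+-assoc (lift a) _ _)))

    -- The residues 0, ..., |a| - 1 are among those counted.
    abs≤count : ∀ a → abs a ≤ ∑ {Fin P} (λ α → 𝟙 (abs α ≤? abs a))
    abs≤count a = begin
      abs a ≡⟨ card-Fin (abs a) ⟨
      ∑ {Fin (abs a)} (λ _ → 1) ≤⟨ ∑-inj-on φ (λ _ → 1) (λ α → 𝟙 (abs α ≤? abs a)) (λ i → ℕₚ.≤-reflexive (sym (𝟙-yes (abs (φ i) ≤? abs a) (small i)))) (λ i j _ _ e → Finₚ.inject≤-injective le le i j e) ⟩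
      ∑ {Fin P} (λ α → 𝟙 (abs α ≤? abs a)) ∎
      where
      open ℕₚ.≤-Reasoning
      le : abs a ≤ P
      le = ℕₚ.≤-trans (ℕₚ.m≤m+n (abs a) (abs a)) (2abs≤P a)
      φ : Fin (abs a) → Fin P
      φ i = Data.Fin.inject≤ i le
        where import Data.Fin
      small : ∀ i → abs (φ i) ≤ abs a
      small i = ℕₚ.≤-trans (proj₁ (abs≤toℕ×abs≤p∸toℕ (φ i))) (ℕₚ.≤-trans (ℕₚ.≤-reflexive (Finₚ.toℕ-inject≤ i le)) (ℕₚ.<⇒≤ (Finₚ.toℕ<n i)))

    -- A zero-sum f can be recovered after one of its coordinates has been overwritten.
    overwrite : ∀ c D → ∑ (λ f → 𝟙 (nrm f +ℕ c ≤? D) *ℕ 𝟙 (ZS? f) *ℕ vsum abs f) ≤ q *ℕ ∑ (λ f → 𝟙 (nrm f +ℕ c ≤? D))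
    overwrite c D = begin
      ∑ (λ f → 𝟙 (nrm f +ℕ c ≤? D) *ℕ 𝟙 (ZS? f) *ℕ vsum abs f) ≤⟨ ∑-mono expand ⟩
      ∑ (λ f → ∑ {Fin q} (λ i → ∑ {Fin P} (λ α → weight (f , i , α)))) ≡⟨ trans (∑-cong (λ f → sym (∑-× {Fin q} {Fin P} (λ iα → weight (f , iα))))) (sym (∑-× {X} {Fin q × Fin P} weight)) ⟩
      ∑ weight ≤⟨ ∑-inj-on φ weight target bound inj ⟩
      ∑ target ≡⟨ trans (∑-× {Fin q} {X} target) (trans (∑-const {Fin q} _) (cong (_*ℕ ∑ (λ f → 𝟙 (nrm f +ℕ c ≤? D))) (card-Fin q))) ⟩
      q *ℕ ∑ (λ f → 𝟙 (nrm f +ℕ c ≤? D)) ∎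
      where
      open ℕₚ.≤-Reasoning
      T = X × Fin q × Fin P
      weight : T → ℕ
      weight (f , i , α) = 𝟙 (nrm f +ℕ c ≤? D) *ℕ 𝟙 (ZS? f) *ℕ 𝟙 (abs α ≤? abs (lookup f i))
      target : Fin q × X → ℕ
      target (_ , y) = 𝟙 (nrm y +ℕ c ≤? D)
      φ : T → Fin q × X
      φ (f , i , α) = i , f [ i ]≔ α
      expand : ∀ f → 𝟙 (nrm f +ℕ c ≤? D) *ℕ 𝟙 (ZS? f) *ℕ vsum abs f ≤ ∑ {Fin q} (λ i → ∑ {Fin P} (λ α → weight (f , i , α)))
      expand f = ℕₚ.≤-trans (ℕₚ.*-monoʳ-≤ w (ℕₚ.≤-trans (ℕₚ.≤-reflexive (vsum-∑ abs f)) (∑-mono (λ i → abs≤count (lookup f i)))))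
        (ℕₚ.≤-reflexive (trans (sym (∑-* w _)) (∑-cong (λ i → sym (∑-* w _)))))
        where w = 𝟙 (nrm f +ℕ c ≤? D) *ℕ 𝟙 (ZS? f)
      bound : ∀ t → weight t ≤ target (φ t)
      bound (f , i , α) = by (nrm f +ℕ c ≤? D) (abs α ≤? abs (lookup f i))
        where
        by : (d : Dec (nrm f +ℕ c ≤ D)) (e : Dec (abs α ≤ abs (lookup f i))) → 𝟙 d *ℕ 𝟙 (ZS? f) *ℕ 𝟙 e ≤ target (φ (f , i , α))
        by (no _) e = z≤n
        by (yes _) (no _) = ℕₚ.≤-trans (ℕₚ.≤-reflexive (ℕₚ.*-zeroʳ (1 *ℕ 𝟙 (ZS? f)))) z≤n
        by (yes h) (yes h₁) = ℕₚ.≤-trans (ℕₚ.*-mono-≤ (ℕₚ.*-mono-≤ (ℕₚ.≤-refl {1}) (𝟙≤1 (ZS? f))) (ℕₚ.≤-refl {1})) (ℕₚ.≤-reflexive (sym (𝟙-yes (nrm (f [ i ]≔ α) +ℕ c ≤? D)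
          (ℕₚ.≤-trans (ℕₚ.+-monoˡ-≤ c (ℕₚ.+-cancelʳ-≤ (sq (abs (lookup f i))) _ _ (ℕₚ.≤-trans (ℕₚ.≤-reflexive (vsum-update (λ a → sq (abs a)) f i α)) (ℕₚ.+-monoʳ-≤ (nrm f) (sq-mono h₁))))) h))))
      inj : ∀ s t → 0 < weight s → 0 < weight t → φ s ≡ φ t → s ≡ t
      inj (f , i , α) (g , j , β) hs ht e = same i j (cong proj₁ e) (cong proj₂ e)
        where
        zs : ∀ {n k} (f : X) → 0 < n *ℕ 𝟙 (ZS? f) *ℕ k → ZS f
        zs {n} {k} f h = 𝟙>0 (ZS? f) (*-pos₂ n _ (*-pos₁ _ k h))
        zf : ZS f
        zf = zs {𝟙 (nrm f +ℕ c ≤? D)} {𝟙 (abs α ≤? abs (lookup f i))} f hs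
        zg : ZS g
        zg = zs {𝟙 (nrm g +ℕ c ≤? D)} {𝟙 (abs β ≤? abs (lookup g j))} g ht
        same : ∀ i j → i ≡ j → f [ i ]≔ α ≡ g [ j ]≔ β → (f , i , α) ≡ (g , j , β)
        same i .i refl e = cong₂ (λ x a → x , i , a) (update-inj f g i e coord) α≡
          where
          α≡ : α ≡ β
          α≡ = trans (sym (Vecₚ.lookup∘update i f α)) (trans (cong (λ t → lookup t i) e) (Vecₚ.lookup∘update i g β))
          c₀ : ∀ f α → ZS f → Cong (+ P) (zsum (f [ i ]≔ α) +ᶻ lift (lookup f i)) (lift α)
          c₀ f α z = cong-trans (cong-≡ (zsum-update f i α)) (cong-trans (cong-+ (cong-trans (cong-≡ (sym (σ-zsum f))) z) (cong-refl {a = lift α})) (cong-≡ (ℤₚ.+-identityˡ (lift α))))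
          lem : ∀ a b → b ≡ (a +ᶻ b) +ᶻ -ᶻ a
          lem = solve-∀
          solve-coord : ∀ f α → ZS f → Cong (+ P) (lift (lookup f i)) (lift α +ᶻ -ᶻ zsum (f [ i ]≔ α))
          solve-coord f α z = cong-trans (cong-≡ (lem (zsum (f [ i ]≔ α)) (lift (lookup f i)))) (cong-+ (c₀ f α z) (cong-refl {a = -ᶻ zsum (f [ i ]≔ α)}))
          coord : lookup f i ≡ lookup g i
          coord = trans (sym (res-lift (lookup f i))) (trans (Cong⇒res≡ m (cong-trans (solve-coord f α zf)
            (cong-trans (cong-≡ (cong₂ (λ a y → lift a +ᶻ -ᶻ zsum y) α≡ e)) (cong-sym (solve-coord g β zg))))) (res-lift (lookup g i)))

    -- `Ω` is the weighted total that smoothing produces; `Z` counts the zero-sum pairs, on which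
    -- the weight is P + 1 instead of 1.
    Ω Z : ℕ → ℕ
    Ω D = ∑ (λ f → ∑ (λ g → 𝟙 (within? f D g) *ℕ ω f g))
    Z D = ∑ (λ f → ∑ (λ g → 𝟙 (within? f D g) *ℕ (𝟙 (ZS? f) *ℕ 𝟙 (ZS? g))))

    Ω-split : ∀ D → Ω D ≡ pairBall q D +ℕ P *ℕ Z D
    Ω-split D = trans (∑-cong (λ f → trans (∑-cong (λ g → lem (𝟙 (within? f D g)) P (𝟙 (ZS? f) *ℕ 𝟙 (ZS? g)))) (trans (∑-+ _ _) (cong (∑ (λ g → 𝟙 (within? f D g)) +ℕ_) (∑-* P _)))))
      (trans (∑-+ _ _) (cong (pairBall q D +ℕ_) (∑-* P _)))
      where
      lem : ∀ a p b → a *ℕ suc (p *ℕ b) ≡ a +ℕ p *ℕ (a *ℕ b)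
      lem = solveℕ-∀

    module _ (μ : ℕ) where
      Typical : X → Set
      Typical f = q < levels μ f

      typical? : ∀ f → Dec (Typical f)
      typical? f = q <? levels μ f

      zt : X → ℕ
      zt f = 𝟙 (ZS? f) *ℕ 𝟙 (typical? f)

      -- The absolute values of the entries of a typical f add up to at least q (μ + 1). So each
      -- typical zero-sum f accounts for that many overwritten vectors, and `overwrite` reaches each
      -- vector of the ball at most q times.
      thin : ∀ c D → suc μ *ℕ ∑ (λ f → 𝟙 (nrm f +ℕ c ≤? D) *ℕ zt f) ≤ ∑ (λ f → 𝟙 (nrm f +ℕ c ≤? D))
      thin c D = ℕₚ.*-cancelˡ-≤ q (begin
        q *ℕ (suc μ *ℕ ∑ (λ f → 𝟙 (nrm f +ℕ c ≤? D) *ℕ zt f)) ≡⟨ trans (sym (ℕₚ.*-assoc q (suc μ) _)) (sym (∑-* (q *ℕ suc μ) _)) ⟩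
        ∑ (λ f → q *ℕ suc μ *ℕ (𝟙 (nrm f +ℕ c ≤? D) *ℕ zt f)) ≤⟨ ∑-mono pt ⟩
        ∑ (λ f → 𝟙 (nrm f +ℕ c ≤? D) *ℕ 𝟙 (ZS? f) *ℕ vsum abs f) ≤⟨ overwrite c D ⟩
        q *ℕ ∑ (λ f → 𝟙 (nrm f +ℕ c ≤? D)) ∎)
        where
        open ℕₚ.≤-Reasoning
        pt : ∀ f → q *ℕ suc μ *ℕ (𝟙 (nrm f +ℕ c ≤? D) *ℕ zt f) ≤ 𝟙 (nrm f +ℕ c ≤? D) *ℕ 𝟙 (ZS? f) *ℕ vsum abs f
        pt f = ℕₚ.≤-trans (ℕₚ.≤-reflexive (lem (q *ℕ suc μ) (𝟙 (nrm f +ℕ c ≤? D)) (𝟙 (ZS? f)) (𝟙 (typical? f))))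
          (ℕₚ.*-monoʳ-≤ (𝟙 (nrm f +ℕ c ≤? D) *ℕ 𝟙 (ZS? f)) (by (typical? f)))
          where
          lem : ∀ a b c d → a *ℕ (b *ℕ (c *ℕ d)) ≡ b *ℕ c *ℕ (a *ℕ d)
          lem = solveℕ-∀
          by : (d : Dec (Typical f)) → q *ℕ suc μ *ℕ 𝟙 d ≤ vsum abs f
          by (no _) = ℕₚ.≤-trans (ℕₚ.≤-reflexive (ℕₚ.*-zeroʳ (q *ℕ suc μ))) z≤n
          by (yes h) = ℕₚ.≤-trans (ℕₚ.≤-reflexive (ℕₚ.*-identityʳ (q *ℕ suc μ))) (ℕₚ.≤-trans (ℕₚ.*-monoˡ-≤ (suc μ) (ℕₚ.<⇒≤ h)) (levels≤sum μ f))

      -- `thin` is applied to g with f fixed, and then to f with g fixed; the parameter c holds the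
      -- norm of the fixed component.
      thin² : ∀ D → sq (suc μ) *ℕ ∑ (λ f → ∑ (λ g → 𝟙 (within? f D g) *ℕ (zt f *ℕ zt g))) ≤ pairBall q D
      thin² D = begin
        suc μ *ℕ suc μ *ℕ ∑ (λ f → ∑ (λ g → 𝟙 (within? f D g) *ℕ (zt f *ℕ zt g))) ≡⟨ trans (ℕₚ.*-assoc (suc μ) (suc μ) _) (cong (suc μ *ℕ_) (sym (∑-* (suc μ) _))) ⟩
        suc μ *ℕ ∑ (λ f → suc μ *ℕ ∑ (λ g → 𝟙 (within? f D g) *ℕ (zt f *ℕ zt g))) ≤⟨ ℕₚ.*-monoʳ-≤ (suc μ) (∑-mono inner) ⟩
        suc μ *ℕ ∑ (λ f → zt f *ℕ ∑ (λ g → 𝟙 (within? f D g))) ≡⟨ cong (suc μ *ℕ_) (trans (∑-cong (λ f → sym (∑-* (zt f) _))) (∑-swap _)) ⟩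
        suc μ *ℕ ∑ (λ g → ∑ (λ f → zt f *ℕ 𝟙 (within? f D g))) ≡⟨ trans (sym (∑-* (suc μ) _)) (∑-cong (λ g → cong (suc μ *ℕ_) (∑-cong (λ f → ℕₚ.*-comm (zt f) _)))) ⟩
        ∑ (λ g → suc μ *ℕ ∑ (λ f → 𝟙 (within? f D g) *ℕ zt f)) ≤⟨ ∑-mono (λ g → thin (nrm g) D) ⟩
        ∑ (λ g → ∑ (λ f → 𝟙 (within? f D g))) ≡⟨ ∑-swap _ ⟩
        pairBall q D ∎
        where
        open ℕₚ.≤-Reasoning
        comm-within : ∀ f g → 𝟙 (within? f D g) ≡ 𝟙 (nrm g +ℕ nrm f ≤? D)
        comm-within f g = cong (λ t → 𝟙 (t ≤? D)) (ℕₚ.+-comm (nrm f) (nrm g))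
        inner : ∀ f → suc μ *ℕ ∑ (λ g → 𝟙 (within? f D g) *ℕ (zt f *ℕ zt g)) ≤ zt f *ℕ ∑ (λ g → 𝟙 (within? f D g))
        inner f = begin
          suc μ *ℕ ∑ (λ g → 𝟙 (within? f D g) *ℕ (zt f *ℕ zt g)) ≡⟨ cong (suc μ *ℕ_) (trans (∑-cong (λ g → trans (cong (_*ℕ (zt f *ℕ zt g)) (comm-within f g)) (lem (𝟙 (nrm g +ℕ nrm f ≤? D)) (zt f) (zt g)))) (∑-* (zt f) _)) ⟩
          suc μ *ℕ (zt f *ℕ ∑ (λ g → 𝟙 (nrm g +ℕ nrm f ≤? D) *ℕ zt g)) ≡⟨ lem (suc μ) (zt f) _ ⟩
          zt f *ℕ (suc μ *ℕ ∑ (λ g → 𝟙 (nrm g +ℕ nrm f ≤? D) *ℕ zt g)) ≤⟨ ℕₚ.*-monoʳ-≤ (zt f) (thin (nrm f) D) ⟩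
          zt f *ℕ ∑ (λ g → 𝟙 (nrm g +ℕ nrm f ≤? D)) ≡⟨ cong (zt f *ℕ_) (∑-cong (λ g → sym (comm-within f g))) ⟩
          zt f *ℕ ∑ (λ g → 𝟙 (within? f D g)) ∎
          where
          lem : ∀ a b c → a *ℕ (b *ℕ c) ≡ b *ℕ (a *ℕ c)
          lem = solveℕ-∀

      atypical : X → ℕ
      atypical f = 𝟙 (levels μ f ≤? q)

      atypicals : ℕ
      atypicals = ∑ atypical

      atypicals≤ : atypicals ≤ (8 *ℕ suc μ) ^ℕ q
      atypicals≤ = ℕₚ.≤-trans (levels-count μ q q) (ℕₚ.≤-reflexive (trans (sym (^-*-distrib 2 (4 *ℕ suc μ) q)) (cong (_^ℕ q) (lem (suc μ)))))
        where
        lem : ∀ a → 2 *ℕ (4 *ℕ a) ≡ 8 *ℕ a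
        lem = solveℕ-∀

      -- Pairs of typical vectors fall under `thin²`. In any other pair one component is among the
      -- few atypical vectors, and of the other it is only kept that it lies in the ball.
      Z-bound : ∀ D → sq (suc μ) *ℕ Z D ≤ pairBall q D +ℕ sq (suc μ) *ℕ (2 *ℕ (atypicals *ℕ ballX D))
      Z-bound D = begin
        sq (suc μ) *ℕ Z D ≤⟨ ℕₚ.*-monoʳ-≤ (sq (suc μ)) (ℕₚ.≤-trans (∑-mono (λ f → ∑-mono (λ g → pt f g))) (ℕₚ.≤-reflexive (trans (∑²-+ t₀ (λ f g → t₁ f g +ℕ t₂ f g)) (cong (Zt +ℕ_) (∑²-+ t₁ t₂))))) ⟩
        sq (suc μ) *ℕ (Zt +ℕ (A₁ +ℕ A₂)) ≡⟨ ℕₚ.*-distribˡ-+ (sq (suc μ)) Zt _ ⟩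
        sq (suc μ) *ℕ Zt +ℕ sq (suc μ) *ℕ (A₁ +ℕ A₂) ≤⟨ ℕₚ.+-mono-≤ (thin² D) (ℕₚ.≤-reflexive (cong (sq (suc μ) *ℕ_) (trans (cong₂ _+ℕ_ A₁≡ A₂≡) (cong (atypicals *ℕ ballX D +ℕ_) (sym (ℕₚ.+-identityʳ (atypicals *ℕ ballX D))))))) ⟩
        pairBall q D +ℕ sq (suc μ) *ℕ (2 *ℕ (atypicals *ℕ ballX D)) ∎
        where
        open ℕₚ.≤-Reasoning
        t₀ t₁ t₂ : X → X → ℕ
        t₀ f g = 𝟙 (within? f D g) *ℕ (zt f *ℕ zt g)
        t₁ f g = atypical f *ℕ 𝟙 (ball? D g)
        t₂ f g = 𝟙 (ball? D f) *ℕ atypical g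
        Zt A₁ A₂ : ℕ
        Zt = ∑ (λ f → ∑ (t₀ f))
        A₁ = ∑ (λ f → ∑ (t₁ f))
        A₂ = ∑ (λ f → ∑ (t₂ f))
        A₁≡ : A₁ ≡ atypicals *ℕ ballX D
        A₁≡ = trans (∑-cong (λ f → ∑-* (atypical f) _)) (∑-*ʳ (ballX D) _)
        A₂≡ : A₂ ≡ atypicals *ℕ ballX D
        A₂≡ = trans (∑-cong (λ f → ∑-* (𝟙 (ball? D f)) _)) (trans (∑-*ʳ atypicals _) (ℕₚ.*-comm (ballX D) atypicals))
        pt : ∀ f g → 𝟙 (within? f D g) *ℕ (𝟙 (ZS? f) *ℕ 𝟙 (ZS? g)) ≤ 𝟙 (within? f D g) *ℕ (zt f *ℕ zt g) +ℕ (atypical f *ℕ 𝟙 (ball? D g) +ℕ 𝟙 (ball? D f) *ℕ atypical g)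
        pt f g = by (within? f D g) (typical? f) (typical? g) refl refl
          where
          by : (w : Dec (nrm f +ℕ nrm g ≤ D)) (a : Dec (Typical f)) (b : Dec (Typical g)) → typical? f ≡ a → typical? g ≡ b →
            𝟙 w *ℕ (𝟙 (ZS? f) *ℕ 𝟙 (ZS? g)) ≤ 𝟙 w *ℕ (zt f *ℕ zt g) +ℕ (atypical f *ℕ 𝟙 (ball? D g) +ℕ 𝟙 (ball? D f) *ℕ atypical g)
          by (no _) _ _ _ _ = z≤n
          by (yes w) (yes a) (yes b) ea eb = ℕₚ.≤-trans (ℕₚ.≤-reflexive (cong (1 *ℕ_) (cong₂ _*ℕ_ (full f ea) (full g eb)))) (ℕₚ.m≤m+n _ _)
            where
            full : ∀ f {a} → typical? f ≡ yes a → 𝟙 (ZS? f) ≡ zt f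
            full f e = sym (trans (cong (λ d → 𝟙 (ZS? f) *ℕ 𝟙 d) e) (ℕₚ.*-identityʳ (𝟙 (ZS? f))))
          by (yes w) (no a) _ _ _ = ℕₚ.≤-trans one (ℕₚ.≤-trans (ℕₚ.≤-reflexive (sym (cong₂ _*ℕ_ (𝟙-yes (levels μ f ≤? q) (ℕₚ.≮⇒≥ a)) (𝟙-yes (ball? D g) (ℕₚ.≤-trans (ℕₚ.m≤n+m _ (nrm f)) w)))))
              (ℕₚ.≤-trans (ℕₚ.m≤m+n _ (𝟙 (ball? D f) *ℕ atypical g)) (ℕₚ.m≤n+m _ (𝟙 (yes w) *ℕ (zt f *ℕ zt g)))))
            where
            one : 1 *ℕ (𝟙 (ZS? f) *ℕ 𝟙 (ZS? g)) ≤ 1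
            one = ℕₚ.*-mono-≤ (ℕₚ.≤-refl {1}) (ℕₚ.*-mono-≤ (𝟙≤1 (ZS? f)) (𝟙≤1 (ZS? g)))
          by (yes w) (yes _) (no b) _ _ = ℕₚ.≤-trans one (ℕₚ.≤-trans (ℕₚ.≤-reflexive (sym (cong₂ _*ℕ_ (𝟙-yes (ball? D f) (ℕₚ.≤-trans (ℕₚ.m≤m+n _ (nrm g)) w)) (𝟙-yes (levels μ g ≤? q) (ℕₚ.≮⇒≥ b)))))
              (ℕₚ.≤-trans (ℕₚ.m≤n+m _ (atypical f *ℕ 𝟙 (ball? D g))) (ℕₚ.m≤n+m _ (𝟙 (yes w) *ℕ (zt f *ℕ zt g)))))
            where
            one : 1 *ℕ (𝟙 (ZS? f) *ℕ 𝟙 (ZS? g)) ≤ 1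
            one = ℕₚ.*-mono-≤ (ℕₚ.≤-refl {1}) (ℕₚ.*-mono-≤ (𝟙≤1 (ZS? f)) (𝟙≤1 (ZS? g)))

-- Rarity of non-units, and the orbits of signed cyclic shifts

module SignedOrbits where
  open FiniteCounting
  open PeriodicConvolution
  open CyclicPowers
  open CyclicDomain
  open FiniteGroupAlgebra
  open ZeroSumPairs
  import Data.Fin.Properties as Finₚ
  import Data.Integer as ℤ
  import Data.Integer.Properties as ℤₚ
  import Data.Nat as ℕ
  import Data.Nat.Properties as ℕₚ
  open import Data.Bool using (Bool; true; false)
  open import Data.Empty using (⊥; ⊥-elim)
  open import Data.Fin using (Fin; zero; suc; toℕ)
  open import Data.Fin using (inject≤)
  open import Data.Integer using (ℤ; +_; ∣_∣) renaming (_+_ to _+ᶻ_; _*_ to _*ᶻ_; _-_ to _-ᶻ_; -_ to -ᶻ_)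
  open import Data.Integer.Tactic.RingSolver using (solve-∀)
  open import Data.Nat using (ℕ; zero; suc; _<_; _≤_; z≤n) renaming (_+_ to _+ℕ_; _*_ to _*ℕ_)
  open import Data.Nat.Divisibility using (_∣_)
  open import Data.Nat.Primality using (Prime)
  open import Data.Nat.Tactic.RingSolver using () renaming (solve-∀ to solveℕ-∀)
  open import Data.Product using (∃; _×_; _,_; proj₁; proj₂)
  open import Data.Sum using ([_,_]′)
  open import Data.Vec using (lookup)
  open import Function using (id)
  open import Relation.Binary.PropositionalEquality using (_≡_; _≢_; refl; sym; trans; cong; cong₂; subst)
  open import Relation.Nullary using (¬_; Dec; yes; no; _×-dec_; ¬?)

  inverse-mod : ∀ {n} → Prime (suc n) → ∀ c → ¬ Cong (+ suc n) c (+ 0) → ∃ λ d → Cong (+ suc n) (c *ᶻ d) (+ 1)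
  inverse-mod {zero} pr c nz = ⊥-elim (nz (cg c (lem c)))
    where
    lem : ∀ c → c ≡ + 0 +ᶻ c *ᶻ + 1
    lem = solve-∀
  inverse-mod {suc n} pr c nz = powℤ c n , [ (λ z → ⊥-elim (nz z)) , Cong-undiff ]′ (Cong-prime pr c (w -ᶻ + 1)
      (subst (λ t → Cong (+ suc (suc n)) t (+ 0)) (sym (lem c w)) (Cong-diff (Cyclic.PrimeChar.fermat 0 pr c))))
    where
    w = c *ᶻ powℤ c n
    lem : ∀ a b → a *ᶻ (b -ᶻ + 1) ≡ a *ᶻ b -ᶻ a
    lem = solve-∀

  odd-prime : ∀ {n} → Prime (suc n) → 2 < suc n → ¬ Cong (+ suc n) (+ 2) (+ 0)
  odd-prime pr lt c = impossible (Cong-small c lt)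
    where
    impossible : ¬ (+ 2 ≡ + 0)
    impossible ()

  module Orbits (q′ m : ℕ) (prq : Prime (suc q′)) (prp : Prime (suc m)) (q≢p : suc q′ ≢ suc m) (q>2 : 2 < suc q′) (p>2 : 2 < suc m) where
    open ZeroSum q′ m prq prp q≢p public

    -- Non-units are rare: f + τλ is annihilated by a given e_i for at most one τ.

    ω-cong : ∀ {f f₁} z → (ZS f → ZS f₁) → (ZS f₁ → ZS f) → ω f z ≡ ω f₁ z
    ω-cong {f} {f₁} z a b = cong (λ t → suc (P *ℕ (t *ℕ 𝟙 (ZS? z)))) (ℕₚ.≤-antisym (𝟙-mono (ZS? f) (ZS? f₁) a) (𝟙-mono (ZS? f₁) (ZS? f) b))

    G : ℕ → X → ℕ
    G D f = ∑ (λ g → 𝟙 (within? f D g) *ℕ ω f g)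

    ∣ind0∣≤1 : ∀ n → ∣ ind0 n ∣ ≤ 1
    ∣ind0∣≤1 zero = ℕₚ.≤-refl
    ∣ind0∣≤1 (suc n) = z≤n

    lam≤2 : ∀ k → ∣ at lam k ∣ ≤ 2
    lam≤2 k = ℕₚ.≤-trans (∣i-j∣≤ (at (x^ (+ 1)) k) (at oneP k)) (ℕₚ.+-mono-≤ (∣ind0∣≤1 (rem (k -ᶻ + 1))) (∣ind0∣≤1 (rem (k -ᶻ + 0))))

    opaque
      unfolding scale
      scale-λ : ∀ a → scale a λX ≡ π (sc a ⋆ lam)
      scale-λ a = π-cong (F.*-congˡ {sc a} (emb-π lam))

    module _ (T : ℕ) (T≤P : T ≤ P) where
      Λ : Fin T → X
      Λ τ = scale (+ toℕ (inject≤ τ T≤P)) λX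

      Λ-ZS : ∀ τ → ZS (Λ τ)
      Λ-ZS τ = subst ZS (sym (trans (cong (scale a) (sym (XM.*-identityʳ λX))) (trans (cong (scale a) (XM.*-comm λX 1X)) (scale-⊗ a 1X λX)))) (ZS-⊗ (scale a 1X) ZS-λ)
        where a = + toℕ (inject≤ τ T≤P)

      shiftE : ℕ
      shiftE = q *ℕ sq (T *ℕ 2)

      Λ-nrm : ∀ τ → nrm (Λ τ) ≤ shiftE
      Λ-nrm τ = ℕₚ.≤-trans (ℕₚ.≤-reflexive (cong nrm (scale-λ a))) (ℕₚ.≤-trans (nrm-π (sc a ⋆ lam)) (ℕₚ.≤-trans (Σℕ-mono q (λ i _ → sq-mono (entry (+ i)))) (ℕₚ.≤-reflexive (Σℕ-const q _))))
        where
        a = + toℕ (inject≤ τ T≤P)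
        entry : ∀ k → ∣ at (sc a ⋆ lam) k ∣ ≤ T *ℕ 2
        entry k = ℕₚ.≤-trans (ℕₚ.≤-reflexive (trans (cong ∣_∣ (sc⋆ a lam k)) (ℤₚ.abs-* a (at lam k)))) (ℕₚ.*-mono-≤ (ℕₚ.≤-trans (ℕₚ.≤-reflexive (Finₚ.toℕ-inject≤ τ T≤P)) (ℕₚ.<⇒≤ (Finₚ.toℕ<n τ))) (lam≤2 k))

      -- Subtracting gives (τ - τ₁) λ e = 0, and λ e ≠ 0 for a nonzero e in X₀.
      unique-τ : ∀ i y τ τ₁ → (y ⊖ Λ τ) ⊗ lookup es i ≡ 0X → (y ⊖ Λ τ₁) ⊗ lookup es i ≡ 0X → τ ≡ τ₁
      unique-τ i y τ τ₁ h h₁ = Finₚ.inject≤-injective T≤P T≤P τ τ₁ (scale-inj _ _ (λX ⊗ e) λe≢0 (trans (scale-⊗ _ λX e) (trans eq (sym (scale-⊗ _ λX e)))))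
        where
        e = lookup es i
        λe≢0 : λX ⊗ e ≢ 0X
        λe≢0 z = proj₁ (proj₂ (es-leaf i)) (λ-kernel e (proj₂ (proj₂ (es-leaf i))) z)
        eq : Λ τ ⊗ e ≡ Λ τ₁ ⊗ e
        eq = trans (XM.solve 3 (λ y l e → l XM.:* e XM.:= y XM.:* e XM.:+ (XM.:- ((y XM.:+ (XM.:- l)) XM.:* e))) refl y (Λ τ) e)
          (trans (cong (y ⊗ e ⊖_) (trans h (sym h₁))) (sym (XM.solve 3 (λ y l e → l XM.:* e XM.:= y XM.:* e XM.:+ (XM.:- ((y XM.:+ (XM.:- l)) XM.:* e))) refl y (Λ τ₁) e)))

      hits : ∀ y → ∑ {Fin T} (λ τ → 𝟙 (nonUnit? (y ⊖ Λ τ))) ≤ q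
      hits y = begin
        ∑ {Fin T} (λ τ → 𝟙 (nonUnit? (y ⊖ Λ τ))) ≤⟨ ∑-mono (λ τ → some (y ⊖ Λ τ) (nonUnit? (y ⊖ Λ τ))) ⟩
        ∑ {Fin T} (λ τ → ∑ {Fin rank} (λ i → 𝟙 (kills? (y ⊖ Λ τ) i))) ≡⟨ ∑-swap _ ⟩
        ∑ {Fin rank} (λ i → ∑ {Fin T} (λ τ → 𝟙 (kills? (y ⊖ Λ τ) i))) ≤⟨ ∑-mono (λ i → count≤1 (λ τ → kills? (y ⊖ Λ τ) i) (unique-τ i y)) ⟩
        ∑ {Fin rank} (λ _ → 1) ≡⟨ card-Fin rank ⟩
        rank ≤⟨ rank≤q ⟩
        q ∎
        where
        open ℕₚ.≤-Reasoning
        some : ∀ f (d : Dec (NonUnit f)) → 𝟙 d ≤ ∑ {Fin rank} (λ i → 𝟙 (kills? f i))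
        some f (no _) = z≤n
        some f (yes (i , h)) = ℕₚ.≤-trans (ℕₚ.≤-reflexive (sym (𝟙-yes (kills? f i) h))) (term≤∑ i (λ i → 𝟙 (kills? f i)))

      negate : ∀ y τ → NonUnit (y ⊕ Λ τ) → NonUnit ((⊝ y) ⊖ Λ τ)
      negate y τ (i , h) = i , trans (XM.solve 3 (λ y l e → ((XM.:- y) XM.:+ (XM.:- l)) XM.:* e XM.:= XM.:- ((y XM.:+ l) XM.:* e)) refl y (Λ τ) (lookup es i)) (trans (cong ⊝_ h) (XM.solve 0 ((XM.:- XM.con (+ 0)) XM.:= XM.con (+ 0)) refl))

      hits₋ : ∀ y → ∑ {Fin T} (λ τ → 𝟙 (nonUnit? (y ⊕ Λ τ))) ≤ q
      hits₋ y = ℕₚ.≤-trans (∑-mono (λ τ → 𝟙-mono (nonUnit? (y ⊕ Λ τ)) (nonUnit? ((⊝ y) ⊖ Λ τ)) (negate y τ))) (hits (⊝ y))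

      G-shift : ∀ D f τ → G D f ≤ G (D +ℕ shiftE) (f ⊕ Λ τ) +ℕ G (D +ℕ shiftE) (f ⊖ Λ τ)
      G-shift D f τ = [ (λ le → ℕₚ.≤-trans (∑-mono (λ g → pt (f ⊕ Λ τ) g le (λ z → ZS-⊕ z (Λ-ZS τ)) (λ z → subst ZS (cancel₊ f (Λ τ)) (ZS-⊕ z (ZS-⊝ (Λ-ZS τ)))))) (ℕₚ.m≤m+n _ _))
        , (λ le → ℕₚ.≤-trans (∑-mono (λ g → pt (f ⊖ Λ τ) g le (λ z → ZS-⊕ z (ZS-⊝ (Λ-ZS τ))) (λ z → subst ZS (cancel₋ f (Λ τ)) (ZS-⊕ z (Λ-ZS τ))))) (ℕₚ.m≤n+m _ (G (D +ℕ shiftE) (f ⊕ Λ τ)))) ]′ (nrm-± f (Λ τ))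
        where
        cancel₊ : ∀ a b → a ⊕ b ⊖ b ≡ a
        cancel₊ = XM.solve 2 (λ a b → a XM.:+ b XM.:+ (XM.:- b) XM.:= a) refl
        cancel₋ : ∀ a b → a ⊖ b ⊕ b ≡ a
        cancel₋ = XM.solve 2 (λ a b → a XM.:+ (XM.:- b) XM.:+ b XM.:= a) refl
        pt : ∀ f₁ g → nrm f₁ ≤ nrm f +ℕ nrm (Λ τ) → (ZS f → ZS f₁) → (ZS f₁ → ZS f) → 𝟙 (within? f D g) *ℕ ω f g ≤ 𝟙 (within? f₁ (D +ℕ shiftE) g) *ℕ ω f₁ g
        pt f₁ g le a b = ℕₚ.*-mono-≤ (𝟙-mono (within? f D g) (within? f₁ (D +ℕ shiftE) g) (λ h → begin
            nrm f₁ +ℕ nrm g ≤⟨ ℕₚ.+-monoˡ-≤ (nrm g) le ⟩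
            nrm f +ℕ nrm (Λ τ) +ℕ nrm g ≡⟨ lem (nrm f) (nrm (Λ τ)) (nrm g) ⟩
            nrm f +ℕ nrm g +ℕ nrm (Λ τ) ≤⟨ ℕₚ.+-mono-≤ h (Λ-nrm τ) ⟩
            D +ℕ shiftE ∎)) (ℕₚ.≤-reflexive (ω-cong g a b))
          where
          open ℕₚ.≤-Reasoning
          lem : ∀ a b c → a +ℕ b +ℕ c ≡ a +ℕ c +ℕ b
          lem = solveℕ-∀

      -- Double counting over τ: every non-unit f moves to some y = f ± τλ in the enlarged ball, and
      -- for each sign at most q values of τ lead from a given y back to a non-unit.
      nonunit-count : ∀ D → T *ℕ ∑ (λ f → 𝟙 (nonUnit? f) *ℕ G D f) ≤ 2 *ℕ (q *ℕ Ω (D +ℕ shiftE))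
      nonunit-count D = begin
        T *ℕ ∑ (λ f → H f *ℕ G D f) ≡⟨ trans (cong (_*ℕ ∑ (λ f → H f *ℕ G D f)) (sym (card-Fin T))) (sym (∑-const {Fin T} (∑ (λ f → H f *ℕ G D f)))) ⟩
        ∑ {Fin T} (λ τ → ∑ (λ f → H f *ℕ G D f)) ≤⟨ ∑-mono perτ ⟩
        ∑ {Fin T} (λ τ → ∑ (λ y → H (y ⊖ Λ τ) *ℕ G′ y) +ℕ ∑ (λ y → H (y ⊕ Λ τ) *ℕ G′ y)) ≡⟨ ∑-+ _ _ ⟩
        ∑ {Fin T} (λ τ → ∑ (λ y → H (y ⊖ Λ τ) *ℕ G′ y)) +ℕ ∑ {Fin T} (λ τ → ∑ (λ y → H (y ⊕ Λ τ) *ℕ G′ y)) ≤⟨ ℕₚ.+-mono-≤ (side (λ y τ → y ⊖ Λ τ) hits) (side (λ y τ → y ⊕ Λ τ) hits₋) ⟩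
        q *ℕ Ω (D +ℕ shiftE) +ℕ q *ℕ Ω (D +ℕ shiftE) ≡⟨ cong (q *ℕ Ω (D +ℕ shiftE) +ℕ_) (sym (ℕₚ.+-identityʳ (q *ℕ Ω (D +ℕ shiftE)))) ⟩
        2 *ℕ (q *ℕ Ω (D +ℕ shiftE)) ∎
        where
        open ℕₚ.≤-Reasoning
        H : X → ℕ
        H f = 𝟙 (nonUnit? f)
        G′ : X → ℕ
        G′ = G (D +ℕ shiftE)
        cancel₊ : ∀ a b → a ⊕ b ⊖ b ≡ a
        cancel₊ = XM.solve 2 (λ a b → a XM.:+ b XM.:+ (XM.:- b) XM.:= a) refl
        cancel₋ : ∀ a b → a ⊖ b ⊕ b ≡ a
        cancel₋ = XM.solve 2 (λ a b → a XM.:+ (XM.:- b) XM.:+ b XM.:= a) refl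
        perτ : ∀ τ → ∑ (λ f → H f *ℕ G D f) ≤ ∑ (λ y → H (y ⊖ Λ τ) *ℕ G′ y) +ℕ ∑ (λ y → H (y ⊕ Λ τ) *ℕ G′ y)
        perτ τ = ℕₚ.≤-trans (∑-mono (λ f → ℕₚ.≤-trans (ℕₚ.*-monoʳ-≤ (H f) (G-shift D f τ)) (ℕₚ.≤-reflexive (ℕₚ.*-distribˡ-+ (H f) (G′ (f ⊕ Λ τ)) (G′ (f ⊖ Λ τ))))))
          (ℕₚ.≤-trans (ℕₚ.≤-reflexive (∑-+ (λ f → H f *ℕ G′ (f ⊕ Λ τ)) (λ f → H f *ℕ G′ (f ⊖ Λ τ)))) (ℕₚ.+-mono-≤
            (∑-inj-on (λ f → f ⊕ Λ τ) _ (λ y → H (y ⊖ Λ τ) *ℕ G′ y) (λ f → ℕₚ.≤-reflexive (cong (λ t → H t *ℕ G′ (f ⊕ Λ τ)) (sym (cancel₊ f (Λ τ)))))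
              (λ f g _ _ e → trans (sym (cancel₊ f (Λ τ))) (trans (cong (_⊖ Λ τ) e) (cancel₊ g (Λ τ)))))
            (∑-inj-on (λ f → f ⊖ Λ τ) _ (λ y → H (y ⊕ Λ τ) *ℕ G′ y) (λ f → ℕₚ.≤-reflexive (cong (λ t → H t *ℕ G′ (f ⊖ Λ τ)) (sym (cancel₋ f (Λ τ)))))
              (λ f g _ _ e → trans (sym (cancel₋ f (Λ τ))) (trans (cong (_⊕ Λ τ) e) (cancel₋ g (Λ τ)))))))
        side : (s : X → Fin T → X) → (∀ y → ∑ {Fin T} (λ τ → H (s y τ)) ≤ q) → ∑ {Fin T} (λ τ → ∑ (λ y → H (s y τ) *ℕ G′ y)) ≤ q *ℕ Ω (D +ℕ shiftE)
        side s h = ℕₚ.≤-trans (ℕₚ.≤-reflexive (trans (∑-swap _) (∑-cong (λ y → ∑-*ʳ (G′ y) _)))) (ℕₚ.≤-trans (∑-mono (λ y → ℕₚ.*-monoˡ-≤ (G′ y) (h y))) (ℕₚ.≤-reflexive (∑-* q G′)))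

    -- Orbits of ± xⁱ

    rot : ℤ → X → X
    rot c f = π (x^ c) ⊗ f

    rot-π : ∀ c f → rot c f ≡ π (x^ c ⋆ emb f)
    rot-π c f = emb-inj (F.≈trans (emb-⊗ (π (x^ c)) f) (F.≈trans (F.*-congʳ {emb f} (emb-π (x^ c))) (F.≈sym (emb-π (x^ c ⋆ emb f)))))

    emb-rot : ∀ c f k → Cong (+ P) (at (emb (rot c f)) k) (at (emb f) (k -ᶻ c))
    emb-rot c f k = cong-trans (ap (F.≈trans (emb-cong (rot-π c f)) (emb-π (x^ c ⋆ emb f))) k) (cong-≡ (x^⋆ c (emb f) k))

    Σℕ-Sn : ∀ n (g : ℕ → ℕ) (G : ℤ → ℤ) → (∀ i → G (+ i) ≡ + g i) → + Σℕ n g ≡ Sn n G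
    Σℕ-Sn zero g G h = refl
    Σℕ-Sn (suc n) g G h = trans (ℤₚ.pos-+ (Σℕ n g) (g n)) (cong₂ _+ᶻ_ (Σℕ-Sn n g G h) (sym (h n)))

    nrm-rot : ∀ c f → nrm (rot c f) ≤ nrm f
    nrm-rot c f = ℕₚ.≤-trans (ℕₚ.≤-reflexive (cong nrm (rot-π c f))) (ℕₚ.≤-trans (nrm-π (x^ c ⋆ emb f)) (ℕₚ.≤-reflexive (ℤₚ.+-injective (trans
      (Σℕ-Sn q _ (λ k → A (k -ᶻ c)) (λ j → cong (λ t → + sq ∣ t ∣) (sym (x^⋆ c (emb f) (+ j)))))
      (trans (S-shift {A} (λ k → cong (λ t → + sq ∣ t ∣) (per (emb f) k)) (-ᶻ c)) (trans (sym (Σℕ-Sn q _ A (λ j → refl))) (cong +_ (sym (nrm-emb f)))))))))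
      where
      A : ℤ → ℤ
      A k = + sq ∣ at (emb f) k ∣

    nrm-⊝ : ∀ f → nrm (⊝ f) ≤ nrm f
    nrm-⊝ f = ℕₚ.≤-trans (ℕₚ.≤-reflexive (cong nrm (⊝-def f))) (ℕₚ.≤-trans (nrm-π (neg (emb f))) (ℕₚ.≤-reflexive (trans (Σℕ-cong q (λ i _ → cong sq (ℤₚ.∣-i∣≡∣i∣ (at (emb f) (+ i))))) (sym (nrm-emb f)))))

    NonConst : X → Set
    NonConst f = λX ⊗ f ≢ 0X

    -- Some multiple of t is 1 modulo q, so 1 is a period as well.
    periodic-const : ∀ f t → ¬ Cong (+ q) t (+ 0) → (∀ k → Cong (+ P) (at (emb f) k) (at (emb f) (k +ᶻ t))) → λX ⊗ f ≡ 0X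
    periodic-const f t nz h = by (inverse-mod prq t nz)
      where
      g = emb f
      many : ∀ n k → Cong (+ P) (at g k) (at g (k +ᶻ + n *ᶻ t))
      many zero k = cong-≡ (cong (at g) (lem k t))
        where
        lem : ∀ k t → k ≡ k +ᶻ + 0 *ᶻ t
        lem = solve-∀
      many (suc n) k = cong-trans (many n k) (cong-trans (h (k +ᶻ + n *ᶻ t)) (cong-≡ (cong (at g) (lem k (+ n) t))))
        where
        lem : ∀ k n t → (k +ᶻ n *ᶻ t) +ᶻ t ≡ k +ᶻ (+ 1 +ᶻ n) *ᶻ t
        lem = solve-∀
      by : (∃ λ d → Cong (+ q) (t *ᶻ d) (+ 1)) → λX ⊗ f ≡ 0X
      by (d , c) = emb-inj (F.≈trans (emb-⊗ λX f) (F.≈trans (F.*-congʳ {g} (emb-π lam)) (F.≈trans (pw zer) (F.≈sym emb-0))))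
        where
        n = rem d
        c′ : Cong (+ q) (+ n *ᶻ t) (+ 1)
        c′ = cong-trans (cong-* (cong-sym (rem-Cong d)) (cong-refl {a = t})) (cong-trans (cong-≡ (ℤₚ.*-comm d t)) c)
        step : ∀ k → Cong (+ P) (at g k) (at g (k +ᶻ + 1))
        step k = cong-trans (many n k) (cong-≡ (per-Cong (per g) (cong-+ (cong-refl {a = k}) c′)))
        lem : ∀ k → (k -ᶻ + 1) +ᶻ + 1 ≡ k
        lem = solve-∀
        zer : ∀ k → Cong (+ P) (at (lam ⋆ g) k) (+ 0)
        zer k = cong-trans (cong-≡ (lam⋆ g k)) (Cong-diff (cong-trans (step (k -ᶻ + 1)) (cong-≡ (cong (at g) (lem k)))))

    signed : Bool → X → X
    signed true x = x
    signed false x = ⊝ x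

    sgn : Bool → ℤ
    sgn true = + 1
    sgn false = -ᶻ + 1

    emb-signed : ∀ s x k → Cong (+ P) (at (emb (signed s x)) k) (sgn s *ᶻ at (emb x) k)
    emb-signed true x k = cong-≡ (sym (ℤₚ.*-identityˡ (at (emb x) k)))
    emb-signed false x k = cong-trans (ap (emb-⊝ x) k) (cong-≡ (lem (at (emb x) k)))
      where
      lem : ∀ a → -ᶻ a ≡ (-ᶻ + 1) *ᶻ a
      lem = solve-∀

    2≢0q : ¬ Cong (+ q) (+ 2) (+ 0)
    2≢0q = odd-prime prq q>2

    2≢0p : ¬ Cong (+ P) (+ 2) (+ 0)
    2≢0p = odd-prime prp p>2

    act : Bool × Fin q → X → X
    act (s , i) f = signed s (rot (+ toℕ i) f)

    -- Equal signs give the period i - j, opposite signs the period 2 (i - j). If i ≠ j, both are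
    -- nonzero modulo the odd prime q and f would be constant. If i = j, opposite signs mean f = -f,
    -- so f = 0 as p is odd.
    act-inj : ∀ f → NonConst f → ∀ a b → act a f ≡ act b f → a ≡ b
    act-inj f nc (s , i) (t , j) e = by s t (i Finₚ.≟ j) base
      where
      g = emb f
      I = + toℕ i
      J = + toℕ j
      base : ∀ k → Cong (+ P) (sgn s *ᶻ at g (k -ᶻ I)) (sgn t *ᶻ at g (k -ᶻ J))
      base k = cong-trans (cong-sym (cong-trans (emb-signed s (rot (+ toℕ i) f) k) (cong-* (cong-refl {a = sgn s}) (emb-rot (+ toℕ i) f k))))
        (cong-trans (ap (emb-cong e) k) (cong-trans (emb-signed t (rot (+ toℕ j) f) k) (cong-* (cong-refl {a = sgn t}) (emb-rot (+ toℕ j) f k))))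
      i≢j⇒ : i ≢ j → ¬ Cong (+ q) (I -ᶻ J) (+ 0)
      i≢j⇒ ne c = ne (Finₚ.toℕ-injective (residue-unique (Finₚ.toℕ<n i) (Finₚ.toℕ<n j) (Cong-undiff {+ q} {I} {J} c)))
      lem₁ : ∀ k i → (k +ᶻ i) -ᶻ i ≡ k
      lem₁ = solve-∀
      lem₂ : ∀ k i j → (k +ᶻ i) -ᶻ j ≡ k +ᶻ (i -ᶻ j)
      lem₂ = solve-∀
      at-k : ∀ {s t} → (∀ k → Cong (+ P) (sgn s *ᶻ at g (k -ᶻ I)) (sgn t *ᶻ at g (k -ᶻ J))) → ∀ k → Cong (+ P) (sgn s *ᶻ at g k) (sgn t *ᶻ at g (k +ᶻ (I -ᶻ J)))
      at-k {s} {t} h k = subst₂ (λ a b → Cong (+ P) (sgn s *ᶻ at g a) (sgn t *ᶻ at g b)) (lem₁ k I) (lem₂ k I J) (h (k +ᶻ I))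
        where open import Relation.Binary.PropositionalEquality using (subst₂)
      plus : ∀ {a b} → Cong (+ P) (+ 1 *ᶻ a) (+ 1 *ᶻ b) → Cong (+ P) a b
      plus {a} {b} c = cong-trans (cong-≡ (sym (ℤₚ.*-identityˡ a))) (cong-trans c (cong-≡ (ℤₚ.*-identityˡ b)))
      minus : ∀ {a b} → Cong (+ P) (-ᶻ + 1 *ᶻ a) (-ᶻ + 1 *ᶻ b) → Cong (+ P) a b
      minus {a} {b} c = cong-trans (cong-≡ (lem a)) (cong-trans (cong-neg c) (cong-≡ (sym (lem b))))
        where
        lem : ∀ a → a ≡ -ᶻ (-ᶻ + 1 *ᶻ a)
        lem = solve-∀
      flip : ∀ {a b} → Cong (+ P) (+ 1 *ᶻ a) (-ᶻ + 1 *ᶻ b) → Cong (+ P) a (-ᶻ b)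
      flip {a} {b} c = cong-trans (cong-≡ (sym (ℤₚ.*-identityˡ a))) (cong-trans c (cong-≡ (lem b)))
        where
        lem : ∀ a → -ᶻ + 1 *ᶻ a ≡ -ᶻ a
        lem = solve-∀
      flip′ : ∀ {a b} → Cong (+ P) (-ᶻ + 1 *ᶻ a) (+ 1 *ᶻ b) → Cong (+ P) a (-ᶻ b)
      flip′ {a} {b} c = cong-trans (cong-≡ (lem a)) (cong-trans (cong-neg c) (cong-≡ (cong -ᶻ_ (ℤₚ.*-identityˡ b))))
        where
        lem : ∀ a → a ≡ -ᶻ (-ᶻ + 1 *ᶻ a)
        lem = solve-∀
      same-sign : (∀ k → Cong (+ P) (at g k) (at g (k +ᶻ (I -ᶻ J)))) → i ≢ j → ⊥
      same-sign h ne = nc (periodic-const f (I -ᶻ J) (i≢j⇒ ne) h)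
      opposite : (∀ k → Cong (+ P) (at g k) (-ᶻ at g (k +ᶻ (I -ᶻ J)))) → Dec (i ≡ j) → ⊥
      opposite h (no ne) = nc (periodic-const f (+ 2 *ᶻ (I -ᶻ J)) (λ c → [ 2≢0q , i≢j⇒ ne ]′ (Cong-prime prq (+ 2) (I -ᶻ J) c))
        (λ k → cong-trans (h k) (cong-trans (cong-neg (h (k +ᶻ (I -ᶻ J)))) (cong-≡ (trans (ℤₚ.neg-involutive _) (cong (at g) (lem k (I -ᶻ J))))))))
        where
        lem : ∀ k t → (k +ᶻ t) +ᶻ t ≡ k +ᶻ + 2 *ᶻ t
        lem = solve-∀
      opposite h (yes refl) = nc (trans (cong (λX ⊗_) f≡0) (XM.zeroʳ λX))
        where
        lem : ∀ k i → k +ᶻ (i -ᶻ i) ≡ k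
        lem = solve-∀
        lem₂′ : ∀ a → + 2 *ᶻ a ≡ a -ᶻ (-ᶻ a)
        lem₂′ = solve-∀
        f≡0 : f ≡ 0X
        f≡0 = emb-inj (F.≈trans (pw λ k → [ (λ c → ⊥-elim (2≢0p c)) , id ]′ (Cong-prime prp (+ 2) (at g k)
          (cong-trans (cong-≡ (lem₂′ (at g k))) (Cong-diff (cong-trans (h k) (cong-≡ (cong (λ t → -ᶻ at g t) (lem k I)))))))) (F.≈sym emb-0))
      by : ∀ s t → Dec (i ≡ j) → (∀ k → Cong (+ P) (sgn s *ᶻ at g (k -ᶻ I)) (sgn t *ᶻ at g (k -ᶻ J))) → (s , i) ≡ (t , j)
      by true true (yes refl) _ = refl
      by false false (yes refl) _ = refl
      by true true (no ne) h = ⊥-elim (same-sign (λ k → plus (at-k {true} {true} h k)) ne)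
      by false false (no ne) h = ⊥-elim (same-sign (λ k → minus (at-k {false} {false} h k)) ne)
      by true false d h = ⊥-elim (opposite (λ k → flip (at-k {true} {false} h k)) d)
      by false true d h = ⊥-elim (opposite (λ k → flip′ (at-k {false} {true} h k)) d)

    nonConst? : ∀ f → Dec (NonConst f)
    nonConst? f = ¬? (λX ⊗ f ≟ 0X)

    rot-undo : ∀ c f → λX ⊗ rot c f ≡ 0X → λX ⊗ f ≡ 0X
    rot-undo c f h = trans (sym (XM.*-identityˡ (λX ⊗ f))) (trans (cong (_⊗ (λX ⊗ f)) (sym inv)) (trans (XM.solve 4 (λ y x l f → (y XM.:* x) XM.:* (l XM.:* f) XM.:= y XM.:* (l XM.:* (x XM.:* f))) refl (π (x^ (-ᶻ c))) (π (x^ c)) λX f)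
      (trans (cong (π (x^ (-ᶻ c)) ⊗_) h) (XM.zeroʳ _))))
      where
      inv : π (x^ (-ᶻ c)) ⊗ π (x^ c) ≡ 1X
      inv = emb-inj (F.≈trans (emb-⊗ _ _) (F.≈trans (F.*-cong (emb-π (x^ (-ᶻ c))) (emb-π (x^ c))) (F.≈trans (pw≡ λ k → trans (x^-+ (-ᶻ c) c k) (cong (λ t → at (x^ t) k) (ℤₚ.+-inverseˡ c))) (F.≈sym emb-1))))

    Hit : ℕ → X → X → Set
    Hit D h f = NonConst f × nrm f +ℕ nrm (f ⊗ h) ≤ D

    hit? : ∀ D h f → Dec (Hit D h f)
    hit? D h f = nonConst? f ×-dec within? f D (f ⊗ h)

    act-hit : ∀ D h f a → Hit D h f → Hit D h (act a f)
    act-hit D h f (s , i) (nc , le) = nc′ s , ℕₚ.≤-trans (ℕₚ.+-mono-≤ (ℕₚ.≤-trans (nrm-s s (rot (+ toℕ i) f)) (nrm-rot (+ toℕ i) f))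
        (ℕₚ.≤-trans (ℕₚ.≤-reflexive (cong nrm (comm s))) (ℕₚ.≤-trans (nrm-s s (rot (+ toℕ i) (f ⊗ h))) (nrm-rot (+ toℕ i) (f ⊗ h))))) le
      where
      nrm-s : ∀ s x → nrm (signed s x) ≤ nrm x
      nrm-s true x = ℕₚ.≤-refl
      nrm-s false x = nrm-⊝ x
      comm : ∀ s → signed s (rot (+ toℕ i) f) ⊗ h ≡ signed s (rot (+ toℕ i) (f ⊗ h))
      comm true = XM.*-assoc (π (x^ (+ toℕ i))) f h
      comm false = XM.solve 3 (λ x f h → (XM.:- (x XM.:* f)) XM.:* h XM.:= XM.:- (x XM.:* (f XM.:* h))) refl (π (x^ (+ toℕ i))) f h
      nc′ : ∀ s → NonConst (signed s (rot (+ toℕ i) f))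
      nc′ true e = nc (rot-undo (+ toℕ i) f e)
      nc′ false e = nc (rot-undo (+ toℕ i) f (trans (XM.solve 2 (λ l x → l XM.:* x XM.:= XM.:- (l XM.:* (XM.:- x))) refl λX (rot (+ toℕ i) f)) (trans (cong ⊝_ e) (XM.solve 0 ((XM.:- XM.con (+ 0)) XM.:= XM.con (+ 0)) refl))))

    Covered : ℕ → X → Set
    Covered D h = ∃ λ f → Hit D h f

    covered? : ∀ D h → Dec (Covered D h)
    covered? D h = ∃? (hit? D h)

    -- An h covered by f is covered by all 2 q distinct elements ± xⁱ f. This is the saved factor n
    -- = 2 q.
    orbit-count : ∀ D → 2 *ℕ q *ℕ ∑ (λ h → 𝟙 (covered? D h)) ≤ ∑ (λ f → 𝟙 (nonConst? f) *ℕ ∑ (λ h → 𝟙 (within? f D (f ⊗ h))))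
    orbit-count D = begin
      2 *ℕ q *ℕ ∑ (λ h → 𝟙 (covered? D h)) ≡⟨ ∑-* (2 *ℕ q) _ ⟨
      ∑ (λ h → 2 *ℕ q *ℕ 𝟙 (covered? D h)) ≤⟨ ∑-mono (λ h → perh h (covered? D h)) ⟩
      ∑ (λ h → ∑ (λ f → 𝟙 (hit? D h f))) ≡⟨ ∑-swap _ ⟩
      ∑ (λ f → ∑ (λ h → 𝟙 (hit? D h f))) ≡⟨ ∑-cong (λ f → trans (∑-cong (λ h → 𝟙-× (nonConst? f) (within? f D (f ⊗ h)))) (∑-* (𝟙 (nonConst? f)) _)) ⟩
      ∑ (λ f → 𝟙 (nonConst? f) *ℕ ∑ (λ h → 𝟙 (within? f D (f ⊗ h)))) ∎
      where
      open ℕₚ.≤-Reasoning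
      card-B×F : card (Bool × Fin q) ≡ 2 *ℕ q
      card-B×F = trans (card-× {Bool} {Fin q}) (cong₂ _*ℕ_ (∑-Bool (λ _ → 1)) (card-Fin q))
      perh : ∀ h (d : Dec (Covered D h)) → 2 *ℕ q *ℕ 𝟙 d ≤ ∑ (λ f → 𝟙 (hit? D h f))
      perh h (no _) = ℕₚ.≤-trans (ℕₚ.≤-reflexive (ℕₚ.*-zeroʳ (2 *ℕ q))) z≤n
      perh h (yes (f , hit)) = ℕₚ.≤-trans (ℕₚ.≤-reflexive (trans (ℕₚ.*-identityʳ (2 *ℕ q)) (sym card-B×F)))
        (∑-inj-on (λ a → act a f) (λ _ → 1) (λ f → 𝟙 (hit? D h f)) (λ a → ℕₚ.≤-reflexive (sym (𝟙-yes (hit? D h (act a f)) (act-hit D h f a hit)))) (λ a b _ _ → act-inj f (proj₁ hit) a b))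

-- Counting the multipliers h that are ruled out

module CoveredMultipliers where
  open FiniteCounting
  open PeriodicConvolution
  open CyclicPowers
  open CyclicDomain
  open FiniteGroupAlgebra
  open LatticePoints
  open SignedOrbits
  import Data.Integer.Properties as ℤₚ
  import Data.Nat as ℕ
  import Data.Nat.Properties as ℕₚ
  open import Data.Bool using (Bool; true; false)
  open import Data.Empty using (⊥; ⊥-elim)
  open import Data.Fin using (Fin; zero; suc; toℕ)
  open import Data.Integer using (ℤ; +_; ∣_∣) renaming (_*_ to _*ᶻ_; _-_ to _-ᶻ_; -_ to -ᶻ_)
  open import Data.Integer.Tactic.RingSolver using (solve-∀)
  open import Data.Nat using (ℕ; zero; suc; _∸_; _<_; _≤_; _≤?_; _<?_; z≤n; s≤s) renaming (_+_ to _+ℕ_; _*_ to _*ℕ_; _^_ to _^ℕ_)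
  open import Data.Nat.Divisibility using (_∣_)
  open import Data.Nat.Primality using (Prime)
  open import Data.Nat.Tactic.RingSolver using () renaming (solve-∀ to solveℕ-∀)
  open import Data.Product using (∃; _×_; _,_; proj₁; proj₂)
  open import Data.Sum using ([_,_]′)
  open import Data.Vec using (Vec; []; _∷_; lookup)
  open import Data.Vec using (tail)
  open import Relation.Binary.PropositionalEquality using (_≡_; _≢_; refl; sym; trans; cong; cong₂; subst)
  open import Relation.Nullary using (¬_; Dec; yes; no; _×-dec_; ¬?)

  vsum-const : ∀ {A : Set} {n} (g : A → ℕ) c (x : Vec A n) → (∀ i → g (lookup x i) ≡ c) → vsum g x ≡ n *ℕ c
  vsum-const g c [] h = refl
  vsum-const g c (a ∷ x) h = cong₂ _+ℕ_ (h zero) (vsum-const g c x (λ i → h (suc i)))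

  vsum-+ : ∀ {A : Set} {n} (g h : A → ℕ) (x : Vec A n) → vsum (λ a → g a +ℕ h a) x ≡ vsum g x +ℕ vsum h x
  vsum-+ g h [] = refl
  vsum-+ g h (a ∷ x) = trans (cong (g a +ℕ h a +ℕ_) (vsum-+ g h x)) (lem (g a) (h a) (vsum g x) (vsum h x))
    where
    lem : ∀ a b c d → a +ℕ b +ℕ (c +ℕ d) ≡ a +ℕ c +ℕ (b +ℕ d)
    lem = solveℕ-∀

  am-gm : ∀ ν a → a *ℕ (2 *ℕ ν) ≤ sq a +ℕ sq ν
  am-gm ν a = [ (λ le → go a ν le) , (λ le → ℕₚ.≤-trans (ℕₚ.≤-reflexive (lem a ν)) (ℕₚ.≤-trans (go ν a le) (ℕₚ.≤-reflexive (ℕₚ.+-comm (sq ν) (sq a))))) ]′ (ℕₚ.≤-total a ν)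
    where
    lem : ∀ a ν → a *ℕ (2 *ℕ ν) ≡ ν *ℕ (2 *ℕ a)
    lem = solveℕ-∀
    go : ∀ a ν → a ≤ ν → a *ℕ (2 *ℕ ν) ≤ sq a +ℕ sq ν
    go a ν le = subst (λ t → a *ℕ (2 *ℕ t) ≤ sq a +ℕ sq t) (ℕₚ.m+[n∸m]≡n le) (ℕₚ.≤-trans (ℕₚ.m≤m+n _ (sq (ν ∸ a))) (ℕₚ.≤-reflexive (eq a (ν ∸ a))))
      where
      eq : ∀ a d → a *ℕ (2 *ℕ (a +ℕ d)) +ℕ d *ℕ d ≡ a *ℕ a +ℕ (a +ℕ d) *ℕ (a +ℕ d)
      eq = solveℕ-∀

  module Selection (q′ m : ℕ) (prq : Prime (suc q′)) (prp : Prime (suc m)) (q≢p : suc q′ ≢ suc m) (q>2 : 2 < suc q′) (p>2 : 2 < suc m) where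
    open Orbits q′ m prq prp q≢p q>2 p>2 public

    -- Constant codewords

    const-lookup : ∀ f → λX ⊗ f ≡ 0X → ∀ i → lookup f i ≡ lookup f zero
    const-lookup f h i = trans (sym (res-lift (lookup f i))) (trans (Cong⇒res≡ m (cong-trans (cong-≡ (sym (emb-at f i))) (cong-trans (lam-zero⇒const (emb f) zer (+ toℕ i)) (cong-≡ (emb-at f zero))))) (res-lift (lookup f zero)))
      where
      zer : lam ⋆ emb f ≈[ + P ] zeroP
      zer = F.≈trans (F.≈sym (F.≈trans (emb-⊗ λX f) (F.*-congʳ {emb f} (emb-π lam)))) (F.≈trans (emb-cong h) emb-0)

    const-nrm : ∀ f → λX ⊗ f ≡ 0X → nrm f ≡ q *ℕ sq (abs (lookup f zero))
    const-nrm f h = vsum-const _ _ f (λ i → cong (λ a → sq (abs a)) (const-lookup f h i))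

    const-product : ∀ f h → λX ⊗ f ≡ 0X → Cong (+ P) (lift (lookup (f ⊗ h) zero)) (lift (lookup f zero) *ᶻ σ (emb h))
    const-product f h z = cong-trans (cong-≡ (sym (emb-at (f ⊗ h) zero))) (cong-trans (ap (emb-⊗ f h) (+ 0)) (cong-trans (ap (F.*-congʳ {emb h} cf) (+ 0)) (cong-≡ (const⋆ (lift (lookup f zero)) (emb h) (+ 0)))))
      where
      cf : emb f ≈[ + P ] const (lift (lookup f zero))
      cf = residuesF {+ P} {emb f} {const (lift (lookup f zero))} (λ i → cong-≡ (trans (emb-at f i) (cong lift (const-lookup f z i))))

    ConstHit : ℕ → X → X → Set
    ConstHit D h f = λX ⊗ f ≡ 0X × f ≢ 0X × nrm f +ℕ nrm (f ⊗ h) ≤ D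

    constHit? : ∀ D h f → Dec (ConstHit D h f)
    constHit? D h f = (λX ⊗ f ≟ 0X) ×-dec (¬? (f ≟ 0X) ×-dec within? f D (f ⊗ h))

    ConstCovered : ℕ → X → Set
    ConstCovered D h = ∃ λ f → ConstHit D h f

    constCovered? : ∀ D h → Dec (ConstCovered D h)
    constCovered? D h = ∃? (constHit? D h)

    module _ (D r : ℕ) (D<q[1+r] : D < q *ℕ suc r) where
      private
        T : Set
        T = (Fin P × Fin P) × X₀
        target : T → ℕ
        target ((a , b) , _) = 𝟙 (sq (abs a) +ℕ sq (abs b) ≤? r)
        A B : Bool → ∀ h → ConstCovered D h → ℤ
        A s h (f , _) = sgn s *ᶻ lift (lookup f zero)
        B s h (f , _) = sgn s *ᶻ lift (lookup (f ⊗ h) zero)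
        φ′ : Bool → ∀ h → Dec (ConstCovered D h) → T
        φ′ s h (yes c) = (res m (A s h c) , res m (B s h c)) , tail h
        φ′ s h (no _) = (zero , zero) , tail h
        φ : Bool × X → T
        φ (s , h) = φ′ s h (constCovered? D h)
        weight : Bool × X → ℕ
        weight (s , h) = 𝟙 (constCovered? D h)

        ∣sgn∣ : ∀ s a → ∣ sgn s *ᶻ a ∣ ≡ ∣ a ∣
        ∣sgn∣ true a = cong ∣_∣ (ℤₚ.*-identityˡ a)
        ∣sgn∣ false a = trans (cong ∣_∣ (ℤₚ.-1*i≡-i a)) (ℤₚ.∣-i∣≡∣i∣ a)

        bound : ∀ t → weight t ≤ target (φ t)
        bound (s , h) = by (constCovered? D h)
          where
          by : (d : Dec (ConstCovered D h)) → 𝟙 d ≤ target (φ′ s h d)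
          by (no _) = z≤n
          by (yes c@(f , z , _ , le)) = ℕₚ.≤-reflexive (sym (𝟙-yes (sq (abs (res m (A s h c))) +ℕ sq (abs (res m (B s h c))) ≤? r)
            (ℕₚ.≤-trans (ℕₚ.+-mono-≤ (sq-mono (small (lookup f zero))) (sq-mono (small (lookup (f ⊗ h) zero))))
              (ℕₚ.≤-pred (ℕₚ.*-cancelˡ-< q (sq (abs (lookup f zero)) +ℕ sq (abs (lookup (f ⊗ h) zero))) (suc r) (ℕₚ.≤-<-trans (ℕₚ.≤-reflexive (trans (ℕₚ.*-distribˡ-+ q (sq (abs (lookup f zero))) (sq (abs (lookup (f ⊗ h) zero)))) (sym (cong₂ _+ℕ_ (const-nrm f z) (const-nrm (f ⊗ h) zfh))))) (ℕₚ.≤-<-trans le D<q[1+r])))))))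
            where
            small : ∀ a → abs (res m (sgn s *ᶻ lift a)) ≤ abs a
            small a = ℕₚ.≤-trans (abs-minimal (sgn s *ᶻ lift a)) (ℕₚ.≤-reflexive (∣sgn∣ s (lift a)))
            zfh : λX ⊗ (f ⊗ h) ≡ 0X
            zfh = trans (sym (XM.*-assoc λX f h)) (trans (cong (_⊗ h) z) (XM.zeroˡ h))

        A≢0 : ∀ s h c → ¬ Cong (+ P) (A s h c) (+ 0)
        A≢0 s h (f , z , f≢0 , _) c = f≢0 (emb-inj (F.≈trans (residuesF {+ P} {emb f} {zeroP} (λ i → cong-trans (cong-≡ (trans (emb-at f i) (cong lift (const-lookup f z i)))) (zer s c))) (F.≈sym emb-0)))
          where
          a = lift (lookup f zero)
          lem : ∀ a → a ≡ -ᶻ (-ᶻ + 1 *ᶻ a)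
          lem = solve-∀
          zer : ∀ s → Cong (+ P) (sgn s *ᶻ a) (+ 0) → Cong (+ P) a (+ 0)
          zer true c = cong-trans (cong-≡ (sym (ℤₚ.*-identityˡ a))) c
          zer false c = cong-trans (cong-≡ (lem a)) (cong-neg c)

        B≡Aσ : ∀ s h c → Cong (+ P) (B s h c) (A s h c *ᶻ σ (emb h))
        B≡Aσ s h (f , z , _) = cong-trans (cong-* (cong-refl {a = sgn s}) (const-product f h z)) (cong-≡ (sym (ℤₚ.*-assoc (sgn s) (lift (lookup f zero)) (σ (emb h)))))

        same-sign : ∀ s t a → ¬ Cong (+ P) (sgn s *ᶻ a) (+ 0) → Cong (+ P) (sgn s *ᶻ a) (sgn t *ᶻ a) → s ≡ t
        same-sign true true a _ _ = refl
        same-sign false false a _ _ = refl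
        same-sign true false a nz c = ⊥-elim ([ 2≢0p , (λ z → nz (cong-trans (cong-≡ (ℤₚ.*-identityˡ a)) z)) ]′ (Cong-prime prp (+ 2) a (cong-trans (cong-≡ (lem a)) (Cong-diff c))))
          where
          lem : ∀ a → + 2 *ᶻ a ≡ + 1 *ᶻ a -ᶻ -ᶻ + 1 *ᶻ a
          lem = solve-∀
        same-sign false true a nz c = ⊥-elim ([ 2≢0p , (λ z → nz (cong-trans (cong-≡ (ℤₚ.-1*i≡-i a)) (cong-neg z))) ]′ (Cong-prime prp (+ 2) a (cong-trans (cong-≡ (lem a)) (Cong-diff (cong-sym c)))))
          where
          lem : ∀ a → + 2 *ᶻ a ≡ + 1 *ᶻ a -ᶻ -ᶻ + 1 *ᶻ a
          lem = solve-∀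

        inj′ : ∀ s h t g d e → 0 < 𝟙 d → 0 < 𝟙 e → (h ≡ g → ∀ c c₁ → d ≡ yes c → e ≡ yes c₁ → lookup (proj₁ c) zero ≡ lookup (proj₁ c₁) zero) → φ′ s h d ≡ φ′ t g e → (s , h) ≡ (t , g)
        inj′ s h t g (yes c) (yes c₁) _ _ coh e = cong₂ _,_ s≡t h≡g
          where
          Ae : Cong (+ P) (A s h c) (A t g c₁)
          Ae = res≡⇒Cong m (cong (λ x → proj₁ (proj₁ x)) e)
          Be : Cong (+ P) (B s h c) (B t g c₁)
          Be = res≡⇒Cong m (cong (λ x → proj₂ (proj₁ x)) e)
          lem : ∀ a x y → a *ᶻ x -ᶻ a *ᶻ y ≡ a *ᶻ (x -ᶻ y)
          lem = solve-∀
          σe : Cong (+ P) (σ (emb h)) (σ (emb g))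
          σe = [ (λ z → ⊥-elim (A≢0 s h c z)) , Cong-undiff ]′ (Cong-prime prp (A s h c) (σ (emb h) -ᶻ σ (emb g))
            (subst (λ t → Cong (+ P) t (+ 0)) (lem (A s h c) (σ (emb h)) (σ (emb g))) (Cong-diff (cong-trans (cong-sym (B≡Aσ s h c)) (cong-trans Be (cong-trans (B≡Aσ t g c₁) (cong-* (cong-sym Ae) (cong-refl {a = σ (emb g)}))))))))
          h≡g : h ≡ g
          h≡g = same-tail (cong proj₂ e) σe
          s≡t : s ≡ t
          s≡t = same-sign s t (lift (lookup (proj₁ c) zero)) (A≢0 s h c) (cong-trans Ae (cong-≡ (cong (λ a → sgn t *ᶻ lift a) (sym (coh h≡g c c₁ refl refl)))))

        inj : ∀ u v → 0 < weight u → 0 < weight v → φ u ≡ φ v → u ≡ v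
        inj (s , h) (t , g) hu hv e = inj′ s h t g (constCovered? D h) (constCovered? D g) hu hv coh e
          where
          -- The decision procedure selects one f for each h. With that f fixed, the two signs have
          -- different images.
          coh : h ≡ g → ∀ c c₁ → constCovered? D h ≡ yes c → constCovered? D g ≡ yes c₁ → lookup (proj₁ c) zero ≡ lookup (proj₁ c₁) zero
          coh refl c c₁ ec ec₁ = cong (λ c → lookup (proj₁ c) zero) (yes-inj (trans (sym ec) ec₁))
            where
            yes-inj : ∀ {ℓ} {Q : Set ℓ} {a b : Q} → yes a ≡ yes b → a ≡ b
            yes-inj refl = refl

      -- For a constant f with value a the product f h is the constant b = a σ(h), and D < q (r + 1)
      -- forces a² + b² ≤ r. As a ≠ 0, the pair (a, b) yields σ(h) and so h, given its tail. The
      -- pair (-a, -b) does the same, which is the factor 2.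
      const-count : 2 *ℕ ∑ (λ h → 𝟙 (constCovered? D h)) ≤ disc r *ℕ card X₀
      const-count = begin
        2 *ℕ ∑ (λ h → 𝟙 (constCovered? D h)) ≡⟨ cong (∑ (λ h → 𝟙 (constCovered? D h)) +ℕ_) (ℕₚ.+-identityʳ _) ⟩
        ∑ (λ h → 𝟙 (constCovered? D h)) +ℕ ∑ (λ h → 𝟙 (constCovered? D h)) ≡⟨ ∑-Bool (λ _ → ∑ (λ h → 𝟙 (constCovered? D h))) ⟨
        ∑ {Bool} (λ s → ∑ (λ h → 𝟙 (constCovered? D h))) ≡⟨ ∑-× {Bool} {X} weight ⟨
        ∑ weight ≤⟨ ∑-inj-on φ weight target bound inj ⟩
        ∑ target ≡⟨ trans (∑-× {Fin P × Fin P} {X₀} target) (trans (∑-cong {Fin P × Fin P} (λ ab → trans (∑-const {X₀} (𝟙 (sq (abs (proj₁ ab)) +ℕ sq (abs (proj₂ ab)) ≤? r))) (ℕₚ.*-comm (card X₀) _)))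
            (trans (∑-*ʳ {Fin P × Fin P} (card X₀) _) (cong (_*ℕ card X₀) (∑-× {Fin P} {Fin P} (λ ab → 𝟙 (sq (abs (proj₁ ab)) +ℕ sq (abs (proj₂ ab)) ≤? r)))))) ⟩
        disc r *ℕ card X₀ ∎
        where open ℕₚ.≤-Reasoning

    -- Elements with a large annihilator

    hits-of : ℕ → X → ℕ
    hits-of D f = ∑ (λ h → 𝟙 (within? f D (f ⊗ h)))

    hits-far : ∀ D f → ¬ nrm f ≤ D → hits-of D f ≡ 0
    hits-far D f h = trans (∑-cong (λ g → 𝟙-no (within? f D (f ⊗ g)) (λ le → h (ℕₚ.≤-trans (ℕₚ.m≤m+n _ _) le)))) ∑-0

    ω≤ : ∀ f z → ω f z ≤ suc P
    ω≤ f z = s≤s (ℕₚ.≤-trans (ℕₚ.*-monoʳ-≤ P (ℕₚ.*-mono-≤ (𝟙≤1 (ZS? f)) (𝟙≤1 (ZS? z)))) (ℕₚ.≤-reflexive (ℕₚ.*-identityʳ P)))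

    -- The wasteful bound ω ≤ P + 1 is affordable for elements with a large annihilator, where an
    -- exponential slack absorbs it.
    hits-crude : ∀ D f {E} → Shortening f E → hits-of D f ≤ 2 *ℕ (ballX (D +ℕ E) *ℕ suc P)
    hits-crude D f {E} sh = ℕₚ.≤-trans (multiples-count sh D) (ℕₚ.*-monoʳ-≤ 2 (ℕₚ.≤-trans (∑-mono (λ z → ℕₚ.*-mono-≤ (𝟙-mono (within? f (D +ℕ E) z) (ball? (D +ℕ E) z) (ℕₚ.≤-trans (ℕₚ.m≤n+m _ (nrm f)))) (ω≤ f z))) (ℕₚ.≤-reflexive (∑-*ʳ (suc P) _))))

    -- Cauchy-Schwarz, in the form 2 ν |a| ≤ a² + ν² for each entry.
    ‖emb‖≤ : ∀ f ν D → 0 < ν → D ≤ q *ℕ sq ν → nrm f ≤ D → ‖ emb f ‖ ≤ q *ℕ ν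
    ‖emb‖≤ f ν D ν>0 hD le = ℕₚ.*-cancelʳ-≤ _ _ (2 *ℕ ν) {{ℕ.>-nonZero (ℕₚ.≤-trans ν>0 (ℕₚ.m≤m+n ν _))}} (begin
      ‖ emb f ‖ *ℕ (2 *ℕ ν) ≡⟨ cong (_*ℕ (2 *ℕ ν)) (sym (vsum-Σℕ abs f _ (λ i → cong ∣_∣ (emb-at f i)))) ⟩
      vsum abs f *ℕ (2 *ℕ ν) ≡⟨ vsum-*ʳ abs (2 *ℕ ν) f ⟨
      vsum (λ a → abs a *ℕ (2 *ℕ ν)) f ≤⟨ vsum-mono (λ a → am-gm ν (abs a)) f ⟩
      vsum (λ a → sq (abs a) +ℕ sq ν) f ≡⟨ vsum-+ (λ a → sq (abs a)) (λ _ → sq ν) f ⟩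
      nrm f +ℕ vsum (λ _ → sq ν) f ≤⟨ ℕₚ.+-mono-≤ (ℕₚ.≤-trans le hD) (ℕₚ.≤-reflexive (vsum-const (λ _ → sq ν) (sq ν) f (λ _ → refl))) ⟩
      q *ℕ sq ν +ℕ q *ℕ sq ν ≡⟨ lem q ν ⟩
      q *ℕ ν *ℕ (2 *ℕ ν) ∎)
      where
      open ℕₚ.≤-Reasoning
      lem : ∀ q ν → q *ℕ (ν *ℕ ν) +ℕ q *ℕ (ν *ℕ ν) ≡ q *ℕ ν *ℕ (2 *ℕ ν)
      lem = solveℕ-∀

    module _ (D M₀ ν M′ : ℕ) (ν>0 : 0 < ν) (D≤ : D ≤ q *ℕ sq ν) (small : q *ℕ ν *ℕ M′ < P)
      (budget : ∀ M → M₀ < M → M ^ℕ q′ *ℕ suc M′ ^ℕ q′ ≤ P *ℕ card X₀ → 4 *ℕ (suc P *ℕ sq (ballX (D +ℕ radius M))) *ℕ 2 ^ℕ q ≤ card X *ℕ M ^ℕ q′) where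
      Bad : X → Set
      Bad f = NonConst f × ¬ annSize f < suc M₀ ^ℕ q′

      bad? : ∀ f → Dec (Bad f)
      bad? f = nonConst? f ×-dec ¬? (annSize f <? suc M₀ ^ℕ q′)

      module _ (f₀ : X) (bad₀ : Bad f₀) (near₀ : nrm f₀ ≤ D) where
        private
          n<sucn^q′ : ∀ n → n < suc n ^ℕ q′
          n<sucn^q′ n = ℕₚ.≤-trans (ℕₚ.≤-reflexive (sym (ℕₚ.^-identityʳ (suc n)))) (ℕₚ.^-monoʳ-≤ (suc n) (ℕₚ.≤-pred (ℕₚ.<⇒≤ q>2)))

          -- For the least such M the annihilator has between M^(q-1) and (M + 1)^(q-1) elements:
          -- few enough for smoothing at `radius M`, and enough to pay for that radius.
          choice : ∃ λ M → annSize f₀ < suc M ^ℕ q′ × (∀ j → j < M → ¬ annSize f₀ < suc j ^ℕ q′)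
          choice = least (λ M → annSize f₀ <? suc M ^ℕ q′) (annSize f₀) (n<sucn^q′ (annSize f₀))
          M = proj₁ choice
          M-ok = proj₁ (proj₂ choice)

          M₀<M : M₀ < M
          M₀<M = ℕₚ.≰⇒> (λ le → proj₂ bad₀ (ℕₚ.<-≤-trans M-ok (ℕₚ.^-monoˡ-≤ q′ (s≤s le))))

          M^≤ : M ^ℕ q′ ≤ annSize f₀
          M^≤ = go M M₀<M (proj₂ (proj₂ choice))
            where
            go : ∀ M → M₀ < M → (∀ j → j < M → ¬ annSize f₀ < suc j ^ℕ q′) → M ^ℕ q′ ≤ annSize f₀
            go (suc M) _ h = ℕₚ.≮⇒≥ (h M ℕₚ.≤-refl)

          upper : M ^ℕ q′ *ℕ suc M′ ^ℕ q′ ≤ P *ℕ card X₀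
          upper = ℕₚ.≤-trans (ℕₚ.*-monoˡ-≤ (suc M′ ^ℕ q′) M^≤) (annSize-upper f₀ M′ (proj₁ bad₀) (ℕₚ.≤-<-trans (ℕₚ.*-monoˡ-≤ M′ (‖emb‖≤ f₀ ν D ν>0 D≤ near₀)) small))

          E = radius M
          b = pattern-of f₀
          C = 2 *ℕ (ballX (D +ℕ E) *ℕ suc P)
          class? : ∀ f → Dec (pattern-of f ≡ b)
          class? f = pattern-of f ≟ b

          pt : ∀ f → 𝟙 (class? f) *ℕ (𝟙 (bad? f) *ℕ hits-of D f) ≤ 𝟙 (class? f ×-dec ball? D f) *ℕ C
          pt f = by (class? f) (ball? D f)
            where
            by : (d : Dec (pattern-of f ≡ b)) (e : Dec (nrm f ≤ D)) → 𝟙 d *ℕ (𝟙 (bad? f) *ℕ hits-of D f) ≤ 𝟙 (d ×-dec e) *ℕ C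
            by (no _) _ = z≤n
            by (yes _) (no far) = ℕₚ.≤-reflexive (trans (cong (λ t → 1 *ℕ (𝟙 (bad? f) *ℕ t)) (hits-far D f far)) (cong (1 *ℕ_) (ℕₚ.*-zeroʳ (𝟙 (bad? f)))))
            by (yes e) (yes _) = ℕₚ.*-monoʳ-≤ 1 (ℕₚ.≤-trans (ℕₚ.*-monoˡ-≤ (hits-of D f) (𝟙≤1 (bad? f))) (ℕₚ.≤-trans (ℕₚ.≤-reflexive (ℕₚ.*-identityˡ (hits-of D f)))
              (hits-crude D f (short-shortening f M (subst (_< suc M ^ℕ q′) (annSize-pattern f₀ f (sym e)) M-ok)))))

        -- All f of one pattern share the annihilator of f₀. `ideal-count` bounds how many are short
        -- by 2 |ball| / |Ann f₀|, `hits-crude` bounds the h for each of them, and `budget` compares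
        -- the product with |X| / 2^q.
        class-total : ∑ (λ f → 𝟙 (class? f) *ℕ (𝟙 (bad? f) *ℕ hits-of D f)) *ℕ 2 ^ℕ q ≤ card X
        class-total = ℕₚ.*-cancelʳ-≤ _ _ (annSize f₀) {{ℕ.>-nonZero (ℕₚ.<-≤-trans (ℕₚ.m^n>0 M {{ℕ.>-nonZero (ℕₚ.≤-<-trans z≤n M₀<M)}} q′) M^≤)}} (begin
          W *ℕ 2 ^ℕ q *ℕ annSize f₀ ≡⟨ lem₁ W (2 ^ℕ q) (annSize f₀) ⟩
          W *ℕ annSize f₀ *ℕ 2 ^ℕ q ≤⟨ ℕₚ.*-monoˡ-≤ (2 ^ℕ q) (ℕₚ.*-monoˡ-≤ (annSize f₀) (ℕₚ.≤-trans (∑-mono pt) (ℕₚ.≤-reflexive (∑-*ʳ C _)))) ⟩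
          I *ℕ C *ℕ annSize f₀ *ℕ 2 ^ℕ q ≡⟨ cong (_*ℕ 2 ^ℕ q) (lem₁ I C (annSize f₀)) ⟩
          I *ℕ annSize f₀ *ℕ C *ℕ 2 ^ℕ q ≤⟨ ℕₚ.*-monoˡ-≤ (2 ^ℕ q) (ℕₚ.*-monoˡ-≤ C (ideal-count (short-shortening f₀ M M-ok) D class? (λ {x} e u a → same-pattern f₀ x (sym e) (ι u) (ZS-ι u) a))) ⟩
          2 *ℕ ballX (D +ℕ E) *ℕ C *ℕ 2 ^ℕ q ≡⟨ cong (_*ℕ 2 ^ℕ q) (lem₂ (ballX (D +ℕ E)) (suc P)) ⟩
          4 *ℕ (suc P *ℕ sq (ballX (D +ℕ E))) *ℕ 2 ^ℕ q ≤⟨ budget M M₀<M upper ⟩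
          card X *ℕ M ^ℕ q′ ≤⟨ ℕₚ.*-monoʳ-≤ (card X) M^≤ ⟩
          card X *ℕ annSize f₀ ∎)
          where
          open ℕₚ.≤-Reasoning
          W = ∑ (λ f → 𝟙 (class? f) *ℕ (𝟙 (bad? f) *ℕ hits-of D f))
          I = ∑ (λ f → 𝟙 (class? f ×-dec ball? D f))
          lem₁ : ∀ a b c → a *ℕ b *ℕ c ≡ a *ℕ c *ℕ b
          lem₁ = solveℕ-∀
          lem₂ : ∀ x p → 2 *ℕ x *ℕ (2 *ℕ (x *ℕ p)) ≡ 4 *ℕ (p *ℕ (x *ℕ x))
          lem₂ = solveℕ-∀

      -- There are 2^rank ≤ 2^q patterns, and each contributes at most |X| / 2^q.
      bad-total : ∑ (λ f → 𝟙 (bad? f) *ℕ hits-of D f) ≤ card X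
      bad-total = ℕₚ.*-cancelʳ-≤ _ _ (2 ^ℕ q) {{ℕₚ.m^n≢0 2 q}} (begin
        ∑ w *ℕ 2 ^ℕ q ≡⟨ cong (_*ℕ 2 ^ℕ q) (trans (∑-cong (λ f → sym (trans (∑-*ʳ (w f) _) (trans (cong (_*ℕ w f) (trans (∑-cong (λ b → flip≟ f b)) (∑-once (pattern-of f)))) (ℕₚ.*-identityˡ (w f)))))) (∑-swap _)) ⟩
        ∑ (λ b → ∑ (λ f → 𝟙 (pattern-of f ≟ b) *ℕ w f)) *ℕ 2 ^ℕ q ≡⟨ ∑-*ʳ (2 ^ℕ q) _ ⟨
        ∑ {Vec Bool rank} (λ b → ∑ (λ f → 𝟙 (pattern-of f ≟ b) *ℕ w f) *ℕ 2 ^ℕ q) ≤⟨ ∑-mono (λ b → class b (∃? (λ f → (pattern-of f ≟ b) ×-dec (bad? f ×-dec ball? D f)))) ⟩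
        ∑ {Vec Bool rank} (λ b → card X) ≡⟨ trans (∑-const {Vec Bool rank} (card X)) (ℕₚ.*-comm _ (card X)) ⟩
        card X *ℕ card (Vec Bool rank) ≡⟨ cong (card X *ℕ_) (trans (card-Vec {Bool} rank) (cong (_^ℕ rank) (∑-Bool (λ _ → 1)))) ⟩
        card X *ℕ 2 ^ℕ rank ≤⟨ ℕₚ.*-monoʳ-≤ (card X) (ℕₚ.^-monoʳ-≤ 2 rank≤q) ⟩
        card X *ℕ 2 ^ℕ q ∎)
        where
        open ℕₚ.≤-Reasoning
        w : X → ℕ
        w f = 𝟙 (bad? f) *ℕ hits-of D f
        flip≟ : ∀ f b → 𝟙 (pattern-of f ≟ b) ≡ 𝟙 (b ≟ pattern-of f)
        flip≟ f b = ℕₚ.≤-antisym (𝟙-mono (pattern-of f ≟ b) (b ≟ pattern-of f) sym) (𝟙-mono (b ≟ pattern-of f) (pattern-of f ≟ b) sym)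
        class : ∀ b → Dec (∃ λ f → pattern-of f ≡ b × Bad f × nrm f ≤ D) → ∑ (λ f → 𝟙 (pattern-of f ≟ b) *ℕ w f) *ℕ 2 ^ℕ q ≤ card X
        class b (yes (f₀ , refl , bad₀ , near₀)) = class-total f₀ bad₀ near₀
        class b (no none) = ℕₚ.≤-trans (ℕₚ.≤-reflexive (cong (_*ℕ 2 ^ℕ q) (trans (∑-cong zer) ∑-0))) z≤n
          where
          zer : ∀ f → 𝟙 (pattern-of f ≟ b) *ℕ w f ≡ 0
          zer f = by (pattern-of f ≟ b) (bad? f) (ball? D f)
            where
            by : (x : Dec (pattern-of f ≡ b)) (y : Dec (Bad f)) (z : Dec (nrm f ≤ D)) → 𝟙 x *ℕ (𝟙 y *ℕ hits-of D f) ≡ 0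
            by (no _) _ _ = refl
            by (yes _) (no _) _ = refl
            by (yes _) (yes _) (no far) = trans (cong (λ t → 1 *ℕ (1 *ℕ t)) (hits-far D f far)) refl
            by (yes e) (yes bd) (yes nr) = ⊥-elim (none (f , e , bd , nr))

      -- The three terms belong to the three kinds of nonconstant f: units, smoothed without
      -- enlarging the ball; non-units with a small annihilator, smoothed at `radius M₀`; and bad
      -- elements.
      cover-bound : ∀ T (T≤P : T ≤ P) → 2 *ℕ q *ℕ ∑ (λ h → 𝟙 (covered? D h)) ≤ 2 *ℕ Ω D +ℕ (2 *ℕ ∑ (λ f → 𝟙 (nonUnit? f) *ℕ G (D +ℕ radius M₀) f) +ℕ card X)
      cover-bound T T≤P = begin
        2 *ℕ q *ℕ ∑ (λ h → 𝟙 (covered? D h)) ≤⟨ orbit-count D ⟩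
        ∑ (λ f → 𝟙 (nonConst? f) *ℕ hits-of D f) ≤⟨ ∑-mono (λ f → pt f (nonConst? f) (nonUnit? f) (annSize f <? suc M₀ ^ℕ q′) refl) ⟩
        ∑ (λ f → 2 *ℕ G D f +ℕ (2 *ℕ (𝟙 (nonUnit? f) *ℕ G (D +ℕ radius M₀) f) +ℕ 𝟙 (bad? f) *ℕ hits-of D f)) ≡⟨ trans (∑-+ (λ f → 2 *ℕ G D f) _) (cong₂ _+ℕ_ (∑-* 2 (G D)) (trans (∑-+ (λ f → 2 *ℕ (𝟙 (nonUnit? f) *ℕ G (D +ℕ radius M₀) f)) _) (cong (_+ℕ ∑ (λ f → 𝟙 (bad? f) *ℕ hits-of D f)) (∑-* 2 _)))) ⟩
        2 *ℕ Ω D +ℕ (2 *ℕ ∑ (λ f → 𝟙 (nonUnit? f) *ℕ G (D +ℕ radius M₀) f) +ℕ ∑ (λ f → 𝟙 (bad? f) *ℕ hits-of D f)) ≤⟨ ℕₚ.+-monoʳ-≤ (2 *ℕ Ω D) (ℕₚ.+-monoʳ-≤ _ bad-total) ⟩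
        2 *ℕ Ω D +ℕ (2 *ℕ ∑ (λ f → 𝟙 (nonUnit? f) *ℕ G (D +ℕ radius M₀) f) +ℕ card X) ∎
        where
        open ℕₚ.≤-Reasoning
        pt : ∀ f (a : Dec (NonConst f)) (b : Dec (NonUnit f)) (c : Dec (annSize f < suc M₀ ^ℕ q′)) → (annSize f <? suc M₀ ^ℕ q′) ≡ c →
          𝟙 a *ℕ hits-of D f ≤ 2 *ℕ G D f +ℕ (2 *ℕ (𝟙 b *ℕ G (D +ℕ radius M₀) f) +ℕ 𝟙 (bad? f) *ℕ hits-of D f)
        pt f (no _) _ _ _ = z≤n
        pt f (yes _) (no unit) _ _ = ℕₚ.≤-trans (ℕₚ.≤-reflexive (ℕₚ.*-identityˡ (hits-of D f))) (ℕₚ.≤-trans (multiples-count (unit-shortening f unit) D)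
          (ℕₚ.≤-trans (ℕₚ.≤-reflexive (cong (λ t → 2 *ℕ G t f) (ℕₚ.+-identityʳ D))) (ℕₚ.m≤m+n _ _)))
        pt f (yes _) (yes _) (yes nice) _ = ℕₚ.≤-trans (ℕₚ.≤-reflexive (ℕₚ.*-identityˡ (hits-of D f))) (ℕₚ.≤-trans (multiples-count (short-shortening f M₀ nice) D)
          (ℕₚ.≤-trans (ℕₚ.≤-reflexive (cong (2 *ℕ_) (sym (ℕₚ.*-identityˡ (G (D +ℕ radius M₀) f))))) (ℕₚ.≤-trans (ℕₚ.m≤m+n _ _) (ℕₚ.m≤n+m _ (2 *ℕ G D f)))))
        pt f (yes nc) (yes _) (no nn) _ = ℕₚ.≤-trans (ℕₚ.≤-reflexive (cong (_*ℕ hits-of D f) (sym (𝟙-yes (bad? f) (nc , nn))))) (ℕₚ.≤-trans (ℕₚ.m≤n+m _ (2 *ℕ (1 *ℕ G (D +ℕ radius M₀) f))) (ℕₚ.m≤n+m _ (2 *ℕ G D f)))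

    -- Constants rule out at most 3/4 of all h and the other f fewer than 1/4.
    select : ∀ D r → D < q *ℕ suc r → 2 *ℕ disc r ≤ 3 *ℕ P → 4 *ℕ ∑ (λ h → 𝟙 (covered? D h)) < card X → ∃ λ h → ∀ f → f ≢ 0X → D < nrm f +ℕ nrm (f ⊗ h)
    select D r h₁ h₂ h₃ = by (∑-find (λ h → 𝟙 (constCovered? D h) +ℕ 𝟙 (covered? D h)) (λ _ → 1) total)
      where
      open ℕₚ.≤-Reasoning
      a = ∑ (λ h → 𝟙 (constCovered? D h))
      b = ∑ (λ h → 𝟙 (covered? D h))
      lem : ∀ x → 4 *ℕ x ≡ 2 *ℕ (2 *ℕ x)
      lem = solveℕ-∀
      a-bound : 4 *ℕ a ≤ 3 *ℕ card X
      a-bound = begin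
        4 *ℕ a ≡⟨ lem a ⟩
        2 *ℕ (2 *ℕ a) ≤⟨ ℕₚ.*-monoʳ-≤ 2 (const-count D r h₁) ⟩
        2 *ℕ (disc r *ℕ card X₀) ≡⟨ ℕₚ.*-assoc 2 (disc r) (card X₀) ⟨
        2 *ℕ disc r *ℕ card X₀ ≤⟨ ℕₚ.*-monoˡ-≤ (card X₀) h₂ ⟩
        3 *ℕ P *ℕ card X₀ ≡⟨ trans (ℕₚ.*-assoc 3 P (card X₀)) (cong (3 *ℕ_) (sym card-X)) ⟩
        3 *ℕ card X ∎
      total : ∑ (λ h → 𝟙 (constCovered? D h) +ℕ 𝟙 (covered? D h)) < card X
      total = subst (_< card X) (sym (∑-+ (λ h → 𝟙 (constCovered? D h)) (λ h → 𝟙 (covered? D h)))) (ℕₚ.*-cancelˡ-< 4 (a +ℕ b) (card X) (begin-strict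
        4 *ℕ (a +ℕ b) ≡⟨ ℕₚ.*-distribˡ-+ 4 a b ⟩
        4 *ℕ a +ℕ 4 *ℕ b <⟨ ℕₚ.+-mono-≤-< a-bound h₃ ⟩
        3 *ℕ card X +ℕ card X ≡⟨ ℕₚ.+-comm (3 *ℕ card X) (card X) ⟩
        4 *ℕ card X ∎))
      by : (∃ λ h → 𝟙 (constCovered? D h) +ℕ 𝟙 (covered? D h) < 1) → ∃ λ h → ∀ f → f ≢ 0X → D < nrm f +ℕ nrm (f ⊗ h)
      by (h , lt) = h , λ f f≢0 → ℕₚ.≰⇒> (λ le → contra f f≢0 le (λX ⊗ f ≟ 0X))
        where
        contra : ∀ f → f ≢ 0X → nrm f +ℕ nrm (f ⊗ h) ≤ D → Dec (λX ⊗ f ≡ 0X) → ⊥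
        contra f f≢0 le (yes z) = ℕₚ.<⇒≱ lt (ℕₚ.≤-trans (ℕₚ.≤-reflexive (sym (𝟙-yes (constCovered? D h) (f , z , f≢0 , le)))) (ℕₚ.m≤m+n _ _))
        contra f f≢0 le (no nc) = ℕₚ.<⇒≱ lt (ℕₚ.≤-trans (ℕₚ.≤-reflexive (sym (𝟙-yes (covered? D h) (f , nc , le)))) (ℕₚ.m≤n+m _ (𝟙 (constCovered? D h))))

-- Numerical inequalities for the scales

module ScaleEstimates where
  open FiniteGroupAlgebra using (sq; sq-mono)
  open Multiples using (^-*-distrib)
  open import Data.Empty using (⊥-elim)
  open import Data.Nat
  open import Data.Nat.DivMod using (_/_; m/n*n≤m; m≡m%n+[m/n]*n; m%n<n)
  open import Data.Nat.Properties
  open import Data.Nat.Tactic.RingSolver using (solve-∀)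
  open import Data.Product using (∃; _×_; _,_; proj₁; proj₂)
  open import Data.Sum using ([_,_]′)
  open import Relation.Binary.PropositionalEquality using (_≡_; refl; sym; trans; cong; subst)
  open import Relation.Nullary using (yes; no)

  m<[1+m/n]*n : ∀ m n .{{_ : NonZero n}} → m < suc (m / n) * n
  m<[1+m/n]*n m n = ≤-trans (≤-reflexive (cong suc (m≡m%n+[m/n]*n m n))) (+-monoˡ-≤ (m / n * n) (m%n<n m n))

  -- That is, (3/2)^q ≥ 2 q. It accounts for the 3/4 lost to constants.
  3^≥ : ∀ q → 8 ≤ q → 2 ^ q * (2 * q) ≤ 3 ^ q
  3^≥ q h = subst (λ n → 2 ^ n * (2 * n) ≤ 3 ^ n) (m+[n∸m]≡n h) (go (q ∸ 8))
    where
    open ≤-Reasoning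
    go : ∀ k → 2 ^ (8 + k) * (2 * (8 + k)) ≤ 3 ^ (8 + k)
    go zero = ≤ᵇ⇒≤ (2 ^ 8 * 16) (3 ^ 8) _
    go (suc k) = begin
      2 * x * (2 * suc n) ≡⟨ lem x n ⟩
      x * (4 + 4 * n) ≤⟨ *-monoʳ-≤ x (≤-trans (+-monoˡ-≤ (4 * n) (≤-trans (m≤m+n 4 4) (≤-trans (m≤m+n 8 k) (m≤m+n n _)))) (≤-reflexive (lem₂ n))) ⟩
      x * (3 * (2 * n)) ≡⟨ lem₃ x n ⟩
      3 * (x * (2 * n)) ≤⟨ *-monoʳ-≤ 3 (go k) ⟩
      3 * 3 ^ n ∎
      where
      n = 8 + k
      x = 2 ^ n
      lem : ∀ x n → 2 * x * (2 * suc n) ≡ x * (4 + 4 * n)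
      lem = solve-∀
      lem₂ : ∀ n → n + 1 * n + 4 * n ≡ 3 * (2 * n)
      lem₂ = solve-∀
      lem₃ : ∀ x n → x * (3 * (2 * n)) ≡ 3 * (x * (2 * n))
      lem₃ = solve-∀

  linear<2^ : ∀ c a → 0 < c → c * suc a ≤ 2 ^ a → ∀ n → a ≤ n → c * suc n ≤ 2 ^ n
  linear<2^ c a c>0 base n h = subst (λ n → c * suc n ≤ 2 ^ n) (m+[n∸m]≡n h) (go (n ∸ a))
    where
    open ≤-Reasoning
    go : ∀ k → c * suc (a + k) ≤ 2 ^ (a + k)
    go zero = subst (λ n → c * suc n ≤ 2 ^ n) (sym (+-identityʳ a)) base
    go (suc k) = subst (λ n → c * suc n ≤ 2 ^ n) (sym (+-suc a k)) (begin
      c * suc (suc (a + k)) ≡⟨ *-suc c (suc (a + k)) ⟩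
      c + c * suc (a + k) ≤⟨ +-mono-≤ (≤-trans (m≤m*n c (suc (a + k))) (go k)) (go k) ⟩
      2 ^ (a + k) + 2 ^ (a + k) ≡⟨ cong (2 ^ (a + k) +_) (sym (+-identityʳ (2 ^ (a + k)))) ⟩
      2 ^ suc (a + k) ∎)

  log₂ : ∀ q → 0 < q → ∃ λ ℓ → 2 ^ ℓ ≤ q × q < 2 ^ suc ℓ
  log₂ (suc zero) _ = 0 , ≤-refl , s≤s (s≤s z≤n)
  log₂ (suc (suc n)) _ with log₂ (suc n) (s≤s z≤n)
  ... | ℓ , lo , hi with suc (suc n) <? 2 ^ suc ℓ
  ...   | yes lt = ℓ , ≤-trans lo (n≤1+n _) , lt
  ...   | no ≮ = suc ℓ , ≮⇒≥ ≮ , ≤-trans (s≤s hi) (+-mono-≤ (≤-trans (m^n>0 2 (suc ℓ)) ≤-refl) (≤-reflexive (sym (+-identityʳ _))))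

  power≤exponential : ∀ b .{{_ : NonZero b}} c ℓ q → q < b ^ suc ℓ → c * suc ℓ ≤ q → q ^ c ≤ b ^ q
  power≤exponential b c ℓ q hi h = begin
    q ^ c ≤⟨ ^-monoˡ-≤ c (<⇒≤ hi) ⟩
    (b ^ suc ℓ) ^ c ≡⟨ ^-*-assoc b (suc ℓ) c ⟩
    b ^ (suc ℓ * c) ≡⟨ cong (b ^_) (*-comm (suc ℓ) c) ⟩
    b ^ (c * suc ℓ) ≤⟨ ^-monoʳ-≤ b h ⟩
    b ^ q ∎
    where open ≤-Reasoning

  -- With 2^ℓ ≤ q < 2^(ℓ+1) it suffices that 32 (ℓ + 1) ≤ 2^ℓ, which holds for ℓ ≥ 20. The exponent
  -- 32 exceeds every power of q that has to be absorbed later.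
  q³²≤2^q : ∀ q → 2 ^ 20 ≤ q → q ^ 32 ≤ 2 ^ q
  q³²≤2^q q h = by (log₂ q (≤-trans (m^n>0 2 20) h))
    where
    by : (∃ λ ℓ → 2 ^ ℓ ≤ q × q < 2 ^ suc ℓ) → q ^ 32 ≤ 2 ^ q
    by (ℓ , lo , hi) = power≤exponential 2 32 ℓ q hi (≤-trans (linear<2^ 32 20 (≤ᵇ⇒≤ 1 32 _) (≤ᵇ⇒≤ (32 * 21) (2 ^ 20) _) ℓ (≮⇒≥ λ ℓ<20 → <⇒≱ hi (≤-trans (^-monoʳ-≤ 2 ℓ<20) h))) lo)

  sqrt : ∀ p → ∃ λ r → sq r ≤ p × p < sq (suc r)
  sqrt zero = 0 , z≤n , s≤s z≤n
  sqrt (suc p) with sqrt p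
  ... | r , lo , hi with suc p <? sq (suc r)
  ...   | yes lt = r , ≤-trans lo (n≤1+n p) , lt
  ...   | no ≮ = suc r , ≮⇒≥ ≮ , ≤-trans (s≤s hi) (≤-trans (m≤m+n _ (suc (suc (r + r)))) (≤-reflexive (lem r)))
    where
    lem : ∀ r → suc (suc r * suc r) + suc (suc (r + r)) ≡ suc (suc r) * suc (suc r)
    lem = solve-∀

  sq-cancel-≤ : ∀ {a b} → sq a ≤ sq b → a ≤ b
  sq-cancel-≤ {a} {b} h = ≮⇒≥ λ b<a → <⇒≱ (*-mono-< b<a b<a) h

  *-sq : ∀ a b → sq (a * b) ≡ sq a * sq b
  *-sq = lem
    where
    lem : ∀ a b → a * b * (a * b) ≡ a * a * (b * b)
    lem = solve-∀

  ^-sq : ∀ a n → sq (a ^ n) ≡ sq a ^ n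
  ^-sq a n = sym (^-*-distrib a a n)

  sq-+ : ∀ a b → sq (a + b) ≤ 2 * (sq a + sq b)
  sq-+ a b = [ ordered a b , (λ le → subst₂ _≤_ (cong sq (+-comm b a)) (cong (2 *_) (+-comm (sq b) (sq a))) (ordered b a le)) ]′ (≤-total a b)
    where
    open import Relation.Binary.PropositionalEquality using (subst₂)
    lem : ∀ a d → (a + (a + d)) * (a + (a + d)) + d * d ≡ 2 * (a * a + (a + d) * (a + d))
    lem = solve-∀
    ordered : ∀ a b → a ≤ b → sq (a + b) ≤ 2 * (sq a + sq b)
    ordered a b le = subst (λ b → sq (a + b) ≤ 2 * (sq a + sq b)) (m+[n∸m]≡n le) (≤-trans (m≤m+n _ (sq (b ∸ a))) (≤-reflexive (lem a (b ∸ a))))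

  -- r approximates √P; s and t are r / 16 and r / 640 up to a factor of 2. The squared radius of a ball is increased in
  -- steps of s², and a vector v counts as typical when ∑ ⌊ |vᵢ| / t ⌋ exceeds q.
  record Scales (q P : ℕ) : Set where
    field
      q≥ : 2 ^ 20 ≤ q
      P≤q¹¹ : P ≤ q ^ 11
      r s t : ℕ
      r²≤P : sq r ≤ P
      P≤4r² : P ≤ 4 * sq r
      r≥ : 2 ^ 9 * q ^ 4 ≤ r
      s*16≤r : s * 16 ≤ r
      r≤s*32 : r ≤ s * 32
      t*640≤r : t * 640 ≤ r
      r≤t*1280 : r ≤ t * 1280

  scales : ∀ q P → 2 ^ 20 ≤ q → q ^ 9 ≤ P → P ≤ q ^ 11 → Scales q P
  scales q P q≥ lo hi = record { q≥ = q≥ ; P≤q¹¹ = hi ; r = r ; s = r / 16 ; t = r / 640 ; r²≤P = r² ; P≤4r² = P4 ; r≥ = r≥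
    ; s*16≤r = m/n*n≤m r 16 ; r≤s*32 = double 15 big16 ; t*640≤r = m/n*n≤m r 640 ; r≤t*1280 = double 639 big640 }
    where
    r = proj₁ (sqrt P)
    r² : sq r ≤ P
    r² = proj₁ (proj₂ (sqrt P))
    r>0 : 0 < r
    r>0 = go r (proj₂ (proj₂ (sqrt P)))
      where
      go : ∀ r → P < sq (suc r) → 0 < r
      go zero (s≤s lt) = ⊥-elim (<⇒≱ (≤-trans (m^n>0 q {{>-nonZero (≤-trans (m^n>0 2 20) q≥)}} 9) lo) lt)
      go (suc r) _ = s≤s z≤n
    P4 : P ≤ 4 * sq r
    P4 = ≤-trans (<⇒≤ (proj₂ (proj₂ (sqrt P)))) (≤-trans (sq-mono (+-monoˡ-≤ r r>0)) (≤-reflexive (lem r)))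
      where
      lem : ∀ r → (r + r) * (r + r) ≡ 4 * (r * r)
      lem = solve-∀
    r≥ : 2 ^ 9 * q ^ 4 ≤ r
    -- 4 (2⁹ q⁴)² = 2²⁰ q⁸ ≤ q⁹: the place where q ≥ 2²⁰ and P ≥ q⁹ combine.
    r≥ = sq-cancel-≤ (*-cancelˡ-≤ 4 (begin
      4 * sq (2 ^ 9 * q ^ 4) ≡⟨ cong (4 *_) (*-sq (2 ^ 9) (q ^ 4)) ⟩
      4 * (sq (2 ^ 9) * sq (q ^ 4)) ≡⟨ *-assoc 4 (sq (2 ^ 9)) (sq (q ^ 4)) ⟨
      2 ^ 20 * sq (q ^ 4) ≤⟨ *-monoˡ-≤ (sq (q ^ 4)) q≥ ⟩
      q * sq (q ^ 4) ≡⟨ cong (q *_) (^-distribˡ-+-* q 4 4) ⟨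
      q ^ 9 ≤⟨ lo ⟩
      P ≤⟨ P4 ⟩
      4 * sq r ∎))
      where open ≤-Reasoning
    r≥q : q ≤ r
    r≥q = ≤-trans (≤-trans (m≤m*n q (q ^ 3) {{m^n≢0 q 3 {{>-nonZero (≤-trans (m^n>0 2 20) q≥)}}}}) (m≤n*m (q ^ 4) (2 ^ 9))) r≥
    big16 : 16 ≤ r
    big16 = ≤-trans (≤ᵇ⇒≤ 16 (2 ^ 20) _) (≤-trans q≥ r≥q)
    big640 : 640 ≤ r
    big640 = ≤-trans (≤ᵇ⇒≤ 640 (2 ^ 20) _) (≤-trans q≥ r≥q)
    double : ∀ k → suc k ≤ r → r ≤ r / suc k * (suc k + suc k)
    double k h = ≤-trans (<⇒≤ (m<[1+m/n]*n r (suc k))) (≤-trans (*-monoˡ-≤ (suc k) (+-monoˡ-≤ (r / suc k) (pos (r / suc k) (m<[1+m/n]*n r (suc k))))) (≤-reflexive (lem (r / suc k) (suc k))))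
      where
      pos : ∀ d → r < suc d * suc k → 0 < d
      pos zero lt = ⊥-elim (<⇒≱ lt (≤-trans (≤-reflexive (+-identityʳ (suc k))) h))
      pos (suc d) _ = s≤s z≤n
      lem : ∀ d k → (d + d) * k ≡ d * (k + k)
      lem = solve-∀

  module Estimates {q P : ℕ} (sc : Scales q P) where
    open Scales sc public
    open ≤-Reasoning

    q>0 : 0 < q
    q>0 = ≤-trans (m^n>0 2 20) q≥

    instance
      q≢0 : NonZero q
      q≢0 = >-nonZero q>0

    const≤q : ∀ c → c ≤ 2 ^ 20 → c ≤ q
    const≤q c h = ≤-trans h q≥

    q^≤r : ∀ c → c ≤ 2 ^ 9 → c * q ^ 4 ≤ r
    q^≤r c h = ≤-trans (*-monoˡ-≤ (q ^ 4) h) r≥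

    r>0 : 0 < r
    r>0 = ≤-trans (m^n>0 q 4) (≤-trans (≤-reflexive (sym (*-identityˡ (q ^ 4)))) (q^≤r 1 (≤ᵇ⇒≤ 1 (2 ^ 9) _)))

    s>0 : 0 < s
    s>0 = go s r≤s*32
      where
      go : ∀ s → r ≤ s * 32 → 0 < s
      go zero h = ⊥-elim (<⇒≱ r>0 h)
      go (suc s) _ = s≤s z≤n

    t>0 : 0 < t
    t>0 = go t r≤t*1280
      where
      go : ∀ t → r ≤ t * 1280 → 0 < t
      go zero h = ⊥-elim (<⇒≱ r>0 h)
      go (suc t) _ = s≤s z≤n

    r≤P : r ≤ P
    r≤P = ≤-trans (≤-trans (≤-reflexive (sym (*-identityʳ r))) (*-monoʳ-≤ r r>0)) r²≤P

    P>0 : 0 < P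
    P>0 = ≤-trans r>0 r≤P

    -- 128 s² = 2 (8 s)², where 8 s is the base of `ball-count`. The 2 yields a factor 2^q to spare
    -- in dimension 2 q.
    128s² : 128 * sq s ≤ P
    128s² = ≤-trans (*-monoˡ-≤ (sq s) (≤ᵇ⇒≤ 128 256 _)) (≤-trans (≤-reflexive (trans (*-comm 256 (sq s)) (sym (*-sq s 16)))) (≤-trans (sq-mono s*16≤r) r²≤P))

    -- 640 = 2 · 8 · (8 · 5): there are at most (8 t)^q atypical vectors, a ball of squared radius q
    -- (5 r)² has at most (8 · 5 r)^q points, and the 2 yields a factor 2^q to spare.
    640tr : 640 * (t * r) ≤ P
    640tr = ≤-trans (≤-reflexive (trans (sym (*-assoc 640 t r)) (cong (_* r) (*-comm 640 t)))) (≤-trans (*-monoˡ-≤ r t*640≤r) r²≤P)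

    P≤t² : P ≤ 4 * sq 1280 * sq t
    P≤t² = ≤-trans P≤4r² (≤-trans (*-monoʳ-≤ 4 (≤-trans (sq-mono r≤t*1280) (≤-reflexive (trans (*-sq t 1280) (*-comm (sq t) (sq 1280)))))) (≤-reflexive (sym (*-assoc 4 (sq 1280) (sq t)))))

    t²≤P : sq t ≤ P
    t²≤P = ≤-trans (sq-mono (≤-trans (m≤m*n t 640) t*640≤r)) r²≤P

    s²≤r² : sq s ≤ sq r
    s²≤r² = sq-mono (≤-trans (m≤m*n s 16) s*16≤r)

    poly : ∀ k → k ≤ 32 → q ^ k ≤ 2 ^ q
    poly k h = ≤-trans (^-monoʳ-≤ q h) (q³²≤2^q q q≥)

    opaque
      -- T compensates the factor 2 q lost in `nonunit-count` and the factor 2 q + 1 lost in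
      -- `ball-growth`. M₀ is a power of 2 above 4 · 256 · 25, as `256y²` requires.
      T M₀ : ℕ
      T = 2 * q * suc (q + q)
      M₀ = 2 ^ 15

      T≡ : T ≡ 2 * q * suc (q + q)
      T≡ = refl

      M₀≡ : M₀ ≡ 2 ^ 15
      M₀≡ = refl

    T>0 : 0 < T
    T>0 = ≤-trans (*-mono-≤ {1} {2 * q} (≤-trans q>0 (m≤n*m q 2)) (s≤s z≤n)) (≤-reflexive (sym T≡))

    T≤ : T ≤ 6 * sq q
    T≤ = ≤-trans (≤-reflexive T≡) (≤-trans (*-monoʳ-≤ (2 * q) (+-monoˡ-≤ (q + q) q>0)) (≤-reflexive (lem q)))
      where
      lem : ∀ q → 2 * q * (q + (q + q)) ≡ 6 * (q * q)
      lem = solve-∀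

    sqq : sq q ≤ q ^ 4
    sqq = ≤-trans (≤-reflexive (cong (q *_) (sym (*-identityʳ q)))) (^-monoʳ-≤ q (≤ᵇ⇒≤ 2 4 _))

    T≤P : T ≤ P
    T≤P = ≤-trans T≤ (≤-trans (*-monoʳ-≤ 6 sqq) (≤-trans (q^≤r 6 (≤ᵇ⇒≤ 6 (2 ^ 9) _)) r≤P))

    s≥ : 16 * q ^ 4 ≤ s
    s≥ = *-cancelʳ-≤ (16 * q ^ 4) s 32 (≤-trans (≤-reflexive (trans (*-comm (16 * q ^ 4) 32) (sym (*-assoc 32 16 (q ^ 4))))) (≤-trans r≥ r≤s*32))

    -- Smoothing at `radius M₀` and translating by τλ together fit into the single step s² of
    -- `ball-growth`.
    radii : q * sq (q * (2 * M₀)) + q * sq (T * 2) ≤ sq s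
    radii = begin
      q * sq (q * (2 * M₀)) + q * sq (T * 2) ≤⟨ +-mono-≤ part₁ part₂ ⟩
      q ^ 8 + q ^ 8 ≤⟨ +-monoʳ-≤ (q ^ 8) (m≤n*m (q ^ 8) 255) ⟩
      q ^ 8 + 255 * q ^ 8 ≡⟨⟩
      256 * q ^ 8 ≡⟨ cong (256 *_) (^-distribˡ-+-* q 4 4) ⟩
      sq 16 * sq (q ^ 4) ≡⟨ *-sq 16 (q ^ 4) ⟨
      sq (16 * q ^ 4) ≤⟨ sq-mono s≥ ⟩
      sq s ∎
      where
      c₁ : sq (2 * M₀) ≤ q ^ 2
      c₁ = ≤-trans (subst (λ M → sq (2 * M) ≤ 2 ^ 20 * (2 ^ 20 * 1)) (sym M₀≡) (≤ᵇ⇒≤ (sq (2 * 2 ^ 15)) (2 ^ 20 * (2 ^ 20 * 1)) _)) (^-monoˡ-≤ 2 q≥)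
      part₁ : q * sq (q * (2 * M₀)) ≤ q ^ 8
      part₁ = begin
        q * sq (q * (2 * M₀)) ≡⟨ cong (q *_) (*-sq q (2 * M₀)) ⟩
        q * (sq q * sq (2 * M₀)) ≤⟨ *-monoʳ-≤ q (*-monoʳ-≤ (sq q) c₁) ⟩
        q * (sq q * q ^ 2) ≡⟨ cong (λ x → q * (q * x * q ^ 2)) (sym (*-identityʳ q)) ⟩
        q * (q ^ 2 * q ^ 2) ≡⟨ cong (q *_) (^-distribˡ-+-* q 2 2) ⟨
        q ^ 5 ≤⟨ ^-monoʳ-≤ q (≤ᵇ⇒≤ 5 8 _) ⟩
        q ^ 8 ∎
      T2 : T * 2 ≤ q ^ 3
      T2 = ≤-trans (*-monoˡ-≤ 2 T≤) (≤-trans (≤-reflexive (lem q)) (*-monoˡ-≤ (q ^ 2) (const≤q 12 (≤ᵇ⇒≤ 12 (2 ^ 20) _))))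
        where
        lem : ∀ q → 6 * (q * q) * 2 ≡ 12 * (q * (q * 1))
        lem = solve-∀
      part₂ : q * sq (T * 2) ≤ q ^ 8
      part₂ = ≤-trans (*-monoʳ-≤ q (sq-mono T2)) (≤-trans (≤-reflexive (cong (q *_) (sym (^-distribˡ-+-* q 3 3)))) (^-monoʳ-≤ q (≤ᵇ⇒≤ 7 8 _)))

    -- The largest M′ with 5 q r M′ < P. Vectors of the critical ball have ℓ¹ norm at most 5 q r, so
    -- this is the size condition of `annSize-upper`.
    M′ : ℕ
    M′ = (pred P / (5 * (q * r))) {{>-nonZero (*-mono-≤ {1} {5} (≤ᵇ⇒≤ 1 5 _) (*-mono-≤ q>0 r>0))}}

    private
      instance
        5qr≢0 : NonZero (5 * (q * r))
        5qr≢0 = >-nonZero (*-mono-≤ {1} {5} (≤ᵇ⇒≤ 1 5 _) (*-mono-≤ q>0 r>0))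

    M′-small : q * (5 * r) * M′ < P
    M′-small = ≤-trans (s≤s (≤-trans (≤-reflexive (trans (cong (_* M′) (lem q r)) (*-comm (5 * (q * r)) M′))) (m/n*n≤m (pred P) (5 * (q * r))))) (≤-reflexive (suc-pred P {{>-nonZero P>0}}))
      where
      lem : ∀ q r → q * (5 * r) ≡ 5 * (q * r)
      lem = solve-∀

    M′-big : P ≤ suc M′ * (5 * (q * r))
    M′-big = ≤-trans (≤-reflexive (sym (suc-pred P {{>-nonZero P>0}}))) (m<[1+m/n]*n (pred P) (5 * (q * r)))

    2^q′>P : ∀ {q′} → q ≡ suc q′ → P < 2 ^ q′
    2^q′>P {q′} e = *-cancelˡ-< 2 P (2 ^ q′) (subst (λ n → 2 * P < 2 ^ n) e (begin-strict
      2 * P ≤⟨ *-mono-≤ (const≤q 2 (≤ᵇ⇒≤ 2 (2 ^ 20) _)) P≤q¹¹ ⟩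
      q ^ 12 <⟨ ^-monoʳ-< q (≤-trans (≤ᵇ⇒≤ 2 (2 ^ 20) _) q≥) (≤ᵇ⇒≤ 13 32 _) ⟩
      q ^ 32 ≤⟨ q³²≤2^q q q≥ ⟩
      2 ^ q ∎))

    -- On taking (q - 1)-th roots the surplus factor P < 2^(q-1) costs at most 2, so M (M′ + 1) ≤ 2
    -- P; and M′ + 1 ≥ P / (5 q r).
    M-upper : ∀ {q′} → q ≡ suc q′ → ∀ M → M ^ q′ * suc M′ ^ q′ ≤ P * P ^ q′ → M ≤ 10 * (q * r)
    M-upper {q′} e M h = *-cancelʳ-≤ M (10 * (q * r)) P {{>-nonZero P>0}} (begin
      M * P ≤⟨ *-monoʳ-≤ M M′-big ⟩
      M * (suc M′ * (5 * (q * r))) ≡⟨ *-assoc M (suc M′) (5 * (q * r)) ⟨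
      M * suc M′ * (5 * (q * r)) ≤⟨ *-monoˡ-≤ (5 * (q * r)) prod ⟩
      2 * P * (5 * (q * r)) ≡⟨ lem P (q * r) ⟩
      10 * (q * r) * P ∎)
      where
      lem : ∀ p x → 2 * p * (5 * x) ≡ 10 * x * p
      lem = solve-∀
      prod : M * suc M′ ≤ 2 * P
      prod = ≮⇒≥ λ lt → <⇒≱ (2^q′>P e) (*-cancelʳ-≤ (2 ^ q′) P (P ^ q′) {{m^n≢0 P q′ {{>-nonZero P>0}}}} (begin
        2 ^ q′ * P ^ q′ ≡⟨ ^-*-distrib 2 P q′ ⟨
        (2 * P) ^ q′ ≤⟨ ^-monoˡ-≤ q′ (<⇒≤ lt) ⟩
        (M * suc M′) ^ q′ ≡⟨ ^-*-distrib M (suc M′) q′ ⟩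
        M ^ q′ * suc M′ ^ q′ ≤⟨ h ⟩
        P * P ^ q′ ∎))

    -- The ball of squared radius 18 q r² + 4 q³ M² sits inside the one of radius √q y.
    y : ℕ → ℕ
    y M = 5 * r + 2 * (q * M)

    -- After separating the two parts of y, the part 5 r is absorbed by the lower bound on M. In the
    -- part 2 q M one factor M is replaced by 10 q r, and then q⁴ ≤ r suffices.
    ky²≤PM : ∀ k M → 4 * k * 25 ≤ M → 4 * k * 40 ≤ q → M ≤ 10 * (q * r) → k * sq (y M) ≤ P * M
    ky²≤PM k M lo big hi = *-cancelˡ-≤ 2 (begin
      2 * (k * sq (y M)) ≤⟨ *-monoʳ-≤ 2 (*-monoʳ-≤ k (sq-+ (5 * r) (2 * (q * M)))) ⟩
      2 * (k * (2 * (sq (5 * r) + sq (2 * (q * M))))) ≡⟨ eq₁ k (sq (5 * r)) (sq (2 * (q * M))) ⟩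
      4 * k * sq (5 * r) + 4 * k * sq (2 * (q * M)) ≤⟨ +-mono-≤ part₁ part₂ ⟩
      P * M + P * M ≡⟨ cong (P * M +_) (sym (+-identityʳ (P * M))) ⟩
      2 * (P * M) ∎)
      where
      eq₁ : ∀ k a b → 2 * (k * (2 * (a + b))) ≡ 4 * k * a + 4 * k * b
      eq₁ = solve-∀
      part₁ : 4 * k * sq (5 * r) ≤ P * M
      part₁ = begin
        4 * k * sq (5 * r) ≡⟨ cong (4 * k *_) (*-sq 5 r) ⟩
        4 * k * (25 * sq r) ≡⟨ *-assoc (4 * k) 25 (sq r) ⟨
        4 * k * 25 * sq r ≤⟨ *-mono-≤ lo r²≤P ⟩
        M * P ≡⟨ *-comm M P ⟩
        P * M ∎
      part₂ : 4 * k * sq (2 * (q * M)) ≤ P * M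
      part₂ = begin
        4 * k * sq (2 * (q * M)) ≡⟨ eq (4 * k) q M ⟩
        4 * k * 4 * (q * q) * M * M ≤⟨ *-monoˡ-≤ M (*-monoʳ-≤ (4 * k * 4 * (q * q)) hi) ⟩
        4 * k * 4 * (q * q) * (10 * (q * r)) * M ≡⟨ eq₂ (4 * k) q r M ⟩
        4 * k * 40 * (q * q * q) * r * M ≤⟨ *-monoˡ-≤ M (*-monoˡ-≤ r (*-monoˡ-≤ (q * q * q) big)) ⟩
        q * (q * q * q) * r * M ≡⟨ cong (λ x → x * r * M) (eq₃ q) ⟩
        1 * q ^ 4 * r * M ≤⟨ *-monoˡ-≤ M (*-monoˡ-≤ r (q^≤r 1 (≤ᵇ⇒≤ 1 (2 ^ 9) _))) ⟩
        r * r * M ≤⟨ *-monoˡ-≤ M r²≤P ⟩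
        P * M ∎
        where
        eq : ∀ k q M → k * (2 * (q * M) * (2 * (q * M))) ≡ k * 4 * (q * q) * M * M
        eq = solve-∀
        eq₂ : ∀ k q r M → k * 4 * (q * q) * (10 * (q * r)) * M ≡ k * 40 * (q * q * q) * r * M
        eq₂ = solve-∀
        eq₃ : ∀ q → q * (q * q * q) ≡ 1 * (q * (q * (q * (q * 1))))
        eq₃ = solve-∀

    256y² : ∀ M → M₀ ≤ M → M ≤ 10 * (q * r) → 256 * sq (y M) ≤ P * M
    256y² M lo = ky²≤PM 256 M (≤-trans (≤-trans (≤ᵇ⇒≤ (4 * 256 * 25) (2 ^ 15) _) (≤-reflexive (sym M₀≡))) lo) (const≤q (4 * 256 * 40) (≤ᵇ⇒≤ (4 * 256 * 40) (2 ^ 20) _))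

    4[1+P]M : ∀ M → M ≤ 10 * (q * r) → 4 * (suc P * M) ≤ 2 ^ q
    4[1+P]M M hi = begin
      4 * (suc P * M) ≤⟨ *-monoʳ-≤ 4 (*-mono-≤ {suc P} {P + P} (+-monoˡ-≤ P P>0) (≤-trans hi (*-monoʳ-≤ 10 (*-monoʳ-≤ q r≤P)))) ⟩
      4 * ((P + P) * (10 * (q * P))) ≡⟨ eq P q ⟩
      80 * (q * (P * P)) ≤⟨ *-mono-≤ (const≤q 80 (≤ᵇ⇒≤ 80 (2 ^ 20) _)) (*-monoʳ-≤ q (*-mono-≤ P≤q¹¹ P≤q¹¹)) ⟩
      q * (q * (q ^ 11 * q ^ 11)) ≡⟨ cong (λ t → q * (q * t)) (^-distribˡ-+-* q 11 11) ⟨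
      q ^ 24 ≤⟨ poly 24 (≤ᵇ⇒≤ 24 32 _) ⟩
      2 ^ q ∎
      where
      eq : ∀ p q → 4 * ((p + p) * (10 * (q * p))) ≡ 80 * (q * (p * p))
      eq = solve-∀

    -- Multiplied by M, this compares q-th powers: 2 · (8 y)² · 2 = 256 y² ≤ P M, where one of the
    -- 2s absorbs 4 (P + 1) M ≤ 2^q and the other is the number of patterns.
    budget : ∀ {q′} → q ≡ suc q′ → ∀ M B → M₀ ≤ M → M ≤ 10 * (q * r) → B ≤ (8 * y M) ^ q → 4 * (suc P * sq B) * 2 ^ q ≤ P ^ q * M ^ q′
    budget {q′} refl M B lo hi hB = *-cancelˡ-≤ M {{>-nonZero (≤-trans (≤-trans (m^n>0 2 15) (≤-reflexive (sym M₀≡))) lo)}} (begin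
      M * (4 * (suc P * sq B) * 2 ^ q) ≡⟨ eq₁ M (suc P) (sq B) (2 ^ q) ⟩
      4 * (suc P * M) * (sq B * 2 ^ q) ≤⟨ *-mono-≤ (4[1+P]M M hi) (*-monoˡ-≤ (2 ^ q) (sq-mono hB)) ⟩
      2 ^ q * (sq ((8 * y M) ^ q) * 2 ^ q) ≡⟨ cong (λ t → 2 ^ q * (t * 2 ^ q)) (^-sq (8 * y M) q) ⟩
      2 ^ q * (sq (8 * y M) ^ q * 2 ^ q) ≡⟨ cong (2 ^ q *_) (^-*-distrib (sq (8 * y M)) 2 q) ⟨
      2 ^ q * (sq (8 * y M) * 2) ^ q ≡⟨ ^-*-distrib 2 (sq (8 * y M) * 2) q ⟨
      (2 * (sq (8 * y M) * 2)) ^ q ≡⟨ cong (_^ q) (eq₂ (y M)) ⟩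
      (256 * sq (y M)) ^ q ≤⟨ ^-monoˡ-≤ q (256y² M lo hi) ⟩
      (P * M) ^ q ≡⟨ ^-*-distrib P M q ⟩
      P ^ q * (M * M ^ q′) ≡⟨ eq₃ (P ^ q) M (M ^ q′) ⟩
      M * (P ^ q * M ^ q′) ∎)
      where
      eq₁ : ∀ a b c d → a * (4 * (b * c) * d) ≡ 4 * (b * a) * (c * d)
      eq₁ = solve-∀
      eq₂ : ∀ y → 2 * (8 * y * (8 * y) * 2) ≡ 256 * (y * y)
      eq₂ = solve-∀
      eq₃ : ∀ a b c → a * (b * c) ≡ b * (a * c)
      eq₃ = solve-∀

-- The critical radius and the final count

module DenseRadius where
  open FiniteCounting
  open Multiples
  open FiniteGroupAlgebra
  open LatticePoints
  open CoveredMultipliers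
  open ScaleEstimates
  import Data.Fin.Properties as Finₚ
  import Data.Nat as ℕ
  import Data.Nat.DivMod as DM
  import Data.Nat.Properties as ℕₚ
  open import Data.Fin using (Fin; suc)
  open import Data.Nat using (ℕ; suc; _<_; _≤_; _≤?_; z≤n; s≤s) renaming (_+_ to _+ℕ_; _*_ to _*ℕ_; _^_ to _^ℕ_)
  open import Data.Nat.Primality using (Prime)
  open import Data.Nat.Tactic.RingSolver using () renaming (solve-∀ to solveℕ-∀)
  open import Data.Product using (∃; _×_; _,_; proj₁; proj₂)
  open import Data.Vec using (lookup)
  open import Relation.Binary.PropositionalEquality using (_≡_; _≢_; refl; sym; trans; cong; cong₂; subst)
  open import Relation.Nullary using (¬_)

  -- Opaque, so that the numerals are never unfolded.
  opaque
    κ c₀ : ℕ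
    κ = 4 *ℕ sq 1280
    c₀ = 64 *ℕ suc κ

    κ≡ : κ ≡ 4 *ℕ sq 1280
    κ≡ = refl

    c₀≡ : c₀ ≡ 64 *ℕ suc κ
    c₀≡ = refl

    c₀>0 : 0 < c₀
    c₀>0 = s≤s z≤n

  C₂ : ℕ
  C₂ = suc κ

  -- The n-th root of the factor 2 n is at most 3/2.
  doubled-base≤ : ∀ n P d B → 2 ^ℕ n *ℕ (2 *ℕ n) ≤ 3 ^ℕ n → d ^ℕ n ≤ B → B < 2 *ℕ n *ℕ P ^ℕ n → 2 *ℕ d ≤ 3 *ℕ P
  doubled-base≤ n P d B growth dⁿ≤B B< = ℕₚ.≮⇒≥ λ lt → ℕₚ.<-irrefl refl (begin-strict
    3 ^ℕ n *ℕ P ^ℕ n ≡⟨ ^-*-distrib 3 P n ⟨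
    (3 *ℕ P) ^ℕ n ≤⟨ ℕₚ.^-monoˡ-≤ n (ℕₚ.<⇒≤ lt) ⟩
    (2 *ℕ d) ^ℕ n ≡⟨ ^-*-distrib 2 d n ⟩
    2 ^ℕ n *ℕ d ^ℕ n ≤⟨ ℕₚ.*-monoʳ-≤ (2 ^ℕ n) dⁿ≤B ⟩
    2 ^ℕ n *ℕ B <⟨ ℕₚ.*-monoʳ-< (2 ^ℕ n) {{ℕₚ.m^n≢0 2 n}} B< ⟩
    2 ^ℕ n *ℕ (2 *ℕ n *ℕ P ^ℕ n) ≡⟨ ℕₚ.*-assoc (2 ^ℕ n) (2 *ℕ n) (P ^ℕ n) ⟨
    2 ^ℕ n *ℕ (2 *ℕ n) *ℕ P ^ℕ n ≤⟨ ℕₚ.*-monoˡ-≤ (P ^ℕ n) growth ⟩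
    3 ^ℕ n *ℕ P ^ℕ n ∎)
    where open ℕₚ.≤-Reasoning

  module Existence (q′ m : ℕ) (prq : Prime (suc q′)) (prp : Prime (suc m)) (q≢p : suc q′ ≢ suc m) (q>2 : 2 < suc q′) (p>2 : 2 < suc m) (scl : Scales (suc q′) (suc m)) where
    private
      module E = Estimates scl
      module Sc = Scales scl
    open Sc using (r; s; t)

    private
      2q≤r : 2 *ℕ suc q′ ≤ r
      2q≤r = ℕₚ.≤-trans (ℕₚ.*-monoʳ-≤ 2 (ℕₚ.≤-trans (ℕₚ.≤-reflexive (sym (ℕₚ.^-identityʳ (suc q′)))) (ℕₚ.^-monoʳ-≤ (suc q′) (ℕₚ.≤ᵇ⇒≤ 1 4 _)))) (E.q^≤r 2 (ℕₚ.≤ᵇ⇒≤ 2 (2 ^ℕ 9) _))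

    open Selection q′ m prq prp q≢p q>2 p>2 public

    private
      cX : card X ≡ P ^ℕ q
      cX = trans (card-Vec {Fin P} q) (cong (_^ℕ q) (card-Fin P))

      cX₀ : card X₀ ≡ P ^ℕ q′
      cX₀ = trans (card-Vec {Fin P} q′) (cong (_^ℕ q′) (card-Fin P))

      V : ℕ
      V = P ^ℕ q

      ball-bound : ∀ n ν D → 0 < ν → D ≤ n *ℕ sq ν → ballV n D ≤ (8 *ℕ ν) ^ℕ n
      ball-bound n (suc μ) D _ h = ball-count μ n D h

      β : ℕ → ℕ
      β = pairBall q

      β-mono : ∀ {D D₁} → D ≤ D₁ → β D ≤ β D₁
      β-mono {D} {D₁} h = ∑-mono (λ f → ∑-mono (λ g → 𝟙-mono (within? f D g) (within? f D₁ g) (λ le → ℕₚ.≤-trans le h)))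

      Ω-mono : ∀ {D D₁} → D ≤ D₁ → Ω D ≤ Ω D₁
      Ω-mono {D} {D₁} h = ∑-mono (λ f → ∑-mono (λ g → ℕₚ.*-monoˡ-≤ (ω f g) (𝟙-mono (within? f D g) (within? f D₁ g) (λ le → ℕₚ.≤-trans le h))))

      Dense : ℕ → Set
      Dense D = 2 *ℕ q *ℕ V ≤ c₀ *ℕ β D

      top : ℕ
      top = q *ℕ sq P +ℕ q *ℕ sq P

      nrm≤ : ∀ f → nrm f ≤ q *ℕ sq P
      nrm≤ f = vsum-bounded _ (sq P) f (λ i → sq-mono (ℕₚ.≤-trans (ℕₚ.m≤m+n (abs (lookup f i)) (abs (lookup f i))) (2abs≤P (lookup f i))))

      top-dense : Dense top
      top-dense = begin
        2 *ℕ q *ℕ V ≤⟨ ℕₚ.*-monoˡ-≤ V (ℕₚ.≤-trans 2q≤r (ℕₚ.≤-trans E.r≤P (ℕₚ.≤-trans (ℕₚ.≤-reflexive (sym (ℕₚ.^-identityʳ P))) (ℕₚ.^-monoʳ-≤ P (s≤s (z≤n {q′})))))) ⟩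
        V *ℕ V ≡⟨ cong₂ _*ℕ_ (sym cX) (sym cX) ⟩
        card X *ℕ card X ≡⟨ ∑-const {X} (card X) ⟨
        ∑ (λ f → ∑ {X} (λ g → 1)) ≤⟨ ∑-mono (λ f → ∑-mono (λ g → ℕₚ.≤-reflexive (sym (𝟙-yes (within? f top g) (ℕₚ.+-mono-≤ (nrm≤ f) (nrm≤ g)))))) ⟩
        β top ≤⟨ ℕₚ.m≤n*m (β top) c₀ {{ℕ.>-nonZero c₀>0}} ⟩
        c₀ *ℕ β top ∎
        where open ℕₚ.≤-Reasoning

      -- Up to squared radius 2 q s² the crude count is at most P^q / 2^q, far too few points. So
      -- the critical radius is large enough for `ball-growth` with step s.
      sparse : ∀ D → D ≤ (q +ℕ q) *ℕ sq s → ¬ Dense D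
      sparse D h d = ℕₚ.<⇒≱ c₀<2^q (ℕₚ.≤-trans (ℕₚ.m≤n*m (2 ^ℕ q) (2 *ℕ q)) (ℕₚ.*-cancelʳ-≤ (2 *ℕ q *ℕ 2 ^ℕ q) c₀ W {{ℕₚ.m^n≢0 (sq (8 *ℕ s)) q {{ℕ.>-nonZero (ℕₚ.*-mono-≤ 8s>0 8s>0)}}}} (begin
        2 *ℕ q *ℕ 2 ^ℕ q *ℕ W ≡⟨ ℕₚ.*-assoc (2 *ℕ q) (2 ^ℕ q) W ⟩
        2 *ℕ q *ℕ (2 ^ℕ q *ℕ W) ≡⟨ cong (2 *ℕ q *ℕ_) (sym (^-*-distrib 2 (sq (8 *ℕ s)) q)) ⟩
        2 *ℕ q *ℕ (2 *ℕ sq (8 *ℕ s)) ^ℕ q ≤⟨ ℕₚ.*-monoʳ-≤ (2 *ℕ q) (ℕₚ.^-monoˡ-≤ q (ℕₚ.≤-trans (ℕₚ.≤-reflexive (lem s)) E.128s²)) ⟩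
        2 *ℕ q *ℕ V ≤⟨ d ⟩
        c₀ *ℕ β D ≤⟨ ℕₚ.*-monoʳ-≤ c₀ (ℕₚ.≤-trans (ℕₚ.≤-reflexive (pairBall-ballV q D)) (ball-bound (q +ℕ q) s D E.s>0 h)) ⟩
        c₀ *ℕ (8 *ℕ s) ^ℕ (q +ℕ q) ≡⟨ cong (c₀ *ℕ_) (trans (ℕₚ.^-distribˡ-+-* (8 *ℕ s) q q) (^-sq (8 *ℕ s) q)) ⟩
        c₀ *ℕ W ∎)))
        where
        open ℕₚ.≤-Reasoning
        W = sq (8 *ℕ s) ^ℕ q
        8s>0 : 0 < 8 *ℕ s
        8s>0 = ℕₚ.≤-trans E.s>0 (ℕₚ.m≤n*m s 8)
        lem : ∀ s → 2 *ℕ (8 *ℕ s *ℕ (8 *ℕ s)) ≡ 128 *ℕ (s *ℕ s)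
        lem = solveℕ-∀
        c₀<2^q : c₀ < 2 ^ℕ q
        c₀<2^q = ℕₚ.<-≤-trans (subst (_< 2 ^ℕ 20 *ℕ (2 ^ℕ 20 *ℕ 1)) (sym (trans c₀≡ (cong (λ k → 64 *ℕ suc k) κ≡))) (ℕₚ.≤ᵇ⇒≤ (suc (64 *ℕ suc (4 *ℕ sq 1280))) (2 ^ℕ 20 *ℕ (2 ^ℕ 20 *ℕ 1)) _)) (ℕₚ.≤-trans (ℕₚ.^-monoˡ-≤ 2 Sc.q≥) (E.poly 2 (ℕₚ.≤ᵇ⇒≤ 2 32 _)))

      threshold : ∃ λ D → Dense D × (∀ j → j < D → ¬ Dense j)
      threshold = least (λ D → 2 *ℕ q *ℕ V ≤? c₀ *ℕ β D) top top-dense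

      opaque
        -- The least dense radius is positive by `sparse`; D is its predecessor. Sparseness at D
        -- feeds the union bound, density from D + 1 on is what the theorem asserts.
        critical : ∃ λ D → Dense (suc D) × ¬ Dense D × (q +ℕ q) *ℕ sq s ≤ D
        critical = go (proj₁ threshold) (proj₁ (proj₂ threshold)) (proj₂ (proj₂ threshold)) (ℕₚ.≰⇒> (λ le → sparse (proj₁ threshold) le (proj₁ (proj₂ threshold))))
          where
          go : ∀ D → Dense D → (∀ j → j < D → ¬ Dense j) → (q +ℕ q) *ℕ sq s < D → ∃ λ D → Dense (suc D) × ¬ Dense D × (q +ℕ q) *ℕ sq s ≤ D
          go (suc D) d h lt = D , d , h D ℕₚ.≤-refl , ℕₚ.≤-pred lt

    D₀ : ℕ
    D₀ = proj₁ critical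

    dense : ∀ D → D₀ < D → 2 *ℕ q *ℕ P ^ℕ q ≤ c₀ *ℕ pairBall q D
    dense D h = ℕₚ.≤-trans (proj₁ (proj₂ critical)) (ℕₚ.*-monoʳ-≤ c₀ (β-mono h))

    private
      D₀-low : (q +ℕ q) *ℕ sq s ≤ D₀
      D₀-low = proj₂ (proj₂ (proj₂ critical))

      b : ℕ
      b = β D₀

      b< : c₀ *ℕ b < 2 *ℕ q *ℕ V
      b< = ℕₚ.≰⇒> (proj₁ (proj₂ (proj₂ critical)))

      ρ : ℕ
      ρ = D₀ DM./ q

      -- The q-th power of the disc of squared radius ρ = D₀ / q lies in the ball of squared radius
      -- D₀, which is sparse.
      disc≤ : 2 *ℕ disc ρ ≤ 3 *ℕ P
      disc≤ = doubled-base≤ q P (disc ρ) (c₀ *ℕ b) (3^≥ q (ℕₚ.≤-trans (ℕₚ.≤ᵇ⇒≤ 8 (2 ^ℕ 20) _) Sc.q≥))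
        (ℕₚ.≤-trans (disc-power q ρ) (ℕₚ.≤-trans (β-mono (ℕₚ.≤-trans (ℕₚ.≤-reflexive (ℕₚ.*-comm q ρ)) (DM.m/n*n≤m D₀ q))) (ℕₚ.m≤n*m b c₀ {{ℕ.>-nonZero c₀>0}}))) b<

      disc-square : ∀ n ρ → suc n ≤ P → 2 *ℕ sq n ≤ ρ → sq (suc n) ≤ disc ρ
      disc-square n ρ n<P h = ℕₚ.≤-trans (ℕₚ.≤-reflexive (sym (trans (card-× {Fin (suc n)} {Fin (suc n)}) (cong₂ _*ℕ_ (card-Fin (suc n)) (card-Fin (suc n))))))
        (ℕₚ.≤-trans (∑-inj-on φ (λ _ → 1) (λ ab → 𝟙 (sq (abs (proj₁ ab)) +ℕ sq (abs (proj₂ ab)) ≤? ρ)) inside inj) (ℕₚ.≤-reflexive (∑-× {Fin P} {Fin P} _)))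
        where
        open import Data.Fin using (inject≤)
        φ : Fin (suc n) × Fin (suc n) → Fin P × Fin P
        φ (i , j) = inject≤ i n<P , inject≤ j n<P
        small : ∀ i → abs (inject≤ i n<P) ≤ n
        small i = ℕₚ.≤-trans (proj₁ (abs≤toℕ×abs≤p∸toℕ (inject≤ i n<P))) (ℕₚ.≤-trans (ℕₚ.≤-reflexive (Finₚ.toℕ-inject≤ i n<P)) (ℕₚ.≤-pred (Finₚ.toℕ<n i)))
        inside : ∀ (ij : Fin (suc n) × Fin (suc n)) → 1 ≤ 𝟙 (sq (abs (proj₁ (φ ij))) +ℕ sq (abs (proj₂ (φ ij))) ≤? ρ)
        inside (i , j) = ℕₚ.≤-reflexive (sym (𝟙-yes (sq (abs (inject≤ i n<P)) +ℕ sq (abs (inject≤ j n<P)) ≤? ρ) (ℕₚ.≤-trans (ℕₚ.+-mono-≤ (sq-mono (small i)) (sq-mono (small j))) (ℕₚ.≤-trans (ℕₚ.≤-reflexive (cong (sq n +ℕ_) (sym (ℕₚ.+-identityʳ (sq n))))) h))))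
        inj : ∀ (u v : Fin (suc n) × Fin (suc n)) → 0 < 1 → 0 < 1 → φ u ≡ φ v → u ≡ v
        inj (i , j) (i₁ , j₁) _ _ e = cong₂ _,_ (Finₚ.inject≤-injective n<P n<P i i₁ (cong proj₁ e)) (Finₚ.inject≤-injective n<P n<P j j₁ (cong proj₂ e))

      -- From ρ ≥ 2 (3 r)² on, the disc contains the square with sides 0, ..., 3 r, and its (3 r +
      -- 1)² points exceed 6 r² ≥ 3 P / 2.
      ρ< : ρ < 18 *ℕ sq r
      ρ< = ℕₚ.≰⇒> λ le → ℕₚ.<⇒≱ (begin-strict
          3 *ℕ P ≤⟨ ℕₚ.*-monoʳ-≤ 3 Sc.P≤4r² ⟩
          3 *ℕ (4 *ℕ sq r) <⟨ ℕₚ.≤-trans (ℕₚ.m≤m+n (suc (3 *ℕ (4 *ℕ sq r))) (6 *ℕ sq r +ℕ 12 *ℕ r +ℕ 1)) (ℕₚ.≤-reflexive (lem r)) ⟩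
          2 *ℕ sq (suc (3 *ℕ r)) ≤⟨ ℕₚ.*-monoʳ-≤ 2 (disc-square (3 *ℕ r) ρ 3r<P (ℕₚ.≤-trans (ℕₚ.≤-reflexive (lem₂ r)) le)) ⟩
          2 *ℕ disc ρ ∎) disc≤
        where
        open ℕₚ.≤-Reasoning
        lem : ∀ r → suc (3 *ℕ (4 *ℕ (r *ℕ r))) +ℕ (6 *ℕ (r *ℕ r) +ℕ 12 *ℕ r +ℕ 1) ≡ 2 *ℕ (suc (3 *ℕ r) *ℕ suc (3 *ℕ r))
        lem = solveℕ-∀
        lem₂ : ∀ r → 2 *ℕ (3 *ℕ r *ℕ (3 *ℕ r)) ≡ 18 *ℕ (r *ℕ r)
        lem₂ = solveℕ-∀
        3r<P : suc (3 *ℕ r) ≤ P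
        3r<P = ℕₚ.≤-trans (ℕₚ.+-monoˡ-≤ (3 *ℕ r) E.r>0) (ℕₚ.≤-trans (ℕₚ.*-monoˡ-≤ r (ℕₚ.≤-trans (ℕₚ.≤ᵇ⇒≤ 4 (2 ^ℕ 20) _) (ℕₚ.≤-trans Sc.q≥ (ℕₚ.≤-trans (ℕₚ.m≤n*m q 2) 2q≤r)))) Sc.r²≤P)

      D₀<q[1+ρ] : D₀ < q *ℕ suc ρ
      D₀<q[1+ρ] = ℕₚ.<-≤-trans (m<[1+m/n]*n D₀ q) (ℕₚ.≤-reflexive (ℕₚ.*-comm (suc ρ) q))

      D₀≤ : D₀ ≤ q *ℕ (18 *ℕ sq r)
      D₀≤ = ℕₚ.≤-trans (ℕₚ.<⇒≤ D₀<q[1+ρ]) (ℕₚ.*-monoʳ-≤ q ρ<)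

      sq5r : sq (5 *ℕ r) ≡ 25 *ℕ sq r
      sq5r = *-sq 5 r

      5r>0 : 0 < 5 *ℕ r
      5r>0 = ℕₚ.≤-trans E.r>0 (ℕₚ.m≤n*m r 5)

      D₀≤5r : D₀ ≤ q *ℕ sq (5 *ℕ r)
      D₀≤5r = ℕₚ.≤-trans D₀≤ (ℕₚ.*-monoʳ-≤ q (ℕₚ.≤-trans (ℕₚ.*-monoˡ-≤ (sq r) (ℕₚ.≤ᵇ⇒≤ 18 25 _)) (ℕₚ.≤-reflexive (sym sq5r))))

      D₁ : ℕ
      D₁ = D₀ +ℕ sq s

      D₁≤5r : D₁ ≤ q *ℕ sq (5 *ℕ r)
      D₁≤5r = begin
        D₀ +ℕ sq s ≤⟨ ℕₚ.+-mono-≤ D₀≤ (ℕₚ.≤-trans E.s²≤r² (ℕₚ.m≤n*m (sq r) q)) ⟩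
        q *ℕ (18 *ℕ sq r) +ℕ q *ℕ sq r ≡⟨ lem q (sq r) ⟩
        q *ℕ (19 *ℕ sq r) ≤⟨ ℕₚ.*-monoʳ-≤ q (ℕₚ.≤-trans (ℕₚ.*-monoˡ-≤ (sq r) (ℕₚ.≤ᵇ⇒≤ 19 25 _)) (ℕₚ.≤-reflexive (sym sq5r))) ⟩
        q *ℕ sq (5 *ℕ r) ∎
        where
        open ℕₚ.≤-Reasoning
        lem : ∀ q x → q *ℕ (18 *ℕ x) +ℕ q *ℕ x ≡ q *ℕ (19 *ℕ x)
        lem = solveℕ-∀

      -- The share of the atypical vectors in `Ω`, negligible by `16Θ≤V`.
      Θ : ℕ
      Θ = κ *ℕ (sq t *ℕ (2 *ℕ ((8 *ℕ t) ^ℕ q *ℕ (8 *ℕ (5 *ℕ r)) ^ℕ q)))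

      16Θ≤V : 16 *ℕ Θ ≤ V
      16Θ≤V = begin
        16 *ℕ Θ ≡⟨ lem κ (sq t) ((8 *ℕ t) ^ℕ q *ℕ (8 *ℕ (5 *ℕ r)) ^ℕ q) ⟩
        32 *ℕ κ *ℕ sq t *ℕ ((8 *ℕ t) ^ℕ q *ℕ (8 *ℕ (5 *ℕ r)) ^ℕ q) ≤⟨ ℕₚ.*-mono-≤ small (ℕₚ.≤-reflexive (sym (^-*-distrib (8 *ℕ t) (8 *ℕ (5 *ℕ r)) q))) ⟩
        2 ^ℕ q *ℕ (8 *ℕ t *ℕ (8 *ℕ (5 *ℕ r))) ^ℕ q ≡⟨ ^-*-distrib 2 (8 *ℕ t *ℕ (8 *ℕ (5 *ℕ r))) q ⟨
        (2 *ℕ (8 *ℕ t *ℕ (8 *ℕ (5 *ℕ r)))) ^ℕ q ≡⟨ cong (_^ℕ q) (lem₂ t r) ⟩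
        (640 *ℕ (t *ℕ r)) ^ℕ q ≤⟨ ℕₚ.^-monoˡ-≤ q E.640tr ⟩
        V ∎
        where
        open ℕₚ.≤-Reasoning
        lem : ∀ k t x → 16 *ℕ (k *ℕ (t *ℕ (2 *ℕ x))) ≡ 32 *ℕ k *ℕ t *ℕ x
        lem = solveℕ-∀
        lem₂ : ∀ t r → 2 *ℕ (8 *ℕ t *ℕ (8 *ℕ (5 *ℕ r))) ≡ 640 *ℕ (t *ℕ r)
        lem₂ = solveℕ-∀
        small : 32 *ℕ κ *ℕ sq t ≤ 2 ^ℕ q
        small = ℕₚ.≤-trans (ℕₚ.*-mono-≤ (ℕₚ.≤-trans (subst (λ k → 32 *ℕ k ≤ 2 ^ℕ 20 *ℕ (2 ^ℕ 20 *ℕ 1)) (sym κ≡) (ℕₚ.≤ᵇ⇒≤ (32 *ℕ (4 *ℕ sq 1280)) (2 ^ℕ 20 *ℕ (2 ^ℕ 20 *ℕ 1)) _)) (ℕₚ.^-monoˡ-≤ 2 Sc.q≥)) (ℕₚ.≤-trans E.t²≤P Sc.P≤q¹¹))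
          (ℕₚ.≤-trans (ℕₚ.≤-reflexive (sym (ℕₚ.^-distribˡ-+-* q 2 11))) (E.poly 13 (ℕₚ.≤ᵇ⇒≤ 13 32 _)))

      Z≤ : ∀ ν D → 0 < ν → sq ν *ℕ Z D ≤ β D +ℕ sq ν *ℕ (2 *ℕ ((8 *ℕ ν) ^ℕ q *ℕ ballX D))
      Z≤ (suc μ) D _ = ℕₚ.≤-trans (Z-bound μ D) (ℕₚ.+-monoʳ-≤ (β D) (ℕₚ.*-monoʳ-≤ (sq (suc μ)) (ℕₚ.*-monoʳ-≤ 2 (ℕₚ.*-monoˡ-≤ (ballX D) (atypicals≤ μ)))))

      -- In `Ω-split` the factor P is at most κ t², and `Z-bound` at scale t turns t² Z back into a
      -- ball count. So the heavy weight on zero-sum pairs costs only the constant C₂.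
      Ω≤ : ∀ D → D ≤ q *ℕ sq (5 *ℕ r) → Ω D ≤ C₂ *ℕ β D +ℕ Θ
      Ω≤ D h = begin
        Ω D ≡⟨ Ω-split D ⟩
        β D +ℕ P *ℕ Z D ≤⟨ ℕₚ.+-monoʳ-≤ (β D) (ℕₚ.*-monoˡ-≤ (Z D) (subst (λ k → P ≤ k *ℕ sq t) (sym κ≡) E.P≤t²)) ⟩
        β D +ℕ κ *ℕ sq t *ℕ Z D ≡⟨ cong (β D +ℕ_) (ℕₚ.*-assoc κ (sq t) (Z D)) ⟩
        β D +ℕ κ *ℕ (sq t *ℕ Z D) ≤⟨ ℕₚ.+-monoʳ-≤ (β D) (ℕₚ.*-monoʳ-≤ κ (ℕₚ.≤-trans (Z≤ t D E.t>0) (ℕₚ.+-monoʳ-≤ (β D) (ℕₚ.*-monoʳ-≤ (sq t) (ℕₚ.*-monoʳ-≤ 2 (ℕₚ.*-monoʳ-≤ ((8 *ℕ t) ^ℕ q) (ball-bound q (5 *ℕ r) D 5r>0 h))))))) ⟩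
        β D +ℕ κ *ℕ (β D +ℕ sq t *ℕ (2 *ℕ ((8 *ℕ t) ^ℕ q *ℕ (8 *ℕ (5 *ℕ r)) ^ℕ q))) ≡⟨ lem (β D) κ (sq t *ℕ (2 *ℕ ((8 *ℕ t) ^ℕ q *ℕ (8 *ℕ (5 *ℕ r)) ^ℕ q))) ⟩
        C₂ *ℕ β D +ℕ Θ ∎
        where
        open ℕₚ.≤-Reasoning
        lem : ∀ b k x → b +ℕ k *ℕ (b +ℕ x) ≡ suc k *ℕ b +ℕ k *ℕ x
        lem = solveℕ-∀

      Nᵤ : ℕ
      Nᵤ = ∑ (λ f → 𝟙 (nonUnit? f) *ℕ G (D₀ +ℕ radius E.M₀) f)

      -- The losses 2 q from averaging and 2 q + 1 from enlarging the ball multiply to exactly T,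
      -- which cancels. Non-units thus get the same bound as the units.
      Nᵤ≤ : Nᵤ ≤ C₂ *ℕ b +ℕ Θ
      Nᵤ≤ = ℕₚ.*-cancelˡ-≤ E.T {{ℕ.>-nonZero E.T>0}} (begin
        E.T *ℕ Nᵤ ≤⟨ nonunit-count E.T E.T≤P (D₀ +ℕ radius E.M₀) ⟩
        2 *ℕ (q *ℕ Ω (D₀ +ℕ radius E.M₀ +ℕ q *ℕ sq (E.T *ℕ 2))) ≤⟨ ℕₚ.*-monoʳ-≤ 2 (ℕₚ.*-monoʳ-≤ q (ℕₚ.≤-trans (Ω-mono (ℕₚ.≤-trans (ℕₚ.≤-reflexive (ℕₚ.+-assoc D₀ (radius E.M₀) _)) (ℕₚ.+-monoʳ-≤ D₀ E.radii))) (Ω≤ D₁ D₁≤5r))) ⟩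
        2 *ℕ (q *ℕ (C₂ *ℕ β D₁ +ℕ Θ)) ≤⟨ ℕₚ.*-monoʳ-≤ 2 (ℕₚ.*-monoʳ-≤ q (ℕₚ.+-mono-≤ (ℕₚ.*-monoʳ-≤ C₂ grow) (ℕₚ.m≤n*m Θ (suc (q +ℕ q))))) ⟩
        2 *ℕ (q *ℕ (C₂ *ℕ (suc (q +ℕ q) *ℕ b) +ℕ suc (q +ℕ q) *ℕ Θ)) ≡⟨ trans (lem q C₂ b Θ) (cong (_*ℕ (C₂ *ℕ b +ℕ Θ)) (sym E.T≡)) ⟩
        E.T *ℕ (C₂ *ℕ b +ℕ Θ) ∎)
        where
        open ℕₚ.≤-Reasoning
        grow : β D₁ ≤ suc (q +ℕ q) *ℕ b
        grow = ℕₚ.≤-trans (ℕₚ.≤-reflexive (pairBall-ballV q D₁)) (ℕₚ.≤-trans (ball-growth (q +ℕ q) D₀ s E.s>0 D₀-low) (ℕₚ.≤-reflexive (cong (suc (q +ℕ q) *ℕ_) (sym (pairBall-ballV q D₀)))))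
        lem : ∀ q c b t → 2 *ℕ (q *ℕ (c *ℕ (suc (q +ℕ q) *ℕ b) +ℕ suc (q +ℕ q) *ℕ t)) ≡ 2 *ℕ q *ℕ suc (q +ℕ q) *ℕ (c *ℕ b +ℕ t)
        lem = solveℕ-∀

      bud : ∀ M → E.M₀ < M → M ^ℕ q′ *ℕ suc E.M′ ^ℕ q′ ≤ P *ℕ card X₀ → 4 *ℕ (suc P *ℕ sq (ballX (D₀ +ℕ radius M))) *ℕ 2 ^ℕ q ≤ card X *ℕ M ^ℕ q′
      bud M lo up = ℕₚ.≤-trans (E.budget refl M (ballX (D₀ +ℕ radius M)) (ℕₚ.<⇒≤ lo) (E.M-upper refl M (subst (λ z → M ^ℕ q′ *ℕ suc E.M′ ^ℕ q′ ≤ P *ℕ z) cX₀ up))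
          (ball-bound q (E.y M) (D₀ +ℕ radius M) (ℕₚ.≤-trans 5r>0 (ℕₚ.m≤m+n _ _)) rad)) (ℕₚ.≤-reflexive (cong (_*ℕ M ^ℕ q′) (sym cX)))
        where
        open ℕₚ.≤-Reasoning
        rad : D₀ +ℕ radius M ≤ q *ℕ sq (E.y M)
        rad = begin
          D₀ +ℕ q *ℕ sq (q *ℕ (2 *ℕ M)) ≤⟨ ℕₚ.+-monoˡ-≤ _ D₀≤5r ⟩
          q *ℕ sq (5 *ℕ r) +ℕ q *ℕ sq (q *ℕ (2 *ℕ M)) ≡⟨ ℕₚ.*-distribˡ-+ q (sq (5 *ℕ r)) (sq (q *ℕ (2 *ℕ M))) ⟨
          q *ℕ (sq (5 *ℕ r) +ℕ sq (q *ℕ (2 *ℕ M))) ≤⟨ ℕₚ.*-monoʳ-≤ q (ℕₚ.≤-trans (ℕₚ.m≤m+n _ (2 *ℕ (5 *ℕ r *ℕ (2 *ℕ (q *ℕ M))))) (ℕₚ.≤-reflexive (lem (5 *ℕ r) q M))) ⟩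
          q *ℕ sq (E.y M) ∎
          where
          lem : ∀ a q M → a *ℕ a +ℕ q *ℕ (2 *ℕ M) *ℕ (q *ℕ (2 *ℕ M)) +ℕ 2 *ℕ (a *ℕ (2 *ℕ (q *ℕ M))) ≡ (a +ℕ 2 *ℕ (q *ℕ M)) *ℕ (a +ℕ 2 *ℕ (q *ℕ M))
          lem = solveℕ-∀

      cov : ℕ
      cov = ∑ (λ h → 𝟙 (covered? D₀ h))

      -- Units and non-units contribute 2 (C₂ b + Θ) each. Times 16 this contains 64 C₂ b = c₀ b,
      -- which is below 2 q V since D₀ is sparse: this fixes c₀. All other terms amount to at most
      -- 20 V ≤ 6 q V.
      few : 4 *ℕ cov < card X
      few = subst (4 *ℕ cov <_) (sym cX) (ℕₚ.*-cancelˡ-< (8 *ℕ q) (4 *ℕ cov) V (begin-strict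
        8 *ℕ q *ℕ (4 *ℕ cov) ≡⟨ lem₁ q cov ⟩
        16 *ℕ (2 *ℕ q *ℕ cov) ≤⟨ ℕₚ.*-monoʳ-≤ 16 (ℕₚ.≤-trans (cover-bound D₀ E.M₀ (5 *ℕ r) E.M′ 5r>0 D₀≤5r E.M′-small bud E.T E.T≤P)
            (ℕₚ.+-mono-≤ (ℕₚ.*-monoʳ-≤ 2 (Ω≤ D₀ D₀≤5r)) (ℕₚ.+-mono-≤ (ℕₚ.*-monoʳ-≤ 2 Nᵤ≤) (ℕₚ.≤-reflexive cX)))) ⟩
        16 *ℕ (2 *ℕ (C₂ *ℕ b +ℕ Θ) +ℕ (2 *ℕ (C₂ *ℕ b +ℕ Θ) +ℕ V)) ≡⟨ lem₂ C₂ b Θ V ⟩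
        64 *ℕ C₂ *ℕ b +ℕ (4 *ℕ (16 *ℕ Θ) +ℕ 16 *ℕ V) <⟨ ℕₚ.+-mono-<-≤ (subst (λ c → c *ℕ b < 2 *ℕ q *ℕ V) c₀≡ b<) (ℕₚ.+-monoˡ-≤ (16 *ℕ V) (ℕₚ.*-monoʳ-≤ 4 16Θ≤V)) ⟩
        2 *ℕ q *ℕ V +ℕ (4 *ℕ V +ℕ 16 *ℕ V) ≡⟨ lem₃ q V ⟩
        2 *ℕ q *ℕ V +ℕ 20 *ℕ V ≤⟨ ℕₚ.+-monoʳ-≤ (2 *ℕ q *ℕ V) (ℕₚ.*-monoˡ-≤ V (ℕₚ.≤-trans (ℕₚ.≤-trans (ℕₚ.≤ᵇ⇒≤ 20 (2 ^ℕ 20) _) Sc.q≥) (ℕₚ.m≤n*m q 6))) ⟩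
        2 *ℕ q *ℕ V +ℕ 6 *ℕ q *ℕ V ≡⟨ lem₄ q V ⟩
        8 *ℕ q *ℕ V ∎))
        where
        open ℕₚ.≤-Reasoning
        lem₁ : ∀ q c → 8 *ℕ q *ℕ (4 *ℕ c) ≡ 16 *ℕ (2 *ℕ q *ℕ c)
        lem₁ = solveℕ-∀
        lem₂ : ∀ c b t v → 16 *ℕ (2 *ℕ (c *ℕ b +ℕ t) +ℕ (2 *ℕ (c *ℕ b +ℕ t) +ℕ v)) ≡ 64 *ℕ c *ℕ b +ℕ (4 *ℕ (16 *ℕ t) +ℕ 16 *ℕ v)
        lem₂ = solveℕ-∀
        lem₃ : ∀ q v → 2 *ℕ q *ℕ v +ℕ (4 *ℕ v +ℕ 16 *ℕ v) ≡ 2 *ℕ q *ℕ v +ℕ 20 *ℕ v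
        lem₃ = solveℕ-∀
        lem₄ : ∀ q v → 2 *ℕ q *ℕ v +ℕ 6 *ℕ q *ℕ v ≡ 8 *ℕ q *ℕ v
        lem₄ = solveℕ-∀

    generator : ∃ λ h → ∀ f → f ≢ 0X → D₀ < nrm f +ℕ nrm (f ⊗ h)
    generator = select D₀ ρ D₀<q[1+ρ] disc≤ few

-- A prime between q⁹ and q¹¹

module PrimeBetweenPowers where
  open FrobeniusIdentity using (C-zero; C-absorb)
  open CyclicDomain using (Σℕ; Σℕ-front; Σℕ-const; Σℕ-mono; Σℕ-cong; Σℕ-*ʳ)
  open CountingMultiples using (Σℕ-+)
  open ScaleEstimates using (q³²≤2^q)
  open import Data.Empty using (⊥-elim)
  open import Data.List using ([]; _∷_)
  open import Data.List.Relation.Unary.All using (All; []; _∷_)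
  open import Data.Nat
  open import Data.Nat.Combinatorics using (_C_; nCk+nC[k+1]≡[n+1]C[k+1]; k>n⇒nCk≡0)
  open import Data.Nat.Divisibility
  open import Data.Nat.Induction using (<-wellFounded; Acc; acc)
  open import Data.Nat.ListAction using (product)
  open import Data.Nat.Primality using (Prime; prime?; prime⇒nonZero; prime⇒nonTrivial)
  open import Data.Nat.Primality.Factorisation using (factorise; PrimeFactorisation)
  open import Data.Nat.Properties
  open import Data.Nat.Tactic.RingSolver using (solve-∀)
  open import Data.Product using (∃; _×_; _,_; proj₁; proj₂)
  open import Relation.Binary.PropositionalEquality using (_≡_; refl; sym; trans; cong; cong₂; subst)
  open import Relation.Nullary using (¬_; Dec; yes; no; _×-dec_)

  -- Leibniz' harmonic triangle: 1/L(n,k) + 1/L(n,k+1) = 1/L(n-1,k) for L(n,k) = (n+1) C(n,k).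
  leibniz : ∀ D n → (∀ j → 0 < j → j ≤ suc n → j ∣ D) → ∀ k → k ≤ n → suc n * (n C k) ∣ D
  leibniz D n h zero _ = subst (_∣ D) (sym (trans (cong (suc n *_) (C-zero n)) (*-identityʳ (suc n)))) (h (suc n) (s≤s z≤n) ≤-refl)
  leibniz D (suc n) h (suc k) (s≤s k≤n) = combine (leibniz D (suc n) h k (≤-trans k≤n (n≤1+n n))) (leibniz D n (λ j j>0 j≤ → h j j>0 (≤-trans j≤ (n≤1+n _))) k k≤n)
    where
    A = suc n C k
    B = suc n C suc k
    N = suc (suc n)
    absorb : suc k * (A + B) ≡ N * A
    absorb = trans (cong (suc k *_) (nCk+nC[k+1]≡[n+1]C[k+1] (suc n) k)) (C-absorb (suc n) k)
    combine : N * A ∣ D → suc n * (n C k) ∣ D → N * B ∣ D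
    combine (divides u eu) (divides w ew) = ∣m+n∣m⇒∣n {N * B} {N * B * u} {D} (divides w (trans (sym key) (*-comm (N * B) w))) (divides u (*-comm (N * B) u))
      where
      ew′ : D ≡ suc k * B * w
      ew′ = trans ew (trans (*-comm w (suc n * (n C k))) (cong (_* w) (sym (C-absorb n k))))
      eu′ : D ≡ N * A * u
      eu′ = trans eu (*-comm u (N * A))
      key : N * B * w ≡ N * B * u + D
      key = *-cancelˡ-≡ (N * B * w) (N * B * u + D) (suc k) (trans (lem₁ (suc k) N B w) (trans (cong (N *_) (trans (sym ew′) eu′))
          (trans (cong (λ t → N * (t * u)) (sym absorb)) (trans (lem₂ (suc k) N A B u) (cong (λ t → suc k * (N * B * u + t)) (sym eu′))))))
        where
        lem₁ : ∀ k n b w → k * (n * b * w) ≡ n * (k * b * w)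
        lem₁ = solve-∀
        lem₂ : ∀ k n a b u → n * (k * (a + b) * u) ≡ k * (n * b * u + n * a * u)
        lem₂ = solve-∀

  binomial-row : ∀ n → Σℕ (suc n) (n C_) ≡ 2 ^ n
  binomial-row zero = refl
  binomial-row (suc n) = begin-equality
    Σℕ (suc (suc n)) (suc n C_) ≡⟨ Σℕ-front (suc n) (suc n C_) ⟩
    suc n C 0 + Σℕ (suc n) (λ k → suc n C suc k) ≡⟨ cong₂ _+_ (C-zero (suc n)) (trans (Σℕ-cong (suc n) (λ k _ → sym (nCk+nC[k+1]≡[n+1]C[k+1] n k))) (Σℕ-+ (suc n) (n C_) (λ k → n C suc k))) ⟩
    1 + (Σℕ (suc n) (n C_) + Σℕ (suc n) (λ k → n C suc k)) ≡⟨ lem (Σℕ (suc n) (n C_)) (Σℕ (suc n) (λ k → n C suc k)) ⟩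
    Σℕ (suc n) (n C_) + (1 + Σℕ (suc n) (λ k → n C suc k)) ≡⟨ cong (Σℕ (suc n) (n C_) +_) (trans (cong (_+ Σℕ (suc n) (λ k → n C suc k)) (sym (C-zero n))) (sym (Σℕ-front (suc n) (n C_)))) ⟩
    Σℕ (suc n) (n C_) + (Σℕ (suc n) (n C_) + n C suc n) ≡⟨ cong₂ (λ a b → a + (a + b)) (binomial-row n) (k>n⇒nCk≡0 {n} {suc n} ≤-refl) ⟩
    2 ^ n + (2 ^ n + 0) ∎
    where
    open ≤-Reasoning
    lem : ∀ a b → 1 + (a + b) ≡ a + (1 + b)
    lem = solve-∀

  -- Sum the inequalities (n + 1) C(n, k) ≤ D, which come from `leibniz`, over k = 0, ..., n.
  common-multiple-large : ∀ D n → 0 < D → (∀ j → 0 < j → j ≤ suc n → j ∣ D) → 2 ^ n ≤ D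
  common-multiple-large D n D>0 h = *-cancelʳ-≤ (2 ^ n) D (suc n) (begin
    2 ^ n * suc n ≡⟨ cong (_* suc n) (binomial-row n) ⟨
    Σℕ (suc n) (n C_) * suc n ≡⟨ Σℕ-*ʳ (suc n) (suc n) (n C_) ⟨
    Σℕ (suc n) (λ k → (n C k) * suc n) ≤⟨ Σℕ-mono (suc n) (λ k k<1+n → ≤-trans (≤-reflexive (*-comm (n C k) (suc n))) (∣⇒≤ {{>-nonZero D>0}} (leibniz D n h k (≤-pred k<1+n)))) ⟩
    Σℕ (suc n) (λ k → D) ≡⟨ trans (Σℕ-const (suc n) D) (*-comm (suc n) D) ⟩
    D * suc n ∎)
    where open ≤-Reasoning

  prime-factor : ∀ m → 2 ≤ m → ∃ λ p → Prime p × p ∣ m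
  prime-factor m@(suc _) h = go factors isFactorisation factorsPrime
    where
    open PrimeFactorisation (factorise m)
    go : ∀ ps → m ≡ product ps → All Prime ps → ∃ λ p → Prime p × p ∣ m
    go [] e _ = ⊥-elim (<⇒≱ h (≤-reflexive e))
    go (p ∷ ps) e (pp ∷ _) = p , pp , divides (product ps) (trans e (*-comm p (product ps)))

  Smooth : ℕ → ℕ → Set
  Smooth y m = ∀ p → Prime p → p ∣ m → p < y

  extract : ∀ y m → 2 ≤ y → 0 < m → Acc _<_ m → ∃ λ v → ∃ λ m′ → m ≡ y ^ v * m′ × ¬ y ∣ m′
  extract y m y≥2 m>0 (acc rec) with y ∣? m
  ... | no ¬d = 0 , m , sym (+-identityʳ m) , ¬d
  ... | yes (divides k e) with k ≟ 0
  ...   | yes refl = ⊥-elim (<⇒≱ m>0 (≤-reflexive e))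
  ...   | no k≢0 with extract y k y≥2 (n≢0⇒n>0 k≢0) (rec (subst (k <_) (sym e) (m<m*n k y {{≢-nonZero k≢0}} y≥2)))
  ...     | v , m′ , e′ , nd = suc v , m′ , trans e (trans (*-comm k y) (trans (cong (y *_) e′) (sym (*-assoc y (y ^ v) m′)))) , nd

  largest-power : ∀ y n → 2 ≤ y → 0 < n → ∃ λ w → 0 < w × w ≤ n × (∀ v → y ^ v ≤ n → y ^ v ∣ w)
  largest-power y n y≥2 n>0 = go n
    where
    v<y^v : ∀ v → v < y ^ v
    v<y^v zero = s≤s z≤n
    v<y^v (suc v) = ≤-trans (+-mono-≤ (≤-trans (s≤s z≤n) (v<y^v v)) (v<y^v v)) (≤-trans (≤-reflexive (cong (y ^ v +_) (sym (+-identityʳ (y ^ v))))) (*-monoˡ-≤ (y ^ v) y≥2))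
    pow-∣ : ∀ {a b} → a ≤ b → y ^ a ∣ y ^ b
    pow-∣ {a} {b} h = divides (y ^ (b ∸ a)) (trans (cong (y ^_) (sym (m∸n+n≡m h))) (^-distribˡ-+-* y (b ∸ a) a))
    search : ∀ k → (∀ v → y ^ v ≤ n → v ≤ k) → ∃ λ w → 0 < w × w ≤ n × (∀ v → y ^ v ≤ n → y ^ v ∣ w)
    search zero h = 1 , s≤s z≤n , n>0 , λ v le → pow-∣ (h v le)
    search (suc k) h with y ^ suc k ≤? n
    ... | yes le = y ^ suc k , ≤-trans (s≤s z≤n) (v<y^v (suc k)) , le , λ v le′ → pow-∣ (h v le′)
    ... | no gt = search k (λ v le → ≤-pred (≤∧≢⇒< (h v le) (λ e → gt (subst (λ u → y ^ u ≤ n) e le))))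
    go : ∀ n′ → ∃ λ w → 0 < w × w ≤ n × (∀ v → y ^ v ≤ n → y ^ v ∣ w)
    go _ = search n (λ v le → <⇒≤ (<-≤-trans (v<y^v v) le))

  -- D is the product, over the primes below y, of their largest powers not exceeding n. Each factor
  -- is at most n, and there are at most y of them.
  smooth-multiple : ∀ n → 0 < n → ∀ y → ∃ λ D → 0 < D × D ≤ n ^ y × (∀ m → 0 < m → m ≤ n → Smooth y m → m ∣ D)
  smooth-multiple n n>0 zero = 1 , s≤s z≤n , ≤-refl , λ m m>0 _ sm → only-one m m>0 sm
    where
    only-one : ∀ m → 0 < m → Smooth 0 m → m ∣ 1
    only-one 1 _ _ = ∣-refl
    only-one (suc (suc m)) _ sm = let (p , pp , d) = prime-factor (suc (suc m)) (s≤s (s≤s z≤n)) in ⊥-elim (<⇒≱ (sm p pp d) z≤n)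
  smooth-multiple n n>0 (suc y) with smooth-multiple n n>0 y | prime? y
  ... | D , D>0 , D≤ , h | no ¬pr = D , D>0 , ≤-trans D≤ (m≤n*m (n ^ y) n {{>-nonZero n>0}}) , λ m m>0 m≤n sm → h m m>0 m≤n (λ p pp d → ≤∧≢⇒< (≤-pred (sm p pp d)) (λ e → ¬pr (subst Prime e pp)))
  ... | D , D>0 , D≤ , h | yes pr = w * D , *-mono-≤ w>0 D>0 , *-mono-≤ w≤ D≤ , covers
    where
    y≥2 : 2 ≤ y
    y≥2 = nonTrivial⇒n>1 y {{prime⇒nonTrivial pr}}
    lp = largest-power y n y≥2 n>0
    w = proj₁ lp
    w>0 = proj₁ (proj₂ lp)
    w≤ = proj₁ (proj₂ (proj₂ lp))
    covers : ∀ m → 0 < m → m ≤ n → Smooth (suc y) m → m ∣ w * D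
    covers m m>0 m≤n sm = split (extract y m y≥2 m>0 (<-wellFounded m))
      where
      split : (∃ λ v → ∃ λ m′ → m ≡ y ^ v * m′ × ¬ y ∣ m′) → m ∣ w * D
      split (v , m′ , e , nd) = subst (_∣ w * D) (sym e) (*-pres-∣ (proj₂ (proj₂ (proj₂ lp)) v (≤-trans (pow≤ m′ m′>0 e) m≤n))
          (h m′ m′>0 (≤-trans (≤-trans (m≤n*m m′ (y ^ v) {{m^n≢0 y v {{prime⇒nonZero pr}}}}) (≤-reflexive (sym e))) m≤n)
            (λ p pp d → ≤∧≢⇒< (≤-pred (sm p pp (subst (p ∣_) (sym e) (∣n⇒∣m*n (y ^ v) d)))) (λ eq → nd (subst (_∣ m′) eq d)))))
        where
        m′>0 : 0 < m′
        m′>0 = n≢0⇒n>0 (λ z → <⇒≱ m>0 (≤-reflexive (trans e (trans (cong (y ^ v *_) z) (*-zeroʳ (y ^ v))))))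
        pow≤ : ∀ m′ → 0 < m′ → m ≡ y ^ v * m′ → y ^ v ≤ m
        pow≤ m′ h e = ≤-trans (m≤m*n (y ^ v) m′ {{>-nonZero h}}) (≤-reflexive (sym e))

  prime-in-range : ∀ q → 2 ^ 20 ≤ q → ∃ λ p → Prime p × q ^ 9 ≤ p × p ≤ q ^ 11
  prime-in-range q q≥ = by (anyUpTo? (λ p → prime? p ×-dec (q ^ 9 ≤? p)) (suc (q ^ 11)))
    where
    open ≤-Reasoning
    q>1 : 1 < q
    q>1 = ≤-trans (≤ᵇ⇒≤ 2 (2 ^ 20) _) q≥
    instance
      q≢0 : NonZero q
      q≢0 = >-nonZero (<⇒≤ q>1)
    n = q ^ 11
    n>0 : 0 < n
    n>0 = m^n>0 q 11
    by : Dec (∃ λ p → p < suc n × Prime p × q ^ 9 ≤ p) → ∃ λ p → Prime p × q ^ 9 ≤ p × p ≤ n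
    by (yes (p , p≤ , pp , lo)) = p , pp , lo , ≤-pred p≤
    by (no none) = ⊥-elim (<⇒≱ gap (≤-trans (common-multiple-large D (pred n) D>0 (λ j j>0 j≤ → covers j j>0 (≤-trans j≤ (≤-reflexive (suc-pred n {{>-nonZero n>0}}))) (smooth j j>0 j≤))) D≤))
      where
      sm = smooth-multiple n n>0 (q ^ 9)
      D = proj₁ sm
      D>0 = proj₁ (proj₂ sm)
      D≤ = proj₁ (proj₂ (proj₂ sm))
      covers = proj₂ (proj₂ (proj₂ sm))
      smooth : ∀ j → 0 < j → j ≤ suc (pred n) → Smooth (q ^ 9) j
      smooth j j>0 j≤ p pp d = ≰⇒> (λ lo → none (p , s≤s (≤-trans (∣⇒≤ {{>-nonZero j>0}} d) (≤-trans j≤ (≤-reflexive (suc-pred n {{>-nonZero n>0}})))) , pp , lo))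
      -- Since n = q¹¹ ≤ 2^q, the left side is at most 2^(q¹⁰), and q¹⁰ < q¹¹ - 1.
      gap : n ^ (q ^ 9) < 2 ^ pred n
      gap = begin-strict
        n ^ (q ^ 9) ≤⟨ ^-monoˡ-≤ (q ^ 9) (≤-trans (^-monoʳ-≤ q (≤ᵇ⇒≤ 11 32 _)) (q³²≤2^q q q≥)) ⟩
        (2 ^ q) ^ (q ^ 9) ≡⟨ ^-*-assoc 2 q (q ^ 9) ⟩
        2 ^ (q ^ 10) <⟨ ^-monoʳ-< 2 ≤-refl (≤-pred (≤-trans (s≤s (s≤s ≤-refl)) (≤-trans big (≤-reflexive (sym (suc-pred n {{>-nonZero n>0}})))))) ⟩
        2 ^ pred n ∎
        where
        big : suc (suc (q ^ 10)) ≤ n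
        big = ≤-trans (+-monoˡ-≤ (q ^ 10) (≤-trans (≤-trans (≤ᵇ⇒≤ 2 (2 ^ 20) _) q≥) (≤-trans (≤-reflexive (sym (^-identityʳ q))) (^-monoʳ-≤ q (≤ᵇ⇒≤ 1 10 _)))))
          (≤-trans (≤-reflexive (cong (q ^ 10 +_) (sym (+-identityʳ (q ^ 10))))) (*-monoˡ-≤ (q ^ 10) q>1))

-- Rational estimates for the logarithmic bounds on p

module RationalLogarithm where
  import Data.Integer.Properties as ℤₚ
  import Data.Nat.Properties as ℕₚ
  import Data.Rational.Properties as ℚₚ
  import Data.Rational.Unnormalised.Properties as ℚᵘₚ
  open import Data.Integer as ℤ using () renaming (+_ to pos)
  open import Data.Nat as ℕ using (ℕ; zero; suc; _!; z≤n; s≤s)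
  open import Data.Nat.Tactic.RingSolver using () renaming (solve-∀ to solveℕ-∀)
  open import Data.Product using (_,_)
  open import Data.Rational using (0ℚ; 1ℚ; _+_; _*_; _≤_; _<_; toℚᵘ; nonNegative)
  open import Data.Rational.Unnormalised as ℚᵘ using (mkℚᵘ; *≤*; *≡*)
  open import Data.Sum using ([_,_]′)
  open import Defs
  open import Relation.Binary.PropositionalEquality using (_≡_; refl; sym; trans; cong; subst)

  ratio-≤ : ∀ a c {b d} → 0 ℕ.< b → 0 ℕ.< d → a ℕ.* d ℕ.≤ c ℕ.* b → ratio a b ≤ ratio c d
  ratio-≤ a c {suc b} {suc d} _ _ h = ℚₚ.toℚᵘ-cancel-≤ (begin
    toℚᵘ (ratio a (suc b)) ≃⟨ ℚₚ.toℚᵘ-fromℚᵘ (mkℚᵘ (pos a) b) ⟩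
    mkℚᵘ (pos a) b ≤⟨ *≤* (subst (ℤ._≤ pos c ℤ.* pos (suc b)) (ℤₚ.pos-* a (suc d)) (subst (pos (a ℕ.* suc d) ℤ.≤_) (ℤₚ.pos-* c (suc b)) (ℤ.+≤+ h))) ⟩
    mkℚᵘ (pos c) d ≃⟨ ℚₚ.toℚᵘ-fromℚᵘ (mkℚᵘ (pos c) d) ⟨
    toℚᵘ (ratio c (suc d)) ∎)
    where open ℚᵘₚ.≤-Reasoning

  fromℕℚ-mono : ∀ {a b} → a ℕ.≤ b → fromℕℚ a ≤ fromℕℚ b
  fromℕℚ-mono {a} {b} h = ratio-≤ a b (s≤s z≤n) (s≤s z≤n) (ℕₚ.*-monoˡ-≤ 1 h)

  ratio-* : ∀ a c b d → ratio a (suc b) * ratio c (suc d) ≡ ratio (a ℕ.* c) (suc b ℕ.* suc d)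
  ratio-* a c b d = ℚₚ.toℚᵘ-injective (begin-equality
    toℚᵘ (ratio a (suc b) * ratio c (suc d)) ≃⟨ ℚₚ.toℚᵘ-homo-* (ratio a (suc b)) (ratio c (suc d)) ⟩
    toℚᵘ (ratio a (suc b)) ℚᵘ.* toℚᵘ (ratio c (suc d)) ≃⟨ ℚᵘₚ.*-cong (ℚₚ.toℚᵘ-fromℚᵘ (mkℚᵘ (pos a) b)) (ℚₚ.toℚᵘ-fromℚᵘ (mkℚᵘ (pos c) d)) ⟩
    mkℚᵘ (pos a) b ℚᵘ.* mkℚᵘ (pos c) d ≃⟨ *≡* (cong (ℤ._* pos (suc b ℕ.* suc d)) (sym (ℤₚ.pos-* a c))) ⟩
    mkℚᵘ (pos (a ℕ.* c)) (d ℕ.+ b ℕ.* suc d) ≃⟨ ℚₚ.toℚᵘ-fromℚᵘ (mkℚᵘ (pos (a ℕ.* c)) (d ℕ.+ b ℕ.* suc d)) ⟨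
    toℚᵘ (ratio (a ℕ.* c) (suc b ℕ.* suc d)) ∎)
    where open ℚᵘₚ.≤-Reasoning

  ratio-+ : ∀ a c b → ratio a (suc b) + ratio c (suc b) ≡ ratio (a ℕ.+ c) (suc b)
  ratio-+ a c b = ℚₚ.toℚᵘ-injective (begin-equality
    toℚᵘ (ratio a (suc b) + ratio c (suc b)) ≃⟨ ℚₚ.toℚᵘ-homo-+ (ratio a (suc b)) (ratio c (suc b)) ⟩
    toℚᵘ (ratio a (suc b)) ℚᵘ.+ toℚᵘ (ratio c (suc b)) ≃⟨ ℚᵘₚ.+-cong (ℚₚ.toℚᵘ-fromℚᵘ (mkℚᵘ (pos a) b)) (ℚₚ.toℚᵘ-fromℚᵘ (mkℚᵘ (pos c) b)) ⟩
    mkℚᵘ (pos a) b ℚᵘ.+ mkℚᵘ (pos c) b ≃⟨ *≡* (trans (cong (ℤ._* pos (suc b)) (trans (sym (ℤₚ.*-distribʳ-+ (pos (suc b)) (pos a) (pos c))) (cong (ℤ._* pos (suc b)) (sym (ℤₚ.pos-+ a c)))))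
        (trans (ℤₚ.*-assoc (pos (a ℕ.+ c)) (pos (suc b)) (pos (suc b))) (cong (pos (a ℕ.+ c) ℤ.*_) (sym (ℤₚ.pos-* (suc b) (suc b)))))) ⟩
    mkℚᵘ (pos (a ℕ.+ c)) b ≃⟨ ℚₚ.toℚᵘ-fromℚᵘ (mkℚᵘ (pos (a ℕ.+ c)) b) ⟨
    toℚᵘ (ratio (a ℕ.+ c) (suc b)) ∎)
    where open ℚᵘₚ.≤-Reasoning

  *-mono-≤-nonNeg : ∀ {a b c d} → 0ℚ ≤ a → 0ℚ ≤ d → a ≤ b → c ≤ d → a * c ≤ b * d
  *-mono-≤-nonNeg {a} {b} {c} {d} a≥0 d≥0 a≤b c≤d = ℚₚ.≤-trans (ℚₚ.*-monoˡ-≤-nonNeg a {{nonNegative a≥0}} c≤d) (ℚₚ.*-monoʳ-≤-nonNeg d {{nonNegative d≥0}} a≤b)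

  *-nonNeg : ∀ {a b} → 0ℚ ≤ a → 0ℚ ≤ b → 0ℚ ≤ a * b
  *-nonNeg {a} {b} a≥0 b≥0 = subst (_≤ a * b) (ℚₚ.*-zeroʳ a) (ℚₚ.*-monoˡ-≤-nonNeg a {{nonNegative a≥0}} b≥0)

  0≤1 : 0ℚ ≤ 1ℚ
  0≤1 = ratio-≤ 0 1 {1} {1} (s≤s z≤n) (s≤s z≤n) z≤n

  powℚ-nonNeg : ∀ {x} k → 0ℚ ≤ x → 0ℚ ≤ powℚ x k
  powℚ-nonNeg zero h = 0≤1
  powℚ-nonNeg (suc k) h = *-nonNeg h (powℚ-nonNeg k h)

  powℚ-mono : ∀ {x y} k → 0ℚ ≤ x → x ≤ y → powℚ x k ≤ powℚ y k
  powℚ-mono zero h l = ℚₚ.≤-refl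
  powℚ-mono (suc k) h l = *-mono-≤-nonNeg h (powℚ-nonNeg k (ℚₚ.≤-trans h l)) l (powℚ-mono k h l)

  powℚ-≤1 : ∀ {x} k → 0ℚ ≤ x → x ≤ 1ℚ → powℚ x k ≤ 1ℚ
  powℚ-≤1 zero h l = ℚₚ.≤-refl
  powℚ-≤1 (suc k) h l = ℚₚ.≤-trans (*-mono-≤-nonNeg h 0≤1 l (powℚ-≤1 k h l)) (ℚₚ.≤-reflexive (ℚₚ.*-identityʳ 1ℚ))

  powℚ-fromℕℚ : ∀ n k → powℚ (fromℕℚ n) k ≡ fromℕℚ (n ℕ.^ k)
  powℚ-fromℕℚ n zero = refl
  powℚ-fromℕℚ n (suc k) = trans (cong (fromℕℚ n *_) (powℚ-fromℕℚ n k)) (ratio-* n (n ℕ.^ k) 0 0)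

  expPartial-2 : ∀ x → expPartial x 2 ≡ 1ℚ + x
  expPartial-2 x = cong (1ℚ +_) (trans (ℚₚ.*-identityʳ (x * 1ℚ)) (ℚₚ.*-identityʳ x))

  -- Telescoping: the sum of the first K + 2 terms plus 1/(K + 1)! does not grow with K, because
  -- 2/(K + 2)! ≤ 1/(K + 1)!, and it starts at 2 + x ≤ 3.
  expPartial-≤3 : ∀ {x} → 0ℚ ≤ x → x ≤ 1ℚ → ∀ K → expPartial x K ≤ fromℕℚ 3
  expPartial-≤3 {x} h l = λ where
      zero → fromℕℚ-mono {0} {3} z≤n
      (suc zero) → fromℕℚ-mono {1} {3} (s≤s z≤n)
      (suc (suc K)) → ℚₚ.≤-trans (ℚₚ.≤-trans (ℚₚ.≤-reflexive (sym (ℚₚ.+-identityʳ _))) (ℚₚ.+-monoʳ-≤ (expPartial x (2 ℕ.+ K)) (ratio-≤ 0 1 {1} (s≤s z≤n) (ℕₚ.1≤n! (suc K)) z≤n))) (tail K)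
    where
    open ℚₚ.≤-Reasoning
    double : ∀ {b} → 0 ℕ.< b → ratio 1 b + ratio 1 b ≡ ratio 2 b
    double {suc b} _ = ratio-+ 1 1 b
    tail : ∀ K → expPartial x (2 ℕ.+ K) + ratio 1 (suc K !) ≤ fromℕℚ 3
    tail zero = begin
      expPartial x 2 + 1ℚ ≡⟨ cong (_+ 1ℚ) (expPartial-2 x) ⟩
      1ℚ + x + 1ℚ ≤⟨ ℚₚ.+-monoˡ-≤ 1ℚ (ℚₚ.+-monoʳ-≤ 1ℚ l) ⟩
      fromℕℚ 3 ∎
    tail (suc K) = begin
      expPartial x (2 ℕ.+ K) + powℚ x (2 ℕ.+ K) * u + u ≤⟨ ℚₚ.+-monoˡ-≤ u (ℚₚ.+-monoʳ-≤ (expPartial x (2 ℕ.+ K)) (ℚₚ.*-monoʳ-≤-nonNeg u {{nonNegative u≥0}} (powℚ-≤1 (2 ℕ.+ K) h l))) ⟩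
      expPartial x (2 ℕ.+ K) + 1ℚ * u + u ≡⟨ ℚₚ.+-assoc (expPartial x (2 ℕ.+ K)) (1ℚ * u) u ⟩
      expPartial x (2 ℕ.+ K) + (1ℚ * u + u) ≡⟨ cong (expPartial x (2 ℕ.+ K) +_) (trans (cong (_+ u) (ℚₚ.*-identityˡ u)) (double (ℕₚ.1≤n! (2 ℕ.+ K)))) ⟩
      expPartial x (2 ℕ.+ K) + ratio 2 ((2 ℕ.+ K) !) ≤⟨ ℚₚ.+-monoʳ-≤ (expPartial x (2 ℕ.+ K)) (ratio-≤ 2 1 (ℕₚ.1≤n! (2 ℕ.+ K)) (ℕₚ.1≤n! (suc K)) halve) ⟩
      expPartial x (2 ℕ.+ K) + ratio 1 (suc K !) ≤⟨ tail K ⟩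
      fromℕℚ 3 ∎
      where
      u = ratio 1 ((2 ℕ.+ K) !)
      u≥0 : 0ℚ ≤ u
      u≥0 = ratio-≤ 0 1 {1} (s≤s z≤n) (ℕₚ.1≤n! (2 ℕ.+ K)) z≤n
      halve : 2 ℕ.* (suc K !) ℕ.≤ 1 ℕ.* ((2 ℕ.+ K) !)
      halve = ℕₚ.≤-trans (ℕₚ.*-monoˡ-≤ (suc K !) (s≤s (s≤s (z≤n {K})))) (ℕₚ.≤-reflexive (sym (ℕₚ.*-identityˡ ((2 ℕ.+ K) !))))

  -- e^x > 1 + x already gives log n < x when n ≤ x.
  cubic⇒LowerBound : ∀ n p → 0 ℕ.< n → n ℕ.* (n ℕ.* n) ℕ.≤ p → LowerBound n p
  cubic⇒LowerBound n p n>0 h = 2 , (begin-strict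
    fromℕℚ n ≤⟨ ratio-≤ n p (s≤s z≤n) (ℕₚ.*-mono-≤ n>0 n>0) (ℕₚ.≤-trans h (ℕₚ.≤-reflexive (sym (ℕₚ.*-identityʳ p)))) ⟩
    x ≡⟨ ℚₚ.+-identityˡ x ⟨
    0ℚ + x <⟨ ℚₚ.+-monoˡ-< x (ℚₚ.positive⁻¹ 1ℚ) ⟩
    1ℚ + x ≡⟨ expPartial-2 x ⟨
    expPartial x 2 ∎)
    where
    open ℚₚ.≤-Reasoning
    x = ratio p (n ℕ.* n)

  -- log n ≥ 1, so (n log n)^11 ≥ n^11.
  eleventh-power⇒UpperBound : ∀ n p → 3 ℕ.≤ n → p ℕ.≤ n ℕ.^ 11 → UpperBound n p
  eleventh-power⇒UpperBound n p n≥3 h (r , r≥0 , (K , small) , lt) = [ below , above ]′ (ℚₚ.≤-total r 1ℚ)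
    where
    open ℚₚ.≤-Reasoning
    below = λ r≤1 → ℚₚ.<-irrefl refl (ℚₚ.<-≤-trans small (ℚₚ.≤-trans (expPartial-≤3 r≥0 r≤1 K) (fromℕℚ-mono n≥3)))
    N = fromℕℚ n
    N≥0 : 0ℚ ≤ N
    N≥0 = fromℕℚ-mono {0} {n} z≤n
    above = λ 1≤r → ℚₚ.<-irrefl refl (ℚₚ.<-≤-trans lt (begin
      fromℕℚ p ≤⟨ fromℕℚ-mono h ⟩
      fromℕℚ (n ℕ.^ 11) ≡⟨ powℚ-fromℕℚ n 11 ⟨
      powℚ N 11 ≤⟨ powℚ-mono 11 N≥0 (ℚₚ.≤-trans (ℚₚ.≤-reflexive (sym (ℚₚ.*-identityʳ N))) (ℚₚ.*-monoˡ-≤-nonNeg N {{nonNegative N≥0}} 1≤r)) ⟩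
      powℚ (N * r) 11 ∎))

  density : ∀ c₀ a b → 0 ℕ.< c₀ → a ℕ.≤ c₀ ℕ.* b → ratio 1 c₀ * fromℕℚ a ≤ fromℕℚ b
  density (suc c) a b _ h = ℚₚ.≤-trans (ℚₚ.≤-reflexive (ratio-* 1 a c 0)) (ratio-≤ (1 ℕ.* a) b (s≤s z≤n) (s≤s z≤n)
    (ℕₚ.≤-trans (ℕₚ.≤-reflexive (lem a)) (ℕₚ.≤-trans h (ℕₚ.≤-reflexive (lem₂ c b)))))
    where
    lem : ∀ a → 1 ℕ.* a ℕ.* 1 ≡ a
    lem = solveℕ-∀
    lem₂ : ∀ c b → suc c ℕ.* b ≡ b ℕ.* (suc c ℕ.* 1)
    lem₂ = solveℕ-∀

-- The double circulant code in coordinates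

module CodeCoordinates where
  open FiniteCounting
  open PeriodicConvolution
  open CyclicPowers
  open CyclicDomain
  open FiniteGroupAlgebra
  open LatticePoints
  open SignedOrbits
  import Data.Fin.Permutation as Perm
  import Data.Fin.Properties as Finₚ
  import Data.Integer as ℤ
  import Data.Integer.Properties as ℤₚ
  import Data.List as List
  import Data.List.Properties as Listₚ
  import Data.Nat as ℕ
  import Data.Nat.DivMod as DM
  import Data.Nat.Properties as ℕₚ
  import Data.Vec.Functional as V
  import Data.Vec.Properties as Vecₚ
  open import Data.Bool using (T)
  open import Data.Bool using (true; false; if_then_else_)
  open import Data.Empty using (⊥-elim)
  open import Data.Fin using (Fin; zero; suc; toℕ; fromℕ<)
  open import Data.Fin using (combine; quotient; remainder)
  open import Data.Fin.Permutation using (permutation)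
  open import Data.Integer using (ℤ; +_) renaming (_+_ to _+ᶻ_; _*_ to _*ᶻ_; _-_ to _-ᶻ_; -_ to -ᶻ_)
  open import Data.Integer.Tactic.RingSolver using (solve-∀)
  open import Data.List using (List; map; foldr; allFin)
  open import Data.Nat using (ℕ; zero; suc; _∸_; _<_; _≤_; _≤?_; z≤n; s≤s) renaming (_+_ to _+ℕ_; _*_ to _*ℕ_)
  open import Data.Nat.ListAction using (sum)
  open import Data.Nat.Primality using (Prime)
  open import Data.Product using (∃; _×_; _,_; proj₁; proj₂)
  open import Data.Unit using (tt)
  open import Data.Vec using (Vec; []; _∷_; lookup; tabulate)
  open import Data.Vec using (concat)
  open import Defs
  open import Function using (_∘_; id)
  open import Relation.Binary.PropositionalEquality using (_≡_; _≢_; refl; sym; trans; cong; cong₂; subst; module ≡-Reasoning)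
  open import Relation.Nullary using (¬_; Dec; yes; no; ¬?)

  lookup-concat : ∀ {A : Set} {m n} (xss : Vec (Vec A m) n) i j → lookup (concat xss) (combine i j) ≡ lookup (lookup xss i) j
  lookup-concat (xs ∷ xss) zero j = Vecₚ.lookup-++ˡ xs (concat xss) j
  lookup-concat (xs ∷ xss) (suc i) j = trans (Vecₚ.lookup-++ʳ xs (concat xss) (combine i j)) (lookup-concat xss i j)

  map-allFin : ∀ {A : Set} {n} (f : Fin n → A) → map f (allFin n) ≡ List.tabulate f
  map-allFin f = Listₚ.map-tabulate id f

  sum-tabulate : ∀ {A : Set} (g : A → ℕ) n (x : Fin n → A) → sum (List.tabulate (g ∘ x)) ≡ vsum g (tabulate x)
  sum-tabulate g zero x = refl
  sum-tabulate g (suc n) x = cong (g (x zero) +ℕ_) (sum-tabulate g n (x ∘ suc))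

  sum-allFin : ∀ n (f : Fin n → ℕ) → sum (map f (allFin n)) ≡ ∑ f
  sum-allFin n f = trans (cong sum (map-allFin f)) (go n f)
    where
    go : ∀ n (f : Fin n → ℕ) → sum (List.tabulate f) ≡ ∑ f
    go zero f = sym ∑-∅
    go (suc n) f = trans (cong (f zero +ℕ_) (go n (f ∘ suc))) (sym (∑-Fin f))

  if-≤ᵇ : ∀ k D → (if k ℕ.≤ᵇ D then 1 else 0) ≡ 𝟙 (k ≤? D)
  if-≤ᵇ k D = by (k ≤? D) (k ℕ.≤ᵇ D) refl
    where
    by : (d : Dec (k ≤ D)) → ∀ b → (k ℕ.≤ᵇ D) ≡ b → (if b then 1 else 0) ≡ 𝟙 d
    by (yes _) true _ = refl
    by (yes h) false e = ⊥-elim (subst T e (ℕₚ.≤⇒≤ᵇ h))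
    by (no _) false _ = refl
    by (no h) true e = ⊥-elim (h (ℕₚ.≤ᵇ⇒≤ k D (subst T (sym e) tt)))

  module Coordinates (m : ℕ) where
    open Fp m
    open Balls m using (nrmV; ballV; abs)

    Cong⇒≡ : ∀ {a b : F} → Cong (+ p) (+ toℕ a) (+ toℕ b) → a ≡ b
    Cong⇒≡ {a} {b} c = trans (sym (res-toℕ m a)) (trans (Cong⇒res≡ m c) (res-toℕ m b))

    toℕ-mod : ∀ k → Cong (+ p) (+ toℕ (k DM.mod p)) (+ k)
    toℕ-mod k = cong-sym (cg (+ (k DM./ p)) (begin
      + k ≡⟨ cong +_ (DM.m≡m%n+[m/n]*n k p) ⟩
      + (k DM.% p +ℕ k DM./ p *ℕ p) ≡⟨ ℤₚ.pos-+ (k DM.% p) (k DM./ p *ℕ p) ⟩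
      + (k DM.% p) +ᶻ + (k DM./ p *ℕ p) ≡⟨ cong₂ _+ᶻ_ (cong +_ (sym (Finₚ.toℕ-fromℕ< (DM.m%n<n k p)))) (ℤₚ.pos-* (k DM./ p) p) ⟩
      + toℕ (k DM.mod p) +ᶻ + (k DM./ p) *ᶻ + p ∎))
      where open ≡-Reasoning

    toℕ-addF : ∀ a b → Cong (+ p) (+ toℕ (addF a b)) (+ toℕ a +ᶻ + toℕ b)
    toℕ-addF a b = cong-trans (toℕ-mod (toℕ a +ℕ toℕ b)) (cong-≡ (ℤₚ.pos-+ (toℕ a) (toℕ b)))

    toℕ-mulF : ∀ a b → Cong (+ p) (+ toℕ (mulF a b)) (+ toℕ a *ᶻ + toℕ b)
    toℕ-mulF a b = cong-trans (toℕ-mod (toℕ a *ℕ toℕ b)) (cong-≡ (ℤₚ.pos-* (toℕ a) (toℕ b)))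

    toℕ-negF : ∀ a → Cong (+ p) (+ toℕ (negF a)) (-ᶻ + toℕ a)
    toℕ-negF a = cong-trans (toℕ-mod (p ∸ toℕ a)) (cg (+ 1) (begin
      + (p ∸ toℕ a) ≡⟨ ℤₚ.⊖-≥ (ℕₚ.<⇒≤ (Finₚ.toℕ<n a)) ⟨
      p ℤ.⊖ toℕ a ≡⟨ ℤₚ.[+m]-[+n]≡m⊖n p (toℕ a) ⟨
      + p -ᶻ + toℕ a ≡⟨ lem (+ p) (+ toℕ a) ⟩
      -ᶻ + toℕ a +ᶻ + 1 *ᶻ + p ∎))
      where
      open ≡-Reasoning
      lem : ∀ p a → p -ᶻ a ≡ -ᶻ a +ᶻ + 1 *ᶻ p
      lem = solve-∀

    negF-involutive : ∀ a → negF (negF a) ≡ a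
    negF-involutive a = Cong⇒≡ (cong-trans (toℕ-negF (negF a)) (cong-trans (cong-neg (toℕ-negF a)) (cong-≡ (ℤₚ.neg-involutive (+ toℕ a)))))

    toℕ-sumF : ∀ k (f : Fin k → F) (G : ℤ → ℤ) → (∀ i → Cong (+ p) (+ toℕ (f i)) (G (+ toℕ i))) → Cong (+ p) (+ toℕ (sumF k f)) (Sn k G)
    toℕ-sumF k f G h = subst (λ l → Cong (+ p) (+ toℕ (foldr addF zeroF l)) (Sn k G)) (sym (map-allFin f)) (go k f G h)
      where
      go : ∀ k (f : Fin k → F) (G : ℤ → ℤ) → (∀ i → Cong (+ p) (+ toℕ (f i)) (G (+ toℕ i))) → Cong (+ p) (+ toℕ (foldr addF zeroF (List.tabulate f))) (Sn k G)
      go zero f G h = cong-refl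
      go (suc k) f G h = cong-trans (toℕ-addF (f zero) (foldr addF zeroF (List.tabulate (f ∘ suc)))) (cong-trans (cong-+ (h zero) (go k (f ∘ suc) (λ t → G (+ 1 +ᶻ t)) (λ i → h (suc i)))) (cong-≡ (sym (Sn-front k G))))

    normSq-tabulate : ∀ {n} (x : Vect n) → normSq x ≡ nrmV (tabulate x)
    normSq-tabulate {n} x = trans (cong sum (map-allFin (λ j → sq (abs (x j))))) (sum-tabulate (λ a → sq (abs a)) n x)

    normSq-lookup : ∀ {n} {x : Vect n} (v : Vec F n) → (∀ j → x j ≡ lookup v j) → normSq x ≡ nrmV v
    normSq-lookup {x = x} v h = trans (normSq-tabulate x) (cong nrmV (trans (Vecₚ.tabulate-cong h) (Vecₚ.tabulate∘lookup v)))

    sumVec-∑ : ∀ n (f : Vect n → ℕ) (g : Vec F n → ℕ) → (∀ x → f x ≡ g (tabulate x)) → sumVec n f ≡ ∑ g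
    sumVec-∑ zero f g h = trans (h (λ ())) (sym (∑-[] {F} g))
    sumVec-∑ (suc n) f g h = trans (sum-allFin p (λ a → sumVec n (λ v → f (a V.∷ v))))
      (trans (∑-cong (λ a → sumVec-∑ n (λ v → f (a V.∷ v)) (λ v → g (a ∷ v)) (λ v → h (a V.∷ v)))) (sym (∑-Vec {F} {n = n} g)))

    ballSize-ballV : ∀ n D → ballSize n D ≡ ballV n D
    ballSize-ballV n D = sumVec-∑ n (λ x → if normSq x ℕ.≤ᵇ D then 1 else 0) (λ v → 𝟙 (nrmV v ≤? D)) (λ x → trans (cong (λ t → if t ℕ.≤ᵇ D then 1 else 0) (normSq-tabulate x)) (if-≤ᵇ (nrmV (tabulate x)) D))

  module DoubleCirculant (q′ m : ℕ) (prq : Prime (suc q′)) (prp : Prime (suc m)) (q≢p : suc q′ ≢ suc m) (q>2 : 2 < suc q′) (p>2 : 2 < suc m) where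
    open Orbits q′ m prq prp q≢p q>2 p>2
    open Coordinates m
    open Fp m hiding (lift; p; F)

    coord : ∀ x j → Cong (+ P) (+ toℕ (lookup x j)) (at (emb x) (+ toℕ j))
    coord x j = cong-trans (cong-sym (lift-Cong (lookup x j))) (cong-≡ (sym (emb-at x j)))

    lookup-0X : ∀ j → lookup 0X j ≡ zeroF
    lookup-0X j = Cong⇒≡ (cong-trans (coord 0X j) (ap emb-0 (+ toℕ j)))

    lookup-⊝ : ∀ x j → lookup (⊝ x) j ≡ negF (lookup x j)
    lookup-⊝ x j = Cong⇒≡ (cong-trans (coord (⊝ x) j) (cong-trans (ap (emb-⊝ x) (+ toℕ j)) (cong-sym (cong-trans (toℕ-negF (lookup x j)) (cong-neg (coord x j))))))

    cyc : ℤ → Fin q → Fin q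
    cyc c j = res q′ (+ toℕ j -ᶻ c)

    lookup-rot : ∀ c x j → lookup (rot c x) j ≡ lookup x (cyc c j)
    lookup-rot c x j = Cong⇒≡ (cong-trans (coord (rot c x) j) (cong-trans (emb-rot c x (+ toℕ j))
      (cong-trans (cong-≡ (per-Cong (per (emb x)) (toℕ-res q′ (+ toℕ j -ᶻ c)))) (cong-sym (coord x (cyc c j))))))

    cyc-+ : ∀ c d j → cyc c (cyc d j) ≡ cyc (c +ᶻ d) j
    cyc-+ c d j = Cong⇒res≡ q′ (cong-trans (cong-+ (cong-sym (toℕ-res q′ (+ toℕ j -ᶻ d))) (cong-refl {a = -ᶻ c})) (cong-≡ (lem (+ toℕ j) c d)))
      where
      lem : ∀ j c d → j -ᶻ d -ᶻ c ≡ j -ᶻ (c +ᶻ d)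
      lem = solve-∀

    cyc-period : ∀ c → Cong (+ q) c (+ 0) → ∀ j → cyc c j ≡ j
    cyc-period c h j = trans (Cong⇒res≡ q′ (cong-trans (cong-+ (cong-refl {a = + toℕ j}) (cong-neg h)) (cong-≡ (ℤₚ.+-identityʳ (+ toℕ j))))) (res-toℕ q′ j)

    -- Convolution written out: combining the rotations of g with coefficients a is multiplication
    -- by the polynomial with coefficients a.
    monomial-sum : ∀ (a : Fin q → Fin P) g j → sumF q (λ i → mulF (a i) (lookup (rot (+ toℕ i) g) j)) ≡ lookup (tabulate a ⊗ g) j
    monomial-sum a g j = Cong⇒≡ (cong-trans (toℕ-sumF q _ (λ i → at (emb f) i *ᶻ at (emb g) (+ toℕ j -ᶻ i)) (λ i →
        cong-trans (toℕ-mulF (a i) (lookup (rot (+ toℕ i) g) j)) (cong-*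
          (cong-trans (cong-≡ (cong (λ t → + toℕ t) (sym (Vecₚ.lookup∘tabulate a i)))) (coord f i))
          (cong-trans (coord (rot (+ toℕ i) g) j) (emb-rot (+ toℕ i) g (+ toℕ j))))))
      (cong-trans (cong-≡ (sym (at-⋆ (emb f) (emb g) (+ toℕ j)))) (cong-trans (cong-sym (ap (emb-⊗ f g) (+ toℕ j))) (cong-sym (coord (f ⊗ g) j)))))
      where f = tabulate a

    -- Positions are pairs of a block and an index within it, encoded by `combine`; φ acts on the
    -- index in both blocks alike.
    rearrange : (Fin q → Fin q) → Fin (2 *ℕ q) → Fin (2 *ℕ q)
    rearrange φ j = combine {2} {q} (quotient {2} q j) (φ (remainder {2} q j))

    rearrange-combine : ∀ φ e i → rearrange φ (combine {2} {q} e i) ≡ combine {2} {q} e (φ i)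
    rearrange-combine φ e i = cong (λ ei → combine {2} {q} (proj₁ ei) (φ (proj₂ ei))) (Finₚ.remQuot-combine {2} {q} e i)

    blockwise : ∀ {B : Fin (2 *ℕ q) → Set} → (∀ e i → B (combine {2} {q} e i)) → ∀ j → B j
    blockwise {B} h j = subst B (Finₚ.combine-remQuot {2} q j) (h (quotient {2} q j) (remainder {2} q j))

    rearrange-∘ : ∀ φ ψ χ → (∀ i → φ (ψ i) ≡ χ i) → ∀ j → rearrange φ (rearrange ψ j) ≡ rearrange χ j
    rearrange-∘ φ ψ χ h = blockwise λ e i → trans (cong (rearrange φ) (rearrange-combine ψ e i)) (trans (rearrange-combine φ e (ψ i)) (trans (cong (combine {2} {q} e) (h i)) (sym (rearrange-combine χ e i))))

    rearrange-id : ∀ φ → (∀ i → φ i ≡ i) → ∀ j → rearrange φ j ≡ j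
    rearrange-id φ h = blockwise λ e i → trans (rearrange-combine φ e i) (cong (combine {2} {q} e) (h i))

    shift : ℤ → Fin (2 *ℕ q) → Fin (2 *ℕ q)
    shift c = rearrange (cyc c)

    shift-+ : ∀ c d j → shift c (shift d j) ≡ shift (c +ᶻ d) j
    shift-+ c d = rearrange-∘ (cyc c) (cyc d) (cyc (c +ᶻ d)) (cyc-+ c d)

    shift-0 : ∀ c → Cong (+ q) c (+ 0) → ∀ j → shift c j ≡ j
    shift-0 c h = rearrange-id (cyc c) (cyc-period c h)

    shift-inv : ∀ c d → c +ᶻ d ≡ + 0 → ∀ j → shift c (shift d j) ≡ j
    shift-inv c d e j = trans (shift-+ c d j) (shift-0 (c +ᶻ d) (cong-≡ e) j)

    -- Multiplication by -1 and by x, the generators of ℤ/2 × ℤ/q.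
    negation translation : Monomial (2 *ℕ q)
    negation = record { perm = Perm.id ; sign = λ _ → true }
    translation = record { perm = permutation (shift (+ 1)) (shift (-ᶻ + 1)) (shift-inv (+ 1) (-ᶻ + 1) refl) (shift-inv (-ᶻ + 1) (+ 1) refl) ; sign = λ _ → false }

    origin : Fin (2 *ℕ q)
    origin = combine {2} {q} zero zero

    shift-1≢ : shift (+ 1) origin ≢ origin
    shift-1≢ e = impossible (Cong-small (res≡⇒Cong q′ {a = -ᶻ + 1} {+ 0} (trans (Finₚ.combine-injectiveʳ {2} {q} zero (cyc (+ 1) zero) zero zero (trans (sym (rearrange-combine (cyc (+ 1)) zero zero)) e)) (sym (res-toℕ q′ zero)))) (ℕₚ.<-trans (s≤s (s≤s z≤n)) q>2))
      where
      impossible : ¬ (-ᶻ + 1 ≡ + 0)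
      impossible ()

    one : Fin P
    one = fromℕ< (ℕₚ.<-trans (s≤s (s≤s z≤n)) p>2)

    toℕ-one : toℕ one ≡ 1
    toℕ-one = Finₚ.toℕ-fromℕ< (ℕₚ.<-trans (s≤s (s≤s z≤n)) p>2)

    one≢0 : one ≢ zeroF
    one≢0 e = impossible (trans (sym toℕ-one) (cong toℕ e))
      where
      impossible : ¬ (1 ≡ 0)
      impossible ()

    one≢-one : negF one ≢ one
    one≢-one e = 2≢0p (cong-trans (cong-≡ (lem (+ 1))) (cong-trans (Cong-diff (cong-trans (cong-≡ (cong +_ (sym toℕ-one))) (cong-trans (cong-≡ (cong (λ t → + toℕ t) (sym e))) (cong-trans (toℕ-negF one) (cong-≡ (cong (λ t → -ᶻ + t) toℕ-one)))))) cong-refl))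
      where
      lem : ∀ a → + 2 ≡ + 1 -ᶻ (-ᶻ + 1)
      lem a = refl

    iter-translation : ∀ k x j → iter k (apply translation) x j ≡ x (shift (+ k) j)
    iter-translation zero x j = cong x (sym (shift-0 (+ 0) cong-refl j))
    iter-translation (suc k) x j = trans (iter-translation k x (shift (+ 1) j)) (cong x (trans (shift-+ (+ k) (+ 1) j) (cong (λ t → shift (+ t) j) (ℕₚ.+-comm k 1))))

    translation-order : ∀ x j → iter q (apply translation) x j ≡ x j
    translation-order x j = trans (iter-translation q x j) (cong x (shift-0 (+ q) (cg (+ 1) (sym (trans (ℤₚ.+-identityˡ (+ 1 *ᶻ + q)) (ℤₚ.*-identityˡ (+ q))))) j))

    -- The witness is 0 at the origin and 1 elsewhere, and the shift moves the origin.
    translation≢id : ¬ SameMap (apply translation) (λ x → x)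
    translation≢id h = shift-1≢ (reflect (shift (+ 1) origin Finₚ.≟ origin) (trans (h x origin) (at-origin (origin Finₚ.≟ origin))))
      where
      χ : ∀ {j : Fin (2 *ℕ q)} → Dec (j ≡ origin) → Fin P
      χ (yes _) = zeroF
      χ (no _) = one
      x : Vect (2 *ℕ q)
      x j = χ (j Finₚ.≟ origin)
      at-origin : (d : Dec (origin ≡ origin)) → χ d ≡ zeroF
      at-origin (yes _) = refl
      at-origin (no ne) = ⊥-elim (ne refl)
      reflect : ∀ {j} (d : Dec (j ≡ origin)) → χ d ≡ zeroF → j ≡ origin
      reflect (yes e) _ = e
      reflect (no _) e = ⊥-elim (one≢0 e)

    module Code (h : X) where
      blocks : X → Vec X 2
      blocks f = f ∷ f ⊗ h ∷ []

      word : X → Vec (Fin P) (2 *ℕ q)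
      word f = concat (blocks f)

      -- The rows (xⁱ , xⁱ h), that is, the generator matrix formed by the identity and the
      -- circulant of h.
      basis : Fin q → Vect (2 *ℕ q)
      basis i = lookup (word (rot (+ toℕ i) 1X))

      word-ext : ∀ {y : Fin (2 *ℕ q) → Fin P} f → (∀ e i → y (combine {2} {q} e i) ≡ lookup (lookup (blocks f) e) i) → ∀ j → y j ≡ lookup (word f) j
      word-ext {y} f hyp = blockwise λ e i → trans (hyp e i) (sym (lookup-concat (blocks f) e i))

      lincomb-word : ∀ a j → lincomb a basis j ≡ lookup (word (tabulate a)) j
      lincomb-word a = word-ext {lincomb a basis} (tabulate a) λ e i → trans (cong (foldr addF zeroF) (Listₚ.map-cong (λ k → cong (mulF (a k)) (lookup-concat (blocks (rot (+ toℕ k) 1X)) e i)) (allFin q))) (block e i)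
        where
        block : ∀ e i → sumF q (λ k → mulF (a k) (lookup (lookup (blocks (rot (+ toℕ k) 1X)) e) i)) ≡ lookup (lookup (blocks (tabulate a)) e) i
        block zero i = trans (monomial-sum a 1X i) (cong (λ v → lookup v i) (XM.*-identityʳ (tabulate a)))
        block (suc zero) i = trans (cong (foldr addF zeroF) (Listₚ.map-cong (λ k → cong (λ v → mulF (a k) (lookup v i)) (trans (XM.*-assoc (π (x^ (+ toℕ k))) 1X h) (cong (π (x^ (+ toℕ k)) ⊗_) (XM.*-identityˡ h)))) (allFin q))) (monomial-sum a h i)

      lookup-word₀ : ∀ f i → lookup (word f) (combine {2} {q} zero i) ≡ lookup f i
      lookup-word₀ f i = lookup-concat (blocks f) zero i

      word-0X : ∀ j → lookup (word 0X) j ≡ zeroF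
      word-0X = blockwise λ e i → trans (lookup-concat (blocks 0X) e i) (block e i)
        where
        block : ∀ e i → lookup (lookup (blocks 0X) e) i ≡ zeroF
        block zero i = lookup-0X i
        block (suc zero) i = trans (cong (λ v → lookup v i) (XM.zeroˡ h)) (lookup-0X i)

      independent : LinIndep basis
      independent a z i = trans (sym (Vecₚ.lookup∘tabulate a i)) (trans (sym (lookup-word₀ (tabulate a) i)) (trans (sym (lincomb-word a (combine {2} {q} zero i))) (z (combine {2} {q} zero i))))

      Codeword : X → Vect (2 *ℕ q) → Set
      Codeword f x = ∀ j → x j ≡ lookup (word f) j

      span⇒ : ∀ {x} → Span basis x → ∃ λ f → Codeword f x
      span⇒ (a , e) = tabulate a , λ j → trans (e j) (lincomb-word a j)

      ⇒span : ∀ {x} f → Codeword f x → Span basis x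
      ⇒span f e = lookup f , λ j → trans (e j) (sym (trans (lincomb-word (lookup f) j) (cong (λ v → lookup (word v) j) (Vecₚ.tabulate∘lookup f))))

      weight : X → ℕ
      weight f = nrm f +ℕ nrm (f ⊗ h)

      normSq-weight : ∀ {x} f → Codeword f x → normSq x ≡ weight f
      normSq-weight f e = trans (normSq-lookup (word f) e) (trans (vsum-++ (λ a → sq (abs a)) f (concat (f ⊗ h ∷ []))) (cong (nrm f +ℕ_) (trans (vsum-++ (λ a → sq (abs a)) (f ⊗ h) []) (ℕₚ.+-identityʳ (nrm (f ⊗ h))))))

      nonzero⇒ : ∀ {x} f → Codeword f x → ¬ IsZero x → f ≢ 0X
      nonzero⇒ f e nz refl = nz λ j → trans (e j) (word-0X j)

      ⇒nonzero : ∀ {x} f → Codeword f x → f ≢ 0X → ¬ IsZero x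
      ⇒nonzero f e nz z = nz (vec-ext λ i → trans (sym (lookup-word₀ f i)) (trans (sym (e (combine {2} {q} zero i))) (trans (z (combine {2} {q} zero i)) (sym (lookup-0X i)))))

      minimum : ∃ λ f → f ≢ 0X × (∀ g → g ≢ 0X → weight f ≤ weight g)
      minimum = argmin {X} (λ f → ¬? (f ≟ 0X)) weight (tabulate (λ _ → one) , λ e → one≢0 (trans (sym (Vecₚ.lookup∘tabulate (λ _ → one) (zero {q′}))) (trans (cong (λ v → lookup v zero) e) (lookup-0X zero))))

      minSqNorm : MinSqNorm basis (weight (proj₁ minimum))
      minSqNorm = (lookup (word f) , ⇒span f (λ _ → refl) , ⇒nonzero f (λ _ → refl) (proj₁ (proj₂ minimum)) , normSq-weight f (λ _ → refl))
        , λ x s nz → ℕₚ.≤-trans (proj₂ (proj₂ minimum) (proj₁ (span⇒ s)) (nonzero⇒ (proj₁ (span⇒ s)) (proj₂ (span⇒ s)) nz)) (ℕₚ.≤-reflexive (sym (normSq-weight (proj₁ (span⇒ s)) (proj₂ (span⇒ s)))))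
        where f = proj₁ minimum

      negate-word : ∀ {x} f → Codeword f x → Codeword (⊝ f) (λ j → negF (x j))
      negate-word {x} f e = word-ext {λ j → negF (x j)} (⊝ f) λ b i → trans (cong negF (trans (e (combine {2} {q} b i)) (lookup-concat (blocks f) b i))) (block b i)
        where
        block : ∀ b i → negF (lookup (lookup (blocks f) b) i) ≡ lookup (lookup (blocks (⊝ f)) b) i
        block zero i = sym (lookup-⊝ f i)
        block (suc zero) i = trans (sym (lookup-⊝ (f ⊗ h) i)) (cong (λ v → lookup v i) (XM.solve 2 (λ f h → XM.:- (f XM.:* h) XM.:= (XM.:- f) XM.:* h) refl f h))

      shift-word : ∀ {x} c f → Codeword f x → Codeword (rot c f) (λ j → x (shift c j))
      shift-word {x} c f e = word-ext {λ j → x (shift c j)} (rot c f) λ b i → trans (cong x (rearrange-combine (cyc c) b i)) (trans (e (combine {2} {q} b (cyc c i))) (trans (lookup-concat (blocks f) b (cyc c i)) (block b i)))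
        where
        block : ∀ b i → lookup (lookup (blocks f) b) (cyc c i) ≡ lookup (lookup (blocks (rot c f)) b) i
        block zero i = sym (lookup-rot c f i)
        block (suc zero) i = trans (sym (lookup-rot c (f ⊗ h) i)) (cong (λ v → lookup v i) (sym (XM.*-assoc (π (x^ c)) f h)))

      negation-aut : IsAut basis negation
      negation-aut = closed , λ y s → (λ j → negF (y j)) , closed y s , λ j → negF-involutive (y j)
        where
        closed : ∀ x → Span basis x → Span basis (λ j → negF (x j))
        closed x s = ⇒span (⊝ proj₁ (span⇒ s)) (negate-word (proj₁ (span⇒ s)) (proj₂ (span⇒ s)))

      translation-aut : IsAut basis translation
      translation-aut = closed (+ 1) , λ y s → (λ j → y (shift (-ᶻ + 1) j)) , closed (-ᶻ + 1) y s , λ j → cong y (shift-inv (-ᶻ + 1) (+ 1) refl j)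
        where
        closed : ∀ c x → Span basis x → Span basis (λ j → x (shift c j))
        closed c x s = ⇒span (rot c (proj₁ (span⇒ s))) (shift-word c (proj₁ (span⇒ s)) (proj₂ (span⇒ s)))

      symmetries : HasZ2xZq q basis
      symmetries = negation , translation , negation-aut , translation-aut , (λ x j → negF-involutive (x j))
        , (λ e → one≢-one (e (λ _ → one) origin)) , translation-order , translation≢id , (λ x j → refl)

    ballSize-pairBall : ∀ D → ballSize (2 *ℕ q) D ≡ pairBall q D
    ballSize-pairBall D = trans (ballSize-ballV (2 *ℕ q) D) (trans (cong (λ n → ballV (q +ℕ n) D) (ℕₚ.+-identityʳ q)) (sym (pairBall-ballV q D)))

-- Assembly: the prime, its range and the code

open ScaleEstimates using (scales; Scales)
open DenseRadius
open PrimeBetweenPowers using (prime-in-range)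
open RationalLogarithm
open CodeCoordinates
import Data.Nat.Properties as ℕₚ
import Data.Rational.Properties as ℚₚ
open import Data.Nat using (suc; z≤n; s≤s)
import Data.Nat as ℕ
open import Data.Bool using (T)
open import Data.Product using (∃; _,_; proj₁; proj₂)
open import Data.Nat.Tactic.RingSolver using () renaming (solve-∀ to solveℕ-∀)
open import Relation.Binary.PropositionalEquality using (_≡_; _≢_; sym; subst)

open import Defs
open import Data.Nat using (ℕ; _*_; _≤_)
open import Data.Nat.Primality using (Prime)
open import Data.Rational using (ℚ; 0ℚ; _<_)
open import Data.Product using (Σ; _×_)

good-code : ∀ q′ m → Prime (suc q′) → Prime (suc m) → suc q′ ≢ suc m → 2 ℕ.< suc q′ → 2 ℕ.< suc m → Scales (suc q′) (suc m) → Fp.GoodCode m (2 * suc q′) (suc q′) (suc q′) (ratio 1 c₀)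
good-code q′ m prq prp q≢p q>2 p>2 scl =
    basis , independent , weight (proj₁ minimum) , minSqNorm
  , density c₀ (2 * suc q′ * suc m ℕ.^ suc q′) (Fp.ballSize m (2 * suc q′) (weight (proj₁ minimum))) c₀>0
      (subst (λ b → 2 * suc q′ * suc m ℕ.^ suc q′ ≤ c₀ * b) (sym (ballSize-pairBall (weight (proj₁ minimum))))
        -- All nonzero codewords have squared norm above D₀, so the minimum lies in the dense range.
        (E.dense (weight (proj₁ minimum)) (proj₂ E.generator (proj₁ minimum) (proj₁ (proj₂ minimum)))))
  , symmetries
  where
  module E = Existence q′ m prq prp q≢p q>2 p>2 scl
  open DoubleCirculant q′ m prq prp q≢p q>2 p>2
  open Code (proj₁ E.generator)

-- For n = 2 q the lower bound on p follows from p ≥ n³, since n > log n.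
cubed≤ : ∀ q p → 8 ≤ q → q ℕ.^ 9 ≤ p → 2 * q * (2 * q * (2 * q)) ≤ p
cubed≤ q p q≥8 h = begin
  2 * q * (2 * q * (2 * q)) ≡⟨ lem q ⟩
  8 * (q * (q * q)) ≤⟨ ℕₚ.*-monoˡ-≤ (q * (q * q)) q≥8 ⟩
  q * (q * (q * q)) ≡⟨ lem₂ q ⟩
  q ℕ.^ 4 ≤⟨ ℕₚ.^-monoʳ-≤ q {{ℕ.>-nonZero (ℕₚ.≤-trans (s≤s z≤n) q≥8)}} (ℕₚ.≤ᵇ⇒≤ 4 9 _) ⟩
  q ℕ.^ 9 ≤⟨ h ⟩
  p ∎
  where
  open ℕₚ.≤-Reasoning
  lem : ∀ q → 2 * q * (2 * q * (2 * q)) ≡ 8 * (q * (q * q))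
  lem = solveℕ-∀
  lem₂ : ∀ q → q * (q * (q * q)) ≡ q * (q * (q * (q * 1)))
  lem₂ = solveℕ-∀

good-code-over : ∀ q p → Prime q → Prime p → 2 ℕ.< q → q ℕ.< p → Scales q p → GoodCodeOver p (2 * q) q q (ratio 1 c₀)
good-code-over (suc q′) (suc m) prq prp q>2 q<p scl = good-code q′ m prq prp (ℕₚ.<⇒≢ q<p) q>2 (ℕₚ.<-trans q>2 q<p) scl

0<ratio : ∀ c → 0 ℕ.< c → 0ℚ < ratio 1 c
0<ratio (suc c) _ = ℚₚ.positive⁻¹ (ratio 1 (suc c)) {{ℚₚ.normalize-pos 1 (suc c)}}

theorem1 : Σ ℚ λ c → (0ℚ < c) × (Σ ℕ λ Q → ∀ q → Prime q → Q ≤ q →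
    Σ ℕ λ p → Prime p × LowerBound (2 * q) p × UpperBound (2 * q) p ×
    GoodCodeOver p (2 * q) q q c)
theorem1 = ratio 1 c₀ , 0<ratio c₀ c₀>0 , 2 ℕ.^ 20 , λ q prq q≥ → build q prq q≥ (prime-in-range q q≥)
  where
  build : ∀ q → Prime q → 2 ℕ.^ 20 ≤ q → (∃ λ p → Prime p × q ℕ.^ 9 ≤ p × p ≤ q ℕ.^ 11) →
    Σ ℕ λ p → Prime p × LowerBound (2 * q) p × UpperBound (2 * q) p × GoodCodeOver p (2 * q) q q (ratio 1 c₀)
  build q prq q≥ (p , prp , lo , hi) = p , prp
    , cubic⇒LowerBound (2 * q) p (ℕₚ.≤-trans (at-least 1 _) (ℕₚ.m≤n*m q 2)) (cubed≤ q p (at-least 8 _) lo)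
    , eleventh-power⇒UpperBound (2 * q) p (ℕₚ.≤-trans (at-least 3 _) (ℕₚ.m≤n*m q 2)) (ℕₚ.≤-trans hi (ℕₚ.^-monoˡ-≤ 11 (ℕₚ.m≤n*m q 2)))
    , good-code-over q p prq prp (at-least 3 _) q<p (scales q p q≥ lo hi)
    where
    at-least : ∀ k → T (k ℕ.≤ᵇ 2 ℕ.^ 20) → k ≤ q
    at-least k h = ℕₚ.≤-trans (ℕₚ.≤ᵇ⇒≤ k (2 ℕ.^ 20) h) q≥
    q<p : q ℕ.< p
    q<p = ℕₚ.<-≤-trans (ℕₚ.≤-<-trans (ℕₚ.≤-reflexive (sym (ℕₚ.^-identityʳ q))) (ℕₚ.^-monoʳ-< q (at-least 2 _) (ℕₚ.≤ᵇ⇒≤ 2 9 _))) lo
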